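{- Suppose $n$ is sufficiently large and $A\subseteq A_n$ is product-free with $\mu(A)\ge n^{ -0.66}$. Then there exist $x\in[n]$ and $I\subseteq[n]$ such that $\mu(A\setminus F_I^x)<n^{ -0.66}$ or $\mu(A^{ -1}\setminus F_I^x)<n^{ -0.66}$, where $F_I^x:=\{\pi\in A_n:\ \pi(x)\in I,\ \pi(I)\cap I=\emptyset\}$.
   Context: $\mu$ denotes the uniform probability measure on the alternating group $A_n$, i.e. $\mu(S)=|S|/|A_n|$. A subset $A$ of a group is product-free if there are no $a,b,c\in A$ with $ab=c$. $A^{ -1}=\{a^{ -1}:a\in A\}$. -}

module Defs where

open import Data.Bool using (Bool; true; false; _∧_; not; if_then_else_)
open import Data.Nat using (ℕ; zero; suc; _*_; _^_; _≤_; _<_; _%_)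
open import Data.Nat as ℕ using ()
open import Data.Fin using (Fin)
open import Data.Fin as F using ()
open import Data.Fin.Subset using (Subset)
open import Data.Vec using (Vec; []; _∷_; lookup; map; tabulate)
open import Data.List using (List; [_]; concatMap; length; filterᵇ; allFin; all)
open import Data.Nat.ListAction using (sum)
open import Data.List as L using ()
open import Relation.Nullary.Decidable using (⌊_⌋)
open import Relation.Binary.PropositionalEquality using (_≡_)

-- A "permutation" of [n] = Fin n is represented concretely by its
-- table of values: the vector (π(0), …, π(n-1)).
Tab : ℕ → Set
Tab n = Vec (Fin n) n

allVecs : (n k : ℕ) → List (Vec (Fin n) k)
allVecs n zero    = [ [] ]
allVecs n (suc k) = concatMap (λ x → L.map (x ∷_) (allVecs n k)) (allFin n)

isPerm : ∀ {n} → Tab n → Bool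
isPerm {n} π = all (λ i → all (λ j → if ⌊ i F.≟ j ⌋ then true
                                    else not ⌊ lookup π i F.≟ lookup π j ⌋)
                               (allFin n)) (allFin n)

inversions : ∀ {n} → Tab n → ℕ
inversions {n} π = sum (L.map (λ i → length (filterᵇ
                     (λ j → ⌊ i F.<? j ⌋ ∧ ⌊ lookup π j F.<? lookup π i ⌋)
                     (allFin n))) (allFin n))

isEven : ∀ {n} → Tab n → Bool
isEven π = ⌊ inversions π % 2 ℕ.≟ 0 ⌋

isAlt : ∀ {n} → Tab n → Bool
isAlt π = isPerm π ∧ isEven π

-- the elements of A_n (each listed exactly once)
Alt : (n : ℕ) → List (Tab n)
Alt n = filterᵇ isAlt (allVecs n n)

countAlt : (n : ℕ) → (Tab n → Bool) → ℕ
countAlt n P = length (filterᵇ P (Alt n))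

_·_ : ∀ {n} → Tab n → Tab n → Tab n
a · b = map (lookup a) b

-- inverse of a permutation: π⁻¹(j) = the i with π(i) = j
-- (the default value j is never used when π is a bijection)
preimage : ∀ {n} → Tab n → Fin n → Fin n
preimage {n} π j = go (allFin n)
  where
  go : List (Fin n) → Fin n
  go L.[]       = j
  go (i L.∷ is) = if ⌊ lookup π i F.≟ j ⌋ then i else go is

inv : ∀ {n} → Tab n → Tab n
inv π = tabulate (preimage π)

SubsetOfAlt : ∀ {n} → (Tab n → Bool) → Set
SubsetOfAlt {n} A = ∀ (π : Tab n) → A π ≡ true → isAlt π ≡ true

ProductFree : ∀ {n} → (Tab n → Bool) → Set
ProductFree {n} A = ∀ (a b c : Tab n) → A a ≡ true → A b ≡ true → A c ≡ true
                    → (a · b ≡ c → Data.Empty.⊥)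
  where import Data.Empty

-- A⁻¹ = {a⁻¹ : a ∈ A}; for π ∈ A_n, π ∈ A⁻¹ iff π⁻¹ ∈ A
invSet : ∀ {n} → (Tab n → Bool) → Tab n → Bool
invSet A π = A (inv π)

inF : ∀ {n} → Subset n → Fin n → Tab n → Bool
inF {n} I x π = lookup I (lookup π x)
                ∧ all (λ i → not (lookup I i ∧ lookup I (lookup π i))) (allFin n)

minusF : ∀ {n} → (Tab n → Bool) → Subset n → Fin n → Tab n → Bool
minusF S I x π = S π ∧ not (inF I x π)

-- μ(S) ≥ n^(-0.66)  ⇔  |S|^50 · n^33 ≥ |A_n|^50
μ≥bound : (n : ℕ) → (Tab n → Bool) → Set
μ≥bound n S = length (Alt n) ^ 50 ≤ countAlt n S ^ 50 * n ^ 33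

-- μ(S) < n^(-0.66)  ⇔  |S|^50 · n^33 < |A_n|^50
μ<bound : (n : ℕ) → (Tab n → Bool) → Set
μ<bound n S = countAlt n S ^ 50 * n ^ 33 < length (Alt n) ^ 50

{-# OPTIONS --safe #-}
-- Write α, β, γ for the densities of F, G, H ⊆ A_n and let a(j,k) = n P(π ∈ F, π(j) = k) − α, and similarly b for G and c for H.
-- In the group algebra, 1 is the sum of the projection Π onto the functions that are linear in the permutation matrix and of a
-- projection Q. Splitting Q into pieces that commute with small alternating subgroups shows that the trace form of Q is O(n⁻²)
-- times that of 1, so only Π matters when products ab = c are counted: if F, G, H have no solution of ab = c, then
-- − Σ a(j,k) b(i,j) c(i,k) ≥ (1 − o(1)) n² α β γ.
--
-- Exchangeable pairs built from 3-cycles give tail bounds for Σ_i s(i, π(i)), hence the negative entries of a, b, c and those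
-- below a threshold nβγ/T contribute little. For F = G = H = A some row or column must therefore be heavy, and replacing A by
-- A⁻¹ we may take row x. Let J be the set of large entries j of row x. As |J| is small, the sets {π ∈ A : π(x) ∈ J′}, J′ ⊆ J,
-- have no heavy entries in other rows. The inequality for these sets and A ∖ {π(x) ∈ J} makes the latter small. Finally let I be
-- the union of the dyadic level classes of J that are not negligible. If many π ∈ A mapped a point of one class into another,
-- the inequality for this set and the two classes would force Σ P(π(j) = k) P(π(x) = j) P(π(x) = k) to be tiny, but it is
-- large: directly if the classes are small, and by concentration otherwise.
module Submission where

open import Defs
open import Algebra.Bundles using (CommutativeRing)
open import Algebra.Structures using (IsCommutativeRing)
open import Axiom.UniquenessOfIdentityProofs using (module Decidable⇒UIP)
open import Data.Bool using (Bool; _xor_; _∧_; _∨_; false; if_then_else_; not; true)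
open import Data.Bool.ListAction using (all; any)
open import Data.Bool.Properties using (not-¬)
open import Data.Empty using (⊥; ⊥-elim)
open import Data.Fin using (Fin; punchOut; suc; zero)
open import Data.Fin.Subset using (Subset)
open import Data.List using (List; []; _++_; _∷_; allFin; cartesianProduct; cartesianProductWith; concatMap; filterᵇ; length; map; replicate; upTo)
open import Data.List.Membership.Propositional using (_∈_; _∉_)
open import Data.List.Membership.Propositional.Properties using (∈-allFin; ∈-cartesianProductWith⁺; ∈-upTo⁺)
open import Data.List.Properties using (length-upTo)
open import Data.List.Relation.Unary.All using (All; []; _∷_)
open import Data.List.Relation.Unary.AllPairs using (AllPairs; []; _∷_)
open import Data.List.Relation.Unary.Any using (here; there)
open import Data.List.Relation.Unary.Unique.Propositional using (Unique)
open import Data.List.Relation.Unary.Unique.Propositional.Properties using (allFin⁺; cartesianProductWith⁺)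
open import Data.Nat using (_%_; _≡ᵇ_; _≥_; suc; zero; ℕ)
open import Data.Nat.DivMod using (%-distribˡ-+; [m+kn]%n≡m%n; m%n%n≡m%n)
open import Data.Nat.Properties using (≡ᵇ⇒≡)
open import Data.Product using (_,_; _×_; proj₁; proj₂; Σ; ∃)
open import Data.Sum using (_⊎_; inj₁; inj₂)
open import Data.Unit using (tt)
open import Data.Vec using (Vec; []; _∷_; lookup; tabulate)
open import Function using (_⇔_; _∘_; mk⇔)
open import Level using (0ℓ)
open import Relation.Binary.Definitions using (DecidableEquality; tri<; tri>; tri≈)
open import Relation.Binary.PropositionalEquality using (_≡_; _≢_; cong; cong₂; refl; subst; subst₂; sym; trans)
open import Relation.Nullary using (Dec; does; no; yes; ¬_)
open import Relation.Nullary.Decidable using (_→-dec_; dec-false; dec-true; does-⇔; from-no; ⌊_⌋)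
import Algebra.Properties.Ring as RingProperties
import Data.Bool as Bool
import Data.Bool.Properties as Bool
import Data.Fin as Fin
import Data.Fin.Properties as Fin
import Data.List.Properties as List
import Data.List.Relation.Unary.All as All
import Data.Nat as ℕ
import Data.Nat.ListAction as ListAction
import Data.Nat.Properties as ℕ
import Data.Rational.Properties as ℚ
import Data.Vec as Vec
import Data.Vec.Properties as Vec
open import Data.Rational as ℚ using (ℚ; 0ℚ; 1ℚ; 1/_)

-- A quasirandomness argument would bound the error by the least dimension of an irreducible
-- representation beyond the trivial and the standard one. No characters appear here: the functional
-- `τ` of `Traces` replaces the dimension. It is cyclic and nonnegative on projections, and by
-- symmetry one projection `E W k` takes at most the share 1/(|W| - 1) of it; two of them on
-- disjoint sets give the share of order n⁻². A component that no such pair detects is annihilated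
-- by the averages over many disjoint blocks, and every block halves its trace, so that
-- logarithmically many blocks suffice.
--
-- Operator bounds are kept as quadratic inequalities with a free parameter `λ′`. They add up
-- without loss and need no square roots, hence any ordered field will do.
--
-- The second-level error for densities α, β, γ is of order √(αβγ)/n, which is below αβγ only if αβγ
-- is well above n⁻². Hence the exponent must stay below 2/3. All constants, logarithms and dyadic
-- sums are absorbed in powers of one scale m, a tiny power of n.

-- Ordered fields and a solver for polynomial identities

record OrderedField : Set₁ where
  infix  8 -_
  infixl 7 _*_
  infixl 6 _+_
  infix  4 _≤_ _≤?_
  field
    F           : Set
    _+_ _*_     : F → F → F
    -_ recip    : F → F
    0# 1#       : F
    _≤_         : F → F → Set
    ring        : IsCommutativeRing _≡_ _+_ _*_ -_ 0# 1#
    *-inv       : ∀ x → x ≢ 0# → x * recip x ≡ 1#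
    ≤-reflexive : ∀ {x y} → x ≡ y → x ≤ y
    ≤-trans     : ∀ {x y z} → x ≤ y → y ≤ z → x ≤ z
    ≤-antisym   : ∀ {x y} → x ≤ y → y ≤ x → x ≡ y
    ≤-total     : ∀ x y → x ≤ y ⊎ y ≤ x
    _≤?_        : ∀ x y → Dec (x ≤ y)
    +-monoʳ     : ∀ z {x y} → x ≤ y → x + z ≤ y + z
    *-nonneg    : ∀ {x y} → 0# ≤ x → 0# ≤ y → 0# ≤ x * y
    1≰0         : ¬ 1# ≤ 0#

module Arithmetic (𝔽 : OrderedField) where
  open OrderedField 𝔽 public
  open IsCommutativeRing ring public using
    (+-assoc; +-comm; +-identityˡ; +-identityʳ; -‿inverseˡ; -‿inverseʳ;
     *-assoc; *-comm; *-identityˡ; *-identityʳ; distribˡ; distribʳ; zeroˡ; zeroʳ)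

  commutativeRing : CommutativeRing 0ℓ 0ℓ
  commutativeRing = record { isCommutativeRing = ring }

  open RingProperties (CommutativeRing.ring commutativeRing) public using
    (-‿distribˡ-*; -‿distribʳ-*; -‿involutive; -‿+-comm; -0#≈0#)

  infixl 6 _-_
  infix  4 _<_
  infixr 2 _≤[_]_ _=[_]_
  infix  3 _qed

  _-_ : F → F → F
  x - y = x + - y

  _<_ : F → F → Set
  x < y = ¬ y ≤ x

  -- The middle clause makes `ι 1` compute to `1#`, so the literal `# 1` of the solver is the unit
  -- of the field without a trailing zero.
  ι : ℕ → F
  ι zero          = 0#
  ι (suc zero)    = 1#
  ι (suc (suc n)) = 1# + ι (suc n)

  pow : F → ℕ → F
  pow x zero    = 1#
  pow x (suc n) = x * pow x n

  ≤-refl : ∀ {x} → x ≤ x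
  ≤-refl = ≤-reflexive refl

  ≡-≤ : ∀ {x y z} → x ≡ y → y ≤ z → x ≤ z
  ≡-≤ refl q = q

  ≤-≡ : ∀ {x y z} → x ≤ y → y ≡ z → x ≤ z
  ≤-≡ p refl = p

  _≤[_]_ : ∀ x {y z} → x ≤ y → y ≤ z → x ≤ z
  _ ≤[ p ] q = ≤-trans p q

  _=[_]_ : ∀ x {y z : F} → x ≡ y → y ≤ z → x ≤ z
  _ =[ refl ] q = q

  _qed : ∀ x → x ≤ x
  _ qed = ≤-refl

  private
    medial : ∀ a b c d → (a + b) + (c + d) ≡ (a + c) + (b + d)
    medial a b c d = trans (+-assoc a b _) (trans (cong (a +_) (trans (sym (+-assoc b c d))
      (trans (cong (_+ d) (+-comm b c)) (+-assoc c b d)))) (sym (+-assoc a c _)))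

    *-medial : ∀ a b c d → (a * b) * (c * d) ≡ (a * c) * (b * d)
    *-medial a b c d = trans (*-assoc a b _) (trans (cong (a *_) (trans (sym (*-assoc b c d))
      (trans (cong (_* d) (*-comm b c)) (*-assoc c b d)))) (sym (*-assoc a c _)))

  ι-suc : ∀ n → ι (suc n) ≡ 1# + ι n
  ι-suc zero    = sym (+-identityʳ 1#)
  ι-suc (suc n) = refl

  ι-+ : ∀ m n → ι (m ℕ.+ n) ≡ ι m + ι n
  ι-+ zero    n = sym (+-identityˡ _)
  ι-+ (suc m) n = trans (ι-suc (m ℕ.+ n)) (trans (cong (1# +_) (ι-+ m n))
    (trans (sym (+-assoc 1# _ _)) (cong (_+ ι n) (sym (ι-suc m)))))

  ι-* : ∀ m n → ι (m ℕ.* n) ≡ ι m * ι n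
  ι-* zero    n = sym (zeroˡ _)
  ι-* (suc m) n = trans (ι-+ n (m ℕ.* n)) (trans (cong₂ _+_ (sym (*-identityˡ _)) (ι-* m n))
    (trans (sym (distribʳ _ _ _)) (cong (_* ι n) (sym (ι-suc m)))))

  pow-+ : ∀ x m n → pow x (m ℕ.+ n) ≡ pow x m * pow x n
  pow-+ x zero    n = sym (*-identityˡ _)
  pow-+ x (suc m) n = trans (cong (x *_) (pow-+ x m n)) (sym (*-assoc x _ _))

  infixl 6 _:+_ _:-_
  infixl 7 _:*_
  infix  8 :-_
  data Expr : Set where
    v #       : ℕ → Expr
    :-_       : Expr → Expr
    _:+_ _:*_ : Expr → Expr → Expr

  _:-_ : Expr → Expr → Expr
  a :- b = a :+ (:- b)

  nth : ℕ → List F → F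
  nth _       []      = 0#
  nth zero    (x ∷ _) = x
  nth (suc i) (_ ∷ ρ) = nth i ρ

  ⟦_⟧ : Expr → List F → F
  ⟦ v i ⟧    ρ = nth i ρ
  ⟦ # n ⟧    ρ = ι n
  ⟦ :- a ⟧   ρ = - ⟦ a ⟧ ρ
  ⟦ a :+ b ⟧ ρ = ⟦ a ⟧ ρ + ⟦ b ⟧ ρ
  ⟦ a :* b ⟧ ρ = ⟦ a ⟧ ρ * ⟦ b ⟧ ρ

  -- A polynomial is a list of terms ((p , m) , es) standing for (p − m) · ∏ xᵢ^eᵢ.
  Mono Poly : Set
  Mono = List ℕ
  Poly = List ((ℕ × ℕ) × Mono)

  hd : List F → F
  hd []      = 0#
  hd (x ∷ _) = x

  tl : List F → List F
  tl []      = []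
  tl (_ ∷ ρ) = ρ

  mono : Mono → List F → F
  mono []       ρ = 1#
  mono (e ∷ es) ρ = pow (hd ρ) e * mono es (tl ρ)

  coef : ℕ × ℕ → F
  coef (p , m) = ι p - ι m

  poly : Poly → List F → F
  poly []             ρ = 0#
  poly ((c , es) ∷ P) ρ = coef c * mono es ρ + poly P ρ

  mulm : Mono → Mono → Mono
  mulm []       b        = b
  mulm (a ∷ as) []       = a ∷ as
  mulm (a ∷ as) (b ∷ bs) = (a ℕ.+ b) ∷ mulm as bs

  eqm : Mono → Mono → Bool
  eqm []       []       = true
  eqm (a ∷ as) (b ∷ bs) = (a ≡ᵇ b) ∧ eqm as bs
  eqm _        _        = false

  addc mulc : ℕ × ℕ → ℕ × ℕ → ℕ × ℕ
  addc (p , m) (q , l) = p ℕ.+ q , m ℕ.+ l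
  mulc (p , m) (q , l) = p ℕ.* q ℕ.+ m ℕ.* l , p ℕ.* l ℕ.+ m ℕ.* q

  insert : (ℕ × ℕ) × Mono → Poly → Poly
  insert t        []             = t ∷ []
  insert (c , es) ((d , fs) ∷ P) = if eqm es fs then (addc c d , es) ∷ P else (d , fs) ∷ insert (c , es) P

  addP : Poly → Poly → Poly
  addP []      Q = Q
  addP (t ∷ P) Q = insert t (addP P Q)

  scaleP : (ℕ × ℕ) × Mono → Poly → Poly
  scaleP _        []             = []
  scaleP (c , es) ((d , fs) ∷ P) = insert (mulc c d , mulm es fs) (scaleP (c , es) P)

  mulP : Poly → Poly → Poly
  mulP []      Q = []
  mulP (t ∷ P) Q = addP (scaleP t Q) (mulP P Q)

  norm : Expr → Poly
  norm (v i)    = ((1 , 0) , (replicate i 0 ++ 1 ∷ [])) ∷ []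
  norm (# n)    = ((n , 0) , []) ∷ []
  norm (:- a)   = scaleP ((0 , 1) , []) (norm a)
  norm (a :+ b) = addP (norm a) (norm b)
  norm (a :* b) = mulP (norm a) (norm b)

  null : Poly → Bool
  null []                   = true
  null (((p , m) , _) ∷ P) = (p ≡ᵇ m) ∧ null P

  private
    mono-mul : ∀ a b ρ → mono (mulm a b) ρ ≡ mono a ρ * mono b ρ
    mono-mul []       b        ρ = sym (*-identityˡ _)
    mono-mul (a ∷ as) []       ρ = sym (*-identityʳ _)
    mono-mul (a ∷ as) (b ∷ bs) ρ = trans (cong₂ _*_ (pow-+ (hd ρ) a b) (mono-mul as bs (tl ρ))) (*-medial _ _ _ _)

    eqm-sound : ∀ a b → eqm a b ≡ true → a ≡ b
    eqm-sound []       []       _ = refl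
    eqm-sound (a ∷ as) (b ∷ bs) p with a ≡ᵇ b in q
    ... | true = cong₂ _∷_ (≡ᵇ⇒≡ a b (subst Bool.T (sym q) tt)) (eqm-sound as bs p)

    addc-sound : ∀ c d → coef (addc c d) ≡ coef c + coef d
    addc-sound (p , m) (q , l) = trans (cong₂ _-_ (ι-+ p q) (ι-+ m l))
      (trans (cong ((ι p + ι q) +_) (sym (-‿+-comm (ι m) (ι l)))) (medial _ _ _ _))

    mulc-sound : ∀ c d → coef (mulc c d) ≡ coef c * coef d
    mulc-sound (p , m) (q , l) = trans
      (cong₂ _-_ (trans (ι-+ (p ℕ.* q) _) (cong₂ _+_ (ι-* p q) (ι-* m l))) (trans (ι-+ (p ℕ.* l) _) (cong₂ _+_ (ι-* p l) (ι-* m q))))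
      (trans (cong ((P * Q + M * L) +_) (sym (-‿+-comm (P * L) (M * Q)))) (trans (medial _ _ _ _)
      (trans (cong₂ _+_ (trans (cong (P * Q +_) (-‿distribʳ-* P L)) (sym (distribˡ P Q (- L))))
        (trans (+-comm (M * L) _) (trans (cong₂ _+_ (-‿distribˡ-* M Q)
          (trans (sym (-‿involutive _)) (trans (cong -_ (-‿distribˡ-* M L)) (-‿distribʳ-* (- M) L)))) (sym (distribˡ (- M) Q (- L))))))
      (sym (distribʳ (Q - L) P (- M))))))
      where P = ι p ; M = ι m ; Q = ι q ; L = ι l

    insert-sound : ∀ t P ρ → poly (insert t P) ρ ≡ poly (t ∷ []) ρ + poly P ρ
    insert-sound t [] ρ = sym (+-identityʳ _)
    insert-sound (c , es) ((d , fs) ∷ P) ρ with eqm es fs in q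
    ... | true  = trans (cong (_+ poly P ρ) (trans (cong (_* mono es ρ) (addc-sound c d)) (distribʳ _ _ _)))
                  (trans (+-assoc _ _ _) (cong₂ _+_ (sym (+-identityʳ _)) (cong (λ z → coef d * mono z ρ + poly P ρ) (eqm-sound es fs q))))
    ... | false = trans (cong (coef d * mono fs ρ +_) (insert-sound (c , es) P ρ))
                  (trans (sym (+-assoc _ _ _)) (trans (cong (_+ poly P ρ) (+-comm _ _)) (+-assoc _ _ _)))

    addP-sound : ∀ P Q ρ → poly (addP P Q) ρ ≡ poly P ρ + poly Q ρ
    addP-sound []      Q ρ = sym (+-identityˡ _)
    addP-sound (t ∷ P) Q ρ = trans (insert-sound t (addP P Q) ρ) (trans (cong₂ _+_ (+-identityʳ _) (addP-sound P Q ρ)) (sym (+-assoc _ _ _)))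

    scaleP-sound : ∀ c es P ρ → poly (scaleP (c , es) P) ρ ≡ (coef c * mono es ρ) * poly P ρ
    scaleP-sound c es []             ρ = sym (zeroʳ _)
    scaleP-sound c es ((d , fs) ∷ P) ρ = trans (insert-sound _ (scaleP (c , es) P) ρ)
      (trans (cong₂ _+_ (trans (+-identityʳ _) (trans (cong₂ _*_ (mulc-sound c d) (mono-mul es fs ρ)) (*-medial _ _ _ _))) (scaleP-sound c es P ρ))
      (sym (distribˡ _ _ _)))

    mulP-sound : ∀ P Q ρ → poly (mulP P Q) ρ ≡ poly P ρ * poly Q ρ
    mulP-sound []            Q ρ = sym (zeroˡ _)
    mulP-sound ((c , es) ∷ P) Q ρ = trans (addP-sound (scaleP (c , es) Q) (mulP P Q) ρ)
      (trans (cong₂ _+_ (scaleP-sound c es Q ρ) (mulP-sound P Q ρ)) (sym (distribʳ _ _ _)))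

    var-sound : ∀ i ρ → mono (replicate i 0 ++ 1 ∷ []) ρ ≡ nth i ρ
    var-sound zero    []      = trans (*-identityʳ _) (*-identityʳ _)
    var-sound zero    (x ∷ ρ) = trans (*-identityʳ _) (*-identityʳ _)
    var-sound (suc i) []      = trans (*-identityˡ _) (trans (var-sound i []) (nth[] i))
      where nth[] : ∀ i → nth i [] ≡ 0#
            nth[] zero    = refl
            nth[] (suc i) = refl
    var-sound (suc i) (x ∷ ρ) = trans (*-identityˡ _) (var-sound i ρ)

    ι1-0 : ι 1 - ι 0 ≡ 1#
    ι1-0 = trans (cong (ι 1 +_) -0#≈0#) (+-identityʳ _)

    norm-sound : ∀ a ρ → poly (norm a) ρ ≡ ⟦ a ⟧ ρ
    norm-sound (v i)    ρ = trans (+-identityʳ _) (trans (cong₂ _*_ ι1-0 (var-sound i ρ)) (*-identityˡ _))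
    norm-sound (# n)    ρ = trans (+-identityʳ _) (trans (*-identityʳ _) (trans (cong (ι n +_) -0#≈0#) (+-identityʳ _)))
    norm-sound (:- a)   ρ = trans (scaleP-sound (0 , 1) [] (norm a) ρ) (trans (cong₂ _*_ (trans (*-identityʳ _) (+-identityˡ _)) (norm-sound a ρ))
                              (trans (sym (-‿distribˡ-* _ _)) (cong -_ (*-identityˡ _))))
    norm-sound (a :+ b) ρ = trans (addP-sound (norm a) (norm b) ρ) (cong₂ _+_ (norm-sound a ρ) (norm-sound b ρ))
    norm-sound (a :* b) ρ = trans (mulP-sound (norm a) (norm b) ρ) (cong₂ _*_ (norm-sound a ρ) (norm-sound b ρ))

    null-sound : ∀ P ρ → null P ≡ true → poly P ρ ≡ 0#
    null-sound []                   ρ _ = refl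
    null-sound (((p , m) , es) ∷ P) ρ z with p ≡ᵇ m in q
    ... | true = trans (cong₂ _+_ (trans (cong (λ x → (ι x - ι m) * mono es ρ) (≡ᵇ⇒≡ p m (subst Bool.T (sym q) tt)))
                   (trans (cong (_* mono es ρ) (-‿inverseʳ (ι m))) (zeroˡ _))) (null-sound P ρ z)) (+-identityʳ _)

    x-y≡0 : ∀ x y → x - y ≡ 0# → x ≡ y
    x-y≡0 x y e = trans (sym (+-identityʳ x)) (trans (cong (x +_) (sym (-‿inverseˡ y)))
      (trans (sym (+-assoc x (- y) y)) (trans (cong (_+ y) e) (+-identityˡ y))))

  -- Only the difference of the two sides is normalised, and each of its coefficients must cancel.
  -- Two normal forms are never compared, so the order in which `insert` leaves the monomials is
  -- immaterial.
  solve : ∀ ρ a b → null (norm (a :- b)) ≡ true → ⟦ a ⟧ ρ ≡ ⟦ b ⟧ ρ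
  solve ρ a b p = x-y≡0 _ _ (trans (sym (norm-sound (a :- b) ρ)) (null-sound (norm (a :- b)) ρ p))

-- Finite sums, certificates for inequalities, and inverses

record Finite (A : Set) : Set where
  field
    elems    : List A
    unique   : Unique elems
    complete : ∀ x → x ∈ elems
    _≟_      : DecidableEquality A

module Equality {A : Set} (E : Finite A) where
  open Finite E

  infix 4 _==_
  opaque
    _==_ : A → A → Bool
    x == y = does (x ≟ y)

    ==-refl : ∀ x → (x == x) ≡ true
    ==-refl x = dec-true (x ≟ x) refl

    ≢⇒== : ∀ {x y} → x ≢ y → (x == y) ≡ false
    ≢⇒== {x} {y} = dec-false (x ≟ y)

    ==⇒≡ : ∀ x y → (x == y) ≡ true → x ≡ y
    ==⇒≡ x y p with x ≟ y
    ... | yes q = q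

  ==-cong : ∀ {x y x′ y′} → (x ≡ y → x′ ≡ y′) → (x′ ≡ y′ → x ≡ y) → (x == y) ≡ (x′ == y′)
  ==-cong {x} {y} {x′} {y′} f g with x ≟ y
  ... | yes refl = trans (==-refl x) (trans (sym (==-refl x′)) (cong (x′ ==_) (f refl)))
  ... | no  p    = trans (≢⇒== p) (sym (≢⇒== (λ q → p (g q))))

  ==-sym : ∀ x y → (x == y) ≡ (y == x)
  ==-sym x y = ==-cong sym sym

module Sums (𝔽 : OrderedField) where
  open Arithmetic 𝔽

  -- Proves a ≤ b from the certificate b ≡ a + e with e nonnegative.
  by : ∀ ρ a b e → 0# ≤ ⟦ e ⟧ ρ → null (norm (b :- (a :+ e))) ≡ true → ⟦ a ⟧ ρ ≤ ⟦ b ⟧ ρ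
  by ρ a b e p q = ≡-≤ (sym (+-identityˡ _))
    (≤-≡ (+-monoʳ (⟦ a ⟧ ρ) p) (trans (+-comm _ _) (sym (solve ρ b (a :+ e) q))))

  -- The atoms of the certificates for `by`, which are then assembled with `_⊹_` and `_⊛_`.
  ⟪_⟫ : ∀ {x y} → x ≤ y → 0# ≤ y - x
  ⟪_⟫ {x} {y} p = ≡-≤ (sym (-‿inverseʳ x)) (+-monoʳ (- x) p)

  infixl 6 _⊹_
  infixl 7 _⊛_

  _⊹_ : ∀ {x y} → 0# ≤ x → 0# ≤ y → 0# ≤ x + y
  _⊹_ {x} {y} p q = ≤-trans p (≡-≤ (sym (+-identityˡ x)) (≤-≡ (+-monoʳ x q) (+-comm y x)))

  _⊛_ : ∀ {x y} → 0# ≤ x → 0# ≤ y → 0# ≤ x * y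
  _⊛_ = *-nonneg

  0≤1 : 0# ≤ 1#
  0≤1 with ≤-total 0# 1#
  ... | inj₁ p = p
  ... | inj₂ p = ⊥-elim (1≰0 p)

  ι-nn : ∀ n → 0# ≤ ι n
  ι-nn zero    = ≤-refl
  ι-nn (suc n) = ≤-≡ (0≤1 ⊹ ι-nn n) (sym (ι-suc n))

  *0ˡ : ∀ {x y} → x ≡ 0# → x * y ≡ 0#
  *0ˡ {y = y} refl = zeroˡ y

  *0ʳ : ∀ {x y} → y ≡ 0# → x * y ≡ 0#
  *0ʳ {x} refl = zeroʳ x

  *1ˡ : ∀ {x y} → x ≡ 1# → x * y ≡ y
  *1ˡ {y = y} refl = *-identityˡ y

  *1ʳ : ∀ {x y} → y ≡ 1# → x * y ≡ x
  *1ʳ {x} refl = *-identityʳ x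

  +-mono : ∀ {a b c d} → a ≤ b → c ≤ d → a + c ≤ b + d
  +-mono {a} {b} {c} {d} p q = by (a ∷ b ∷ c ∷ d ∷ []) (v 0 :+ v 2) (v 1 :+ v 3) (v 1 :- v 0 :+ (v 3 :- v 2)) (⟪ p ⟫ ⊹ ⟪ q ⟫) refl

  *-monoˡ : ∀ {a b c} → 0# ≤ c → a ≤ b → c * a ≤ c * b
  *-monoˡ {a} {b} {c} p q = by (a ∷ b ∷ c ∷ []) (v 2 :* v 0) (v 2 :* v 1) (v 2 :* (v 1 :- v 0)) (p ⊛ ⟪ q ⟫) refl

  *-monoʳ : ∀ {a b c} → 0# ≤ c → a ≤ b → a * c ≤ b * c
  *-monoʳ {a} {b} {c} p q = by (a ∷ b ∷ c ∷ []) (v 0 :* v 2) (v 1 :* v 2) (v 2 :* (v 1 :- v 0)) (p ⊛ ⟪ q ⟫) refl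

  *-mono : ∀ {a b c d} → 0# ≤ a → 0# ≤ d → a ≤ b → c ≤ d → a * c ≤ b * d
  *-mono p r q s = ≤-trans (*-monoˡ p s) (*-monoʳ r q)

  neg-mono : ∀ {a b} → a ≤ b → - b ≤ - a
  neg-mono {a} {b} p = by (a ∷ b ∷ []) (:- v 1) (:- v 0) (v 1 :- v 0) ⟪ p ⟫ refl

  sq-nn : ∀ x → 0# ≤ x * x
  sq-nn x with ≤-total 0# x
  ... | inj₁ p = p ⊛ p
  ... | inj₂ p = ≤-≡ (⟪ p ⟫ ⊛ ⟪ p ⟫) (solve (x ∷ []) ((# 0 :- v 0) :* (# 0 :- v 0)) (v 0 :* v 0) refl)

  ι-mono : ∀ {m n} → m ℕ.≤ n → ι m ≤ ι n
  ι-mono {m} {n} p = subst (λ z → ι m ≤ ι z) (ℕ.m+[n∸m]≡n p)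
    (≤-≡ (≡-≤ (sym (+-identityʳ _)) (+-mono ≤-refl (ι-nn (n ℕ.∸ m)))) (sym (ι-+ m _)))

  <⇒≤ : ∀ {x y} → x < y → x ≤ y
  <⇒≤ {x} {y} p with ≤-total x y
  ... | inj₁ q = q
  ... | inj₂ q = ⊥-elim (p q)

  ≤-<-trans : ∀ {x y z} → x ≤ y → y < z → x < z
  ≤-<-trans p q r = q (≤-trans r p)

  <-≤-trans : ∀ {x y z} → x < y → y ≤ z → x < z
  <-≤-trans p q r = p (≤-trans q r)

  ι-mono-< : ∀ {m n} → m ℕ.< n → ι m < ι n
  ι-mono-< {m} {n} p q = 1≰0 (by (ι m ∷ []) (# 1) (# 0) (v 0 :- (# 1 :+ v 0))
    ⟪ ≡-≤ (sym (ι-suc m)) (≤-trans (ι-mono p) q) ⟫ refl)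

  0<1 : 0# < 1#
  0<1 = 1≰0

  <⇒≢ : ∀ {x} → 0# < x → x ≢ 0#
  <⇒≢ p refl = p ≤-refl

  *-inv⁺ : ∀ {x} → 0# < x → x * recip x ≡ 1#
  *-inv⁺ {x} p = *-inv x (<⇒≢ p)

  inv-nn : ∀ {x} → 0# < x → 0# ≤ recip x
  inv-nn {x} p with ≤-total 0# (recip x)
  ... | inj₁ q = q
  ... | inj₂ q = ⊥-elim (1≰0 (≡-≤ (sym (*-inv⁺ p))
    (by (x ∷ recip x ∷ []) (v 0 :* v 1) (# 0) (v 0 :* (# 0 :- v 1)) (<⇒≤ p ⊛ ⟪ q ⟫) refl)))

  *-cancelˡ : ∀ {a b c} → 0# < c → c * a ≤ c * b → a ≤ b
  *-cancelˡ {a} {b} {c} p q = subst₂ _≤_ (e a) (e b) (*-monoˡ (inv-nn p) q)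
    where
    e : ∀ x → recip c * (c * x) ≡ x
    e x = trans (solve (c ∷ recip c ∷ x ∷ []) (v 1 :* (v 0 :* v 2)) (v 0 :* v 1 :* v 2) refl)
            (trans (cong (_* x) (*-inv⁺ p)) (*-identityˡ x))

  *-pos : ∀ {a b} → 0# < a → 0# < b → 0# < a * b
  *-pos {a} {b} p q r = q (*-cancelˡ p (≤-≡ r (sym (zeroʳ a))))

  inv-pos : ∀ {x} → 0# < x → 0# < recip x
  inv-pos {x} p q = 1≰0 (≡-≤ (sym (*-inv⁺ p)) (≤-≡ (*-monoˡ (<⇒≤ p) q) (zeroʳ x)))

  ι-pos : ∀ n → 0# < ι (suc n)
  ι-pos n = ι-mono-< {0} {suc n} (ℕ.s≤s ℕ.z≤n)

  sq-cancel : ∀ {x y} → 0# ≤ x → 0# ≤ y → x * x ≤ x * y → x ≤ y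
  sq-cancel {x} {y} p q r with x ≤? 0#
  ... | yes s = ≤-trans s q
  ... | no  s = *-cancelˡ s r

  sq-≤ : ∀ {x y} → 0# ≤ y → x * x ≤ y * y → x ≤ y
  sq-≤ {x} {y} p r with x ≤? y
  ... | yes s = s
  ... | no  s = ⊥-elim (s (sq-cancel (≤-trans p (<⇒≤ s)) p (≤-trans r (*-monoʳ p (<⇒≤ s)))))

  pow-nn : ∀ {x} n → 0# ≤ x → 0# ≤ pow x n
  pow-nn zero    p = 0≤1
  pow-nn (suc n) p = p ⊛ pow-nn n p

  pow-pos : ∀ {x} n → 0# < x → 0# < pow x n
  pow-pos zero    p = 0<1
  pow-pos (suc n) p = *-pos p (pow-pos n p)

  pow-mono : ∀ {x y} n → 0# ≤ x → x ≤ y → pow x n ≤ pow y n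
  pow-mono zero    p q = ≤-refl
  pow-mono (suc n) p q = *-mono p (pow-nn n (≤-trans p q)) q (pow-mono n p q)

  pow-* : ∀ x y n → pow (x * y) n ≡ pow x n * pow y n
  pow-* x y zero    = sym (*-identityˡ _)
  pow-* x y (suc n) = trans (cong (x * y *_) (pow-* x y n))
    (solve (x ∷ y ∷ pow x n ∷ pow y n ∷ []) (v 0 :* v 1 :* (v 2 :* v 3)) (v 0 :* v 2 :* (v 1 :* v 3)) refl)

  opaque
    [_] : Bool → F
    [ true ]  = 1#
    [ false ] = 0#

    []-nn : ∀ b → 0# ≤ [ b ]
    []-nn true  = 0≤1
    []-nn false = ≤-refl

    []≤1 : ∀ b → [ b ] ≤ 1#
    []≤1 true  = ≤-refl
    []≤1 false = 0≤1

    []-∧ : ∀ a b → [ a ∧ b ] ≡ [ a ] * [ b ]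
    []-∧ true  b = sym (*-identityˡ _)
    []-∧ false b = sym (zeroˡ _)

    []-idem : ∀ a → [ a ] * [ a ] ≡ [ a ]
    []-idem true  = *-identityˡ _
    []-idem false = zeroˡ _

    []-not : ∀ a → [ not a ] ≡ 1# - [ a ]
    []-not true  = sym (-‿inverseʳ 1#)
    []-not false = solve [] (# 1) (# 1 :- # 0) refl

    []-true : ∀ {b} → b ≡ true → [ b ] ≡ 1#
    []-true refl = refl

    []-false : ∀ {b} → b ≡ false → [ b ] ≡ 0#
    []-false refl = refl

  private
    variable
      A B : Set

  opaque
    ∑ : ∀ {A : Set} → List A → (A → F) → F
    ∑ []       f = 0#
    ∑ (x ∷ xs) f = f x + ∑ xs f

    ∑-cong : ∀ (xs : List A) {f g : A → F} → (∀ x → f x ≡ g x) → ∑ xs f ≡ ∑ xs g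
    ∑-cong []       e = refl
    ∑-cong (x ∷ xs) e = cong₂ _+_ (e x) (∑-cong xs e)

    ∑-mono : ∀ (xs : List A) {f g : A → F} → (∀ x → f x ≤ g x) → ∑ xs f ≤ ∑ xs g
    ∑-mono []       e = ≤-refl
    ∑-mono (x ∷ xs) e = +-mono (e x) (∑-mono xs e)

    ∑-0 : ∀ (xs : List A) → ∑ xs (λ _ → 0#) ≡ 0#
    ∑-0 []       = refl
    ∑-0 (x ∷ xs) = trans (+-identityˡ _) (∑-0 xs)

    ∑-nn : ∀ (xs : List A) {f : A → F} → (∀ x → 0# ≤ f x) → 0# ≤ ∑ xs f
    ∑-nn xs e = ≡-≤ (sym (∑-0 xs)) (∑-mono xs e)

    ∑-+ : ∀ (xs : List A) (f g : A → F) → ∑ xs (λ x → f x + g x) ≡ ∑ xs f + ∑ xs g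
    ∑-+ []       f g = sym (+-identityˡ _)
    ∑-+ (x ∷ xs) f g = trans (cong (f x + g x +_) (∑-+ xs f g))
      (solve (f x ∷ g x ∷ ∑ xs f ∷ ∑ xs g ∷ []) (v 0 :+ v 1 :+ (v 2 :+ v 3)) (v 0 :+ v 2 :+ (v 1 :+ v 3)) refl)

    ∑-*ˡ : ∀ (xs : List A) c (f : A → F) → ∑ xs (λ x → c * f x) ≡ c * ∑ xs f
    ∑-*ˡ []       c f = sym (zeroʳ c)
    ∑-*ˡ (x ∷ xs) c f = trans (cong (c * f x +_) (∑-*ˡ xs c f)) (sym (distribˡ _ _ _))

    ∑-*ʳ : ∀ (xs : List A) c (f : A → F) → ∑ xs (λ x → f x * c) ≡ ∑ xs f * c
    ∑-*ʳ xs c f = trans (∑-cong xs (λ x → *-comm (f x) c)) (trans (∑-*ˡ xs c f) (*-comm c _))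

    ∑-- : ∀ (xs : List A) (f g : A → F) → ∑ xs (λ x → f x - g x) ≡ ∑ xs f - ∑ xs g
    ∑-- []       f g = solve [] (# 0) (# 0 :- # 0) refl
    ∑-- (x ∷ xs) f g = trans (cong (f x - g x +_) (∑-- xs f g))
      (solve (f x ∷ g x ∷ ∑ xs f ∷ ∑ xs g ∷ []) (v 0 :- v 1 :+ (v 2 :- v 3)) (v 0 :+ v 2 :- (v 1 :+ v 3)) refl)

    ∑-swap : ∀ (xs : List A) (ys : List B) (f : A → B → F) → ∑ xs (λ x → ∑ ys (f x)) ≡ ∑ ys (λ y → ∑ xs (λ x → f x y))
    ∑-swap []       ys f = sym (∑-0 ys)
    ∑-swap (x ∷ xs) ys f = trans (cong (∑ ys (f x) +_) (∑-swap xs ys f)) (sym (∑-+ ys (f x) _))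

    ∑-<⇒∃ : ∀ (xs : List A) {f g : A → F} → ∑ xs f < ∑ xs g → ∃ λ x → f x < g x
    ∑-<⇒∃ []       p = ⊥-elim (p ≤-refl)
    ∑-<⇒∃ (x ∷ xs) {f} {g} p with g x ≤? f x
    ... | no  q = x , q
    ... | yes q = ∑-<⇒∃ xs (λ r → p (+-mono q r))

    ∑-++ : ∀ (xs ys : List A) (f : A → F) → ∑ (xs ++ ys) f ≡ ∑ xs f + ∑ ys f
    ∑-++ []       ys f = sym (+-identityˡ _)
    ∑-++ (x ∷ xs) ys f = trans (cong (f x +_) (∑-++ xs ys f)) (sym (+-assoc _ _ _))

    ∑-map : ∀ (xs : List B) (h : B → A) (f : A → F) → ∑ (map h xs) f ≡ ∑ xs (λ x → f (h x))
    ∑-map []       h f = refl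
    ∑-map (x ∷ xs) h f = cong (f (h x) +_) (∑-map xs h f)

    ∑∑-* : ∀ (xs : List A) (ys : List B) (f : A → F) (g : B → F) → ∑ xs (λ x → ∑ ys (λ y → f x * g y)) ≡ ∑ xs f * ∑ ys g
    ∑∑-* xs ys f g = trans (∑-cong xs (λ x → ∑-*ˡ ys (f x) g)) (∑-*ʳ xs (∑ ys g) f)

    -- Σᵢⱼ (fᵢgⱼ − fⱼgᵢ)² ≥ 0.
    cauchy : ∀ (xs : List A) (f g : A → F) → ∑ xs (λ x → f x * g x) * ∑ xs (λ x → f x * g x) ≤ ∑ xs (λ x → f x * f x) * ∑ xs (λ x → g x * g x)
    cauchy xs f g = *-cancelˡ (ι-pos 1) (by (P ∷ Q ∷ R ∷ []) (# 2 :* (v 0 :* v 0)) (# 2 :* (v 1 :* v 2)) (v 1 :* v 2 :+ v 1 :* v 2 :- # 2 :* (v 0 :* v 0))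
        (≤-≡ (∑-nn xs λ x → ∑-nn xs λ y → sq-nn (f x * g y - f y * g x)) expand) refl)
      where
      P Q R : F
      P = ∑ xs (λ x → f x * g x)
      Q = ∑ xs (λ x → f x * f x)
      R = ∑ xs (λ x → g x * g x)
      expand : ∑ xs (λ x → ∑ xs λ y → (f x * g y - f y * g x) * (f x * g y - f y * g x)) ≡ Q * R + Q * R - ι 2 * (P * P)
      expand = trans (∑-cong xs (λ x → trans (∑-cong xs λ y → solve (f x ∷ f y ∷ g x ∷ g y ∷ [])
            ((v 0 :* v 3 :- v 1 :* v 2) :* (v 0 :* v 3 :- v 1 :* v 2))
            (v 0 :* v 0 :* (v 3 :* v 3) :+ v 2 :* v 2 :* (v 1 :* v 1) :- # 2 :* (v 0 :* v 2) :* (v 1 :* v 3)) refl)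
          (trans (∑-- xs _ _) (cong₂ _-_ (trans (∑-+ xs _ _) (cong₂ _+_ (∑-*ˡ xs _ _) (∑-*ˡ xs _ _))) (∑-*ˡ xs _ _)))))
        (trans (∑-- xs _ _) (cong₂ _-_ (trans (∑-+ xs _ _) (cong₂ _+_ (∑-*ʳ xs _ _) (trans (∑-*ʳ xs _ _) (*-comm R Q))))
          (trans (∑-*ʳ xs _ _) (trans (cong (_* P) (∑-*ˡ xs (ι 2) _)) (*-assoc _ P P)))))

    ∑-[] : ∀ (f : A → F) → ∑ [] f ≡ 0#
    ∑-[] f = refl

    ∑-∷ : ∀ x (xs : List A) f → ∑ (x ∷ xs) f ≡ f x + ∑ xs f
    ∑-∷ x xs f = refl

    ∑-1 : ∀ (xs : List A) → ∑ xs (λ _ → 1#) ≡ ι (length xs)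
    ∑-1 []       = refl
    ∑-1 (x ∷ xs) = trans (cong (1# +_) (∑-1 xs)) (sym (ι-suc (length xs)))

    ∑-∈ : ∀ {z} (xs : List A) {f : A → F} → z ∈ xs → (∀ x → 0# ≤ f x) → f z ≤ ∑ xs f
    ∑-∈ (x ∷ xs) (here refl) p = ≡-≤ (sym (+-identityʳ _)) (+-mono ≤-refl (∑-nn xs p))
    ∑-∈ (x ∷ xs) (there m)   p = ≡-≤ (sym (+-identityˡ _)) (+-mono (p x) (∑-∈ xs m p))

  module _ {A : Set} (E : Finite A) where
    open Finite E
    open Equality E

    private opaque
      unfolding ∑

      point' : ∀ xs → Unique xs → ∀ {z} (f : A → F) → z ∈ xs → ∑ xs (λ x → [ x == z ] * f x) ≡ f z
      absent : ∀ xs {z} (f : A → F) → (∀ {x} → x ∈ xs → x ≢ z) → ∑ xs (λ x → [ x == z ] * f x) ≡ 0#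
      absent []       f n = refl
      absent (x ∷ xs) f n = trans (cong₂ _+_ (trans (cong (_* f x) ([]-false (≢⇒== (n (here refl))))) (zeroˡ _)) (absent xs f (λ m → n (there m)))) (+-identityˡ _)
      point' (x ∷ xs) (a ∷ u) f (here refl) = trans (cong₂ _+_ (trans (cong (_* f x) ([]-true (==-refl x))) (*-identityˡ _))
        (absent xs f (λ m e → All.lookup a m (sym e)))) (+-identityʳ _)
      point' (x ∷ xs) (a ∷ u) {z} f (there m) = trans (cong₂ _+_ (trans (cong (_* f x) ([]-false (≢⇒== (All.lookup a m)))) (zeroˡ _)) (point' xs u f m)) (+-identityˡ _)

    ∑-point : ∀ z (f : A → F) → ∑ elems (λ x → [ x == z ] * f x) ≡ f z
    ∑-point z f = point' elems unique f (complete z)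

    ∑-term : ∀ z (f : A → F) → (∀ x → 0# ≤ f x) → f z ≤ ∑ elems f
    ∑-term z f p = ≡-≤ (sym (∑-point z f)) (∑-mono elems λ x →
      ≤-≡ (*-monoʳ (p x) ([]≤1 (x == z))) (*-identityˡ _))

  -- Double counting: f (σ a) is a sum over b weighted by the bracket of b = σ a, and for fixed b
  -- only a = τ b contributes. Thus nothing has to be said about rearranging lists.
  ∑-reindex : ∀ (E : Finite A) (E′ : Finite B) (σ : A → B) (τ : B → A) → (∀ b → σ (τ b) ≡ b) → (∀ a → τ (σ a) ≡ a) →
    ∀ (f : B → F) → ∑ (Finite.elems E) (λ a → f (σ a)) ≡ ∑ (Finite.elems E′) f
  ∑-reindex E E′ σ τ στ τσ f =
    trans (∑-cong as (λ a → sym (∑-point E′ (σ a) f)))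
    (trans (∑-swap as bs _)
    (∑-cong bs (λ b → trans (∑-cong as (λ a → cong (λ z → [ z ] * f b) (flip a b)))
      (∑-point E (τ b) (λ _ → f b)))))
    where
    open Finite
    as = elems E
    bs = elems E′
    flip : ∀ a b → Equality._==_ E′ b (σ a) ≡ Equality._==_ E a (τ b)
    flip a b with _≟_ E a (τ b)
    ... | yes p = trans (cong (Equality._==_ E′ b) (trans (cong σ p) (στ b))) (trans (Equality.==-refl E′ b) (sym (trans (cong (λ z → Equality._==_ E z (τ b)) p) (Equality.==-refl E (τ b)))))
    ... | no  p = trans (Equality.≢⇒== E′ (λ q → p (trans (sym (τσ a)) (cong τ (sym q))))) (sym (Equality.≢⇒== E p))

-- The alternating group and its group algebra

fins : ∀ n → Finite (Fin n)
fins n = record { elems = allFin n ; unique = allFin⁺ n ; complete = ∈-allFin ; _≟_ = Fin._≟_ }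

-- The properties of A_n (n ≥ 3) that the argument uses.
record PermGroup (n : ℕ) : Set₁ where
  infixl 7 _∙_
  infixr 8 _▹_
  infix  9 _⁻¹
  field
    G        : Set
    finite   : Finite G
    _∙_      : G → G → G
    ε        : G
    _⁻¹      : G → G
    _▹_      : G → Fin n → Fin n
    ▹-∙      : ∀ g h i → (g ∙ h) ▹ i ≡ g ▹ (h ▹ i)
    ▹-ε      : ∀ i → ε ▹ i ≡ i
    ▹-⁻¹     : ∀ g i → g ⁻¹ ▹ (g ▹ i) ≡ i
    faithful : ∀ {g h} → (∀ i → g ▹ i ≡ h ▹ i) → g ≡ h
    three    : ∀ {i j k} → i ≢ j → j ≢ k → i ≢ k →
               Σ G λ c → c ▹ i ≡ j × c ▹ j ≡ k × c ▹ k ≡ i × (∀ l → l ≢ i → l ≢ j → l ≢ k → c ▹ l ≡ l)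
    -- Together with `three` and `faithful` this pins the group down: it contains every 3-cycle but
    -- no transposition.
    noSwap   : ∀ g y z → (∀ i → i ≢ y → i ≢ z → g ▹ i ≡ i) → g ▹ y ≡ y

  assoc : ∀ g h k → (g ∙ h) ∙ k ≡ g ∙ (h ∙ k)
  assoc g h k = faithful λ i → trans (▹-∙ (g ∙ h) k i) (trans (▹-∙ g h _) (trans (cong (g ▹_) (sym (▹-∙ h k i))) (sym (▹-∙ g (h ∙ k) i))))

  idˡ : ∀ g → ε ∙ g ≡ g
  idˡ g = faithful λ i → trans (▹-∙ ε g i) (▹-ε _)

  idʳ : ∀ g → g ∙ ε ≡ g
  idʳ g = faithful λ i → trans (▹-∙ g ε i) (cong (g ▹_) (▹-ε i))

  invˡ : ∀ g → g ⁻¹ ∙ g ≡ ε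
  invˡ g = faithful λ i → trans (▹-∙ (g ⁻¹) g i) (trans (▹-⁻¹ g i) (sym (▹-ε i)))

  ⁻¹-invol : ∀ g → (g ⁻¹) ⁻¹ ≡ g
  ⁻¹-invol g = trans (sym (idʳ _)) (trans (cong ((g ⁻¹) ⁻¹ ∙_) (sym (invˡ g))) (trans (sym (assoc _ _ _)) (trans (cong (_∙ g) (invˡ (g ⁻¹))) (idˡ g))))

  invʳ : ∀ g → g ∙ g ⁻¹ ≡ ε
  invʳ g = trans (cong (_∙ g ⁻¹) (sym (⁻¹-invol g))) (invˡ (g ⁻¹))

  ▹-⁻¹ʳ : ∀ g i → g ▹ (g ⁻¹ ▹ i) ≡ i
  ▹-⁻¹ʳ g i = trans (cong (_▹ (g ⁻¹ ▹ i)) (sym (⁻¹-invol g))) (▹-⁻¹ (g ⁻¹) i)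

  ▹-inj : ∀ g {i j} → g ▹ i ≡ g ▹ j → i ≡ j
  ▹-inj g {i} {j} p = trans (sym (▹-⁻¹ g i)) (trans (cong (g ⁻¹ ▹_) p) (▹-⁻¹ g j))

  cancelˡ : ∀ g h → g ⁻¹ ∙ (g ∙ h) ≡ h
  cancelˡ g h = trans (sym (assoc _ _ _)) (trans (cong (_∙ h) (invˡ g)) (idˡ h))

  cancelˡ′ : ∀ g h → g ∙ (g ⁻¹ ∙ h) ≡ h
  cancelˡ′ g h = trans (sym (assoc _ _ _)) (trans (cong (_∙ h) (invʳ g)) (idˡ h))

  cancelʳ : ∀ g h → (h ∙ g) ∙ g ⁻¹ ≡ h
  cancelʳ g h = trans (assoc _ _ _) (trans (cong (h ∙_) (invʳ g)) (idʳ h))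

  cancelʳ′ : ∀ g h → (h ∙ g ⁻¹) ∙ g ≡ h
  cancelʳ′ g h = trans (assoc _ _ _) (trans (cong (h ∙_) (invˡ g)) (idʳ h))

  inv-unique : ∀ {g h} → g ∙ h ≡ ε → h ≡ g ⁻¹
  inv-unique {g} {h} p = trans (sym (cancelˡ g h)) (trans (cong (g ⁻¹ ∙_) p) (idʳ _))

  ⁻¹-∙ : ∀ g h → (g ∙ h) ⁻¹ ≡ h ⁻¹ ∙ g ⁻¹
  ⁻¹-∙ g h = sym (inv-unique (trans (assoc g h _) (trans (cong (g ∙_) (cancelˡ′ h _)) (invʳ g))))

module GroupAlgebra (𝔽 : OrderedField) {n : ℕ} (𝔾 : PermGroup n) where
  open Sums 𝔽
  open Arithmetic 𝔽
  open PermGroup 𝔾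

  Gs : List G
  Gs = Finite.elems finite

  Fs : List (Fin n)
  Fs = allFin n

  open Equality (fins n)

  shiftˡ : ∀ g (f : G → F) → ∑ Gs (λ h → f (g ∙ h)) ≡ ∑ Gs f
  shiftˡ g = ∑-reindex finite finite (g ∙_) (g ⁻¹ ∙_) (cancelˡ′ g) (cancelˡ g)

  shiftʳ : ∀ g (f : G → F) → ∑ Gs (λ h → f (h ∙ g)) ≡ ∑ Gs f
  shiftʳ g = ∑-reindex finite finite (_∙ g) (_∙ g ⁻¹) (cancelʳ′ g) (cancelʳ g)

  flipG : ∀ (f : G → F) → ∑ Gs (λ h → f (h ⁻¹)) ≡ ∑ Gs f
  flipG = ∑-reindex finite finite _⁻¹ _⁻¹ ⁻¹-invol ⁻¹-invol

  permute : ∀ g (f : Fin n → F) → ∑ Fs (λ i → f (g ▹ i)) ≡ ∑ Fs f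
  permute g = ∑-reindex (fins n) (fins n) (g ▹_) (g ⁻¹ ▹_) (▹-⁻¹ʳ g) (▹-⁻¹ g)

  Alg : Set
  Alg = G → F

  infix 4 _≈_
  record _≈_ (x y : Alg) : Set where
    constructor mk
    field at : ∀ g → x g ≡ y g
  open _≈_ public

  ≈-refl : ∀ {x} → x ≈ x
  ≈-refl = mk λ _ → refl

  ≈-sym : ∀ {x y} → x ≈ y → y ≈ x
  ≈-sym p = mk λ g → sym (at p g)

  ≈-trans : ∀ {x y z} → x ≈ y → y ≈ z → x ≈ z
  ≈-trans p q = mk λ g → trans (at p g) (at q g)

  infixl 7 _⋆_
  infixl 6 _⊕_ _⊖_
  infixr 8 _•_

  opaque
    _⋆_ : Alg → Alg → Alg
    (x ⋆ y) g = ∑ Gs λ h → x h * y (h ⁻¹ ∙ g)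

  _⊕_ _⊖_ : Alg → Alg → Alg
  (x ⊕ y) g = x g + y g
  (x ⊖ y) g = x g - y g

  _•_ : F → Alg → Alg
  (c • x) g = c * x g

  𝟘 : Alg
  𝟘 _ = 0#

  _† : Alg → Alg
  (x †) g = x (g ⁻¹)

  Σᶠ : (Fin n → Alg) → Alg
  Σᶠ x g = ∑ Fs λ i → x i g

  ⟨_,_⟩ : Alg → Alg → F
  ⟨ x , y ⟩ = ∑ Gs λ g → x g * y g

  opaque
    unfolding _⋆_

    ⋆-def : ∀ x y g → (x ⋆ y) g ≡ ∑ Gs λ h → x h * y (h ⁻¹ ∙ g)
    ⋆-def x y g = refl

    ⋆-cong : ∀ {x x′ y y′} → x ≈ x′ → y ≈ y′ → x ⋆ y ≈ x′ ⋆ y′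
    ⋆-cong p q = mk λ g → ∑-cong Gs λ h → cong₂ _*_ (at p h) (at q _)

  ⋆-congʳ : ∀ {x y y′} → y ≈ y′ → x ⋆ y ≈ x ⋆ y′
  ⋆-congʳ {x} = ⋆-cong (≈-refl {x})

  ⋆-congˡ : ∀ {x x′ y} → x ≈ x′ → x ⋆ y ≈ x′ ⋆ y
  ⋆-congˡ {y = y} p = ⋆-cong p (≈-refl {y})

  ⊕-cong : ∀ {x x′ y y′} → x ≈ x′ → y ≈ y′ → x ⊕ y ≈ x′ ⊕ y′
  ⊕-cong p q = mk λ g → cong₂ _+_ (at p g) (at q g)

  ⊖-cong : ∀ {x x′ y y′} → x ≈ x′ → y ≈ y′ → x ⊖ y ≈ x′ ⊖ y′
  ⊖-cong p q = mk λ g → cong₂ _-_ (at p g) (at q g)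

  ·-cong : ∀ {c x x′} → x ≈ x′ → c • x ≈ c • x′
  ·-cong {c} p = mk λ g → cong (c *_) (at p g)

  Σ-cong : ∀ {x y : Fin n → Alg} → (∀ i → x i ≈ y i) → Σᶠ x ≈ Σᶠ y
  Σ-cong p = mk λ g → ∑-cong Fs λ i → at (p i) g

  opaque
    unfolding _⋆_

    ⋆-alt : ∀ x y g → (x ⋆ y) g ≡ ∑ Gs λ k → x (g ∙ k ⁻¹) * y k
    ⋆-alt x y g = trans (sym (shiftˡ g (λ h → x h * y (h ⁻¹ ∙ g)))) (trans (sym (flipG _)) (∑-cong Gs λ k → cong (λ z → x (g ∙ k ⁻¹) * y z)
      (trans (cong (_∙ g) (⁻¹-∙ g (k ⁻¹))) (trans (cancelʳ′ g _) (⁻¹-invol k)))))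

    ⋆-assoc : ∀ x y z → (x ⋆ y) ⋆ z ≈ x ⋆ (y ⋆ z)
    ⋆-assoc x y z = mk λ g →
      trans (∑-cong Gs λ k → sym (∑-*ʳ Gs (z (k ⁻¹ ∙ g)) _))
      (trans (∑-swap Gs Gs _) (∑-cong Gs λ h →
        trans (∑-cong Gs λ k → *-assoc (x h) _ _)
        (trans (∑-*ˡ Gs (x h) _) (cong (x h *_)
          (trans (sym (shiftˡ h _)) (∑-cong Gs λ k → cong₂ (λ a b → y a * z b) (cancelˡ h k)
            (trans (cong (_∙ g) (⁻¹-∙ h k)) (assoc _ _ _))))))))

    ⋆-⊕ˡ : ∀ x y z → (x ⊕ y) ⋆ z ≈ x ⋆ z ⊕ y ⋆ z
    ⋆-⊕ˡ x y z = mk λ g → trans (∑-cong Gs λ h → distribʳ _ _ _) (∑-+ Gs _ _)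

    ⋆-⊕ʳ : ∀ x y z → x ⋆ (y ⊕ z) ≈ x ⋆ y ⊕ x ⋆ z
    ⋆-⊕ʳ x y z = mk λ g → trans (∑-cong Gs λ h → distribˡ _ _ _) (∑-+ Gs _ _)

    ⋆-⊖ˡ : ∀ x y z → (x ⊖ y) ⋆ z ≈ x ⋆ z ⊖ y ⋆ z
    ⋆-⊖ˡ x y z = mk λ g → trans (∑-cong Gs λ h → trans (distribʳ _ _ _) (cong (_ +_) (sym (-‿distribˡ-* _ _)))) (∑-- Gs _ _)

    ⋆-⊖ʳ : ∀ x y z → x ⋆ (y ⊖ z) ≈ x ⋆ y ⊖ x ⋆ z
    ⋆-⊖ʳ x y z = mk λ g → trans (∑-cong Gs λ h → trans (distribˡ _ _ _) (cong (_ +_) (sym (-‿distribʳ-* _ _)))) (∑-- Gs _ _)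

    ⋆-·ˡ : ∀ c x y → (c • x) ⋆ y ≈ c • (x ⋆ y)
    ⋆-·ˡ c x y = mk λ g → trans (∑-cong Gs λ h → *-assoc _ _ _) (∑-*ˡ Gs c _)

    ⋆-·ʳ : ∀ c x y → x ⋆ (c • y) ≈ c • (x ⋆ y)
    ⋆-·ʳ c x y = mk λ g → trans (∑-cong Gs λ h → solve (x h ∷ c ∷ y (h ⁻¹ ∙ g) ∷ []) (v 0 :* (v 1 :* v 2)) (v 1 :* (v 0 :* v 2)) refl) (∑-*ˡ Gs c _)

    ⋆-Σˡ : ∀ x y → Σᶠ x ⋆ y ≈ Σᶠ (λ i → x i ⋆ y)
    ⋆-Σˡ x y = mk λ g → trans (∑-cong Gs λ h → sym (∑-*ʳ Fs _ _)) (∑-swap Gs Fs _)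

    ⋆-Σʳ : ∀ x y → x ⋆ Σᶠ y ≈ Σᶠ (λ i → x ⋆ y i)
    ⋆-Σʳ x y = mk λ g → trans (∑-cong Gs λ h → sym (∑-*ˡ Fs _ _)) (∑-swap Gs Fs _)

    ⋆-𝟘ʳ : ∀ x → x ⋆ 𝟘 ≈ 𝟘
    ⋆-𝟘ʳ x = mk λ g → trans (∑-cong Gs λ h → zeroʳ _) (∑-0 Gs)

    ⋆-𝟘ˡ : ∀ x → 𝟘 ⋆ x ≈ 𝟘
    ⋆-𝟘ˡ x = mk λ g → trans (∑-cong Gs λ h → zeroˡ _) (∑-0 Gs)

    ⋆-† : ∀ x y → (x ⋆ y) † ≈ (y †) ⋆ (x †)
    ⋆-† x y = mk λ g → trans (⋆-alt x y (g ⁻¹)) (trans (sym (flipG _)) (∑-cong Gs λ k → trans (*-comm _ _)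
      (cong (λ z → y (k ⁻¹) * x z) (trans (cong (g ⁻¹ ∙_) (⁻¹-invol k)) (trans (sym (⁻¹-invol _)) (cong _⁻¹ (trans (⁻¹-∙ _ _) (cong (k ⁻¹ ∙_) (⁻¹-invol g)))))))))

  †-cong : ∀ {x y} → x ≈ y → x † ≈ y †
  †-cong p = mk λ g → at p (g ⁻¹)

  ⟨⟩-cong : ∀ {x x′ y y′} → x ≈ x′ → y ≈ y′ → ⟨ x , y ⟩ ≡ ⟨ x′ , y′ ⟩
  ⟨⟩-cong p q = ∑-cong Gs λ g → cong₂ _*_ (at p g) (at q g)

  ⟨⟩-comm : ∀ x y → ⟨ x , y ⟩ ≡ ⟨ y , x ⟩
  ⟨⟩-comm x y = ∑-cong Gs λ g → *-comm _ _

  ⟨⟩-nn : ∀ x → 0# ≤ ⟨ x , x ⟩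
  ⟨⟩-nn x = ∑-nn Gs λ g → sq-nn (x g)

  ⟨⟩-⊕ˡ : ∀ x y z → ⟨ x ⊕ y , z ⟩ ≡ ⟨ x , z ⟩ + ⟨ y , z ⟩
  ⟨⟩-⊕ˡ x y z = trans (∑-cong Gs λ g → distribʳ _ _ _) (∑-+ Gs _ _)

  ⟨⟩-⊖ˡ : ∀ x y z → ⟨ x ⊖ y , z ⟩ ≡ ⟨ x , z ⟩ - ⟨ y , z ⟩
  ⟨⟩-⊖ˡ x y z = trans (∑-cong Gs λ g → trans (distribʳ _ _ _) (cong (_ +_) (sym (-‿distribˡ-* _ _)))) (∑-- Gs _ _)

  ⟨⟩-·ˡ : ∀ c x y → ⟨ c • x , y ⟩ ≡ c * ⟨ x , y ⟩
  ⟨⟩-·ˡ c x y = trans (∑-cong Gs λ g → *-assoc _ _ _) (∑-*ˡ Gs c _)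

  ⟨⟩-Σˡ : ∀ x y → ⟨ Σᶠ x , y ⟩ ≡ ∑ Fs λ i → ⟨ x i , y ⟩
  ⟨⟩-Σˡ x y = trans (∑-cong Gs λ g → sym (∑-*ʳ Fs _ _)) (∑-swap Gs Fs _)

  ⟨⟩-⊕ʳ : ∀ x y z → ⟨ z , x ⊕ y ⟩ ≡ ⟨ z , x ⟩ + ⟨ z , y ⟩
  ⟨⟩-⊕ʳ x y z = trans (⟨⟩-comm _ _) (trans (⟨⟩-⊕ˡ x y z) (cong₂ _+_ (⟨⟩-comm _ _) (⟨⟩-comm _ _)))

  ⟨⟩-⊖ʳ : ∀ x y z → ⟨ z , x ⊖ y ⟩ ≡ ⟨ z , x ⟩ - ⟨ z , y ⟩
  ⟨⟩-⊖ʳ x y z = trans (⟨⟩-comm _ _) (trans (⟨⟩-⊖ˡ x y z) (cong₂ _-_ (⟨⟩-comm _ _) (⟨⟩-comm _ _)))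

  ⟨⟩-·ʳ : ∀ c x y → ⟨ y , c • x ⟩ ≡ c * ⟨ y , x ⟩
  ⟨⟩-·ʳ c x y = trans (⟨⟩-comm _ _) (trans (⟨⟩-·ˡ c x y) (cong (c *_) (⟨⟩-comm _ _)))

  ⟨⟩-Σʳ : ∀ x y → ⟨ y , Σᶠ x ⟩ ≡ ∑ Fs λ i → ⟨ y , x i ⟩
  ⟨⟩-Σʳ x y = trans (⟨⟩-comm _ _) (trans (⟨⟩-Σˡ x y) (∑-cong Fs λ i → ⟨⟩-comm _ _))

  opaque
    unfolding _⋆_

    ⟨⟩-†ˡ : ∀ x y z → ⟨ x ⋆ y , z ⟩ ≡ ⟨ y , x † ⋆ z ⟩
    ⟨⟩-†ˡ x y z =
      trans (∑-cong Gs λ g → trans (cong (_* z g) (⋆-alt x y g)) (sym (∑-*ʳ Gs (z g) _)))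
      (trans (∑-swap Gs Gs _) (∑-cong Gs λ k →
        trans (trans (∑-cong Gs λ g → trans (solve (x (g ∙ k ⁻¹) ∷ y k ∷ z g ∷ []) (v 0 :* v 1 :* v 2) (v 1 :* (v 0 :* v 2)) refl)
           (cong (λ a → y k * (x a * z g)) (sym (trans (⁻¹-∙ k (g ⁻¹)) (cong (_∙ k ⁻¹) (⁻¹-invol g)))))) (∑-*ˡ Gs (y k) _))
        (cong (y k *_) (trans (∑-cong Gs λ g → refl) (sym (⋆-alt (x †) z k))))))

  CS : ∀ x y → ⟨ x , y ⟩ * ⟨ x , y ⟩ ≤ ⟨ x , x ⟩ * ⟨ y , y ⟩
  CS x y = cauchy Gs x y

  -- The translate δ_a ⋆ y.
  L : G → Alg → Alg
  L a y g = y (a ⁻¹ ∙ g)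

  ⟨⟩-L : ∀ a x y → ⟨ L a x , L a y ⟩ ≡ ⟨ x , y ⟩
  ⟨⟩-L a x y = shiftˡ (a ⁻¹) (λ g → x g * y g)

  L-L : ∀ a b y → L a (L b y) ≈ L (a ∙ b) y
  L-L a b y = mk λ g → cong y (trans (sym (assoc _ _ _)) (cong (_∙ g) (sym (⁻¹-∙ a b))))

-- Averages over alternating subgroups

module Averages (𝔽 : OrderedField) {n : ℕ} (𝔾 : PermGroup n) where
  open Sums 𝔽
  open Arithmetic 𝔽
  open PermGroup 𝔾
  open GroupAlgebra 𝔽 𝔾
  open Equality (fins n)

  Points : Set
  Points = Fin n → Bool

  infix 4 _⊆_
  _⊆_ : Points → Points → Set
  W ⊆ V = ∀ i → W i ≡ true → V i ≡ true

  infixl 6 _∖_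
  _∖_ : Points → Fin n → Points
  (W ∖ k) i = W i ∧ not (i == k)

  ∣_∣ : Points → F
  ∣ W ∣ = ∑ Fs λ i → [ W i ]

  ∧-true : ∀ {a b} → a ∧ b ≡ true → a ≡ true × b ≡ true
  ∧-true {true} {true} _ = refl , refl

  true≢false : ∀ {b} → b ≡ true → b ≡ false → ⊥
  true≢false refl ()

  bool : ∀ b → b ≡ true ⊎ b ≡ false
  bool true  = inj₁ refl
  bool false = inj₂ refl

  not-== : ∀ {i k} → i ≢ k → not (i == k) ≡ true
  not-== p = cong not (≢⇒== p)

  ∖-⊆ : ∀ W k → W ∖ k ⊆ W
  ∖-⊆ W k i p = proj₁ (∧-true p)

  ∖-≢ : ∀ W k {i} → (W ∖ k) i ≡ true → i ≢ k
  ∖-≢ W k {i} p refl = true≢false (proj₂ (∧-true {W i} p)) (cong not (==-refl k))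

  ∖-in : ∀ {W k i} → W i ≡ true → i ≢ k → (W ∖ k) i ≡ true
  ∖-in p q = cong₂ _∧_ p (not-== q)

  ∖-out : ∀ W k → (W ∖ k) k ≡ false
  ∖-out W k = trans (cong (λ b → W k ∧ not b) (==-refl k)) (Bool.∧-zeroʳ (W k))

  ∑-pointF : ∀ k (f : Fin n → F) → ∑ Fs (λ i → [ i == k ] * f i) ≡ f k
  ∑-pointF = ∑-point (fins n)

  ∑-pointF′ : ∀ k (f : Fin n → F) → ∑ Fs (λ i → f i * [ i == k ]) ≡ f k
  ∑-pointF′ k f = trans (∑-cong Fs λ i → *-comm _ _) (∑-pointF k f)

  ∑-point1 : ∀ k → ∑ Fs (λ i → [ i == k ]) ≡ 1#
  ∑-point1 k = trans (∑-cong Fs λ i → sym (*-identityʳ _)) (∑-pointF k (λ _ → 1#))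

  []-∖ : ∀ W k i → [ (W ∖ k) i ] ≡ [ W i ] - [ W i ] * [ i == k ]
  []-∖ W k i = trans ([]-∧ (W i) _) (trans (cong ([ W i ] *_) ([]-not (i == k)))
    (solve ([ W i ] ∷ [ i == k ] ∷ []) (v 0 :* (# 1 :- v 1)) (v 0 :- v 0 :* v 1) refl))

  card-∖ : ∀ {W k} → W k ≡ true → ∣ W ∖ k ∣ ≡ ∣ W ∣ - 1#
  card-∖ {W} {k} p = trans (∑-cong Fs ([]-∖ W k)) (trans (∑-- Fs _ _) (cong (λ z → ∣ W ∣ - z) (trans (∑-pointF′ k _) ([]-true p))))

  card-mono : ∀ {W V} → W ⊆ V → ∣ W ∣ ≤ ∣ V ∣
  card-mono {W} {V} p = ∑-mono Fs λ i → le i (bool (W i))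
    where
    le : ∀ i → W i ≡ true ⊎ W i ≡ false → [ W i ] ≤ [ V i ]
    le i (inj₁ q) = ≤-reflexive (trans ([]-true q) (sym ([]-true (p i q))))
    le i (inj₂ q) = ≡-≤ ([]-false q) ([]-nn (V i))

  -- The brackets of i = x, summed over all i and all x in the list, give the length of the list; if
  -- this is less than the size of W, some i in W has a bracket larger than its share.
  pick : ∀ {W} (xs : List (Fin n)) → ι (length xs) < ∣ W ∣ → ∃ λ j → W j ≡ true × j ∉ xs
  pick {W} xs p with ∑-<⇒∃ Fs {λ i → ∑ xs λ x → [ i == x ]} {λ i → [ W i ]} (≤-<-trans (≤-reflexive count) p)
    where
    count : ∑ Fs (λ i → ∑ xs λ x → [ i == x ]) ≡ ι (length xs)
    count = trans (∑-swap Fs xs _) (trans (∑-cong xs ∑-point1) (∑-1 xs))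
  ... | j , q with bool (W j)
  ...   | inj₁ r = j , r , λ m → q (≡-≤ (trans ([]-true r) (sym ([]-true (==-refl j)))) (∑-∈ xs m (λ x → []-nn _)))
  ...   | inj₂ r = ⊥-elim (q (≡-≤ ([]-false r) (∑-nn xs λ x → []-nn _)))

  -- The pointwise stabiliser of the complement of W, that is, the alternating group A_W.
  Fix : Points → G → Set
  Fix W g = ∀ i → W i ≡ false → g ▹ i ≡ i

  opaque
    fix? : ∀ W g → Dec (Fix W g)
    fix? W g = Fin.all? λ i → (W i Bool.≟ false) →-dec (g ▹ i Fin.≟ i)

    inA : Points → G → Bool
    inA W g = does (fix? W g)

    inA-true : ∀ {W g} → Fix W g → inA W g ≡ true
    inA-true {W} {g} p = dec-true (fix? W g) p

    inA-false : ∀ {W g} → ¬ Fix W g → inA W g ≡ false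
    inA-false {W} {g} p = dec-false (fix? W g) p

    inA-cong : ∀ {W V g h} → (Fix W g → Fix V h) → (Fix V h → Fix W g) → inA W g ≡ inA V h
    inA-cong {W} {V} {g} {h} p q = does-⇔ (mk⇔ p q) (fix? W g) (fix? V h)

    inA-fix : ∀ {W g} → inA W g ≡ true → Fix W g
    inA-fix {W} {g} t = from (fix? W g) t
      where
      from : (d : Dec (Fix W g)) → does d ≡ true → Fix W g
      from (yes q) _ = q

  fix-ε : ∀ W → Fix W ε
  fix-ε W i _ = ▹-ε i

  fix-∙ : ∀ {W g h} → Fix W g → Fix W h → Fix W (g ∙ h)
  fix-∙ {W} {g} {h} p q i r = trans (▹-∙ g h i) (trans (cong (g ▹_) (q i r)) (p i r))

  fix-⁻¹ : ∀ {W g} → Fix W g → Fix W (g ⁻¹)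
  fix-⁻¹ {W} {g} p i r = trans (cong (g ⁻¹ ▹_) (sym (p i r))) (▹-⁻¹ g i)

  fix-mono : ∀ {W V g} → W ⊆ V → Fix W g → Fix V g
  fix-mono {W} p q i r with bool (W i)
  ... | inj₁ s = ⊥-elim (true≢false (p i s) r)
  ... | inj₂ s = q i s

  fix-stable : ∀ {W g} → Fix W g → ∀ i → W (g ▹ i) ≡ W i
  fix-stable {W} {g} p i with bool (W i) | bool (W (g ▹ i))
  ... | inj₁ r | inj₁ s = trans s (sym r)
  ... | inj₂ r | _      = cong W (p i r)
  ... | inj₁ r | inj₂ s = ⊥-elim (true≢false (subst (λ z → W z ≡ true) (sym (▹-inj g (p (g ▹ i) s))) r) s)

  ∣A∣ : Points → F
  ∣A∣ W = ∑ Gs λ g → [ inA W g ]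

  A-pos : ∀ W → 0# < ∣A∣ W
  A-pos W = <-≤-trans 0<1 (≡-≤ (sym ([]-true (inA-true {W} (fix-ε W))))
    (∑-term finite ε (λ g → [ inA W g ]) (λ g → []-nn _)))

  opaque
    -- The uniform distribution on A_W. As an element of the group algebra it is the self-adjoint
    -- idempotent onto the functions invariant under left translation by A_W.
    e : Points → Alg
    e W g = [ inA W g ] * recip (∣A∣ W)

    e-def : ∀ W g → e W g ≡ [ inA W g ] * recip (∣A∣ W)
    e-def W g = refl

  e-in : ∀ {W g} → Fix W g → e W g ≡ recip (∣A∣ W)
  e-in {W} {g} p = trans (e-def W g) (trans (cong (_* _) ([]-true (inA-true {W} p))) (*-identityˡ _))

  e-out : ∀ {W g} → ¬ Fix W g → e W g ≡ 0#
  e-out {W} {g} p = trans (e-def W g) (trans (cong (_* _) ([]-false (inA-false {W} p))) (zeroˡ _))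

  e-guard : ∀ W h {a b} → (Fix W h → a ≡ b) → e W h * a ≡ e W h * b
  e-guard W h p with fix? W h
  ... | yes q = cong (e W h *_) (p q)
  ... | no  q = trans (cong (_* _) (e-out {W} q)) (trans (zeroˡ _) (sym (trans (cong (_* _) (e-out {W} q)) (zeroˡ _))))

  e-inA : ∀ {W V g h} → ∣A∣ W ≡ ∣A∣ V → inA W g ≡ inA V h → e W g ≡ e V h
  e-inA {W} {V} p q = trans (e-def W _) (trans (cong₂ (λ a b → [ a ] * recip b) q p) (sym (e-def V _)))

  e-shiftˡ : ∀ {W κ} → Fix W κ → ∀ g → e W (κ ∙ g) ≡ e W g
  e-shiftˡ {W} {κ} p g = e-inA {W} {W} refl (inA-cong {W} {W}
    (λ q → subst (Fix W) (cancelˡ κ g) (fix-∙ {W} (fix-⁻¹ {W} p) q)) (fix-∙ {W} p))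

  e-† : ∀ W → e W † ≈ e W
  e-† W = mk λ g → e-inA {W} {W} refl (inA-cong {W} {W} (λ q → subst (Fix W) (⁻¹-invol g) (fix-⁻¹ {W} q)) (fix-⁻¹ {W}))

  e-sum : ∀ W → ∑ Gs (e W) ≡ 1#
  e-sum W = trans (∑-cong Gs (e-def W)) (trans (∑-*ʳ Gs _ _) (*-inv⁺ (A-pos W)))

  Inv : Points → Alg → Set
  Inv W y = ∀ κ → Fix W κ → ∀ g → y (κ ⁻¹ ∙ g) ≡ y g

  opaque
    unfolding _⋆_

    e-absorb : ∀ {W y} → Inv W y → e W ⋆ y ≈ y
    e-absorb {W} {y} p = mk λ g → trans (∑-cong Gs λ h → e-guard W h (λ q → p h q g)) (trans (∑-*ʳ Gs _ _) (trans (cong (_* y g) (e-sum W)) (*-identityˡ _)))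

    e-Inv : ∀ W y → Inv W (e W ⋆ y)
    e-Inv W y κ p g = trans (sym (shiftˡ (κ ⁻¹) _)) (∑-cong Gs λ h → cong₂ (λ a b → a * y b) (e-shiftˡ {W} (fix-⁻¹ {W} p) h)
      (trans (cong (_∙ (κ ⁻¹ ∙ g)) (⁻¹-∙ (κ ⁻¹) h)) (trans (assoc _ _ _) (cong (h ⁻¹ ∙_) (cancelˡ _ _)))))

  Inv-mono : ∀ {W V y} → W ⊆ V → Inv V y → Inv W y
  Inv-mono p q κ r = q κ (fix-mono p r)

  Inv-e : ∀ W → Inv W (e W)
  Inv-e W κ p g = e-shiftˡ {W} (fix-⁻¹ {W} p) g

  e-subˡ : ∀ {W V} → W ⊆ V → e W ⋆ e V ≈ e V
  e-subˡ {W} {V} p = e-absorb (Inv-mono p (Inv-e V))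

  e-subʳ : ∀ {W V} → W ⊆ V → e V ⋆ e W ≈ e V
  e-subʳ {W} {V} p = ≈-trans (⋆-cong (≈-sym (e-† V)) (≈-sym (e-† W))) (≈-trans (≈-sym (⋆-† (e W) (e V))) (≈-trans (†-cong (e-subˡ p)) (e-† V)))

  ⊆-refl : ∀ {W} → W ⊆ W
  ⊆-refl _ p = p

  e-idem : ∀ W → e W ⋆ e W ≈ e W
  e-idem W = e-subˡ {W} {W} ⊆-refl

  e-cong : ∀ {W V} → (∀ i → W i ≡ V i) → e W ≈ e V
  e-cong {W} {V} p = mk λ g → e-inA {W} {V} (∑-cong Gs λ h → cong [_] (eq h)) (eq g)
    where
    eq : ∀ g → inA W g ≡ inA V g
    eq g = inA-cong {W} {V} (λ q i r → q i (trans (p i) r)) (λ q i r → q i (trans (sym (p i)) r))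

  -- Transitivity of A_W on W takes a third point k of W, for the cycle i → j → k → i.
  move : ∀ {W i j} → W i ≡ true → W j ≡ true → ι 2 < ∣ W ∣ → Σ G λ c → Fix W c × c ▹ i ≡ j
  move {W} {i} {j} p q r with i Fin.≟ j
  ... | yes refl = ε , fix-ε W , ▹-ε i
  ... | no  i≢j with pick (i ∷ j ∷ []) r
  ...   | k , s , k∉ with three i≢j (λ e → k∉ (there (here (sym e)))) (λ e → k∉ (here (sym e)))
  ...     | c , ci , cj , ck , cl = c , (λ l t → cl l (λ e → true≢false (subst (λ z → W z ≡ true) (sym e) p) t)
              (λ e → true≢false (subst (λ z → W z ≡ true) (sym e) q) t) (λ e → true≢false (subst (λ z → W z ≡ true) (sym e) s) t)) , ci

  ==-▹ : ∀ g i j → (g ▹ i == g ▹ j) ≡ (i == j)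
  ==-▹ g i j = ==-cong (▹-inj g) (cong (g ▹_))

  -- The law of the image of l under a uniform element of A_V.
  pr : Points → Fin n → Fin n → F
  pr V l i = ∑ Gs λ κ → e V κ * [ κ ▹ l == i ]

  pr-out : ∀ {V l} → V l ≡ false → ∀ i → pr V l i ≡ [ l == i ]
  pr-out {V} {l} p i = trans (∑-cong Gs λ κ → e-guard V κ (λ q → cong (λ z → [ z == i ]) (q l p)))
    (trans (∑-*ʳ Gs _ _) (*1ˡ (e-sum V)))

  -- The law is constant on V by transitivity, and its total mass there is 1.
  pr-in : ∀ {V l i} → V l ≡ true → V i ≡ true → ι 2 < ∣ V ∣ → ∣ V ∣ * pr V l i ≡ 1#
  pr-in {V} {l} {i} p q r = trans (sym (∑-*ʳ Fs _ _)) (trans (∑-cong Fs λ j → each j (V j) refl) (trans (∑-cong Fs λ j → sym (∑-*ˡ Gs _ _))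
    (trans (∑-swap Fs Gs _) (trans (∑-cong Gs λ κ → trans (∑-cong Fs λ j →
        trans (cong (λ b → [ V j ] * (e V κ * [ b ])) (==-sym (κ ▹ l) j))
          (solve ([ V j ] ∷ e V κ ∷ [ j == κ ▹ l ] ∷ []) (v 0 :* (v 1 :* v 2)) (v 1 :* v 0 :* v 2) refl))
      (trans (∑-pointF′ (κ ▹ l) _) (e-guard V κ λ s → []-true (trans (fix-stable {V} s l) p))))
    (trans (∑-cong Gs λ κ → *-identityʳ _) (e-sum V))))))
    where
    const : ∀ j → V j ≡ true → pr V l i ≡ pr V l j
    const j s with move {V} q s r
    ... | c , fc , ci = trans (∑-cong Gs λ κ → sym (cong₂ (λ a b → a * [ b ]) (e-shiftˡ {V} fc κ)
            (trans (cong₂ _==_ (▹-∙ c κ l) (sym ci)) (==-▹ c _ i)))) (shiftˡ c (λ κ → e V κ * [ κ ▹ l == j ]))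
    each : ∀ j b → V j ≡ b → [ V j ] * pr V l i ≡ [ V j ] * pr V l j
    each j true  s = cong ([ V j ] *_) (const j s)
    each j false s = trans (*0ˡ ([]-false s)) (sym (*0ˡ ([]-false s)))

  inA-∖ : ∀ {W l κ} → W l ≡ true → inA (W ∖ l) κ ≡ inA W κ ∧ (κ ▹ l == l)
  inA-∖ {W} {l} {κ} p = bothways (inA (W ∖ l) κ) (inA W κ) (κ ▹ l == l)
      (λ t → let q = inA-fix {W ∖ l} t in inA-true {W} (fix-mono (∖-⊆ W l) q) , trans (cong (_== l) (q l (∖-out W l))) (==-refl l))
      (λ s t → inA-true {W ∖ l} λ i r → step (inA-fix {W} s) (==⇒≡ (κ ▹ l) l t) i r)
    where
    step : Fix W κ → κ ▹ l ≡ l → ∀ i → (W ∖ l) i ≡ false → κ ▹ i ≡ i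
    step q t i r with i Fin.≟ l | bool (W i)
    ... | yes refl | _      = t
    ... | no  i≢l  | inj₁ s = ⊥-elim (true≢false s (trans (sym (trans (cong (W i ∧_) (not-== i≢l)) (Bool.∧-identityʳ (W i)))) r))
    ... | no  i≢l  | inj₂ s = q i s
    bothways : ∀ a b c → (a ≡ true → b ≡ true × c ≡ true) → (b ≡ true → c ≡ true → a ≡ true) → a ≡ b ∧ c
    bothways true  b     c     f g = sym (cong₂ _∧_ (proj₁ (f refl)) (proj₂ (f refl)))
    bothways false true  true  f g = g refl refl
    bothways false true  false f g = refl
    bothways false false c     f g = refl

  -- Orbit and stabiliser, read off from `pr-in` with i = l: the elements of A_W that fix l have
  -- probability 1/|W|.
  A-index : ∀ {W l} → W l ≡ true → ι 2 < ∣ W ∣ → ∣ W ∣ * ∣A∣ (W ∖ l) ≡ ∣A∣ W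
  A-index {W} {l} p r = trans (sym (*-identityʳ _)) (trans (cong (∣ W ∣ * ∣A∣ (W ∖ l) *_) (sym (*-inv⁺ (A-pos W))))
    (trans (solve (∣ W ∣ ∷ ∣A∣ (W ∖ l) ∷ ∣A∣ W ∷ recip (∣A∣ W) ∷ []) (v 0 :* v 1 :* (v 2 :* v 3)) (v 0 :* (v 1 :* v 3) :* v 2) refl)
    (trans (cong (λ z → ∣ W ∣ * z * ∣A∣ W) (trans (sym (∑-*ʳ Gs _ _)) (∑-cong Gs λ κ → trans (cong (λ b → [ b ] * _) (inA-∖ {W} {l} {κ} p))
       (trans (cong (_* _) ([]-∧ (inA W κ) (κ ▹ l == l))) (trans (solve ([ inA W κ ] ∷ [ κ ▹ l == l ] ∷ recip (∣A∣ W) ∷ []) (v 0 :* v 1 :* v 2) (v 0 :* v 2 :* v 1) refl) (cong (_* [ κ ▹ l == l ]) (sym (e-def W κ))))))))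
    (trans (cong (_* ∣A∣ W) (pr-in {W} {l} {l} p p r)) (*-identityˡ _)))))

  inv-index : ∀ {W l} → W l ≡ true → ι 2 < ∣ W ∣ → recip (∣A∣ (W ∖ l)) ≡ ∣ W ∣ * recip (∣A∣ W)
  inv-index {W} {l} p r = trans (sym (*-identityʳ _)) (trans (cong (recip (∣A∣ (W ∖ l)) *_) (trans (sym (*-inv⁺ (A-pos W))) (cong (_* recip (∣A∣ W)) (sym (A-index {W} {l} p r)))))
    (trans (solve (recip (∣A∣ (W ∖ l)) ∷ ∣ W ∣ ∷ ∣A∣ (W ∖ l) ∷ recip (∣A∣ W) ∷ []) (v 0 :* (v 1 :* v 2 :* v 3)) (v 2 :* v 0 :* (v 1 :* v 3)) refl)
    (*1ˡ (*-inv⁺ (A-pos (W ∖ l))))))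

  -- For |W| ≥ 4 this has rank one in the standard representation of A_W and is zero in every other
  -- irreducible one.
  E : Points → Fin n → Alg
  E W l = e (W ∖ l) ⊖ e W

  S : Points → Alg
  S W = Σᶠ λ l → [ W l ] • E W l

  -- The scalar by which `S W` acts on the standard representation: |W| projections of rank one,
  -- shared among |W| - 1 dimensions.
  ratio : Points → F
  ratio W = ∣ W ∣ * recip (∣ W ∣ - 1#)

  private
    d-1-pos : ∀ {W} → ι 3 < ∣ W ∣ → ι 2 < ∣ W ∣ - 1#
    d-1-pos {W} p q = p (by (∣ W ∣ ∷ []) (v 0) (# 3) (# 2 :- (v 0 :- # 1)) ⟪ q ⟫ refl)

    2<⇒0< : ∀ {x} → ι 2 < x → 0# < x
    2<⇒0< = ≤-<-trans (ι-nn 2)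

    3<⇒2< : ∀ {x} → ι 3 < x → ι 2 < x
    3<⇒2< = ≤-<-trans (ι-mono {2} {3} (ℕ.s≤s (ℕ.s≤s ℕ.z≤n)))

    ee : ∀ {W l} → W l ≡ true → ι 3 < ∣ W ∣ → ∀ l′ g →
         (e (W ∖ l′) ⋆ e (W ∖ l)) g ≡ [ inA W g ] * recip (∣A∣ (W ∖ l)) * pr (W ∖ l′) l (g ▹ l)
    ee {W} {l} p r l′ g = trans (⋆-def _ _ g) (trans (∑-cong Gs λ κ → trans (e-guard (W ∖ l′) κ (λ q → trans (e-def (W ∖ l) _) (trans (cong (λ b → [ b ] * w) (mem κ q)) (cong (_* w) ([]-∧ (inA W g) (κ ▹ l == g ▹ l))))))
        (solve (e (W ∖ l′) κ ∷ [ inA W g ] ∷ [ κ ▹ l == g ▹ l ] ∷ w ∷ []) (v 0 :* (v 1 :* v 2 :* v 3)) (v 1 :* v 3 :* (v 0 :* v 2)) refl))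
      (∑-*ˡ Gs _ _))
      where
      w = recip (∣A∣ (W ∖ l))
      mem : ∀ κ → Fix (W ∖ l′) κ → inA (W ∖ l) (κ ⁻¹ ∙ g) ≡ inA W g ∧ (κ ▹ l == g ▹ l)
      mem κ q = trans (inA-∖ {W} p) (cong₂ _∧_
        (inA-cong {W} {W} (λ t → subst (Fix W) (cancelˡ′ κ g) (fix-∙ {W} (fix-mono (∖-⊆ W l′) q) t)) (fix-∙ {W} (fix-⁻¹ {W} (fix-mono (∖-⊆ W l′) q))))
        (trans (sym (==-▹ κ _ l)) (trans (cong (_== κ ▹ l) (trans (cong (κ ▹_) (▹-∙ (κ ⁻¹) g l)) (▹-⁻¹ʳ κ _)))
          (==-sym _ _))))

    -- Three cases in one polynomial: l stays put if l′ = l; otherwise the image i must differ from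
    -- l′ and is uniform among |W| - 1 points. In this form it can be summed over l′.
    prs : ∀ {W l i} → W l ≡ true → W i ≡ true → ι 3 < ∣ W ∣ → ∀ l′ →
          [ W l′ ] * pr (W ∖ l′) l i ≡ [ l′ == l ] * [ l == i ] + recip (∣ W ∣ - 1#) * ([ W l′ ] - [ W l′ ] * [ l′ == l ] - [ W l′ ] * [ l′ == i ] + [ W l′ ] * [ l′ == i ] * [ l′ == l ])
    prs {W} {l} {i} p q r l′ with l′ Fin.≟ l
    ... | yes refl = trans (cong₂ _*_ ([]-true p) (pr-out {W ∖ l′} (∖-out W l′) i)) (trans
        (solve (x ∷ ρ ∷ []) (# 1 :* v 0) (# 1 :* v 0 :+ v 1 :* (# 1 :- # 1 :* # 1 :- # 1 :* v 0 :+ # 1 :* v 0 :* # 1)) refl)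
        (sym (cong₂ (λ a b → b * x + ρ * (a - a * b - a * x + a * x * b)) ([]-true p) ([]-true (==-refl l)))))
      where x = [ l == i ]
            ρ = recip (∣ W ∣ - 1#)
    ... | no l′≢l with bool (W l′) | l′ Fin.≟ i
    ...   | inj₂ s | _ = trans (*0ˡ ([]-false s)) (trans
              (solve (x ∷ ρ ∷ y ∷ []) (# 0) (# 0 :* v 0 :+ v 1 :* (# 0 :- # 0 :* # 0 :- # 0 :* v 2 :+ # 0 :* v 2 :* # 0)) refl)
              (sym (cong₂ (λ a b → b * x + ρ * (a - a * b - a * y + a * y * b)) ([]-false s) ([]-false (≢⇒== l′≢l)))))
      where x = [ l == i ]
            ρ = recip (∣ W ∣ - 1#)
            y = [ l′ == i ]
    ...   | inj₁ s | yes refl = trans (*0ʳ (none (W ∖ l′) (∖-in {W} p (λ t → l′≢l (sym t))) (∖-out W l′))) (trans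
              (solve (x ∷ ρ ∷ [ W l′ ] ∷ []) (# 0) (# 0 :* v 0 :+ v 1 :* (v 2 :- v 2 :* # 0 :- v 2 :* # 1 :+ v 2 :* # 1 :* # 0)) refl)
              (sym (cong₂ (λ a b → b * x + ρ * ([ W l′ ] - [ W l′ ] * b - [ W l′ ] * a + [ W l′ ] * a * b)) ([]-true (==-refl l′)) ([]-false (≢⇒== l′≢l)))))
      where
      x = [ l == i ]
      ρ = recip (∣ W ∣ - 1#)
      none : ∀ V {i} → V l ≡ true → V i ≡ false → pr V l i ≡ 0#
      none V {i} a b = trans (∑-cong Gs λ κ → trans (e-guard V κ {[ κ ▹ l == i ]} {0#} λ t → []-false (≢⇒== λ u →
        true≢false (trans (fix-stable {V} t l) a) (trans (cong V u) b))) (zeroʳ _)) (∑-0 Gs)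
    ...   | inj₁ s | no l′≢i = trans (cong₂ _*_ ([]-true s) (trans (sym (*-identityˡ _)) (trans (cong (_* pr (W ∖ l′) l i) (sym (trans (*-comm _ _) (*-inv⁺ (2<⇒0< (d-1-pos {W} r))))))
              (trans (*-assoc _ _ _) (cong (ρ *_) (trans (cong (_* pr (W ∖ l′) l i) (sym (card-∖ {W} s)))
                (pr-in {W ∖ l′} (∖-in {W} p (λ t → l′≢l (sym t))) (∖-in {W} q (λ t → l′≢i (sym t))) (subst (ι 2 <_) (sym (card-∖ {W} s)) (d-1-pos {W} r)))))))))
              (trans (solve (x ∷ ρ ∷ []) (# 1 :* (v 1 :* # 1)) (# 0 :* v 0 :+ v 1 :* (# 1 :- # 1 :* # 0 :- # 1 :* # 0 :+ # 1 :* # 0 :* # 0)) refl)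
              (trans (cong (λ z → 0# * x + ρ * (z - z * 0# - z * 0# + z * 0# * 0#)) (sym ([]-true s)))
                (sym (cong₂ (λ a b → b * x + ρ * ([ W l′ ] - [ W l′ ] * b - [ W l′ ] * a + [ W l′ ] * a * b)) ([]-false (≢⇒== l′≢i)) ([]-false (≢⇒== l′≢l))))))
      where x = [ l == i ]
            ρ = recip (∣ W ∣ - 1#)

  -- Both sides vanish off A_W; at g ∈ A_W they only depend on whether g fixes l.
  S-e : ∀ {W l} → W l ≡ true → ι 3 < ∣ W ∣ → S W ⋆ e (W ∖ l) ≈ ratio W • E W l
  S-e {W} {l} p r = ≈-trans (⋆-Σˡ (λ l′ → [ W l′ ] • E W l′) (e (W ∖ l))) (≈-trans
      (Σ-cong λ l′ → ≈-trans (⋆-·ˡ [ W l′ ] (E W l′) (e (W ∖ l))) (·-cong (≈-trans (⋆-⊖ˡ (e (W ∖ l′)) (e W) (e (W ∖ l))) (⊖-cong ≈-refl (e-subʳ (∖-⊆ W l))))))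
      (mk λ g → main g (fix? W g)))
    where
    d = ∣ W ∣
    ρ = recip (∣ W ∣ - 1#)
    u = recip (∣A∣ W)
    w = recip (∣A∣ (W ∖ l))
    main : ∀ g → Dec (Fix W g) → ∑ Fs (λ l′ → [ W l′ ] * ((e (W ∖ l′) ⋆ e (W ∖ l)) g - e W g)) ≡ ratio W * E W l g
    main g (no q) = trans (∑-cong Fs λ l′ → trans (cong ([ W l′ ] *_) (cong₂ _-_ (trans (ee {W} p r l′ g) (*0ˡ (*0ˡ z))) (e-out {W} q)))
        (solve ([ W l′ ] ∷ []) (v 0 :* (# 0 :- # 0)) (# 0) refl))
      (trans (∑-0 Fs) (sym (trans (cong (ratio W *_) (cong₂ _-_ (e-out {W ∖ l} λ t → q (fix-mono (∖-⊆ W l) t)) (e-out {W} q)))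
        (solve (ratio W ∷ []) (v 0 :* (# 0 :- # 0)) (# 0) refl))))
      where z = []-false (inA-false {W} q)
    main g (yes q) = trans (∑-cong Fs step)
      (trans (∑-- Fs _ _) (trans (cong₂ _-_ (trans (∑-*ˡ Fs _ _) (cong (w *_) (trans (∑-+ Fs _ _) (cong₂ _+_ (∑-pointF l _)
          (trans (∑-*ˡ Fs _ _) (cong (ρ *_) count)))))) (∑-*ʳ Fs _ _))
      (trans (cong (λ z → z * (x + ρ * (d - 1# - 1# + x)) - d * u) (inv-index {W} {l} p (3<⇒2< r)))
      (trans (solve (d ∷ u ∷ ρ ∷ x ∷ []) (v 0 :* v 1 :* (v 3 :+ v 2 :* (v 0 :- # 1 :- # 1 :+ v 3)) :- v 0 :* v 1)
               (v 0 :* v 2 :* (v 3 :* (v 0 :* v 1) :- v 1) :+ v 0 :* v 1 :* (v 3 :- # 1) :* (# 1 :- (v 0 :- # 1) :* v 2)) refl)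
      (trans (cong (λ z → d * ρ * (x * (d * u) - u) + d * u * (x - 1#) * (1# - z)) (*-inv⁺ (2<⇒0< (d-1-pos {W} r))))
      (trans (solve (d ∷ u ∷ ρ ∷ x ∷ []) (v 0 :* v 2 :* (v 3 :* (v 0 :* v 1) :- v 1) :+ v 0 :* v 1 :* (v 3 :- # 1) :* (# 1 :- # 1))
               (v 0 :* v 2 :* (v 3 :* (v 0 :* v 1) :- v 1)) refl)
      (cong (ratio W *_) (cong₂ _-_ (sym e-l) (sym (e-in {W} q))))))))))
      where
      i = g ▹ l
      x = [ l == i ]
      Wi = trans (fix-stable {W} q l) p
      step : ∀ l′ → [ W l′ ] * ((e (W ∖ l′) ⋆ e (W ∖ l)) g - e W g) ≡
             w * ([ l′ == l ] * x + ρ * ([ W l′ ] - [ W l′ ] * [ l′ == l ] - [ W l′ ] * [ l′ == i ] + [ W l′ ] * [ l′ == i ] * [ l′ == l ])) - [ W l′ ] * u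
      step l′ = trans (cong ([ W l′ ] *_) (cong₂ _-_ (trans (ee {W} p r l′ g) (cong (λ b → b * w * pr (W ∖ l′) l i) ([]-true (inA-true {W} q)))) (e-in {W} q)))
        (trans (solve ([ W l′ ] ∷ w ∷ u ∷ pr (W ∖ l′) l i ∷ []) (v 0 :* (# 1 :* v 1 :* v 3 :- v 2)) (v 1 :* (v 0 :* v 3) :- v 0 :* v 2) refl)
          (cong (λ z → w * z - [ W l′ ] * u) (prs {W} p Wi r l′)))
      count : ∑ Fs (λ l′ → [ W l′ ] - [ W l′ ] * [ l′ == l ] - [ W l′ ] * [ l′ == i ] + [ W l′ ] * [ l′ == i ] * [ l′ == l ]) ≡ d - 1# - 1# + x
      count = trans (∑-+ Fs _ _) (cong₂ _+_ (trans (∑-- Fs _ _) (cong₂ _-_ (trans (∑-- Fs _ _) (cong (λ z → d - z) (trans (∑-pointF′ l _) ([]-true p)))) (trans (∑-pointF′ i _) ([]-true Wi))))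
                (trans (∑-pointF′ l _) (trans (cong (_* x) ([]-true p)) (*-identityˡ _))))
      e-l : e (W ∖ l) g ≡ x * (d * u)
      e-l = trans (e-def (W ∖ l) g) (cong₂ _*_ (trans (cong [_] (inA-∖ {W} {l} {g} p)) (trans ([]-∧ (inA W g) (i == l))
              (trans (cong (_* [ i == l ]) ([]-true (inA-true {W} q))) (trans (*-identityˡ _) (cong [_] (==-sym i l)))))) (inv-index {W} {l} p (3<⇒2< r)))

-- Projections onto linear functions and their complement

module Projections (𝔽 : OrderedField) {n : ℕ} (𝔾 : PermGroup n) where
  open Sums 𝔽
  open Arithmetic 𝔽
  open PermGroup 𝔾
  open GroupAlgebra 𝔽 𝔾
  open Averages 𝔽 𝔾
  open Equality (fins n)

  Supp Cl : Points → Alg → Set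
  Supp W x = ∀ g → ¬ Fix W g → x g ≡ 0#
  Cl W p = ∀ κ → Fix W κ → ∀ h → p (κ ⁻¹ ∙ h ∙ κ) ≡ p h

  -- In both convolutions only k ∈ A_W occurs on the side of x, and conjugation by such a k does not
  -- change p.
  comm : ∀ {W x p} → Supp W x → Cl W p → p ⋆ x ≈ x ⋆ p
  comm {W} {x} {p} s c = mk λ g → trans (⋆-alt p x g) (trans (∑-cong Gs λ k → each g k (fix? W k)) (sym (⋆-def x p g)))
    where
    each : ∀ g k → Dec (Fix W k) → p (g ∙ k ⁻¹) * x k ≡ x k * p (k ⁻¹ ∙ g)
    each g k (no q)  = trans (*0ʳ (s k q)) (sym (*0ˡ (s k q)))
    each g k (yes q) = trans (*-comm _ _) (cong (x k *_) (trans (sym (c k q _)) (cong p (trans (assoc _ _ _) (cong (k ⁻¹ ∙_) (cancelʳ′ k g))))))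

  conjG : ∀ κ (f : G → F) → ∑ Gs (λ h → f (κ ⁻¹ ∙ h ∙ κ)) ≡ ∑ Gs f
  conjG κ f = trans (shiftˡ (κ ⁻¹) (λ h → f (h ∙ κ))) (shiftʳ κ f)

  e-conj : ∀ κ {V V′} → (∀ i → V′ (κ ▹ i) ≡ V i) → ∀ h → e V (κ ⁻¹ ∙ h ∙ κ) ≡ e V′ h
  e-conj κ {V} {V′} p h = e-inA {V} {V′} (trans (sym (conjG κ _)) (∑-cong Gs λ g → cong [_] (same g))) (same h)
    where
    same : ∀ h → inA V (κ ⁻¹ ∙ h ∙ κ) ≡ inA V′ h
    same h = inA-cong {V} {V′}
      (λ f i r → trans (cong (h ▹_) (sym (▹-⁻¹ʳ κ i))) (trans (sym (▹-⁻¹ʳ κ _)) (trans (cong (κ ▹_)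
          (trans (sym (trans (▹-∙ (κ ⁻¹ ∙ h) κ _) (▹-∙ (κ ⁻¹) h _))) (f (κ ⁻¹ ▹ i) (trans (sym (p _)) (trans (cong V′ (▹-⁻¹ʳ κ i)) r))))) (▹-⁻¹ʳ κ i))))
      (λ f i r → trans (▹-∙ (κ ⁻¹ ∙ h) κ i) (trans (▹-∙ (κ ⁻¹) h _) (trans (cong (κ ⁻¹ ▹_) (f (κ ▹ i) (trans (p i) r))) (▹-⁻¹ κ i))))

  Disjoint : Points → Points → Set
  Disjoint W V = ∀ i → W i ≡ true → V i ≡ false

  stab-⊆ : ∀ {W V κ} → W ⊆ V → Fix W κ → ∀ i → V (κ ▹ i) ≡ V i
  stab-⊆ {W} {V} p f = fix-stable {V} (fix-mono p f)

  stab-disj : ∀ {W V κ} → Disjoint W V → Fix W κ → ∀ i → V (κ ▹ i) ≡ V i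
  stab-disj {W} {V} {κ} p f i with bool (W i)
  ... | inj₁ r = trans (p _ (trans (fix-stable {W} f i) r)) (sym (p i r))
  ... | inj₂ r = cong V (f i r)

  Cl-e-⊆ : ∀ {W V} → W ⊆ V → Cl W (e V)
  Cl-e-⊆ p κ f = e-conj κ (stab-⊆ p f)

  Cl-e-disj : ∀ {W V} → Disjoint W V → Cl W (e V)
  Cl-e-disj p κ f = e-conj κ (stab-disj p f)

  Cl-⊖ : ∀ {W x y} → Cl W x → Cl W y → Cl W (x ⊖ y)
  Cl-⊖ p q κ f h = cong₂ _-_ (p κ f h) (q κ f h)

  Cl-⊕ : ∀ {W x y} → Cl W x → Cl W y → Cl W (x ⊕ y)
  Cl-⊕ p q κ f h = cong₂ _+_ (p κ f h) (q κ f h)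

  Cl-· : ∀ {W x} c → Cl W x → Cl W (c • x)
  Cl-· c p κ f h = cong (c *_) (p κ f h)

  Cl-mono : ∀ {W V x} → W ⊆ V → Cl V x → Cl W x
  Cl-mono s p κ f = p κ (fix-mono s f)

  Cl-⋆ : ∀ {W x y} → Cl W x → Cl W y → Cl W (x ⋆ y)
  Cl-⋆ {W} {x} {y} p q κ f g = trans (⋆-def x y _) (trans (trans (sym (conjG κ _)) (∑-cong Gs λ h → cong₂ _*_ (p κ f h) (trans (cong y (eq h)) (q κ f _)))) (sym (⋆-def x y g)))
    where
    eq : ∀ h → (κ ⁻¹ ∙ h ∙ κ) ⁻¹ ∙ (κ ⁻¹ ∙ g ∙ κ) ≡ κ ⁻¹ ∙ (h ⁻¹ ∙ g) ∙ κ
    eq h = trans (cong (_∙ (κ ⁻¹ ∙ g ∙ κ)) (trans (⁻¹-∙ (κ ⁻¹ ∙ h) κ) (cong (κ ⁻¹ ∙_) (⁻¹-∙ (κ ⁻¹) h)))) (trans (assoc _ _ _) (trans (cong (κ ⁻¹ ∙_)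
      (trans (assoc _ _ _) (trans (cong (h ⁻¹ ∙_) (trans (cong ((κ ⁻¹) ⁻¹ ∙_) (assoc _ _ _)) (cancelˡ (κ ⁻¹) _))) (sym (assoc _ _ _))))) (sym (assoc _ _ _))))

  Supp-e : ∀ {W V} → W ⊆ V → Supp V (e W)
  Supp-e {W} s g p = e-out {W} (λ q → p (fix-mono s q))

  Supp-⊖ : ∀ {W x y} → Supp W x → Supp W y → Supp W (x ⊖ y)
  Supp-⊖ p q g r = trans (cong₂ _-_ (p g r) (q g r)) (-‿inverseʳ 0#)

  Supp-E : ∀ {W V l} → W ⊆ V → Supp V (E W l)
  Supp-E {W} {V} {l} s = Supp-⊖ {V} {e (W ∖ l)} (Supp-e {W ∖ l} λ i p → s i (∖-⊆ W l i p)) (Supp-e {W} s)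

  record Proj (p : Alg) : Set where
    constructor proj
    field
      idem : p ⋆ p ≈ p
      self : p † ≈ p
  open Proj public

  norm² : Alg → F
  norm² y = ⟨ y , y ⟩

  ⟨⟩-self : ∀ {p} → p † ≈ p → ∀ x y → ⟨ p ⋆ x , y ⟩ ≡ ⟨ x , p ⋆ y ⟩
  ⟨⟩-self {p} s x y = trans (⟨⟩-†ˡ p x y) (⟨⟩-cong {x} {x} ≈-refl (⋆-congˡ s))

  proj-norm : ∀ {p} → Proj p → ∀ y → norm² (p ⋆ y) ≡ ⟨ y , p ⋆ y ⟩
  proj-norm {p} P y = trans (⟨⟩-self (self P) y _) (⟨⟩-cong {y} {y} ≈-refl (≈-trans (≈-sym (⋆-assoc p p y)) (⋆-congˡ (idem P))))

  proj-nn : ∀ {p} → Proj p → ∀ y → 0# ≤ ⟨ y , p ⋆ y ⟩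
  proj-nn P y = ≤-≡ (⟨⟩-nn _) (proj-norm P y)

  proj-⋆ : ∀ {p q} → Proj p → Proj q → p ⋆ q ≈ q ⋆ p → Proj (p ⋆ q)
  proj-⋆ {p} {q} P Q c = proj
    (≈-trans (⋆-assoc p q (p ⋆ q)) (≈-trans (⋆-congʳ {p} (≈-trans (≈-sym (⋆-assoc q p q)) (≈-trans (⋆-congˡ (≈-sym c)) (≈-trans (⋆-assoc p q q) (⋆-congʳ {p} (idem Q))))))
      (≈-trans (≈-sym (⋆-assoc p p q)) (⋆-congˡ (idem P)))))
    (≈-trans (⋆-† p q) (≈-trans (⋆-cong (self Q) (self P)) (≈-sym c)))

  proj-e : ∀ W → Proj (e W)
  proj-e W = proj (e-idem W) (e-† W)

  proj-⊖ : ∀ {p q} → Proj p → Proj q → p ⋆ q ≈ q → q ⋆ p ≈ q → Proj (p ⊖ q)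
  proj-⊖ {p} {q} P Q a b = proj
    (≈-trans (⋆-⊖ˡ p q (p ⊖ q)) (≈-trans (⊖-cong (≈-trans (⋆-⊖ʳ p p q) (⊖-cong (idem P) a)) (≈-trans (⋆-⊖ʳ q p q) (⊖-cong b (idem Q))))
      (mk λ g → solve (p g ∷ q g ∷ []) (v 0 :- v 1 :- (v 1 :- v 1)) (v 0 :- v 1) refl)))
    (⊖-cong (self P) (self Q))

  proj-E : ∀ W l → Proj (E W l)
  proj-E W l = proj-⊖ (proj-e (W ∖ l)) (proj-e W) (e-subˡ (∖-⊆ W l)) (e-subʳ (∖-⊆ W l))

  ·-𝟘 : ∀ c {x} → x ≈ 𝟘 → c • x ≈ 𝟘
  ·-𝟘 c p = mk λ g → *0ʳ (at p g)

  Σ-𝟘 : ∀ {x} → (∀ i → x i ≈ 𝟘) → Σᶠ x ≈ 𝟘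
  Σ-𝟘 p = mk λ g → trans (∑-cong Fs λ i → at (p i) g) (∑-0 Fs)

  ⊖-𝟘 : ∀ {x y} → x ≈ y → x ⊖ y ≈ 𝟘
  ⊖-𝟘 {x} {y} p = mk λ g → trans (cong (_- y g) (at p g)) (-‿inverseʳ (y g))

  -- Weighted terms vanish outside W, so an identity is only needed on W.
  ·-on : ∀ (W : Points) i {x y} → (W i ≡ true → x ≈ y) → [ W i ] • x ≈ [ W i ] • y
  ·-on W i p with bool (W i)
  ... | inj₁ r = ·-cong (p r)
  ... | inj₂ r = mk λ g → trans (*0ˡ ([]-false r)) (sym (*0ˡ ([]-false r)))

  S-eW : ∀ W → S W ⋆ e W ≈ 𝟘
  S-eW W = ≈-trans (⋆-Σˡ _ (e W)) (Σ-𝟘 λ l → ≈-trans (⋆-·ˡ _ (E W l) (e W)) (·-𝟘 _ (≈-trans (⋆-⊖ˡ _ _ _) (⊖-𝟘 (≈-trans (e-subˡ (∖-⊆ W l)) (≈-sym (e-idem W)))))))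

  S-† : ∀ W → S W † ≈ S W
  S-† W = mk λ g → ∑-cong Fs λ l → cong ([ W l ] *_) (at (self (proj-E W l)) g)

  S-E : ∀ {W l} → W l ≡ true → ι 3 < ∣ W ∣ → S W ⋆ E W l ≈ ratio W • E W l
  S-E {W} {l} p r = ≈-trans (⋆-⊖ʳ (S W) (e (W ∖ l)) (e W)) (≈-trans (⊖-cong (S-e p r) (S-eW W)) (mk λ g → solve (ratio W * E W l g ∷ []) (v 0 :- # 0) (v 0) refl))

  S-S : ∀ {W} → ι 3 < ∣ W ∣ → S W ⋆ S W ≈ ratio W • S W
  S-S {W} r = ≈-trans (⋆-Σʳ (S W) _) (≈-trans (Σ-cong λ l → ≈-trans (⋆-·ʳ _ (S W) (E W l)) (≈-trans (·-on W l λ p → S-E p r)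
      (mk λ g → solve ([ W l ] ∷ ratio W ∷ E W l g ∷ []) (v 0 :* (v 1 :* v 2)) (v 1 :* (v 0 :* v 2)) refl)))
    (mk λ g → ∑-*ˡ Fs (ratio W) _))

  card-pos : ∀ {W k} → ι k < ∣ W ∣ → 0# < ∣ W ∣
  card-pos {W} {k} = ≤-<-trans (ι-nn k)

  d-1-pos : ∀ {W} → ι 3 < ∣ W ∣ → 0# < ∣ W ∣ - 1#
  d-1-pos {W} p q = p (≤-trans (by (∣ W ∣ ∷ []) (v 0) (# 1) (# 0 :- (v 0 :- # 1)) ⟪ q ⟫ refl) (ι-mono {1} {3} (ℕ.s≤s ℕ.z≤n)))

  ratio-nn : ∀ {W} → ι 3 < ∣ W ∣ → 0# ≤ ratio W
  ratio-nn {W} r = <⇒≤ (card-pos {W} {3} r) ⊛ inv-nn (d-1-pos {W} r)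

  S-form : ∀ W y → ⟨ y , S W ⋆ y ⟩ ≡ ∑ Fs λ l → [ W l ] * ⟨ y , E W l ⋆ y ⟩
  S-form W y = trans (⟨⟩-cong {y} {y} ≈-refl (≈-trans (⋆-Σˡ _ y) (Σ-cong λ l → ⋆-·ˡ _ (E W l) y))) (trans (⟨⟩-Σʳ _ y) (∑-cong Fs λ l → ⟨⟩-·ʳ _ _ y))

  -- For t = ⟨y, S y⟩, Cauchy-Schwarz and S² = ratio · S give t² ≤ ‖y‖² · ratio · t, and t ≥ 0 can
  -- be cancelled. This is the operator norm of `S W` without spectral theory.
  S-bound : ∀ {W} → ι 3 < ∣ W ∣ → ∀ y → ∑ Fs (λ l → [ W l ] * ⟨ y , E W l ⋆ y ⟩) ≤ ratio W * norm² y
  S-bound {W} r y = subst (_≤ ratio W * norm² y) (S-form W y) (sq-cancel t-nn (ratio-nn {W} r ⊛ ⟨⟩-nn y)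
      (≤-≡ (CS y (S W ⋆ y)) (trans (cong (norm² y *_) (trans (⟨⟩-self (S-† W) y _) (trans (⟨⟩-cong {y} {y} ≈-refl (≈-trans (≈-sym (⋆-assoc (S W) (S W) y))
         (≈-trans (⋆-congˡ (S-S r)) (⋆-·ˡ _ (S W) y)))) (⟨⟩-·ʳ _ _ y)))) (solve (norm² y ∷ ratio W ∷ t ∷ []) (v 0 :* (v 1 :* v 2)) (v 2 :* (v 1 :* v 0)) refl))))
    where
    t = ⟨ y , S W ⋆ y ⟩
    t-nn : 0# ≤ t
    t-nn = ≤-≡ (∑-nn Fs λ l → []-nn (W l) ⊛ proj-nn (proj-E W l) y) (sym (S-form W y))

  -- The identity of the group algebra is the average over the trivial group A_∅.
  ∅ : Points
  ∅ _ = false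

  𝟙 : Alg
  𝟙 = e ∅

  𝟙-⋆ : ∀ x → 𝟙 ⋆ x ≈ x
  𝟙-⋆ x = e-absorb λ κ f g → cong x (trans (cong (λ k → k ⁻¹ ∙ g) (faithful {κ} {ε} (λ i → trans (f i refl) (sym (▹-ε i)))))
    (trans (cong (_∙ g) (sym (inv-unique (idˡ ε)))) (idˡ g)))

  ⋆-𝟙 : ∀ x → x ⋆ 𝟙 ≈ x
  ⋆-𝟙 x = mk λ g → trans (cong (x ⋆ 𝟙) (sym (⁻¹-invol g))) (trans (at (≈-trans (⋆-† x 𝟙) (≈-trans (⋆-congˡ (e-† ∅)) (𝟙-⋆ (x †)))) (g ⁻¹)) (cong x (⁻¹-invol g)))

  -- The inverse of `ratio`, which makes the multiple of `S` idempotent.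
  cZ : Points → F
  cZ Y = (∣ Y ∣ - 1#) * recip ∣ Y ∣

  -- `Π Y` is the projection onto the trivial and the standard part for A_Y. For `full` these are
  -- the functions linear in the permutation matrix, since invariance under the stabiliser of l from
  -- the left means dependence on `g ⁻¹ ▹ l` only.
  Π Q : Points → Alg
  Π Y = e Y ⊕ cZ Y • S Y
  Q Y = 𝟙 ⊖ Π Y

  cZ-ratio : ∀ {Y} → ι 3 < ∣ Y ∣ → cZ Y * ratio Y ≡ 1#
  cZ-ratio {Y} r = trans (solve (∣ Y ∣ ∷ recip ∣ Y ∣ ∷ recip (∣ Y ∣ - 1#) ∷ []) ((v 0 :- # 1) :* v 1 :* (v 0 :* v 2)) (v 0 :* v 1 :* ((v 0 :- # 1) :* v 2)) refl)
    (trans (cong₂ _*_ (*-inv⁺ (card-pos {Y} {3} r)) (*-inv⁺ (d-1-pos {Y} r))) (*-identityˡ _))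

  Π-eY : ∀ Y → Π Y ⋆ e Y ≈ e Y
  Π-eY Y = ≈-trans (⋆-⊕ˡ _ _ _) (≈-trans (⊕-cong (e-idem Y) (≈-trans (⋆-·ˡ _ (S Y) (e Y)) (·-𝟘 _ (S-eW Y)))) (mk λ g → +-identityʳ _))

  Π-e : ∀ {Y k} → Y k ≡ true → ι 3 < ∣ Y ∣ → Π Y ⋆ e (Y ∖ k) ≈ e (Y ∖ k)
  Π-e {Y} {k} p r = ≈-trans (⋆-⊕ˡ _ _ _) (≈-trans (⊕-cong (e-subʳ (∖-⊆ Y k)) (≈-trans (⋆-·ˡ _ (S Y) _) (·-cong (S-e p r))))
    (mk λ g → trans (solve (e Y g ∷ e (Y ∖ k) g ∷ cZ Y ∷ ratio Y ∷ []) (v 0 :+ v 2 :* (v 3 :* (v 1 :- v 0))) (v 0 :+ v 2 :* v 3 :* (v 1 :- v 0)) refl)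
      (trans (cong (λ z → e Y g + z * (e (Y ∖ k) g - e Y g)) (cZ-ratio {Y} r)) (solve (e Y g ∷ e (Y ∖ k) g ∷ []) (v 0 :+ # 1 :* (v 1 :- v 0)) (v 1) refl))))

  Π-† : ∀ Y → Π Y † ≈ Π Y
  Π-† Y = ⊕-cong (e-† Y) (·-cong (S-† Y))

  -- x ⋆ S and x ⋆ Π only depend on the products of x with the averages e (Y ∖ l) and e Y.
  ⋆S : ∀ {Y x} → x ⋆ e Y ≈ e Y → (∀ l → Y l ≡ true → x ⋆ e (Y ∖ l) ≈ e (Y ∖ l)) → x ⋆ Π Y ≈ Π Y
  ⋆S {Y} {x} a b = ≈-trans (⋆-⊕ʳ x _ _) (⊕-cong a (≈-trans (⋆-·ʳ _ x (S Y)) (·-cong (≈-trans (⋆-Σʳ x _) (Σ-cong λ l →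
    ≈-trans (⋆-·ʳ _ x (E Y l)) (·-on Y l λ p → ≈-trans (⋆-⊖ʳ x _ _) (⊖-cong (b l p) a)))))))

  Π-Π : ∀ {Y} → ι 3 < ∣ Y ∣ → Π Y ⋆ Π Y ≈ Π Y
  Π-Π {Y} r = ⋆S (Π-eY Y) (λ l p → Π-e p r)

  proj-Q : ∀ {Y} → ι 3 < ∣ Y ∣ → Proj (Q Y)
  proj-Q {Y} r = proj-⊖ (proj-e ∅) (proj (Π-Π r) (Π-† Y)) (𝟙-⋆ _) (⋆-𝟙 _)

  Q-e : ∀ {Y k} → Y k ≡ true → ι 3 < ∣ Y ∣ → Q Y ⋆ e (Y ∖ k) ≈ 𝟘
  Q-e p r = ≈-trans (⋆-⊖ˡ _ _ _) (⊖-𝟘 (≈-trans (𝟙-⋆ _) (≈-sym (Π-e p r))))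

  Q-eY : ∀ Y → Q Y ⋆ e Y ≈ 𝟘
  Q-eY Y = ≈-trans (⋆-⊖ˡ _ _ _) (⊖-𝟘 (≈-trans (𝟙-⋆ _) (≈-sym (Π-eY Y))))

  †-swap : ∀ {x y z} → x † ≈ x → y † ≈ y → z † ≈ z → x ⋆ y ≈ z → y ⋆ x ≈ z
  †-swap {x} {y} {z} a b c p = ≈-trans (⋆-cong (≈-sym b) (≈-sym a)) (≈-trans (≈-sym (⋆-† x y)) (≈-trans (†-cong p) c))

  Q-† : ∀ Y → Q Y † ≈ Q Y
  Q-† Y = ⊖-cong (e-† ∅) (Π-† Y)

  e-Q : ∀ {Y k} → Y k ≡ true → ι 3 < ∣ Y ∣ → e (Y ∖ k) ⋆ Q Y ≈ 𝟘
  e-Q {Y} {k} p r = †-swap (Q-† Y) (e-† _) ≈-refl (Q-e p r)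

  eY-Q : ∀ Y → e Y ⋆ Q Y ≈ 𝟘
  eY-Q Y = †-swap (Q-† Y) (e-† _) ≈-refl (Q-eY Y)

  Cl-𝟙 : ∀ W → Cl W 𝟙
  Cl-𝟙 W κ f = e-conj κ {∅} {∅} (λ _ → refl)

  Cl-Q : ∀ Y → Cl Y (Q Y)
  Cl-Q Y = Cl-⊖ {Y} {𝟙} {Π Y} (Cl-𝟙 Y) (Cl-⊕ {Y} {e Y} (Cl-e-⊆ {Y} {Y} ⊆-refl) (Cl-· {Y} {S Y} (cZ Y) λ κ f h →
    trans (∑-cong Fs λ l → cong₂ (λ a b → [ a ] * b) (sym (fix-stable {Y} f l)) (cong₂ _-_ (e-conj κ {Y ∖ l} {Y ∖ (κ ▹ l)} (λ i →
        cong₂ (λ a b → a ∧ not b) (fix-stable {Y} f i) (==-▹ κ i l)) h) (e-conj κ {Y} {Y} (fix-stable {Y} f) h)))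
      (permute κ (λ l → [ Y l ] * E Y l h))))

  Cl-Q-disj : ∀ {W Y} → Disjoint W Y → Cl W (Q Y)
  Cl-Q-disj {W} {Y} d = Cl-⊖ {W} {𝟙} {Π Y} (Cl-𝟙 W) (Cl-⊕ {W} {e Y} (Cl-e-disj d) (Cl-· {W} {S Y} (cZ Y) λ κ f h →
    ∑-cong Fs λ l → cong ([ Y l ] *_) (cong₂ _-_ (Cl-e-disj {W} {Y ∖ l} (λ i p → cong (_∧ _) (d i p)) κ f h) (Cl-e-disj {W} {Y} d κ f h))))

  -- The components of 1 − Π_Y that become linear when the point z is frozen.
  chain-step : ∀ {Y z} → Y z ≡ true → ι 4 < ∣ Y ∣ →
    Π (Y ∖ z) ⊖ Π Y ≈ cZ (Y ∖ z) • Σᶠ (λ l → [ (Y ∖ z) l ] • (e (Y ∖ z ∖ l) ⋆ Q Y))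
  chain-step {Y} {z} p r = ≈-trans (≈-sym (≈-trans (⋆-⊖ʳ (Π Z) 𝟙 (Π Y)) (⊖-cong (⋆-𝟙 _) ΠZΠY)))
    (≈-trans (⋆-⊕ˡ (e Z) _ (Q Y)) (≈-trans (⊕-cong (e-Q p r3) (≈-trans (⋆-·ˡ _ (S Z) (Q Y)) (·-cong (≈-trans (⋆-Σˡ _ (Q Y)) (Σ-cong λ l →
        ≈-trans (⋆-·ˡ _ (E Z l) (Q Y)) (·-cong (≈-trans (⋆-⊖ˡ (e (Z ∖ l)) (e Z) (Q Y)) (≈-trans (⊖-cong (≈-refl {e (Z ∖ l) ⋆ Q Y}) (e-Q p r3))
          (mk λ g → solve ((e (Z ∖ l) ⋆ Q Y) g ∷ []) (v 0 :- # 0) (v 0) refl)))))))))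
      (mk λ g → +-identityˡ _)))
    where
    Z = Y ∖ z
    r3 : ι 3 < ∣ Y ∣
    r3 = ≤-<-trans (ι-mono {3} {4} (ℕ.n≤1+n 3)) r
    rZ : ι 3 < ∣ Z ∣
    rZ q = r (by (∣ Y ∣ ∷ []) (v 0) (# 4) (# 3 :- (v 0 :- # 1)) ⟪ ≡-≤ (sym (card-∖ {Y} p)) q ⟫ refl)
    through : ∀ {x y} → x ⋆ y ≈ y → Π Z ⋆ x ≈ x → Π Z ⋆ y ≈ y
    through {x} {y} a b = ≈-trans (⋆-congʳ {Π Z} (≈-sym a)) (≈-trans (≈-sym (⋆-assoc (Π Z) x y)) (≈-trans (⋆-congˡ b) a))
    ΠZΠY : Π Z ⋆ Π Y ≈ Π Y
    ΠZΠY = ⋆S (through (e-subˡ (∖-⊆ Y z)) (Π-eY Z)) each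
      where
      each : ∀ l → Y l ≡ true → Π Z ⋆ e (Y ∖ l) ≈ e (Y ∖ l)
      each l q with l Fin.≟ z
      ... | yes refl = Π-eY Z
      ... | no  l≢z  = through (e-subˡ λ i t → ∖-in {Y} (∖-⊆ Y z i (∖-⊆ Z l i t)) (∖-≢ Z l t)) (Π-e {Z} (∖-in {Y} q l≢z) rZ)

  -- Since z = e_W a is A_W-invariant, all ‖E_l z‖ with l ∈ W agree, and they share the bound S-bound.
  concentrated : ∀ {V W k a} → W ⊆ V → W k ≡ true → ι 2 < ∣ W ∣ → ι 3 < ∣ V ∣ → E V k ⋆ a ≈ a →
    ∣ W ∣ * norm² (e W ⋆ a) ≤ ratio V * norm² a
  concentrated {V} {W} {k} {a} sub kW r2 r3 fixed = cancel
    where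
    z = e W ⋆ a
    X = ⟨ z , E V k ⋆ z ⟩
    zz : norm² z ≡ ⟨ E V k ⋆ z , a ⟩
    zz = trans (proj-norm (proj-e W) a) (trans (⟨⟩-comm _ _) (trans (⟨⟩-cong {z} {z} ≈-refl (≈-sym fixed)) (sym (⟨⟩-self (self (proj-E V k)) z a))))
    same : ∀ l → W l ≡ true → ⟨ z , E V l ⋆ z ⟩ ≡ X
    same l lW with move {W} kW lW r2
    ... | σ , f , σk = trans (sym (shiftˡ σ _)) (∑-cong Gs λ g → cong₂ _*_ (zσ g) (trans (⋆-def _ z _) (trans (trans (sym (conjG (σ ⁻¹) _)) (∑-cong Gs λ h →
            cong₂ _*_ (trans (cong (E V l) (cong (λ s → s ∙ h ∙ σ ⁻¹) (⁻¹-invol σ))) (El h)) (trans (cong z (eq g h)) (zσ _)))) (sym (⋆-def _ z g)))))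
      where
      zσ : ∀ g → z (σ ∙ g) ≡ z g
      zσ g = trans (cong (λ s → z (s ∙ g)) (sym (⁻¹-invol σ))) (e-Inv W a (σ ⁻¹) (fix-⁻¹ {W} f) g)
      fV = fix-mono {W} {V} sub f
      El : ∀ h → E V l (σ ∙ h ∙ σ ⁻¹) ≡ E V k h
      El h = sym (trans (cong (E V k) (sym (trans (cong (λ s → s ∙ σ) (trans (cong (σ ⁻¹ ∙_) (assoc _ _ _)) (cancelˡ σ _))) (cancelʳ′ σ h))))
        (cong₂ _-_ (e-conj σ {V ∖ k} {V ∖ l} (λ i → cong₂ (λ a b → a ∧ not b) (fix-stable {V} fV i) (trans (cong (σ ▹ i ==_) (sym σk)) (==-▹ σ i k))) _)
          (e-conj σ {V} {V} (fix-stable {V} fV) _)))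
      eq : ∀ g h → ((σ ⁻¹) ⁻¹ ∙ h ∙ σ ⁻¹) ⁻¹ ∙ (σ ∙ g) ≡ σ ∙ (h ⁻¹ ∙ g)
      eq g h = trans (cong (_∙ (σ ∙ g)) (trans (⁻¹-∙ _ _) (cong₂ _∙_ (⁻¹-invol σ) (trans (⁻¹-∙ _ h) (cong (h ⁻¹ ∙_) (cong _⁻¹ (⁻¹-invol σ)))))))
        (trans (assoc _ _ _) (cong (σ ∙_) (trans (assoc _ _ _) (cong (h ⁻¹ ∙_) (cancelˡ σ g)))))
    WX : ∣ W ∣ * X ≤ ratio V * norm² z
    WX = ≡-≤ (sym (∑-*ʳ Fs X _)) (≤-trans (∑-mono Fs each) (S-bound {V} r3 z))
      where
      each : ∀ l → [ W l ] * X ≤ [ V l ] * ⟨ z , E V l ⋆ z ⟩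
      each l with bool (W l)
      ... | inj₁ t = ≤-reflexive (trans (*1ˡ ([]-true t)) (sym (trans (*1ˡ ([]-true (sub l t))) (same l t))))
      ... | inj₂ t = ≡-≤ (*0ˡ ([]-false t)) ([]-nn _ ⊛ proj-nn (proj-E V l) z)
    -- As `E V k` fixes a, ‖z‖² = ⟨E z, a⟩, so ‖z‖⁴ ≤ X ‖a‖² and `WX` bounds X by a multiple of
    -- ‖z‖². One factor ‖z‖² is then cancelled, which is why its vanishing is treated apart.
    cancel : ∣ W ∣ * norm² z ≤ ratio V * norm² a
    cancel with norm² z ≤? 0#
    ... | yes q = ≤-trans (≤-≡ (*-monoˡ (<⇒≤ (card-pos {W} {2} r2)) q) (zeroʳ _)) (ratio-nn {V} r3 ⊛ ⟨⟩-nn a)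
    ... | no  q = *-cancelˡ q (norm² z * (∣ W ∣ * norm² z)
        =[ trans (solve (norm² z ∷ ∣ W ∣ ∷ []) (v 0 :* (v 1 :* v 0)) (v 1 :* (v 0 :* v 0)) refl) (cong (λ s → ∣ W ∣ * (s * s)) zz) ] _
        ≤[ *-monoˡ (<⇒≤ (card-pos {W} {2} r2)) (CS (E V k ⋆ z) a) ] _
        =[ trans (cong (λ s → ∣ W ∣ * (s * norm² a)) (proj-norm (proj-E V k) z)) (solve (∣ W ∣ ∷ X ∷ norm² a ∷ []) (v 0 :* (v 1 :* v 2)) (v 0 :* v 1 :* v 2) refl) ] _
        ≤[ *-monoʳ (⟨⟩-nn a) WX ] _
        =[ solve (ratio V ∷ norm² z ∷ norm² a ∷ []) (v 0 :* v 1 :* v 2) (v 1 :* (v 0 :* v 2)) refl ] _ qed)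

  disj-sym : ∀ {W V} → Disjoint W V → Disjoint V W
  disj-sym {W} d i p with bool (W i)
  ... | inj₁ q = ⊥-elim (true≢false p (d i q))
  ... | inj₂ q = q

  full : Points
  full _ = true

  infixl 6 _∪_
  _∪_ : Points → Points → Points
  (A ∪ B) i = A i ∨ B i

  ∪-introˡ : ∀ {A B} → A ⊆ A ∪ B
  ∪-introˡ i p = cong (_∨ _) p

  ∪-introʳ : ∀ {A B} → B ⊆ A ∪ B
  ∪-introʳ {A} i p = trans (cong (A i ∨_) p) (Bool.∨-zeroʳ (A i))

  ∪-elim : ∀ {A B : Points} {i} → (A ∪ B) i ≡ true → A i ≡ true ⊎ B i ≡ true
  ∪-elim {A} {B} {i} p with bool (A i)
  ... | inj₁ q = inj₁ q
  ... | inj₂ q = inj₂ (trans (sym (cong (_∨ B i) q)) p)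

  ｛_｝ : Fin n → Points
  ｛ l ｝ i = i == l

  card-∖-≥ : ∀ W l → ∣ W ∣ - 1# ≤ ∣ W ∖ l ∣
  card-∖-≥ W l with bool (W l)
  ... | inj₁ p = ≤-reflexive (sym (card-∖ {W} p))
  ... | inj₂ p = by (∣ W ∣ ∷ ∣ W ∖ l ∣ ∷ []) (v 0 :- # 1) (v 1) (v 1 :- v 0 :+ # 1)
        (⟪ card-mono {W} {W ∖ l} (λ i q → ∖-in {W} q (λ { refl → true≢false q p })) ⟫ ⊹ 0≤1) refl

  -- Two disjoint halves, so that each of two given points can be joined to a large set of its own;
  -- see `pair-𝔅`.
  record Block (s : F) : Set where
    field
      A B      : Points
      disjoint : Disjoint A B
      sizeA    : s ≤ ∣ A ∣
      sizeB    : s ≤ ∣ B ∣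
    U : Points
    U = A ∪ B

-- The trace functional and quadratic bounds

module Traces (𝔽 : OrderedField) {n : ℕ} (𝔾 : PermGroup n) (y₀ : GroupAlgebra.Alg 𝔽 𝔾) where
  open Sums 𝔽
  open Arithmetic 𝔽
  open PermGroup 𝔾
  open GroupAlgebra 𝔽 𝔾
  open Averages 𝔽 𝔾
  open Projections 𝔽 𝔾
  open Equality (fins n)

  y : G → Alg
  y a = L a y₀

  opaque
    -- Paired with x it yields the sum of ⟨y_a, x y_a⟩ over all translates y_a of y₀. Because the
    -- translates are permuted by the group, γ is a class function, and this makes `τ` cyclic.
    γ : G → F
    γ κ = ∑ Gs λ a → ⟨ y a , y (κ ∙ a) ⟩

    γ-class : ∀ κ σ → γ (κ ∙ σ) ≡ γ (σ ∙ κ)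
    γ-class κ σ = trans (sym (shiftˡ κ _)) (∑-cong Gs λ a →
      trans (sym (⟨⟩-cong (L-L κ a y₀) (≈-trans (L-L κ (σ ∙ κ ∙ a) y₀) (mk λ g → cong (λ s → y s g) (trans (cong (κ ∙_) (assoc σ κ a)) (sym (assoc κ σ _)))))))
        (⟨⟩-L κ (y a) (y (σ ∙ κ ∙ a))))

  γ-conj : ∀ κ h → γ (κ ⁻¹ ∙ h ∙ κ) ≡ γ h
  γ-conj κ h = trans (γ-class (κ ⁻¹ ∙ h) κ) (cong γ (cancelˡ′ κ h))

  ∑-⋆ : ∀ x z (φ : G → F) → ∑ Gs (λ g → (x ⋆ z) g * φ g) ≡ ∑ Gs λ h → ∑ Gs λ k → x h * (z k * φ (h ∙ k))
  ∑-⋆ x z φ = trans (∑-cong Gs λ g → trans (cong (_* φ g) (⋆-def x z g)) (sym (∑-*ʳ Gs (φ g) _))) (trans (∑-swap Gs Gs _) (∑-cong Gs λ h →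
    trans (sym (shiftˡ h _)) (∑-cong Gs λ k → trans (*-assoc _ _ _) (cong (λ s → x h * (z s * φ (h ∙ k))) (cancelˡ h k)))))

  -- On a projection p this is the sum of ‖p y_a‖² over the translates of y₀, a weighted substitute
  -- for the rank.
  τ : Alg → F
  τ x = ∑ Gs λ κ → x κ * γ κ

  opaque
    unfolding γ

    τ-form : ∀ x → τ x ≡ ∑ Gs λ a → ⟨ y a , x ⋆ y a ⟩
    τ-form x = trans (∑-cong Gs λ κ → sym (∑-*ˡ Gs (x κ) _)) (trans (∑-swap Gs Gs _) (∑-cong Gs λ a →
      trans (∑-cong Gs λ κ → trans (cong (x κ *_) (⟨⟩-cong {y a} {y a} ≈-refl (≈-sym (L-L κ a y₀)))) (sym (∑-*ˡ Gs (x κ) _)))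
      (trans (∑-swap Gs Gs _) (∑-cong Gs λ g → trans (∑-cong Gs λ κ → solve (x κ ∷ y a g ∷ L κ (y a) g ∷ []) (v 0 :* (v 1 :* v 2)) (v 1 :* (v 0 :* v 2)) refl)
        (trans (∑-*ˡ Gs (y a g) _) (cong (y a g *_) (sym (⋆-def x (y a) g))))))))

  τ-cong : ∀ {x x′} → x ≈ x′ → τ x ≡ τ x′
  τ-cong p = ∑-cong Gs λ κ → cong (_* γ κ) (at p κ)

  τ-⊖ : ∀ x x′ → τ (x ⊖ x′) ≡ τ x - τ x′
  τ-⊖ x x′ = trans (∑-cong Gs λ κ → solve (x κ ∷ x′ κ ∷ γ κ ∷ []) ((v 0 :- v 1) :* v 2) (v 0 :* v 2 :- v 1 :* v 2) refl) (∑-- Gs _ _)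

  τ-⊕ : ∀ x x′ → τ (x ⊕ x′) ≡ τ x + τ x′
  τ-⊕ x x′ = trans (∑-cong Gs λ κ → distribʳ _ _ _) (∑-+ Gs _ _)

  τ-· : ∀ c x → τ (c • x) ≡ c * τ x
  τ-· c x = trans (∑-cong Gs λ κ → *-assoc _ _ _) (∑-*ˡ Gs c _)

  τ-cyc : ∀ x z → τ (x ⋆ z) ≡ τ (z ⋆ x)
  τ-cyc x z = trans (∑-⋆ x z γ) (trans (∑-swap Gs Gs _) (trans (∑-cong Gs λ k → ∑-cong Gs λ h →
    trans (solve (x h ∷ z k ∷ γ (h ∙ k) ∷ []) (v 0 :* (v 1 :* v 2)) (v 1 :* (v 0 :* v 2)) refl) (cong (λ s → z k * (x h * s)) (γ-class h k))) (sym (∑-⋆ z x γ))))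

  τ-conj : ∀ {W p x x′} κ → Cl W p → Fix W κ → (∀ h → x (κ ⁻¹ ∙ h ∙ κ) ≡ x′ h) → τ (p ⋆ x) ≡ τ (p ⋆ x′)
  τ-conj {W} {p} {x} {x′} κ c f q = trans (∑-⋆ p x γ) (trans (sym (conjG κ _)) (trans (∑-cong Gs λ h → trans (sym (conjG κ _)) (∑-cong Gs λ k →
      cong₂ _*_ (c κ f h) (cong₂ _*_ (q k) (trans (cong γ (eq h k)) (γ-conj κ _))))) (sym (∑-⋆ p x′ γ))))
    where
    eq : ∀ h k → (κ ⁻¹ ∙ h ∙ κ) ∙ (κ ⁻¹ ∙ k ∙ κ) ≡ κ ⁻¹ ∙ (h ∙ k) ∙ κ
    eq h k = trans (assoc _ _ _) (trans (cong (κ ⁻¹ ∙ h ∙_) (trans (cong (κ ∙_) (assoc _ _ _)) (cancelˡ′ κ _)))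
      (trans (sym (assoc _ _ _)) (cong (_∙ κ) (assoc _ _ _))))

  τ-proj : ∀ {p} → Proj p → τ p ≡ ∑ Gs λ a → norm² (p ⋆ y a)
  τ-proj {p} P = trans (τ-form p) (∑-cong Gs λ a → sym (proj-norm P (y a)))

  τ-nn : ∀ {p} → Proj p → 0# ≤ τ p
  τ-nn P = ≤-≡ (∑-nn Gs λ a → ⟨⟩-nn _) (sym (τ-proj P))

  proj-contract : ∀ {p} → Proj p → ∀ x → norm² (p ⋆ x) ≤ norm² x
  proj-contract {p} P x = ≡-≤ (proj-norm P x) (sub-le (≤-≡ (⟨⟩-nn (x ⊖ p ⋆ x)) expand))
    where
    t = ⟨ x , p ⋆ x ⟩
    expand : norm² (x ⊖ p ⋆ x) ≡ norm² x - t
    expand = trans (⟨⟩-⊖ˡ x _ _) (trans (cong₂ _-_ (⟨⟩-⊖ʳ x _ x) (trans (⟨⟩-⊖ʳ x _ _) (cong₂ _-_ (⟨⟩-comm _ _) (proj-norm P x))))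
      (solve (norm² x ∷ t ∷ []) (v 0 :- v 1 :- (v 1 :- v 1)) (v 0 :- v 1) refl))
    sub-le : 0# ≤ norm² x - t → t ≤ norm² x
    sub-le q = by (t ∷ norm² x ∷ []) (v 0) (v 1) (v 1 :- v 0) q refl

  -- All `E W l` with l in W are conjugate under A_W, which p respects, so they have the same trace
  -- against p. Their sum is at most ratio W times τ p by `S-bound` at the vectors p y_a.
  τ-E : ∀ {W p k} → Proj p → Cl W p → W k ≡ true → ι 3 < ∣ W ∣ → (∣ W ∣ - 1#) * τ (p ⋆ E W k) ≤ τ p
  τ-E {W} {p} {k} P c kW r = *-cancelˡ (card-pos {W} {3} r) (≡-≤ (trans
       (solve (∣ W ∣ ∷ τ (p ⋆ E W k) ∷ []) (v 0 :* ((v 0 :- # 1) :* v 1)) ((v 0 :- # 1) :* (v 0 :* v 1)) refl) (cong ((∣ W ∣ - 1#) *_) sum))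
     (≤-≡ (*-monoˡ (<⇒≤ (d-1-pos {W} r)) bound) (trans (solve (∣ W ∣ ∷ recip (∣ W ∣ - 1#) ∷ τ p ∷ []) ((v 0 :- # 1) :* (v 0 :* v 1 :* v 2)) (v 0 :* ((v 0 :- # 1) :* v 1 :* v 2)) refl)
       (cong (∣ W ∣ *_) (*1ˡ (*-inv⁺ (d-1-pos {W} r)))))))
    where
    sum : ∣ W ∣ * τ (p ⋆ E W k) ≡ ∑ Fs λ l → [ W l ] * τ (p ⋆ E W l)
    sum = trans (sym (∑-*ʳ Fs _ _)) (∑-cong Fs λ l → each l (bool (W l)))
      where
      each : ∀ l → W l ≡ true ⊎ W l ≡ false → [ W l ] * τ (p ⋆ E W k) ≡ [ W l ] * τ (p ⋆ E W l)
      each l (inj₂ q) = trans (*0ˡ ([]-false q)) (sym (*0ˡ ([]-false q)))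
      each l (inj₁ q) with move {W} kW q (≤-<-trans (ι-mono {2} {3} (ℕ.n≤1+n 2)) r)
      ... | κ , f , κk = cong ([ W l ] *_) (τ-conj {W} {p} κ c f λ h → cong₂ _-_
              (e-conj κ {W ∖ k} {W ∖ l} (λ i → cong₂ (λ a b → a ∧ not b) (fix-stable {W} f i) (trans (cong (κ ▹ i ==_) (sym κk)) (==-▹ κ i k))) h)
              (e-conj κ {W} {W} (fix-stable {W} f) h))
    form : ∀ l a → ⟨ y a , (p ⋆ E W l) ⋆ y a ⟩ ≡ ⟨ p ⋆ y a , E W l ⋆ (p ⋆ y a) ⟩
    form l a = trans (⟨⟩-cong {y a} {y a} ≈-refl (≈-trans (⋆-congˡ (≈-trans (⋆-congˡ (≈-sym (idem P))) (≈-trans (⋆-assoc p p _) (⋆-congʳ {p} (comm {W} (Supp-E {W} ⊆-refl) c)))))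
       (≈-trans (⋆-assoc p _ _) (⋆-congʳ {p} (⋆-assoc _ p (y a)))))) (sym (⟨⟩-self (self P) (y a) _))
    bound : ∑ Fs (λ l → [ W l ] * τ (p ⋆ E W l)) ≤ ratio W * τ p
    bound = ≡-≤ (trans (∑-cong Fs λ l → trans (cong ([ W l ] *_) (τ-form _)) (sym (∑-*ˡ Gs _ _))) (∑-swap Fs Gs _))
      (≤-≡ (∑-mono Gs λ a → ≡-≤ (∑-cong Fs λ l → cong ([ W l ] *_) (form l a)) (S-bound {W} r (p ⋆ y a)))
        (trans (∑-*ˡ Gs _ _) (cong (ratio W *_) (sym (τ-proj P)))))

  τ-half : ∀ {W p k} → Proj p → Cl W p → W k ≡ true → ι 3 < ∣ W ∣ → ι 2 * τ (p ⋆ E W k) ≤ τ p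
  τ-half {W} {p} {k} P c kW r = ≤-trans (*-monoʳ (τ-nn (proj-⋆ P (proj-E W k) (comm {W} (Supp-E {W} ⊆-refl) c)))
      (by (∣ W ∣ ∷ []) (# 2) (v 0 :- # 1) (v 0 :- # 3) ⟪ <⇒≤ r ⟫ refl)) (τ-E P c kW r)

  -- The inequality 2T ≤ 2√(AcB) with the root replaced by a free parameter. The right side is
  -- linear in A and B, so bounds for several operators can be added for a common λ′.
  amgm : ∀ {A B c T λ′} → 0# ≤ A → 0# ≤ B → 0# ≤ c → 0# < λ′ → T * T ≤ A * c * B → ι 2 * T ≤ λ′ * c * A + recip λ′ * B
  amgm {A} {B} {c} {T} {λ′} a b p l q = sq-≤ (<⇒≤ l ⊛ p ⊛ a ⊹ inv-nn l ⊛ b) (≤-trans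
    (≡-≤ (solve (T ∷ []) (# 2 :* v 0 :* (# 2 :* v 0)) (# 4 :* (v 0 :* v 0)) refl) (≤-≡ (*-monoˡ (ι-nn 4) q)
      (trans (sym (*1ˡ (*-inv⁺ l))) (solve (A ∷ B ∷ c ∷ λ′ ∷ recip λ′ ∷ []) (v 3 :* v 4 :* (# 4 :* (v 0 :* v 2 :* v 1))) (# 4 :* (v 3 :* v 2 :* v 0) :* (v 4 :* v 1)) refl))))
    (by (λ′ * c * A ∷ recip λ′ * B ∷ []) (# 4 :* v 0 :* v 1) ((v 0 :+ v 1) :* (v 0 :+ v 1)) ((v 0 :- v 1) :* (v 0 :- v 1)) (sq-nn _) refl))

  module Bounded (c : F) (c-nn : 0# ≤ c) where

    -- The quadratic bound that the main estimate asserts for the operator 1 − Π; it is additive and stable under B† x B.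
    𝔅 : Alg → Set
    𝔅 x = ∀ u h λ′ → 0# < λ′ → ι 2 * ⟨ (x ⋆ u) ⋆ y₀ , h ⟩ ≤ λ′ * c * ⟨ u , x ⋆ u ⟩ + recip λ′ * ⟨ h , x ⋆ h ⟩

    𝔅-cong : ∀ {x x′} → x ≈ x′ → 𝔅 x → 𝔅 x′
    𝔅-cong e b u h λ′ l = subst₂ _≤_ (cong (ι 2 *_) (⟨⟩-cong {_} {_} {h} {h} (⋆-congˡ (⋆-congˡ e)) ≈-refl))
      (cong₂ (λ a b → λ′ * c * a + recip λ′ * b) (⟨⟩-cong {u} {u} ≈-refl (⋆-congˡ e)) (⟨⟩-cong {h} {h} ≈-refl (⋆-congˡ e))) (b u h λ′ l)

    𝔅-⊕ : ∀ {x x′} → 𝔅 x → 𝔅 x′ → 𝔅 (x ⊕ x′)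
    𝔅-⊕ {x} {x′} b b′ u h λ′ l = ≡-≤ (trans (cong (ι 2 *_) (trans (⟨⟩-cong {_} {_} {h} {h} (≈-trans (⋆-congˡ (⋆-⊕ˡ x x′ u)) (⋆-⊕ˡ _ _ y₀)) ≈-refl) (⟨⟩-⊕ˡ _ _ h))) (distribˡ _ _ _))
      (≤-≡ (+-mono (b u h λ′ l) (b′ u h λ′ l)) (trans
        (solve (λ′ * c ∷ recip λ′ ∷ ⟨ u , x ⋆ u ⟩ ∷ ⟨ u , x′ ⋆ u ⟩ ∷ ⟨ h , x ⋆ h ⟩ ∷ ⟨ h , x′ ⋆ h ⟩ ∷ []) (v 0 :* v 2 :+ v 1 :* v 4 :+ (v 0 :* v 3 :+ v 1 :* v 5)) (v 0 :* (v 2 :+ v 3) :+ v 1 :* (v 4 :+ v 5)) refl)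
        (sym (cong₂ (λ a b → λ′ * c * a + recip λ′ * b) (form u) (form h)))))
      where
      form : ∀ u → ⟨ u , (x ⊕ x′) ⋆ u ⟩ ≡ ⟨ u , x ⋆ u ⟩ + ⟨ u , x′ ⋆ u ⟩
      form u = trans (⟨⟩-cong {u} {u} ≈-refl (⋆-⊕ˡ x x′ u)) (⟨⟩-⊕ʳ _ _ u)

    𝔅-· : ∀ {x} w → 0# ≤ w → 𝔅 x → 𝔅 (w • x)
    𝔅-· {x} w p b u h λ′ l = ≡-≤ (trans (cong (ι 2 *_) (trans (⟨⟩-cong {_} {_} {h} {h} (≈-trans (⋆-congˡ (⋆-·ˡ w x u)) (⋆-·ˡ w _ y₀)) ≈-refl) (⟨⟩-·ˡ w _ h)))
        (solve (w ∷ ⟨ (x ⋆ u) ⋆ y₀ , h ⟩ ∷ []) (# 2 :* (v 0 :* v 1)) (v 0 :* (# 2 :* v 1)) refl))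
      (≤-≡ (*-monoˡ p (b u h λ′ l)) (trans (solve (w ∷ λ′ * c ∷ recip λ′ ∷ ⟨ u , x ⋆ u ⟩ ∷ ⟨ h , x ⋆ h ⟩ ∷ []) (v 0 :* (v 1 :* v 3 :+ v 2 :* v 4)) (v 1 :* (v 0 :* v 3) :+ v 2 :* (v 0 :* v 4)) refl)
        (sym (cong₂ (λ a b → λ′ * c * a + recip λ′ * b) (form u) (form h)))))
      where
      form : ∀ u → ⟨ u , (w • x) ⋆ u ⟩ ≡ w * ⟨ u , x ⋆ u ⟩
      form u = trans (⟨⟩-cong {u} {u} ≈-refl (⋆-·ˡ w x u)) (⟨⟩-·ʳ w _ u)

    𝔅-𝟘 : 𝔅 𝟘
    𝔅-𝟘 u h λ′ l = ≤-reflexive (trans (cong (ι 2 *_) (trans (⟨⟩-cong {_} {_} {h} {h} (≈-trans (⋆-congˡ (⋆-𝟘ˡ u)) (⋆-𝟘ˡ y₀)) ≈-refl) (zero⟨⟩ h)))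
        (trans (solve (λ′ * c ∷ recip λ′ ∷ []) (# 2 :* # 0) (v 0 :* # 0 :+ v 1 :* # 0) refl) (sym (cong₂ (λ a b → λ′ * c * a + recip λ′ * b) (form u) (form h)))))
      where
      zero⟨⟩ : ∀ h → ⟨ 𝟘 , h ⟩ ≡ 0#
      zero⟨⟩ h = trans (∑-cong Gs λ g → zeroˡ _) (∑-0 Gs)
      form : ∀ u → ⟨ u , 𝟘 ⋆ u ⟩ ≡ 0#
      form u = trans (⟨⟩-cong {u} {u} ≈-refl (⋆-𝟘ˡ u)) (trans (⟨⟩-comm u 𝟘) (zero⟨⟩ u))

    opaque
      unfolding ∑

      𝔅-list : ∀ (is : List (Fin n)) (x : Fin n → Alg) → (∀ i → 𝔅 (x i)) → 𝔅 (λ g → ∑ is λ i → x i g)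
      𝔅-list []       x b = 𝔅-𝟘
      𝔅-list (i ∷ is) x b = 𝔅-⊕ (b i) (𝔅-list is x b)

    𝔅-Σ : ∀ (W : Points) (x : Fin n → Alg) → (∀ i → W i ≡ true → 𝔅 (x i)) → 𝔅 (Σᶠ λ i → [ W i ] • x i)
    𝔅-Σ W x b = 𝔅-list Fs _ λ i → each i (bool (W i))
      where
      each : ∀ i → W i ≡ true ⊎ W i ≡ false → 𝔅 ([ W i ] • x i)
      each i (inj₁ p) = 𝔅-· [ W i ] ([]-nn _) (b i p)
      each i (inj₂ p) = 𝔅-cong (mk λ g → sym (*0ˡ ([]-false p))) 𝔅-𝟘

    -- The bound for x at `B ⋆ u` and `B ⋆ h`: multiplication by y₀ from the right does not
    -- interfere with B† on the left, which moves over to h.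
    𝔅-† : ∀ {x} B → 𝔅 x → 𝔅 (B † ⋆ (x ⋆ B))
    𝔅-† {x} B b u h λ′ l = subst₂ _≤_ (cong (ι 2 *_) (trans (sym (trans (⟨⟩-†ˡ (B †) _ h) (⟨⟩-cong {Z} {Z} ≈-refl (⋆-congˡ (mk λ g → cong B (⁻¹-invol g))))))
        (⟨⟩-cong {_} {_} {h} {h} (≈-trans (≈-sym (⋆-assoc (B †) _ y₀)) (⋆-congˡ (≈-sym (assoc3 u)))) ≈-refl)))
      (cong₂ (λ a b → λ′ * c * a + recip λ′ * b) (form u) (form h)) (b (B ⋆ u) (B ⋆ h) λ′ l)
      where
      Z = (x ⋆ (B ⋆ u)) ⋆ y₀
      assoc3 : ∀ u → (B † ⋆ (x ⋆ B)) ⋆ u ≈ B † ⋆ (x ⋆ (B ⋆ u))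
      assoc3 u = ≈-trans (⋆-assoc (B †) (x ⋆ B) u) (⋆-congʳ {B †} (⋆-assoc x B u))
      form : ∀ u → ⟨ B ⋆ u , x ⋆ (B ⋆ u) ⟩ ≡ ⟨ u , (B † ⋆ (x ⋆ B)) ⋆ u ⟩
      form u = trans (⟨⟩-†ˡ B u _) (⟨⟩-cong {u} {u} ≈-refl (≈-sym (assoc3 u)))

    -- Write (q u) y₀ as the sum of (q u)(a) y_a and pass q to y_a and to h. Cauchy-Schwarz over a,
    -- and then in each ⟨q y_a, q h⟩, leaves ‖q u‖² · τ q · ‖q h‖².
    𝔅-proj : ∀ {q} → Proj q → τ q ≤ c → 𝔅 q
    𝔅-proj {q} P t u h λ′ l = amgm (proj-nn P u) (proj-nn P h) c-nn l
      (≡-≤ (cong₂ _*_ T-sum T-sum) (≤-trans (cauchy Gs (q ⋆ u) (λ a → ⟨ q ⋆ y a , q ⋆ h ⟩))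
      (≡-≤ (cong (_* ∑ Gs (λ a → ⟨ q ⋆ y a , q ⋆ h ⟩ * ⟨ q ⋆ y a , q ⋆ h ⟩)) (proj-norm P u))
      (≤-trans (*-monoˡ (proj-nn P u) (≤-≡ (∑-mono Gs λ a → CS (q ⋆ y a) (q ⋆ h)) (trans (∑-*ʳ Gs _ _) (cong₂ _*_ (sym (τ-proj P)) (proj-norm P h)))))
      (≡-≤ (sym (*-assoc _ _ _)) (*-monoʳ (proj-nn P h) (*-monoˡ (proj-nn P u) t)))))))
      where
      T-sum : ⟨ (q ⋆ u) ⋆ y₀ , h ⟩ ≡ ∑ Gs λ a → (q ⋆ u) a * ⟨ q ⋆ y a , q ⋆ h ⟩
      T-sum = trans (⟨⟩-cong {_} {_} {h} {h} (≈-trans (⋆-congˡ (≈-trans (⋆-congˡ (≈-sym (idem P))) (⋆-assoc q q u))) (⋆-assoc q (q ⋆ u) y₀)) ≈-refl)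
        (trans (⟨⟩-self (self P) ((q ⋆ u) ⋆ y₀) h) (trans (∑-cong Gs λ g → trans (cong (_* (q ⋆ h) g) (⋆-def (q ⋆ u) y₀ g)) (sym (∑-*ʳ Gs _ _)))
        (trans (∑-swap Gs Gs _) (∑-cong Gs λ a → trans (∑-cong Gs λ g → *-assoc _ _ _) (trans (∑-*ˡ Gs _ _) (cong ((q ⋆ u) a *_)
          (trans (⟨⟩-cong {y a} {y a} ≈-refl (≈-trans (⋆-congˡ (≈-sym (idem P))) (⋆-assoc q q h))) (sym (⟨⟩-self (self P) (y a) (q ⋆ h))))))))))

-- Components that depend on two points

module SecondLevel (𝔽 : OrderedField) {n : ℕ} (𝔾 : PermGroup n) (y₀ : GroupAlgebra.Alg 𝔽 𝔾)
  (c : OrderedField.F 𝔽) (c-nn : OrderedField._≤_ 𝔽 (OrderedField.0# 𝔽) c) where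
  open Sums 𝔽
  open Arithmetic 𝔽
  open PermGroup 𝔾
  open GroupAlgebra 𝔽 𝔾
  open Averages 𝔽 𝔾
  open Projections 𝔽 𝔾
  open Traces 𝔽 𝔾 y₀
  open Bounded c c-nn
  open Equality (fins n)

  τ-norm : ∀ x → ∑ Gs (λ a → norm² (x ⋆ y a)) ≡ τ (x † ⋆ x)
  τ-norm x = trans (∑-cong Gs λ a → trans (⟨⟩-†ˡ x (y a) _) (⟨⟩-cong {y a} {y a} ≈-refl (≈-sym (⋆-assoc (x †) x (y a))))) (sym (τ-form (x † ⋆ x)))

  norm-complement : ∀ {p} → Proj p → ∀ {x z} → z ≈ x ⊖ p ⋆ x → norm² z ≡ norm² x - norm² (p ⋆ x)
  norm-complement {p} P {x} {z} e = trans (⟨⟩-cong e e) (trans (⟨⟩-⊖ˡ x _ _) (trans (cong₂ _-_ (⟨⟩-⊖ʳ x _ x) (⟨⟩-⊖ʳ x _ _))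
    (trans (cong₂ (λ a b → norm² x - a - (b - norm² (p ⋆ x))) (sym (proj-norm P x)) (trans (⟨⟩-comm _ _) (sym (proj-norm P x))))
      (solve (norm² x ∷ norm² (p ⋆ x) ∷ []) (v 0 :- v 1 :- (v 1 :- v 1)) (v 0 :- v 1) refl))))

  -- The subspace onto which e (Y ∖ k ∖ k′) ⋆ Q Y projects consists of functions of the preimages of k and k′ that have
  -- no linear part. Up to a constant it is seen by E W₁ k ⋆ E W₂ k′, whose trace is small by two applications of τ-E.
  module _ {Y W₁ W₂ : Points} {k k′ : Fin n} (Yk : Y k ≡ true) (Yk′ : Y k′ ≡ true) (k≢ : k ≢ k′)
    (s₁ : W₁ ⊆ Y ∖ k′) (s₂ : W₂ ⊆ Y ∖ k) (kW : W₁ k ≡ true) (kW′ : W₂ k′ ≡ true) (dis : Disjoint W₁ W₂)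
    (r₁ : ι 7 < ∣ W₁ ∣) (r₂ : ι 7 < ∣ W₂ ∣) where

    private
      K = Y ∖ k ∖ k′
      q = e K ⋆ Q Y
      E₁ = E W₁ k
      E₂ = E W₂ k′

      7> : ∀ {m x} → m ℕ.≤ 7 → ι 7 < x → ι m < x
      7> p r = ≤-<-trans (ι-mono p) r

      K⊆Y : K ⊆ Y
      K⊆Y i p = ∖-⊆ Y k i (∖-⊆ (Y ∖ k) k′ i p)

      big : ∀ {l W} → W ⊆ Y ∖ l → ι 7 < ∣ W ∣ → ι 7 < ∣ Y ∖ l ∣
      big {l} {W} s r = <-≤-trans r (card-mono {W} s)

      rY : ι 3 < ∣ Y ∣
      rY = 7> {3} (ℕ.s≤s (ℕ.s≤s (ℕ.s≤s ℕ.z≤n))) (<-≤-trans (big s₁ r₁) (card-mono {Y ∖ k′} (∖-⊆ Y k′)))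

      Pq : Proj q
      Pq = proj-⋆ (proj-e K) (proj-Q rY) (≈-sym (comm {Y} (Supp-e K⊆Y) (Cl-Q Y)))

      absorb : ∀ {W} → W ⊆ K → ∀ u → e W ⋆ (q ⋆ u) ≈ q ⋆ u
      absorb {W} s u = ≈-trans (≈-sym (⋆-assoc (e W) q u)) (⋆-congˡ (≈-trans (≈-sym (⋆-assoc (e W) (e K) (Q Y))) (⋆-congˡ (e-subˡ s))))

      kill : ∀ {l} → Y l ≡ true → K ⊆ Y ∖ l → ∀ u → e (Y ∖ l) ⋆ (q ⋆ u) ≈ 𝟘
      kill {l} Yl s u = ≈-trans (≈-sym (⋆-assoc (e (Y ∖ l)) q u)) (≈-trans (⋆-congˡ (≈-trans (≈-sym (⋆-assoc (e (Y ∖ l)) (e K) (Q Y)))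
        (≈-trans (⋆-congˡ (e-subʳ s)) (e-Q Yl rY)))) (⋆-𝟘ˡ u))

      fixed : ∀ {l j} → Y l ≡ true → K ⊆ Y ∖ l → Y ∖ l ∖ j ⊆ K → ∀ u → E (Y ∖ l) j ⋆ (q ⋆ u) ≈ q ⋆ u
      fixed {l} {j} Yl s s′ u = ≈-trans (⋆-⊖ˡ _ _ _) (≈-trans (⊖-cong (absorb s′ u) (kill Yl s u)) (mk λ g → solve ((q ⋆ u) g ∷ []) (v 0 :- # 0) (v 0) refl))

      ratio≤2 : ∀ {W} → ι 7 < ∣ W ∣ → ratio W ≤ ι 2
      ratio≤2 {W} r = ≤-≡ (*-monoʳ (inv-nn (d-1-pos {W} r3)) (by (∣ W ∣ ∷ []) (v 0) (# 2 :* (v 0 :- # 1)) (v 0 :- # 7 :+ # 5) (⟪ <⇒≤ r ⟫ ⊹ ι-nn 5) refl))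
        (trans (*-assoc _ _ _) (*1ʳ (*-inv⁺ (d-1-pos {W} r3))))
        where
        r3 = 7> {3} (ℕ.s≤s (ℕ.s≤s (ℕ.s≤s ℕ.z≤n))) r

      small : ∀ {V W l a} → W ⊆ V → W l ≡ true → ι 7 < ∣ W ∣ → E V l ⋆ a ≈ a → ι 7 * norm² (e W ⋆ a) ≤ ι 2 * norm² a
      small {V} {W} {l} {a} s lW r f = ≤-trans (*-monoʳ (⟨⟩-nn _) (<⇒≤ r)) (≤-trans
        (concentrated {V} {W} s lW (7> {2} (ℕ.s≤s (ℕ.s≤s ℕ.z≤n)) r) (7> {3} (ℕ.s≤s (ℕ.s≤s (ℕ.s≤s ℕ.z≤n))) rV) f) (*-monoʳ (⟨⟩-nn a) (ratio≤2 {V} rV)))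
        where
        rV = <-≤-trans r (card-mono {W} s)

      -- Each of `e W₁` and `e W₂` carries at most 2/7 of the squared norm of `q ⋆ u`, by
      -- `concentrated` with ratio at most 2 and more than 7 points. So 3/7 of it survives `E₁` and
      -- `E₂`.
      seen : ∀ u → ι 3 * norm² (q ⋆ u) ≤ ι 7 * norm² (E₁ ⋆ (E₂ ⋆ (q ⋆ u)))
      seen u = by (N ∷ N₁ ∷ N₂ ∷ norm² (e W₁ ⋆ x) ∷ norm² (E₁ ⋆ x) ∷ []) (# 3 :* v 0) (# 7 :* v 4)
          ((# 2 :* v 0 :- # 7 :* v 1) :+ (# 2 :* v 0 :- # 7 :* v 2) :+ # 7 :* (v 1 :- v 3) :+ # 7 :* (v 4 :- (v 0 :- v 2 :- v 3)))
          (⟪ small s₁ kW r₁ fixed₁ ⟫ ⊹ ⟪ small s₂ kW′ r₂ fixed₂ ⟫ ⊹ ι-nn 7 ⊛ ⟪ x-small ⟫ ⊹ ι-nn 7 ⊛ ⟪ ≤-reflexive (sym total) ⟫) refl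
        where
        a = q ⋆ u
        x = E₂ ⋆ a
        N = norm² a
        N₁ = norm² (e W₁ ⋆ a)
        N₂ = norm² (e W₂ ⋆ a)
        fixed₁ : E (Y ∖ k′) k ⋆ a ≈ a
        fixed₁ = fixed Yk′ (λ i p → ∖-in {Y} (K⊆Y i p) (∖-≢ (Y ∖ k) k′ p)) (λ i p → ∖-in {Y ∖ k} (∖-in {Y} (∖-⊆ Y k′ i (∖-⊆ (Y ∖ k′) k i p)) (∖-≢ (Y ∖ k′) k p)) (∖-≢ Y k′ (∖-⊆ (Y ∖ k′) k i p))) u
        fixed₂ : E (Y ∖ k) k′ ⋆ a ≈ a
        fixed₂ = fixed Yk (∖-⊆ (Y ∖ k) k′) ⊆-refl u
        in₁ : e (W₁ ∖ k) ⋆ a ≈ a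
        in₁ = absorb (λ i p → let t = s₁ i (∖-⊆ W₁ k i p) in ∖-in {Y ∖ k} (∖-in {Y} (∖-⊆ Y k′ i t) (∖-≢ W₁ k p)) (∖-≢ Y k′ t)) u
        in₂ : e (W₂ ∖ k′) ⋆ a ≈ a
        in₂ = absorb (λ i p → let t = s₂ i (∖-⊆ W₂ k′ i p) in ∖-in {Y ∖ k} t (∖-≢ W₂ k′ p)) u
        swap : ∀ {W} → Disjoint W₂ W → ∀ z → e W ⋆ (E₂ ⋆ z) ≈ E₂ ⋆ (e W ⋆ z)
        swap {W} d z = ≈-trans (≈-sym (⋆-assoc (e W) E₂ z)) (≈-trans (⋆-congˡ (comm {W₂} (Supp-E {W₂} ⊆-refl) (Cl-e-disj {W₂} {W} d))) (⋆-assoc E₂ (e W) z))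
        x-eq : x ≈ a ⊖ e W₂ ⋆ a
        x-eq = ≈-trans (⋆-⊖ˡ _ _ a) (⊖-cong in₂ ≈-refl)
        E₁x-eq : E₁ ⋆ x ≈ x ⊖ e W₁ ⋆ x
        E₁x-eq = ≈-trans (⋆-⊖ˡ _ _ x) (⊖-cong (≈-trans (swap (λ i p → cong (_∧ _) (disj-sym {W₁} dis i p)) a) (⋆-congʳ {E₂} in₁)) ≈-refl)
        x-small : norm² (e W₁ ⋆ x) ≤ N₁
        x-small = ≡-≤ (⟨⟩-cong (swap (disj-sym {W₁} dis) a) (swap (disj-sym {W₁} dis) a)) (proj-contract (proj-E W₂ k′) (e W₁ ⋆ a))
        total : norm² (E₁ ⋆ x) ≡ N - N₂ - norm² (e W₁ ⋆ x)
        total = trans (norm-complement (proj-e W₁) E₁x-eq) (cong (_- norm² (e W₁ ⋆ x)) (norm-complement (proj-e W₂) x-eq))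

      PE : Proj (E₁ ⋆ E₂)
      PE = proj-⋆ (proj-E W₁ k) (proj-E W₂ k′) (comm {W₂} (Supp-E {W₂} ⊆-refl) ClE₁)
        where
        ClE₁ : Cl W₂ E₁
        ClE₁ = Cl-⊖ {W₂} {e (W₁ ∖ k)} (Cl-e-disj {W₂} {W₁ ∖ k} (λ i p → cong (_∧ _) (disj-sym {W₁} dis i p))) (Cl-e-disj {W₂} (disj-sym {W₁} dis))

      traces : ι 3 * τ q ≤ ι 7 * τ (E₁ ⋆ E₂)
      traces = ι 3 * τ q
        =[ trans (cong (ι 3 *_) (τ-proj Pq)) (sym (∑-*ˡ Gs _ _)) ] _
        ≤[ ∑-mono Gs (λ a → seen (y a)) ] _
        =[ trans (∑-*ˡ Gs _ _) (cong (ι 7 *_) (trans (∑-cong Gs λ a → ⟨⟩-cong (≈-sym (x-assoc a)) (≈-sym (x-assoc a))) (trans (τ-norm x) (trans (τ-cyc (x †) x) (sym (trans (τ-norm (x †)) (τ-cong (⋆-congˡ (mk λ g → cong x (⁻¹-invol g)))))))))) ] _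
        ≤[ *-monoˡ (ι-nn 7) (∑-mono Gs λ a → ≡-≤ (⟨⟩-cong (x†-assoc a) (x†-assoc a)) (proj-contract Pq ((E₁ ⋆ E₂) ⋆ y a))) ] _
        =[ cong (ι 7 *_) (sym (τ-proj PE)) ] _ qed
        where
        x = (E₁ ⋆ E₂) ⋆ q
        x-assoc : ∀ a → x ⋆ y a ≈ E₁ ⋆ (E₂ ⋆ (q ⋆ y a))
        x-assoc a = ≈-trans (⋆-assoc _ q _) (⋆-assoc E₁ E₂ _)
        x†-assoc : ∀ a → x † ⋆ y a ≈ q ⋆ ((E₁ ⋆ E₂) ⋆ y a)
        x†-assoc a = ≈-trans (⋆-congˡ (≈-trans (⋆-† _ q) (⋆-cong (self Pq) (self PE)))) (⋆-assoc q _ _)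

    pair-trace : (∣ W₁ ∣ - 1#) * ((∣ W₂ ∣ - 1#) * τ q) ≤ ι 3 * τ 𝟙
    pair-trace = *-cancelˡ (ι-pos 2) (ι 3 * (d₁ * (d₂ * τ q))
        =[ solve (d₁ ∷ d₂ ∷ τ q ∷ []) (# 3 :* (v 0 :* (v 1 :* v 2))) (v 0 :* (v 1 :* (# 3 :* v 2))) refl ] _
        ≤[ *-monoˡ d₁-nn (*-monoˡ d₂-nn traces) ] _
        =[ solve (d₁ ∷ d₂ ∷ τ (E₁ ⋆ E₂) ∷ []) (v 0 :* (v 1 :* (# 7 :* v 2))) (# 7 :* (v 0 :* (v 1 :* v 2))) refl ] _
        ≤[ *-monoˡ (ι-nn 7) (*-monoˡ d₁-nn (τ-E {W₂} (proj-E W₁ k) ClE₁ kW′ r3₂)) ] _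
        ≤[ *-monoˡ (ι-nn 7) (≡-≤ (cong (d₁ *_) (τ-cong (≈-sym (𝟙-⋆ E₁)))) (τ-E {W₁} (proj-e ∅) (Cl-𝟙 W₁) kW r3₁)) ] _
        ≤[ by (τ 𝟙 ∷ []) (# 7 :* v 0) (# 3 :* (# 3 :* v 0)) (# 2 :* v 0) (ι-nn 2 ⊛ τ-nn (proj-e ∅)) refl ] _ qed)
      where
      d₁ = ∣ W₁ ∣ - 1#
      d₂ = ∣ W₂ ∣ - 1#
      r3₁ = 7> {3} (ℕ.s≤s (ℕ.s≤s (ℕ.s≤s ℕ.z≤n))) r₁
      r3₂ = 7> {3} (ℕ.s≤s (ℕ.s≤s (ℕ.s≤s ℕ.z≤n))) r₂
      d₁-nn = <⇒≤ (d-1-pos {W₁} r3₁)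
      d₂-nn = <⇒≤ (d-1-pos {W₂} r3₂)
      ClE₁ : Cl W₂ E₁
      ClE₁ = Cl-⊖ {W₂} {e (W₁ ∖ k)} (Cl-e-disj {W₂} {W₁ ∖ k} (λ i p → cong (_∧ _) (disj-sym {W₁} dis i p))) (Cl-e-disj {W₂} (disj-sym {W₁} dis))

  -- Induction along the list of all points, removing those outside B one at a time. The set reached
  -- in the end agrees with B only pointwise, hence the congruence hypothesis.
  shrink : ∀ {B} (P : Points → Set) → (∀ {Z Z′} → (∀ i → Z i ≡ Z′ i) → P Z → P Z′) →
    (∀ Z z → B ⊆ Z → Z z ≡ true → B z ≡ false → P Z → P (Z ∖ z)) → ∀ Y → B ⊆ Y → P Y → P B
  shrink {B} P P-cong step Y s p = go (allFin n) Y s p (λ i _ → inj₂ (∈-allFin i))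
    where
    go : ∀ zs Z → B ⊆ Z → P Z → (∀ i → Z i ≡ true → B i ≡ true ⊎ i ∈ zs) → P B
    go [] Z s p cover = P-cong ext p
      where
      ext : ∀ i → Z i ≡ B i
      ext i with bool (Z i) | bool (B i)
      ... | inj₁ q | inj₁ r = trans q (sym r)
      ... | inj₂ q | inj₂ r = trans q (sym r)
      ... | inj₂ q | inj₁ r = ⊥-elim (true≢false (s i r) q)
      ... | inj₁ q | inj₂ r with cover i q
      ...   | inj₁ t = ⊥-elim (true≢false t r)
    go (z ∷ zs) Z s p cover with bool (Z z) | bool (B z)
    ... | inj₁ q | inj₂ r = go zs (Z ∖ z) (λ i t → ∖-in {Z} (s i t) (λ { refl → true≢false t r })) (step Z z s q r p) cover′
      where
      cover′ : ∀ i → (Z ∖ z) i ≡ true → B i ≡ true ⊎ i ∈ zs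
      cover′ i t with cover i (∖-⊆ Z z i t)
      ... | inj₁ u         = inj₁ u
      ... | inj₂ (here w)  = ⊥-elim (∖-≢ Z z t w)
      ... | inj₂ (there m) = inj₂ m
    ... | inj₁ q | inj₁ r = go zs Z s p λ i t → keep i (cover i t)
      where
      keep : ∀ i → B i ≡ true ⊎ i ∈ z ∷ zs → B i ≡ true ⊎ i ∈ zs
      keep i (inj₁ u)           = inj₁ u
      keep i (inj₂ (here refl)) = inj₁ r
      keep i (inj₂ (there m))   = inj₂ m
    ... | inj₂ q | _ = go zs Z s p λ i t → keep i t (cover i t)
      where
      keep : ∀ i → Z i ≡ true → B i ≡ true ⊎ i ∈ z ∷ zs → B i ≡ true ⊎ i ∈ zs
      keep i t (inj₁ u)           = inj₁ u
      keep i t (inj₂ (here refl)) = ⊥-elim (true≢false t q)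
      keep i t (inj₂ (there m))   = inj₂ m

  ∖-cong : ∀ {Y Y′} → (∀ i → Y i ≡ Y′ i) → ∀ l i → (Y ∖ l) i ≡ (Y′ ∖ l) i
  ∖-cong p l i = cong (_∧ _) (p i)

  Π-cong : ∀ {Y Y′} → (∀ i → Y i ≡ Y′ i) → Π Y ≈ Π Y′
  Π-cong {Y} {Y′} p = ⊕-cong (e-cong p) (mk λ g → cong₂ _*_ (cong (λ d → (d - 1#) * recip d) (∑-cong Fs λ i → cong [_] (p i)))
    (∑-cong Fs λ l → cong₂ _*_ (cong [_] (p l)) (cong₂ _-_ (at (e-cong (∖-cong p l)) g) (at (e-cong p) g))))

  open Block

  module Chains {s : F} (s-big : ι 9 < s) (c-large : ι 3 * τ 𝟙 ≤ c * ((s - ι 2) * (s - ι 2))) where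

    private
      s-2-pos : 0# < s - ι 2
      s-2-pos q = s-big (by (s ∷ []) (v 0) (# 9) (# 0 :- (v 0 :- # 2) :+ # 7) (⟪ q ⟫ ⊹ ι-nn 7) refl)

    -- The sets for `pair-trace` are A with z added and l removed, and B with l added and z removed.
    -- They stay disjoint and have at least s - 1 points each, whence the factors s - 2.
    pair-𝔅 : ∀ {Y z l} (b : Block s) → U b ⊆ Y → Y z ≡ true → Y l ≡ true → z ≢ l → 𝔅 (e (Y ∖ z ∖ l) ⋆ Q Y)
    pair-𝔅 {Y} {z} {l} b sub Yz Yl z≢l = 𝔅-proj Pq (*-cancelˡ (*-pos s-2-pos s-2-pos) (_
        ≤[ ≤-reflexive (*-assoc _ _ _) ] _
        ≤[ *-mono (<⇒≤ s-2-pos) (≤-trans (<⇒≤ s-2-pos) (d≥ (sizeB b)) ⊛ τ-nn Pq) (d≥ (sizeA b)) (*-monoʳ (τ-nn Pq) (d≥ (sizeB b))) ] _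
        ≤[ pair-trace Yz Yl z≢l s₁ s₂ (∖-in {A b ∪ ｛ z ｝} (∪-introʳ {A b} {｛ z ｝} z (==-refl z)) z≢l) (∖-in {B b ∪ ｛ l ｝} (∪-introʳ {B b} {｛ l ｝} l (==-refl l)) (λ q → z≢l (sym q))) dis (r (sizeA b)) (r (sizeB b)) ] _
        ≤[ c-large ] _
        =[ *-comm c _ ] _ qed))
      where
      grow : ∀ X j i → Points
      grow X j i = (X ∪ ｛ j ｝) ∖ i
      ∪｛｝ : ∀ {X j i} → (X ∪ ｛ j ｝) i ≡ true → X i ≡ true ⊎ i ≡ j
      ∪｛｝ {X} {j} {i} p with ∪-elim {X} {｛ j ｝} {i} p
      ... | inj₁ q = inj₁ q
      ... | inj₂ q = inj₂ (==⇒≡ i j q)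
      inside : ∀ {X j i} → X ⊆ U b → Y j ≡ true → grow X j i ⊆ Y ∖ i
      inside {X} {j} {i} t Yj m p = ∖-in {Y} (case (∪｛｝ {X} (∖-⊆ (X ∪ ｛ j ｝) i m p))) (∖-≢ (X ∪ ｛ j ｝) i p)
        where
        case : X m ≡ true ⊎ m ≡ j → Y m ≡ true
        case (inj₁ q)    = sub m (t m q)
        case (inj₂ refl) = Yj
      s₁ : grow (A b) z l ⊆ Y ∖ l
      s₁ = inside {A b} (∪-introˡ {A b}) Yz
      s₂ : grow (B b) l z ⊆ Y ∖ z
      s₂ = inside {B b} (∪-introʳ {A b}) Yl
      dis : Disjoint (grow (A b) z l) (grow (B b) l z)
      dis m p with bool (grow (B b) l z m)
      ... | inj₂ q = q
      ... | inj₁ q with ∪｛｝ {A b} (∖-⊆ (A b ∪ ｛ z ｝) l m p) | ∪｛｝ {B b} (∖-⊆ (B b ∪ ｛ l ｝) z m q)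
      ...   | inj₁ t | inj₁ u = ⊥-elim (true≢false u (disjoint b m t))
      ...   | inj₂ t | _      = ⊥-elim (∖-≢ (B b ∪ ｛ l ｝) z q t)
      ...   | inj₁ t | inj₂ u = ⊥-elim (∖-≢ (A b ∪ ｛ z ｝) l p u)
      card : ∀ {X j i} → s ≤ ∣ X ∣ → s - 1# ≤ ∣ grow X j i ∣
      card {X} {j} {i} t = ≤-trans (+-monoʳ (- 1#) (≤-trans t (card-mono {X} (∪-introˡ {X})))) (card-∖-≥ (X ∪ ｛ j ｝) i)
      d≥ : ∀ {X j i} → s ≤ ∣ X ∣ → s - ι 2 ≤ ∣ grow X j i ∣ - 1#
      d≥ {X} {j} {i} t = by (s ∷ ∣ grow X j i ∣ ∷ []) (v 0 :- # 2) (v 1 :- # 1) (v 1 :- (v 0 :- # 1)) ⟪ card {X} {j} {i} t ⟫ refl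
      r : ∀ {X j i} → s ≤ ∣ X ∣ → ι 7 < ∣ grow X j i ∣
      r {X} {j} {i} t q = s-big (by (s ∷ []) (v 0) (# 9) (# 7 :- (v 0 :- # 1) :+ # 1) (⟪ ≤-trans (card {X} {j} {i} t) q ⟫ ⊹ 0≤1) refl)
      rY : ι 3 < ∣ Y ∣
      rY q = r {A b} {z} {l} (sizeA b) (≤-trans (card-mono {grow (A b) z l} λ m p → ∖-⊆ Y l m (s₁ m p)) (≤-trans q (ι-mono {3} {7} (ℕ.s≤s (ℕ.s≤s (ℕ.s≤s ℕ.z≤n))))))
      Pq : Proj (e (Y ∖ z ∖ l) ⋆ Q Y)
      Pq = proj-⋆ (proj-e _) (proj-Q rY) (≈-sym (comm {Y} (Supp-e λ i p → ∖-⊆ Y z i (∖-⊆ (Y ∖ z) l i p)) (Cl-Q Y)))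

    large : ∀ (b : Block s) → ι 5 < ∣ U b ∣
    large b q = s-big (≤-trans (≤-trans (sizeA b) (card-mono {A b} (∪-introˡ {A b}))) (≤-trans q (ι-mono {5} {9} (ℕ.s≤s (ℕ.s≤s (ℕ.s≤s (ℕ.s≤s (ℕ.s≤s ℕ.z≤n))))))))

    -- A telescope over the points outside the block: by `chain-step` every difference is a
    -- nonnegative combination of the operators of `pair-𝔅`. However many terms there are, the
    -- constant c stays the same, since `𝔅` compares each with its own quadratic form.
    chain-𝔅 : ∀ (b : Block s) → 𝔅 (Π (U b) ⊖ Π full)
    chain-𝔅 b = shrink {U b} (λ Z → 𝔅 (Π Z ⊖ Π full)) (λ p → 𝔅-cong (⊖-cong (Π-cong p) ≈-refl)) step full (λ _ _ → refl) (𝔅-cong (mk λ g → sym (-‿inverseʳ _)) 𝔅-𝟘)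
      where
      step : ∀ Z z → U b ⊆ Z → Z z ≡ true → U b z ≡ false → 𝔅 (Π Z ⊖ Π full) → 𝔅 (Π (Z ∖ z) ⊖ Π full)
      step Z z s Zz _ p = 𝔅-cong (mk λ g → solve (Π (Z ∖ z) g ∷ Π Z g ∷ Π full g ∷ []) (v 0 :- v 1 :+ (v 1 :- v 2)) (v 0 :- v 2) refl)
        (𝔅-⊕ (𝔅-cong (≈-sym (chain-step Zz r4)) (𝔅-· (cZ (Z ∖ z)) cZ-nn (𝔅-Σ (Z ∖ z) (λ l → e (Z ∖ z ∖ l) ⋆ Q Z) λ l q →
          pair-𝔅 b s Zz (∖-⊆ Z z l q) (λ t → ∖-≢ Z z q (sym t))))) p)
        where
        r5 : ι 5 < ∣ Z ∣
        r5 = <-≤-trans (large b) (card-mono {U b} s)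
        r4 : ι 4 < ∣ Z ∣
        r4 = ≤-<-trans (ι-mono {4} {5} (ℕ.n≤1+n 4)) r5
        r3 : ι 3 < ∣ Z ∖ z ∣
        r3 q = r4 (by (∣ Z ∣ ∷ []) (v 0) (# 4) (# 3 :- (v 0 :- # 1)) ⟪ ≡-≤ (sym (card-∖ {Z} Zz)) q ⟫ refl)
        cZ-nn : 0# ≤ cZ (Z ∖ z)
        cZ-nn = <⇒≤ (d-1-pos {Z ∖ z} r3) ⊛ inv-nn (card-pos {Z ∖ z} {3} r3)

-- Three-cycles and double transpositions

module ThreeCycles {n : ℕ} (𝔾 : PermGroup n) where
  open PermGroup 𝔾

  record Cycle (x y z : Fin n) : Set where
    field
      x≢y  : x ≢ y
      y≢z  : y ≢ z
      x≢z  : x ≢ z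
      c    : G
      cx   : c ▹ x ≡ y
      cy   : c ▹ y ≡ z
      cz   : c ▹ z ≡ x
      cfix : ∀ i → i ≢ x → i ≢ y → i ≢ z → c ▹ i ≡ i

  cycle : ∀ {x y z} → x ≢ y → y ≢ z → x ≢ z → Cycle x y z
  cycle p q r with three p q r
  ... | c , a , b , d , f = record { x≢y = p ; y≢z = q ; x≢z = r ; c = c ; cx = a ; cy = b ; cz = d ; cfix = f }

  back : ∀ g {i j} → g ▹ i ≡ j → g ⁻¹ ▹ j ≡ i
  back g p = trans (cong (g ⁻¹ ▹_) (sym p)) (▹-⁻¹ g _)

  reverse : ∀ {x y z} → Cycle x y z → Cycle y x z
  reverse C = record { x≢y = λ p → x≢y (sym p) ; y≢z = x≢z ; x≢z = y≢z ; c = c ⁻¹ ; cx = back c cx ; cy = back c cz ; cz = back c cy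
                     ; cfix = λ i p q r → back c (cfix i q p r) }
    where
    open Cycle C

  record DoubleSwap (x y u v : Fin n) : Set where
    field
      t    : G
      tx   : t ▹ x ≡ y
      ty   : t ▹ y ≡ x
      tu   : t ▹ u ≡ v
      tv   : t ▹ v ≡ u
      tfix : ∀ i → i ≢ x → i ≢ y → i ≢ u → i ≢ v → t ▹ i ≡ i

  -- (x y)(u v) = (x y u)(y u v).
  doubleSwap : ∀ {x y u v} → x ≢ y → x ≢ u → x ≢ v → y ≢ u → y ≢ v → u ≢ v → DoubleSwap x y u v
  doubleSwap {x} {y} {u} {v} xy xu xv yu yv uv = record
    { t  = a ∙ b
    ; tx = trans (▹-∙ a b x) (trans (cong (a ▹_) (B.cfix x xy xu xv)) A.cx)
    ; ty = trans (▹-∙ a b y) (trans (cong (a ▹_) B.cx) A.cz)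
    ; tu = trans (▹-∙ a b u) (trans (cong (a ▹_) B.cy) (A.cfix v (λ p → xv (sym p)) (λ p → yv (sym p)) (λ p → uv (sym p))))
    ; tv = trans (▹-∙ a b v) (trans (cong (a ▹_) B.cz) A.cy)
    ; tfix = λ i p q r s → trans (▹-∙ a b i) (trans (cong (a ▹_) (B.cfix i q r s)) (A.cfix i p q r)) }
    where
    module A = Cycle (cycle {x} {y} {u} xy yu xu)
    module B = Cycle (cycle {y} {u} {v} yu uv yv)
    a = A.c
    b = B.c

  module _ {x y z : Fin n} (C : Cycle x y z) where
    open Cycle C

    private
      moved : ∀ g → (∀ i → i ≢ x → i ≢ y → i ≢ z → g ▹ i ≡ i) → g ▹ x ≡ x → g ≡ ε
      moved g f gx = faithful λ i → trans (everywhere i) (sym (▹-ε i))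
        where
        f′ : ∀ i → i ≢ y → i ≢ z → g ▹ i ≡ i
        f′ i p q with i Fin.≟ x
        ... | yes refl = gx
        ... | no  r    = f i r p q
        everywhere : ∀ i → g ▹ i ≡ i
        everywhere i with i Fin.≟ y | i Fin.≟ z
        ... | no p     | no q     = f′ i p q
        ... | yes refl | _        = noSwap g y z f′
        ... | no p     | yes refl = noSwap g z y λ j a b → f′ j b a

    -- The image of x decides: after multiplication by a power of c the point x is fixed, and
    -- `noSwap` leaves only the identity.
    classify : ∀ g → (∀ i → i ≢ x → i ≢ y → i ≢ z → g ▹ i ≡ i) → g ≡ ε ⊎ g ≡ c ⊎ g ≡ c ⁻¹
    classify g f with g ▹ x Fin.≟ x | g ▹ x Fin.≟ y | g ▹ x Fin.≟ z
    ... | yes p | _     | _     = inj₁ (moved g f p)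
    ... | no _  | yes p | _     = inj₂ (inj₁ (trans (sym (cancelˡ′ c g)) (trans (cong (c ∙_) (moved (c ⁻¹ ∙ g)
          (λ i a b d → trans (▹-∙ _ _ i) (trans (cong (c ⁻¹ ▹_) (f i a b d)) (back c (cfix i a b d)))) (trans (▹-∙ _ _ x) (trans (cong (c ⁻¹ ▹_) p) (back c cx))))) (idʳ c))))
    ... | no _  | no _  | yes p = inj₂ (inj₂ (trans (sym (cancelˡ c g)) (trans (cong (c ⁻¹ ∙_) (moved (c ∙ g)
          (λ i a b d → trans (▹-∙ _ _ i) (trans (cong (c ▹_) (f i a b d)) (cfix i a b d))) (trans (▹-∙ _ _ x) (trans (cong (c ▹_) p) cz)))) (idʳ (c ⁻¹)))))
    ... | no p  | no q  | no r  = ⊥-elim (p (▹-inj g (f (g ▹ x) p q r)))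

  -- Here t inverts c, so c t c⁻¹ = c² t, and c² = c⁻¹.
  conjugate : ∀ {x y z u v} (C : Cycle x y z) (D : DoubleSwap x y u v) → z ≢ u → z ≢ v → x ≢ u → x ≢ v → y ≢ u → y ≢ v →
    Cycle.c C ∙ DoubleSwap.t D ∙ Cycle.c C ⁻¹ ≡ Cycle.c C ⁻¹ ∙ DoubleSwap.t D
  conjugate {x} {y} {z} {u} {v} C D zu zv xu xv yu yv = faithful λ i → trans (trans (▹-∙ (c ∙ t) (c ⁻¹) i) (▹-∙ c t _)) (trans (point i) (sym (▹-∙ (c ⁻¹) t i)))
    where
    open Cycle C
    open DoubleSwap D
    chain : ∀ {i j k l m} → c ⁻¹ ▹ i ≡ j → t ▹ j ≡ k → c ▹ k ≡ l → t ▹ i ≡ m → c ⁻¹ ▹ m ≡ l → c ▹ (t ▹ (c ⁻¹ ▹ i)) ≡ c ⁻¹ ▹ (t ▹ i)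
    chain refl refl refl refl p = sym p
    point : ∀ i → c ▹ (t ▹ (c ⁻¹ ▹ i)) ≡ c ⁻¹ ▹ (t ▹ i)
    point i with i Fin.≟ x | i Fin.≟ y | i Fin.≟ z | i Fin.≟ u | i Fin.≟ v
    ... | yes refl | _ | _ | _ | _ = chain (back c cz) (tfix z (λ p → x≢z (sym p)) (λ p → y≢z (sym p)) zu zv) cz tx (back c cx)
    ... | no _ | yes refl | _ | _ | _ = chain (back c cx) tx cy ty (back c cz)
    ... | no _ | no _ | yes refl | _ | _ = chain (back c cy) ty cx (tfix z (λ p → x≢z (sym p)) (λ p → y≢z (sym p)) zu zv) (back c cy)
    ... | no p | no q | no r | yes refl | _ = chain (back c (cfix u p q r)) tu (cfix v (λ a → xv (sym a)) (λ a → yv (sym a)) (λ a → zv (sym a))) tu (back c (cfix v (λ a → xv (sym a)) (λ a → yv (sym a)) (λ a → zv (sym a))))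
    ... | no p | no q | no r | no _ | yes refl = chain (back c (cfix v p q r)) tv (cfix u (λ a → xu (sym a)) (λ a → yu (sym a)) (λ a → zu (sym a))) tv (back c (cfix u (λ a → xu (sym a)) (λ a → yu (sym a)) (λ a → zu (sym a))))
    ... | no p | no q | no r | no s | no w = chain (back c (cfix i p q r)) (tfix i p q s w) (cfix i p q r) (tfix i p q s w) (back c (cfix i p q r))

  involution : ∀ {x y u v} (D : DoubleSwap x y u v) → let open DoubleSwap D in t ∙ t ≡ ε
  involution {x} {y} {u} {v} D = faithful λ i → trans (▹-∙ t t i) (trans (point i) (sym (▹-ε i)))
    where
    open DoubleSwap D
    point : ∀ i → t ▹ (t ▹ i) ≡ i
    point i with i Fin.≟ x | i Fin.≟ y | i Fin.≟ u | i Fin.≟ v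
    ... | yes refl | _ | _ | _ = trans (cong (t ▹_) tx) ty
    ... | no _ | yes refl | _ | _ = trans (cong (t ▹_) ty) tx
    ... | no _ | no _ | yes refl | _ = trans (cong (t ▹_) tu) tv
    ... | no _ | no _ | no _ | yes refl = trans (cong (t ▹_) tv) tu
    ... | no p | no q | no r | no s = trans (cong (t ▹_) (tfix i p q r s)) (tfix i p q r s)

  swapped : ∀ {x y u v} → DoubleSwap x y u v → DoubleSwap y x u v
  swapped D = record { t = t ; tx = ty ; ty = tx ; tu = tu ; tv = tv ; tfix = λ i p q → tfix i q p }
    where
    open DoubleSwap D

-- Halving the trace block by block

module Detected (𝔽 : OrderedField) {n : ℕ} (𝔾 : PermGroup n) (y₀ : GroupAlgebra.Alg 𝔽 𝔾)
  (c : OrderedField.F 𝔽) (c-nn : OrderedField._≤_ 𝔽 (OrderedField.0# 𝔽) c) where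
  open Sums 𝔽
  open Arithmetic 𝔽
  open PermGroup 𝔾
  open GroupAlgebra 𝔽 𝔾
  open Averages 𝔽 𝔾
  open Projections 𝔽 𝔾
  open Traces 𝔽 𝔾 y₀
  open Bounded c c-nn
  open SecondLevel 𝔽 𝔾 y₀ c c-nn
  open ThreeCycles 𝔾
  open Equality (fins n)

  -- Permutations with disjoint supports commute, so conjugation by A_W is trivial on A_U and
  -- preserves its complement.
  Supp-Cl : ∀ {U W x} → Supp U x → Disjoint W U → Cl W x
  Supp-Cl {U} {W} {x} s d κ f h with fix? U h
  ... | yes q = cong x (trans (assoc _ _ _) (trans (cong (κ ⁻¹ ∙_) (faithful λ i → trans (▹-∙ h κ i) (trans (point i) (sym (▹-∙ κ h i))))) (cancelˡ κ h)))
    where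
    point : ∀ i → h ▹ (κ ▹ i) ≡ κ ▹ (h ▹ i)
    point i with bool (W i)
    ... | inj₁ r = trans (q (κ ▹ i) (d _ (trans (fix-stable {W} f i) r))) (cong (κ ▹_) (sym (q i (d i r))))
    ... | inj₂ r = trans (cong (h ▹_) (f i r)) (sym (f (h ▹ i) (out i r (bool (U i)))))
      where
      out : ∀ i → W i ≡ false → U i ≡ true ⊎ U i ≡ false → W (h ▹ i) ≡ false
      out i r (inj₁ u) = disj-sym {W} d (h ▹ i) (trans (fix-stable {U} q i) u)
      out i r (inj₂ u) = trans (cong W (q i u)) r
  ... | no q = trans (s _ λ r → q (subst (Fix U) (trans (cong (λ z → κ ∙ z ∙ κ ⁻¹) refl) (undo h)) (conj r))) (sym (s h q))
    where
    undo : ∀ h → κ ∙ (κ ⁻¹ ∙ h ∙ κ) ∙ κ ⁻¹ ≡ h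
    undo h = trans (cong (_∙ κ ⁻¹) (trans (sym (assoc _ _ _)) (cong (_∙ κ) (cancelˡ′ κ h)))) (cancelʳ κ h)
    conj : ∀ {g} → Fix U g → Fix U (κ ∙ g ∙ κ ⁻¹)
    conj {g} r i u = trans (trans (▹-∙ (κ ∙ g) (κ ⁻¹) i) (▹-∙ κ g _)) (trans (cong (κ ▹_) (r (κ ⁻¹ ▹ i)
      (trans (stab-disj {W} {U} d (fix-⁻¹ {W} f) i) u))) (▹-⁻¹ʳ κ i))

  -- `H` stands for the remaining induction in `detected`: it accepts any piece of p that is cut out
  -- inside A_U and has at most half the trace.
  module _ {U : Points} {p : Alg} (P : Proj p) (ClU : Cl U p) {B : Alg}
    (H : ∀ x → Proj (p ⋆ x) → Supp U x → ι 2 * τ (p ⋆ x) ≤ τ p → 𝔅 (B † ⋆ ((p ⋆ x) ⋆ B))) where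

    private
      goal : Points → Set
      goal Z = 𝔅 (B † ⋆ ((p ⋆ (𝟙 ⊖ e Z)) ⋆ B))

      goal-⊕ : ∀ {x x′ x″} → x ≈ x′ ⊕ x″ → 𝔅 (B † ⋆ ((p ⋆ x′) ⋆ B)) → 𝔅 (B † ⋆ ((p ⋆ x″) ⋆ B)) → 𝔅 (B † ⋆ ((p ⋆ x) ⋆ B))
      goal-⊕ {x} {x′} {x″} q a b = 𝔅-cong (≈-trans (≈-sym (⋆-⊕ʳ (B †) _ _)) (⋆-congʳ {B †} (≈-trans (≈-sym (⋆-⊕ˡ _ _ B)) (⋆-congˡ (≈-trans (≈-sym (⋆-⊕ʳ p x′ x″)) (⋆-congʳ {p} (≈-sym q))))))) (𝔅-⊕ a b)

    -- 1 - e_U is 1 - e_W plus the sum of `E Z z` along a chain of sets from U down to W. Every Z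
    -- that is left on the way has more than three points, so `τ-half` applies to each summand.
    descend : ∀ {W} → W ⊆ U → ι 3 ≤ ∣ W ∣ → goal W → goal U
    descend {W} s r g = proj₂ (shrink {W} (λ Z → Z ⊆ U × (goal Z → goal U)) ext step U s ((λ _ q → q) , λ q → q)) g
      where
      ext : ∀ {Z Z′} → (∀ i → Z i ≡ Z′ i) → Z ⊆ U × (goal Z → goal U) → Z′ ⊆ U × (goal Z′ → goal U)
      ext q (a , b) = (λ i t → a i (trans (q i) t)) , λ t → b (𝔅-cong (⋆-congʳ {B †} (⋆-congˡ (⋆-congʳ {p} (⊖-cong (≈-refl {𝟙}) (e-cong λ i → sym (q i)))))) t)
      step : ∀ Z z → W ⊆ Z → Z z ≡ true → W z ≡ false → Z ⊆ U × (goal Z → goal U) → Z ∖ z ⊆ U × (goal (Z ∖ z) → goal U)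
      step Z z sub Zz Wz (a , b) = (λ i t → a i (∖-⊆ Z z i t)) , λ t → b (goal-⊕ {𝟙 ⊖ e Z} (mk λ g → solve (𝟙 g ∷ e (Z ∖ z) g ∷ e Z g ∷ []) (v 0 :- v 2) (v 0 :- v 1 :+ (v 1 :- v 2)) refl) t
          (H (E Z z) (proj-⋆ P (proj-E Z z) (comm {Z} (Supp-E {Z} ⊆-refl) ClZ)) (Supp-E {Z} a) (τ-half P ClZ Zz big)))
        where
        ClZ : Cl Z p
        ClZ = Cl-mono {Z} {U} {p} a ClU
        big : ι 3 < ∣ Z ∣
        big q = ι-mono-< {3} {4} (ℕ.≤-refl) (by (∣ Z ∣ ∷ ∣ W ∣ ∷ ∣ Z ∖ z ∣ ∷ []) (# 4) (# 3) (v 1 :- # 3 :+ (v 2 :- v 1) :+ (v 0 :- # 1 :- v 2) :+ (# 3 :- v 0))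
          (⟪ r ⟫ ⊹ ⟪ card-mono {W} (λ i t → ∖-in {Z} (sub i t) λ { refl → true≢false t Wz }) ⟫ ⊹ ⟪ ≤-reflexive (card-∖ {Z} Zz) ⟫ ⊹ ⟪ q ⟫) refl)

    -- On three points the group is cyclic; its complement 1 − e is halved by the eigenprojections of t.
    module Bottom {x y z u w : Fin n} (C : Cycle x y z) (D : DoubleSwap x y u w) (z≢u : z ≢ u) (z≢v : z ≢ w) (x≢u : x ≢ u) (x≢v : x ≢ w) (y≢u : y ≢ u) (y≢v : y ≢ w)
      (xU : U x ≡ true) (yU : U y ≡ true) (zU : U z ≡ true) (uU : U u ≡ true) (vU : U w ≡ true) where
      open Cycle C using (x≢y; y≢z; x≢z; cfix) renaming (c to κ₀)
      open DoubleSwap D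

      W₀ : Points
      W₀ = ｛ x ｝ ∪ ｛ y ｝ ∪ ｛ z ｝

      private
        -- An ordered field has no primitive cube root of unity, so f cannot be split by elements of
        -- A_{W₀} alone. The element t from outside helps: `g` squares to f and f acts on it as the
        -- identity, so (f ± g)/2 are projections.
        f g : Alg
        f = 𝟙 ⊖ e W₀
        g = L t f

        W₀-x : W₀ x ≡ true
        W₀-x = cong (λ b → (b ∨ (x == y)) ∨ (x == z)) (==-refl x)
        W₀-y : W₀ y ≡ true
        W₀-y = trans (cong (λ b → ((y == x) ∨ b) ∨ (y == z)) (==-refl y)) (cong (_∨ (y == z)) (Bool.∨-zeroʳ (y == x)))
        W₀-z : W₀ z ≡ true
        W₀-z = trans (cong (λ b → ((z == x) ∨ (z == y)) ∨ b) (==-refl z)) (Bool.∨-zeroʳ _)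
        W₀-elim : ∀ i → W₀ i ≡ true → i ≡ x ⊎ i ≡ y ⊎ i ≡ z
        W₀-elim i q with ∪-elim {｛ x ｝ ∪ ｛ y ｝} {｛ z ｝} {i} q
        ... | inj₂ r = inj₂ (inj₂ (==⇒≡ i z r))
        ... | inj₁ r with ∪-elim {｛ x ｝} {｛ y ｝} {i} r
        ...   | inj₁ s = inj₁ (==⇒≡ i x s)
        ...   | inj₂ s = inj₂ (inj₁ (==⇒≡ i y s))
        W₀-out : ∀ i → i ≢ x → i ≢ y → i ≢ z → W₀ i ≡ false
        W₀-out i a b d = cong₂ _∨_ (cong₂ _∨_ (≢⇒== a) (≢⇒== b)) (≢⇒== d)

      W₀⊆U : W₀ ⊆ U
      W₀⊆U i q with W₀-elim i q
      ... | inj₁ refl        = xU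
      ... | inj₂ (inj₁ refl) = yU
      ... | inj₂ (inj₂ refl) = zU

      W₀-card : ι 3 ≤ ∣ W₀ ∣
      W₀-card = by (∣ W₀ ∣ ∷ ∣ W₀ ∖ x ∣ ∷ ∣ W₀ ∖ x ∖ y ∣ ∷ ∣ W₀ ∖ x ∖ y ∖ z ∣ ∷ []) (# 3) (v 0) (v 3 :+ (v 0 :- # 1 :- v 1) :+ (v 1 :- # 1 :- v 2) :+ (v 2 :- # 1 :- v 3))
        (∑-nn Fs (λ i → []-nn _) ⊹ ⟪ ≤-reflexive (card-∖ {W₀} W₀-x) ⟫ ⊹ ⟪ ≤-reflexive (card-∖ {W₀ ∖ x} (∖-in {W₀} W₀-y λ q → x≢y (sym q))) ⟫
          ⊹ ⟪ ≤-reflexive (card-∖ {W₀ ∖ x ∖ y} (∖-in {W₀ ∖ x} (∖-in {W₀} W₀-z λ q → x≢z (sym q)) λ q → y≢z (sym q))) ⟫) refl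

      private
        fix-t : Fix U t
        fix-t i q = tfix i (out xU) (out yU) (out uU) (out vU)
          where
          out : ∀ {j} → U j ≡ true → i ≢ j
          out r refl = true≢false r q

        t⁻¹ : t ⁻¹ ≡ t
        t⁻¹ = sym (inv-unique (involution D))

        t-W₀ : ∀ i → W₀ (t ▹ i) ≡ W₀ i
        t-W₀ i with i Fin.≟ x | i Fin.≟ y | i Fin.≟ u | i Fin.≟ w
        ... | yes refl | _ | _ | _ = trans (cong W₀ tx) (trans W₀-y (sym W₀-x))
        ... | no _ | yes refl | _ | _ = trans (cong W₀ ty) (trans W₀-x (sym W₀-y))
        ... | no _ | no _ | yes refl | _ = trans (cong W₀ tu) (trans (W₀-out w (λ q → x≢v (sym q)) (λ q → y≢v (sym q)) (λ q → z≢v (sym q))) (sym (W₀-out u (λ q → x≢u (sym q)) (λ q → y≢u (sym q)) (λ q → z≢u (sym q)))))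
        ... | no _ | no _ | no _ | yes refl = trans (cong W₀ tv) (trans (W₀-out u (λ q → x≢u (sym q)) (λ q → y≢u (sym q)) (λ q → z≢u (sym q))) (sym (W₀-out w (λ q → x≢v (sym q)) (λ q → y≢v (sym q)) (λ q → z≢v (sym q)))))
        ... | no a | no b | no d | no k = cong W₀ (tfix i a b d k)

        Pf : Proj f
        Pf = proj-⊖ (proj-e ∅) (proj-e W₀) (𝟙-⋆ _) (⋆-𝟙 _)

        f-t : ∀ h → f (t ⁻¹ ∙ h ∙ t) ≡ f h
        f-t h = cong₂ _-_ (e-conj t {∅} {∅} (λ _ → refl) h) (e-conj t {W₀} {W₀} t-W₀ h)

        opaque
          unfolding _⋆_

          L-⋆ : ∀ s a b → L s a ⋆ b ≈ L s (a ⋆ b)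
          L-⋆ s a b = mk λ k → trans (sym (shiftˡ s _)) (∑-cong Gs λ h → cong₂ (λ p q → a p * b q) (cancelˡ s h) (trans (cong (_∙ k) (⁻¹-∙ s h)) (assoc _ _ _)))

        g-† : g † ≈ g
        g-† = mk λ h → trans (cong f (sym (⁻¹-∙ h t))) (trans (at (self Pf) (h ∙ t)) (trans (cong f (cong (_∙ t) (sym (cancelˡ t h))))
          (trans (f-t (t ∙ h)) (cong (λ s → f (s ∙ h)) (sym t⁻¹)))))

        g-f : g ⋆ f ≈ g
        g-f = ≈-trans (L-⋆ t f f) (mk λ h → at (idem Pf) (t ⁻¹ ∙ h))

        f-g : f ⋆ g ≈ g
        f-g = †-swap g-† (self Pf) g-† g-f

        g-g : g ⋆ g ≈ f
        g-g = ≈-trans (L-⋆ t f g) (mk λ h → trans (at f-g (t ⁻¹ ∙ h)) (cong f (trans (cong (λ s → t ⁻¹ ∙ (s ∙ h)) t⁻¹) (cancelˡ t h))))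

        half : F
        half = recip (ι 2)

        half-2 : half * ι 2 ≡ 1#
        half-2 = trans (*-comm _ _) (*-inv⁺ (ι-pos 1))

        eig : F → Alg
        eig s = half • (f ⊕ s • g)

        eig-proj : ∀ {s} → s * s ≡ 1# → Proj (eig s)
        eig-proj {s} ss = proj
          (≈-trans (⋆-·ˡ half _ _) (≈-trans (·-cong (≈-trans (⋆-·ʳ half _ _) (·-cong (≈-trans (⋆-⊕ˡ f _ _) (⊕-cong
              (≈-trans (⋆-⊕ʳ f _ _) (⊕-cong (idem Pf) (≈-trans (⋆-·ʳ s f g) (·-cong f-g))))
              (≈-trans (⋆-·ˡ s g _) (·-cong (≈-trans (⋆-⊕ʳ g _ _) (⊕-cong g-f (≈-trans (⋆-·ʳ s g g) (·-cong g-g)))))))))))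
            (mk λ h → trans (solve (half ∷ f h ∷ g h ∷ s ∷ []) (v 0 :* (v 0 :* (v 1 :+ v 3 :* v 2 :+ v 3 :* (v 2 :+ v 3 :* v 1)))) (v 0 :* (v 0 :* (# 2 :* v 3 :* v 2 :+ (# 1 :+ v 3 :* v 3) :* v 1))) refl)
              (trans (cong (λ q → half * (half * (ι 2 * s * g h + (1# + q) * f h))) ss) (trans (solve (half ∷ f h ∷ g h ∷ s ∷ []) (v 0 :* (v 0 :* (# 2 :* v 3 :* v 2 :+ (# 1 :+ # 1) :* v 1))) (v 0 :* # 2 :* (v 0 :* (v 1 :+ v 3 :* v 2))) refl)
                (*1ˡ half-2))))))
          (·-cong (⊕-cong (self Pf) (·-cong g-†)))

        Supp-f : Supp U f
        Supp-f = Supp-⊖ {U} {𝟙} {e W₀} (Supp-e {∅} λ i ()) (Supp-e {W₀} W₀⊆U)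

        Supp-eig : ∀ s → Supp U (eig s)
        Supp-eig s h q = *0ʳ (trans (cong₂ _+_ (Supp-f h q) (*0ʳ (Supp-f (t ⁻¹ ∙ h) λ r → q (subst (Fix U) (cancelˡ′ t h) (fix-∙ {U} fix-t r))))) (+-identityʳ _))

        P′ : Alg
        P′ = f ⋆ p

        T : G → F
        T s = ∑ Gs λ k → P′ k * γ (s ∙ k)

        ClP′ : Cl W₀ P′
        ClP′ = Cl-⋆ {W₀} {f} {p} (Cl-⊖ {W₀} {𝟙} {e W₀} (Cl-𝟙 W₀) (Cl-e-⊆ {W₀} {W₀} ⊆-refl)) (Cl-mono {W₀} {U} {p} W₀⊆U ClU)

        T-conj : ∀ {κ} → Fix W₀ κ → ∀ s → T s ≡ T (κ ∙ s ∙ κ ⁻¹)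
        T-conj {κ} r s = trans (sym (conjG κ _)) (∑-cong Gs λ k → cong₂ _*_ (ClP′ κ r k)
          (trans (cong γ (sym (assoc s (κ ⁻¹ ∙ k) κ))) (trans (γ-class _ κ) (cong γ (trans (cong (κ ∙_) (sym (assoc s _ k))) (trans (sym (assoc κ _ k)) (cong (_∙ k) (sym (assoc κ s _)))))))))

        T-κ : ∀ κ → Fix W₀ κ → T t ≡ T (κ ∙ t)
        T-κ κ r with classify C κ (λ i a b d → r i (W₀-out i a b d))
        ... | inj₁ refl        = cong T (sym (idˡ t))
        ... | inj₂ (inj₁ refl) = trans (T-conj (fix-⁻¹ {W₀} r) t) (cong T (trans (conjugate (reverse C) (swapped D) z≢u z≢v y≢u y≢v x≢u x≢v) (cong (_∙ t) (⁻¹-invol κ₀))))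
        ... | inj₂ (inj₂ refl) = trans (T-conj (subst (Fix W₀) (⁻¹-invol κ₀) (fix-⁻¹ {W₀} r)) t) (cong T (conjugate C D z≢u z≢v x≢u x≢v y≢u y≢v))

        -- Averaging `T t ≡ T (κ ∙ t)` over κ in A_{W₀} places `e W₀` next to P′, and f annihilates
        -- it. Hence g has trace 0 and both eigenprojections get exactly half of the trace of f.
        T-0 : T t ≡ 0#
        T-0 = trans (sym (*1ˡ (e-sum W₀))) (trans (sym (∑-*ʳ Gs (T t) _)) (trans (∑-cong Gs λ κ → trans (e-guard W₀ κ (T-κ κ)) (sym (∑-*ˡ Gs _ _)))
          (trans (∑-swap Gs Gs _) (trans (∑-cong Gs λ k → ∑-cong Gs λ κ → trans (solve (e W₀ κ ∷ P′ k ∷ γ (κ ∙ t ∙ k) ∷ []) (v 0 :* (v 1 :* v 2)) (v 1 :* (v 0 :* v 2)) refl)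
             (cong (λ q → P′ k * (e W₀ κ * q)) (trans (cong γ (assoc κ t k)) (trans (γ-class κ _) (cong γ (assoc t k κ))))))
          (trans (sym (∑-⋆ P′ (e W₀) (λ s → γ (t ∙ s)))) (trans (∑-cong Gs λ s → *0ˡ (at vanish s)) (∑-0 Gs)))))))
          where
          vanish : P′ ⋆ e W₀ ≈ 𝟘
          vanish = ≈-trans (⋆-assoc f p (e W₀)) (≈-trans (⋆-congʳ {f} (comm {U} (Supp-e {W₀} W₀⊆U) ClU)) (≈-trans (≈-sym (⋆-assoc f (e W₀) p))
            (≈-trans (⋆-congˡ (≈-trans (⋆-⊖ˡ 𝟙 (e W₀) (e W₀)) (⊖-𝟘 (≈-trans (𝟙-⋆ _) (≈-sym (e-idem W₀)))))) (⋆-𝟘ˡ p))))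

        τ-g : τ (p ⋆ g) ≡ 0#
        τ-g = trans (τ-cyc p g) (trans (τ-cong (L-⋆ t f p)) (trans (sym (shiftˡ t _)) (trans (∑-cong Gs λ k → cong (λ s → P′ s * γ (t ∙ k)) (cancelˡ t k)) T-0)))

        τ-f : τ (p ⋆ f) ≤ τ p
        τ-f = ≡-≤ (trans (τ-cong (≈-trans (⋆-⊖ʳ p 𝟙 (e W₀)) (⊖-cong (⋆-𝟙 p) (≈-refl {p ⋆ e W₀})))) (τ-⊖ p (p ⋆ e W₀)))
          (by (τ p ∷ τ (p ⋆ e W₀) ∷ []) (v 0 :- v 1) (v 0) (v 1) (τ-nn (proj-⋆ P (proj-e W₀) (comm {U} (Supp-e {W₀} W₀⊆U) ClU))) refl)

        τ-eig : ∀ s → ι 2 * τ (p ⋆ eig s) ≤ τ p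
        τ-eig s = ≡-≤ (trans (cong (ι 2 *_) (trans (τ-cong (≈-trans (⋆-·ʳ half p _) (·-cong (≈-trans (⋆-⊕ʳ p f (s • g)) (⊕-cong (≈-refl {p ⋆ f}) (⋆-·ʳ s p g))))))
          (trans (τ-· half _) (cong (half *_) (trans (τ-⊕ (p ⋆ f) _) (cong (τ (p ⋆ f) +_) (trans (τ-· s _) (*0ʳ τ-g))))))))
          (trans (solve (half ∷ τ (p ⋆ f) ∷ []) (# 2 :* (v 0 :* (v 1 :+ # 0))) (v 0 :* # 2 :* v 1) refl) (*1ˡ half-2))) τ-f

      bottom : 𝔅 (B † ⋆ ((p ⋆ (𝟙 ⊖ e W₀)) ⋆ B))
      bottom = goal-⊕ (mk λ h → sym (trans (solve (half ∷ f h ∷ g h ∷ []) (v 0 :* (v 1 :+ # 1 :* v 2) :+ v 0 :* (v 1 :+ (:- # 1) :* v 2)) (v 0 :* # 2 :* v 1) refl) (*1ˡ half-2)))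
          (piece 1# (*-identityˡ 1#)) (piece (- 1#) (solve [] ((:- # 1) :* (:- # 1)) (# 1) refl))
        where
        piece : ∀ s → s * s ≡ 1# → 𝔅 (B † ⋆ ((p ⋆ eig s) ⋆ B))
        piece s ss = H (eig s) (proj-⋆ P (eig-proj ss) (comm {U} (Supp-eig s) ClU)) (Supp-eig s) (τ-eig s)

    -- Five points are used: three for the cycle and two more to make (x y)(u w) an even
    -- permutation.
    complement : ι 4 < ∣ U ∣ → 𝔅 (B † ⋆ ((p ⋆ (𝟙 ⊖ e U)) ⋆ B))
    complement r with pick {U} [] (≤-<-trans (ι-mono {0} {4} ℕ.z≤n) r)
    ... | x , xU , _ with pick {U} (x ∷ []) (≤-<-trans (ι-mono {1} {4} (ℕ.s≤s ℕ.z≤n)) r)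
    ... | y , yU , ny with pick {U} (x ∷ y ∷ []) (≤-<-trans (ι-mono {2} {4} (ℕ.s≤s (ℕ.s≤s ℕ.z≤n))) r)
    ... | z , zU , nz with pick {U} (x ∷ y ∷ z ∷ []) (≤-<-trans (ι-mono {3} {4} (ℕ.n≤1+n 3)) r)
    ... | u , uU , nu with pick {U} (x ∷ y ∷ z ∷ u ∷ []) r
    ... | w , wU , nw = descend Bt.W₀⊆U Bt.W₀-card Bt.bottom
      where
      module Bt = Bottom {x} {y} {z} {u} {w} (cycle (λ q → ny (here (sym q))) (λ q → nz (there (here (sym q)))) (λ q → nz (here (sym q))))
        (doubleSwap (λ q → ny (here (sym q))) (λ q → nu (here (sym q))) (λ q → nw (here (sym q))) (λ q → nu (there (here (sym q)))) (λ q → nw (there (here (sym q)))) (λ q → nw (there (there (there (here (sym q)))))))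
        (λ q → nu (there (there (here (sym q))))) (λ q → nw (there (there (here (sym q))))) (λ q → nu (here (sym q))) (λ q → nw (here (sym q))) (λ q → nu (there (here (sym q)))) (λ q → nw (there (here (sym q))))
        xU yU zU uU wU

  -- Since `e U` kills B, p may be replaced by p (1 - e_U), which `complement` cuts into pieces of
  -- at most half the trace. The pieces lie in A_U, so they still commute with the other blocks.
  -- When the list is used up, the trace is at most c and `𝔅-proj` applies.
  detected : ∀ Us → AllPairs Disjoint Us → All (λ U → ι 4 < ∣ U ∣) Us → ∀ p → Proj p → All (λ U → Cl U p) Us → τ p ≤ pow (ι 2) (length Us) * c →
    ∀ B → All (λ U → e U ⋆ B ≈ 𝟘) Us → 𝔅 (B † ⋆ (p ⋆ B))
  detected [] _ _ p P _ t B _ = 𝔅-† B (𝔅-proj P (≤-≡ t (*-identityˡ c)))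
  detected (U ∷ Us) (d ∷ ds) (r ∷ rs) p P (cl ∷ cls) t B (k ∷ ks) =
    𝔅-cong (⋆-congʳ {B †} (≈-trans (⋆-assoc p _ B) (⋆-congʳ {p} (≈-trans (⋆-⊖ˡ 𝟙 (e U) B) (≈-trans (⊖-cong (𝟙-⋆ B) k) (mk λ g → solve (B g ∷ []) (v 0 :- # 0) (v 0) refl))))))
      (complement P cl H r)
    where
    H : ∀ x → Proj (p ⋆ x) → Supp U x → ι 2 * τ (p ⋆ x) ≤ τ p → 𝔅 (B † ⋆ ((p ⋆ x) ⋆ B))
    H x Px s h = detected Us ds rs (p ⋆ x) Px (All.zipWith (λ { {V} (a , b) → Cl-⋆ {V} {p} {x} a (Supp-Cl {U} {V} {x} s (disj-sym {U} b)) }) (cls , d))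
      (*-cancelˡ (ι-pos 1) (≤-trans h (≤-≡ t (*-assoc _ _ _)))) B ks

  module _ {s : F} (s-big : ι 9 < s) (c-large : ι 3 * τ 𝟙 ≤ c * ((s - ι 2) * (s - ι 2))) where
    open Chains s-big c-large
    open Block

    private
      Far : Block s → Block s → Set
      Far b b′ = Disjoint (U b) (U b′)

      -- B†B splits into B†(Π_V - Π_full)B, which is covered by `chain-𝔅`, and (Q_V B)†(Q_V B). The
      -- new factor Q_V B is killed by `e V`, and still by the averages over earlier blocks because
      -- these commute with Q_V.
      go : ∀ todo done → AllPairs Far todo → AllPairs Disjoint done → All (λ V → ι 4 < ∣ V ∣) done → All (λ b → All (Disjoint (U b)) done) todo →
        ∀ B → Q full ⋆ B ≈ B → All (λ V → e V ⋆ B ≈ 𝟘) done → τ 𝟙 ≤ pow (ι 2) (length todo ℕ.+ length done) * c → 𝔅 (B † ⋆ B)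
      go [] done _ dd bd _ B _ ks t = 𝔅-cong (⋆-congʳ {B †} (𝟙-⋆ B)) (detected done dd bd 𝟙 (proj-e ∅) (All.tabulate λ {V} _ → Cl-𝟙 V) t B ks)
      go (b ∷ todo) done (f ∷ fs) dd bd (x ∷ xs) B qB ks t = 𝔅-cong split (𝔅-⊕ (𝔅-† B (chain-𝔅 b))
          (go todo (V ∷ done) fs (x ∷ dd) (≤-<-trans (ι-mono {4} {5} (ℕ.n≤1+n 4)) (large b) ∷ bd) (All.zipWith (λ { {b′} (p , q) → disj-sym {V} p ∷ q }) (f , xs)) (Q V ⋆ B) Q-QB
            (kill ∷ All.zipWith (λ { {V′} (p , q) → kill′ {V′} p q }) (x , ks)) (subst (λ m → τ 𝟙 ≤ pow (ι 2) m * c) (sym (ℕ.+-suc (length todo) (length done))) t)))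
        where
        V = U b
        rV : ι 3 < ∣ V ∣
        rV = ≤-<-trans (ι-mono {3} {5} (ℕ.s≤s (ℕ.s≤s (ℕ.s≤s ℕ.z≤n)))) (large b)
        every : ∀ {z} → Supp full z
        every h q = ⊥-elim (q λ i ())
        Q-QB : Q full ⋆ (Q V ⋆ B) ≈ Q V ⋆ B
        Q-QB = ≈-trans (≈-sym (⋆-assoc (Q full) (Q V) B)) (≈-trans (⋆-congˡ (comm {full} every (Cl-Q full))) (≈-trans (⋆-assoc (Q V) (Q full) B) (⋆-congʳ {Q V} qB)))
        kill : e V ⋆ (Q V ⋆ B) ≈ 𝟘
        kill = ≈-trans (≈-sym (⋆-assoc (e V) (Q V) B)) (≈-trans (⋆-congˡ (eY-Q V)) (⋆-𝟘ˡ B))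
        kill′ : ∀ {V′} → Disjoint V V′ → e V′ ⋆ B ≈ 𝟘 → e V′ ⋆ (Q V ⋆ B) ≈ 𝟘
        kill′ {V′} d k = ≈-trans (≈-sym (⋆-assoc (e V′) (Q V) B)) (≈-trans (⋆-congˡ (≈-sym (comm {V′} (Supp-e {V′} ⊆-refl) (Cl-Q-disj {V′} {V} (disj-sym {V} d)))))
          (≈-trans (⋆-assoc (Q V) (e V′) B) (≈-trans (⋆-congʳ {Q V} k) (⋆-𝟘ʳ (Q V)))))
        ΠfullB : Π full ⋆ B ≈ 𝟘
        ΠfullB = mk λ g → trans (solve (B g ∷ (Π full ⋆ B) g ∷ []) (v 1) (v 0 :- (v 0 :- v 1)) refl) (trans (cong (λ z → B g - z)
          (trans (cong (_- (Π full ⋆ B) g) (sym (at (𝟙-⋆ B) g))) (trans (sym (at (⋆-⊖ˡ 𝟙 (Π full) B) g)) (at qB g)))) (-‿inverseʳ (B g)))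
        split : B † ⋆ ((Π V ⊖ Π full) ⋆ B) ⊕ (Q V ⋆ B) † ⋆ (Q V ⋆ B) ≈ B † ⋆ B
        split = ≈-trans (⊕-cong (⋆-congʳ {B †} (≈-trans (⋆-⊖ˡ (Π V) (Π full) B) (≈-trans (⊖-cong ≈-refl ΠfullB) (mk λ g → solve ((Π V ⋆ B) g ∷ []) (v 0 :- # 0) (v 0) refl))))
            (≈-trans (⋆-congˡ (≈-trans (⋆-† (Q V) B) (⋆-congʳ {B †} (Q-† V)))) (≈-trans (⋆-assoc (B †) (Q V) _) (⋆-congʳ {B †} (≈-trans (≈-sym (⋆-assoc (Q V) (Q V) B)) (⋆-congˡ (idem (proj-Q rV))))))))
          (≈-trans (≈-sym (⋆-⊕ʳ (B †) _ _)) (⋆-congʳ {B †} (≈-trans (≈-sym (⋆-⊕ˡ (Π V) (Q V) B)) (≈-trans (⋆-congˡ (mk λ g → solve (𝟙 g ∷ Π V g ∷ []) (v 1 :+ (v 0 :- v 1)) (v 0) refl)) (𝟙-⋆ B)))))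

    -- Starting from B = `Q full` guarantees `Q full ⋆ B ≈ B` throughout, hence `Π full ⋆ B ≈ 𝟘`,
    -- which makes subtracting Π_full in the splitting harmless.
    level2 : ∀ (bs : List (Block s)) → AllPairs (λ b b′ → Disjoint (U b) (U b′)) bs → ι 3 < ∣ full ∣ → τ 𝟙 ≤ pow (ι 2) (length bs) * c → 𝔅 (Q full)
    level2 bs ds r t = 𝔅-cong (≈-trans (⋆-congˡ (Q-† full)) (idem (proj-Q r)))
      (go bs [] ds [] [] (All.tabulate λ _ → []) (Q full) (idem (proj-Q r)) [] (subst (λ m → τ 𝟙 ≤ pow (ι 2) m * c) (sym (ℕ.+-identityʳ (length bs))) t))

-- Counting products through the linear part

module Densities (𝔽 : OrderedField) {n : ℕ} (𝔾 : PermGroup n) where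
  open Sums 𝔽
  open Arithmetic 𝔽
  open PermGroup 𝔾
  open GroupAlgebra 𝔽 𝔾
  open Averages 𝔽 𝔾
  open Projections 𝔽 𝔾
  open Equality (fins n)

  nF N : F
  nF = ∣ full ∣
  N = ∣A∣ full

  inA-full : ∀ g → inA full g ≡ true
  inA-full g = inA-true {full} (λ i ())

  e-full : ∀ g → e full g ≡ recip N
  e-full g = e-in {full} (λ i ())

  N-1 : ∑ Gs (λ _ → 1#) ≡ N
  N-1 = ∑-cong Gs λ g → sym ([]-true (inA-full g))

  N-pos : 0# < N
  N-pos = A-pos full

  cnt : Alg → Fin n → Fin n → F
  cnt f i j = ∑ Gs λ g → f g * [ g ▹ i == j ]

  tot : Alg → F
  tot f = ∑ Gs f

  cnt-row : ∀ f i → ∑ Fs (cnt f i) ≡ tot f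
  cnt-row f i = trans (∑-swap Fs Gs _) (∑-cong Gs λ g → trans (∑-cong Fs λ j → cong (λ b → f g * [ b ]) (==-sym (g ▹ i) j)) (∑-pointF′ (g ▹ i) (λ _ → f g)))

  ==-⁻¹ : ∀ g i j → (g ▹ i == j) ≡ (i == g ⁻¹ ▹ j)
  ==-⁻¹ g i j = ==-cong (λ p → trans (sym (▹-⁻¹ g i)) (cong (g ⁻¹ ▹_) p)) (λ p → trans (cong (g ▹_) p) (▹-⁻¹ʳ g j))

  cnt-col : ∀ f j → ∑ Fs (λ i → cnt f i j) ≡ tot f
  cnt-col f j = trans (∑-swap Fs Gs _) (∑-cong Gs λ g → trans (∑-cong Fs λ i → cong (λ b → f g * [ b ]) (==-⁻¹ g i j)) (∑-pointF′ (g ⁻¹ ▹ j) (λ _ → f g)))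

  conv : ∀ x z h → ⟨ x ⋆ z , h ⟩ ≡ ∑ Gs λ a → x a * ∑ Gs λ b → z b * h (a ∙ b)
  conv x z h = trans (Traces.∑-⋆ 𝔽 𝔾 z x z h) (∑-cong Gs λ a → ∑-*ˡ Gs (x a) _)

  -- The indices follow one point through a product: b maps i to j, a maps j to k, and ab maps i to
  -- k.
  X₃ : Alg → Alg → Alg → F
  X₃ f g h = ∑ Fs λ k → ∑ Fs λ j → cnt f j k * ∑ Fs λ i → cnt g i j * cnt h i k

  module _ (big : ι 3 < nF) where

    private
      big2 : ι 2 < nF
      big2 = ≤-<-trans (ι-mono {2} {3} (ℕ.n≤1+n 2)) big

    e-point : ∀ k f a → (e (full ∖ k) ⋆ f) a ≡ nF * recip N * cnt f (a ⁻¹ ▹ k) k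
    e-point k f a = trans (⋆-def (e (full ∖ k)) f a) (trans (sym (shiftˡ a _)) (trans (sym (flipG _)) (trans (∑-cong Gs λ ρ → trans
        (cong₂ _*_ (value (a ∙ ρ ⁻¹)) (cong f (trans (cong (_∙ a) (trans (⁻¹-∙ a (ρ ⁻¹)) (cong (_∙ a ⁻¹) (⁻¹-invol ρ)))) (cancelʳ′ a ρ))))
        (trans (cong (λ b → [ b ] * w * f ρ) (eq ρ)) (solve ([ ρ ▹ (a ⁻¹ ▹ k) == k ] ∷ w ∷ f ρ ∷ []) (v 0 :* v 1 :* v 2) (v 1 :* (v 2 :* v 0)) refl)))
      (trans (∑-*ˡ Gs w _) (cong (_* cnt f (a ⁻¹ ▹ k) k) (inv-index {full} {k} refl big2))))))
      where
      w = recip (∣A∣ (full ∖ k))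
      value : ∀ h → e (full ∖ k) h ≡ [ h ▹ k == k ] * w
      value h = trans (e-def (full ∖ k) h) (cong (λ b → [ b ] * w) (trans (inA-∖ {full} {k} {h} refl) (cong (_∧ (h ▹ k == k)) (inA-full h))))
      eq : ∀ ρ → ((a ∙ ρ ⁻¹) ▹ k == k) ≡ (ρ ▹ (a ⁻¹ ▹ k) == k)
      eq ρ = trans (cong (_== k) (▹-∙ a (ρ ⁻¹) k)) (==-cong
        (λ p → trans (cong (ρ ▹_) (trans (cong (a ⁻¹ ▹_) (sym p)) (▹-⁻¹ a _))) (▹-⁻¹ʳ ρ k))
        (λ p → trans (cong (a ▹_) (trans (cong (ρ ⁻¹ ▹_) (sym p)) (▹-⁻¹ ρ _))) (▹-⁻¹ʳ a k)))

    T-full : ∀ f g h → ⟨ (e full ⋆ f) ⋆ g , h ⟩ ≡ recip N * (tot f * tot g * tot h)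
    T-full f g h = trans (conv (e full ⋆ f) g h) (trans (∑-cong Gs λ a → cong (_* _) (const a)) (trans (∑-*ˡ Gs _ _) (trans (cong (recip N * tot f *_)
        (trans (∑-swap Gs Gs _) (trans (∑-cong Gs λ b → trans (∑-*ˡ Gs (g b) _) (cong (g b *_) (shiftʳ b h))) (∑-*ʳ Gs (tot h) g))))
      (solve (recip N ∷ tot f ∷ tot g ∷ tot h ∷ []) (v 0 :* v 1 :* (v 2 :* v 3)) (v 0 :* (v 1 :* v 2 :* v 3)) refl))))
      where
      const : ∀ a → (e full ⋆ f) a ≡ recip N * tot f
      const a = trans (⋆-def (e full) f a) (trans (∑-cong Gs λ h → cong (_* f (h ⁻¹ ∙ a)) (e-full h)) (trans (∑-*ˡ Gs _ _) (cong (recip N *_)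
        (trans (sym (flipG _)) (trans (∑-cong Gs λ h → cong (λ k → f (k ∙ a)) (⁻¹-invol h)) (shiftʳ a f))))))

    T-point : ∀ k f g h → ⟨ (e (full ∖ k) ⋆ f) ⋆ g , h ⟩ ≡ nF * recip N * ∑ Fs λ j → cnt f j k * ∑ Fs λ i → cnt g i j * cnt h i k
    T-point k f g h = trans (conv (e (full ∖ k) ⋆ f) g h) (trans (∑-cong Gs λ a → trans (cong (_* gh a) (e-point k f a)) (*-assoc w _ _)) (trans (∑-*ˡ Gs w _) (cong (w *_)
      (trans (∑-cong Gs λ a → trans (cong (_* gh a) (sym (∑-pointF (a ⁻¹ ▹ k) (λ j → cnt f j k)))) (sym (∑-*ʳ Fs (gh a) _)))
      (trans (∑-swap Gs Fs _) (∑-cong Fs λ j → trans (∑-cong Gs λ a → solve ([ j == a ⁻¹ ▹ k ] ∷ cnt f j k ∷ gh a ∷ []) (v 0 :* v 1 :* v 2) (v 1 :* (v 0 :* v 2)) refl)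
        (trans (∑-*ˡ Gs (cnt f j k) _) (cong (cnt f j k *_) (inner j)))))))))
      where
      w = nF * recip N
      gh : G → F
      gh a = ∑ Gs λ b → g b * h (a ∙ b)
      inner : ∀ j → ∑ Gs (λ a → [ j == a ⁻¹ ▹ k ] * gh a) ≡ ∑ Fs λ i → cnt g i j * cnt h i k
      inner j = trans (∑-cong Gs λ a → sym (∑-*ˡ Gs _ _)) (trans (∑-swap Gs Gs _) (trans (∑-cong Gs λ b → trans (sym (shiftʳ (b ⁻¹) _)) (∑-cong Gs λ z → split b z))
        (trans (∑-cong Gs λ b → ∑-swap Gs Fs _) (trans (∑-swap Gs Fs _) (∑-cong Fs λ i → ∑∑-* Gs Gs (λ b → g b * [ b ▹ i == j ]) (λ z → h z * [ z ▹ i == k ]))))))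
        where
        split : ∀ b z → [ j == (z ∙ b ⁻¹) ⁻¹ ▹ k ] * (g b * h ((z ∙ b ⁻¹) ∙ b)) ≡ ∑ Fs λ i → g b * [ b ▹ i == j ] * (h z * [ z ▹ i == k ])
        split b z = trans (cong₂ (λ p q → [ p ] * (g b * h q)) (trans (cong (j ==_) (trans (cong (_▹ k) (trans (⁻¹-∙ z (b ⁻¹)) (cong (_∙ z ⁻¹) (⁻¹-invol b)))) (▹-∙ b (z ⁻¹) k))) (==-sym j _)) (cancelʳ′ b z))
          (trans (cong (_* (g b * h z)) (sym (∑-pointF (z ⁻¹ ▹ k) (λ i → [ b ▹ i == j ])))) (trans (sym (∑-*ʳ Fs _ _)) (∑-cong Fs λ i →
            trans (cong (λ p → [ p ] * [ b ▹ i == j ] * (g b * h z)) (sym (==-⁻¹ z i k))) (solve ([ z ▹ i == k ] ∷ [ b ▹ i == j ] ∷ g b ∷ h z ∷ []) (v 0 :* v 1 :* (v 2 :* v 3)) (v 2 :* v 1 :* (v 3 :* v 0)) refl))))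

    nF-pos : 0# < nF
    nF-pos = ≤-<-trans (ι-nn 3) big

    -- The averages over point stabilisers produce X₃. The average over the whole group enters once,
    -- and n times with the weight -(n - 1)/n, which leaves -(n - 2).
    T-Π : ∀ f g h → N * ⟨ (Π full ⋆ f) ⋆ g , h ⟩ ≡ (nF - 1#) * X₃ f g h - (nF - ι 2) * (tot f * tot g * tot h)
    T-Π f g h = trans (cong (N *_) (trans (⟨⟩-cong {_} {_} {h} {h} expand ≈-refl) (trans (⟨⟩-⊕ˡ _ _ h) (cong₂ _+_ (T-full f g h) (trans (⟨⟩-·ˡ (cZ full) _ h) (cong (cZ full *_)
        (trans (⟨⟩-Σˡ _ h) (trans (∑-cong Fs λ k → trans (⟨⟩-⊖ˡ _ _ h) (cong₂ _-_ (T-point k f g h) (T-full f g h))) (trans (∑-- Fs _ _) (cong₂ _-_ (∑-*ˡ Fs _ _) (trans (∑-cong Fs λ _ → sym (trans (cong (_* t) ([]-true refl)) (*-identityˡ t))) (∑-*ʳ Fs t _))))))))))))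
      (trans (solve (N ∷ recip N ∷ nF ∷ recip nF ∷ P ∷ X₃ f g h ∷ []) (v 0 :* (v 1 :* v 4 :+ (v 2 :- # 1) :* v 3 :* (v 2 :* v 1 :* v 5 :- v 2 :* (v 1 :* v 4))))
         ((v 2 :- # 1) :* v 5 :* (v 0 :* v 1) :* (v 2 :* v 3) :+ (v 0 :* v 1) :* v 4 :* (# 1 :- (v 2 :- # 1) :* (v 2 :* v 3))) refl)
      (trans (cong₂ (λ a b → (nF - 1#) * X₃ f g h * a * b + a * P * (1# - (nF - 1#) * b)) (*-inv⁺ N-pos) (*-inv⁺ nF-pos))
        (solve (nF ∷ P ∷ X₃ f g h ∷ []) ((v 0 :- # 1) :* v 2 :* # 1 :* # 1 :+ # 1 :* v 1 :* (# 1 :- (v 0 :- # 1) :* # 1)) ((v 0 :- # 1) :* v 2 :- (v 0 :- # 2) :* v 1) refl)))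
      where
      P = tot f * tot g * tot h
      t = recip N * P
      expand : (Π full ⋆ f) ⋆ g ≈ (e full ⋆ f) ⋆ g ⊕ cZ full • Σᶠ (λ k → (e (full ∖ k) ⋆ f) ⋆ g ⊖ (e full ⋆ f) ⋆ g)
      expand = ≈-trans (⋆-congˡ (≈-trans (⋆-⊕ˡ _ _ f) (⊕-cong ≈-refl (≈-trans (⋆-·ˡ _ (S full) f) (·-cong (≈-trans (⋆-Σˡ _ f) (Σ-cong λ k → ≈-trans (⋆-·ˡ _ (E full k) f)
          (≈-trans (mk λ x → *1ˡ ([]-true refl)) (⋆-⊖ˡ _ _ f)))))))))
        (≈-trans (⋆-⊕ˡ _ _ g) (⊕-cong ≈-refl (≈-trans (⋆-·ˡ _ _ g) (·-cong (≈-trans (⋆-Σˡ _ g) (Σ-cong λ k → ⋆-⊖ˡ _ _ g))))))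

  dens : Alg → F
  dens f = tot f * recip N

  P dev : Alg → Fin n → Fin n → F
  P f i j = nF * (cnt f i j * recip N)
  dev f i j = P f i j - dens f

  Σ³ : (Fin n → Fin n → Fin n → F) → F
  Σ³ s = ∑ Fs λ k → ∑ Fs λ j → ∑ Fs λ i → s i j k

  P-row : ∀ f i → ∑ Fs (P f i) ≡ nF * dens f
  P-row f i = trans (∑-*ˡ Fs nF _) (cong (nF *_) (trans (∑-*ʳ Fs (recip N) _) (cong (_* recip N) (cnt-row f i))))

  P-col : ∀ f j → ∑ Fs (λ i → P f i j) ≡ nF * dens f
  P-col f j = trans (∑-*ˡ Fs nF _) (cong (nF *_) (trans (∑-*ʳ Fs (recip N) _) (cong (_* recip N) (cnt-col f j))))

  ∑-const : ∀ x → ∑ Fs (λ _ → x) ≡ nF * x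
  ∑-const x = trans (∑-cong Fs λ _ → sym (*1ˡ ([]-true refl))) (∑-*ʳ Fs x _)

  dev-row : ∀ f i → ∑ Fs (dev f i) ≡ 0#
  dev-row f i = trans (∑-- Fs _ _) (trans (cong₂ _-_ (P-row f i) (∑-const (dens f))) (-‿inverseʳ _))

  dev-col : ∀ f j → ∑ Fs (λ i → dev f i j) ≡ 0#
  dev-col f j = trans (∑-- Fs _ _) (trans (cong₂ _-_ (P-col f j) (∑-const (dens f))) (-‿inverseʳ _))

  ∑-*0 : ∀ (x : Fin n → F) c → ∑ Fs x ≡ 0# → ∑ Fs (λ i → c * x i) ≡ 0#
  ∑-*0 x c p = trans (∑-*ˡ Fs c x) (*0ʳ p)

  -- All mixed terms vanish because the rows and columns of dev sum to zero.
  Σ³-P : ∀ f g h → Σ³ (λ i j k → P f j k * (P g i j * P h i k)) ≡ nF * nF * nF * (dens f * dens g * dens h) + Σ³ (λ i j k → dev f j k * (dev g i j * dev h i k))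
  Σ³-P f g h = trans (∑-cong Fs λ k → trans (∑-cong Fs λ j → trans (∑-cong Fs λ i → term i j k) (sum-i j k)) (sum-j k)) (trans (∑-+ Fs _ _) (cong (λ z → z + Σ³ (λ i j k → a j k * (b i j * c i k))) (trans (∑-const _)
      (solve (nF ∷ α ∷ β ∷ δ ∷ []) (v 0 :* (v 0 :* (v 0 :* (v 1 :* v 2 :* v 3)))) (v 0 :* v 0 :* v 0 :* (v 1 :* v 2 :* v 3)) refl))))
    where
    α = dens f
    β = dens g
    δ = dens h
    a = dev f
    b = dev g
    c = dev h
    Pd : ∀ f i j → P f i j ≡ dens f + dev f i j
    Pd f i j = solve (P f i j ∷ dens f ∷ []) (v 0) (v 1 :+ (v 0 :- v 1)) refl
    term : ∀ i j k → P f j k * (P g i j * P h i k) ≡ a j k * (b i j * c i k) + ((α + a j k) * (β * δ) + ((α + a j k) * δ * b i j + ((α + a j k) * β * c i k + α * (b i j * c i k))))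
    term i j k = trans (cong₂ _*_ (Pd f j k) (cong₂ _*_ (Pd g i j) (Pd h i k))) (solve (α ∷ β ∷ δ ∷ a j k ∷ b i j ∷ c i k ∷ [])
      ((v 0 :+ v 3) :* ((v 1 :+ v 4) :* (v 2 :+ v 5))) (v 3 :* (v 4 :* v 5) :+ ((v 0 :+ v 3) :* (v 1 :* v 2) :+ ((v 0 :+ v 3) :* v 2 :* v 4 :+ ((v 0 :+ v 3) :* v 1 :* v 5 :+ v 0 :* (v 4 :* v 5))))) refl)
    sum-i : ∀ j k → ∑ Fs (λ i → a j k * (b i j * c i k) + ((α + a j k) * (β * δ) + ((α + a j k) * δ * b i j + ((α + a j k) * β * c i k + α * (b i j * c i k)))))
      ≡ ∑ Fs (λ i → a j k * (b i j * c i k)) + (nF * (β * δ) * (α + a j k) + α * ∑ Fs (λ i → b i j * c i k))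
    sum-i j k = trans (∑-+ Fs _ _) (cong (∑ Fs (λ i → a j k * (b i j * c i k)) +_) (trans (∑-+ Fs _ _) (trans (cong₂ _+_ (∑-const _) (trans (∑-+ Fs _ _) (cong₂ _+_ (∑-*0 _ _ (dev-col g j))
      (trans (∑-+ Fs _ _) (cong₂ _+_ (∑-*0 _ _ (dev-col h k)) (∑-*ˡ Fs α _))))))
      (solve (nF ∷ β ∷ δ ∷ α ∷ a j k ∷ ∑ Fs (λ i → b i j * c i k) ∷ []) (v 0 :* ((v 3 :+ v 4) :* (v 1 :* v 2)) :+ (# 0 :+ (# 0 :+ v 3 :* v 5))) (v 0 :* (v 1 :* v 2) :* (v 3 :+ v 4) :+ v 3 :* v 5) refl))))
    sum-j : ∀ k → ∑ Fs (λ j → ∑ Fs (λ i → a j k * (b i j * c i k)) + (nF * (β * δ) * (α + a j k) + α * ∑ Fs (λ i → b i j * c i k)))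
      ≡ nF * (nF * (α * β * δ)) + ∑ Fs (λ j → ∑ Fs (λ i → a j k * (b i j * c i k)))
    sum-j k = trans (∑-+ Fs _ _) (trans (cong (X +_) (trans (∑-+ Fs _ _) (cong₂ _+_ (trans (∑-*ˡ Fs _ _) (cong (nF * (β * δ) *_) (trans (∑-+ Fs _ _) (cong₂ _+_ (∑-const α) (dev-col f k)))))
        (trans (∑-*ˡ Fs α _) (*0ʳ (trans (∑-swap Fs Fs _) (trans (∑-cong Fs λ i → trans (∑-*ʳ Fs (c i k) _) (*0ˡ (dev-row g i))) (∑-0 Fs))))))))
      (solve (X ∷ nF ∷ α ∷ β ∷ δ ∷ []) (v 0 :+ (v 1 :* (v 3 :* v 4) :* (v 1 :* v 2 :+ # 0) :+ # 0)) (v 1 :* (v 1 :* (v 2 :* v 3 :* v 4)) :+ v 0) refl))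
      where
      X = ∑ Fs (λ j → ∑ Fs (λ i → a j k * (b i j * c i k)))

  inv-uniqueF : ∀ {x z} → 0# < x → x * z ≡ 1# → recip x ≡ z
  inv-uniqueF {x} {z} p q = trans (sym (*1ʳ q)) (trans (sym (*-assoc _ _ _)) (*1ˡ (trans (*-comm _ _) (*-inv⁺ p))))

  record Indicator (f : Alg) : Set where
    constructor indicator
    field
      set : G → Bool
      def : ∀ g → f g ≡ [ set g ]
  open Indicator

  norm-ind : ∀ {f} → Indicator f → norm² f ≡ tot f
  norm-ind (indicator s d) = ∑-cong Gs λ g → trans (cong₂ _*_ (d g) (d g)) (trans ([]-idem (s g)) (sym (d g)))

  tot-dens : ∀ f → tot f ≡ N * dens f
  tot-dens f = sym (trans (solve (N ∷ tot f ∷ recip N ∷ []) (v 0 :* (v 1 :* v 2)) (v 1 :* (v 0 :* v 2)) refl) (*1ʳ (*-inv⁺ N-pos)))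

  -- What the second-level estimate says about three sets of permutations without solutions of a b = c.
  module Counting (big : ι 3 < nF) {s κ : F} (s-big : ι 9 < s) (κ-nn : 0# ≤ κ) (κ-s : ι 3 ≤ κ * ((s - ι 2) * (s - ι 2)))
    (bs : List (Block s))
    (ds : AllPairs (λ b b′ → Disjoint (Block.U b) (Block.U b′)) bs)
    (κ-2 : 1# ≤ pow (ι 2) (length bs) * κ) where

    module _ {f g h : Alg} (If : Indicator f) (Ig : Indicator g) (Ih : Indicator h) where

      private
        c = κ * N * tot g
        tot-nn : ∀ {f} → Indicator f → 0# ≤ tot f
        tot-nn (indicator s d) = ∑-nn Gs λ g → ≤-≡ ([]-nn (s g)) (sym (d g))
        c-nn : 0# ≤ c
        c-nn = κ-nn ⊛ <⇒≤ N-pos ⊛ tot-nn Ig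
        -- Without solutions ⟨f g, h⟩ = 0, so the part beyond the linear one is the negative of Y.
        -- The upper bound for `Q full` is therefore used at -h.
        h⁻ : Alg
        h⁻ x = - h x
        τ𝟙 : Traces.τ 𝔽 𝔾 g 𝟙 ≡ N * tot g
        τ𝟙 = trans (Traces.τ-proj 𝔽 𝔾 g (proj-e ∅)) (trans (∑-cong Gs λ a → trans (⟨⟩-cong (𝟙-⋆ _) (𝟙-⋆ _)) (trans (⟨⟩-L a g g) (trans (norm-ind Ig) (sym (*-identityˡ _)))))
          (trans (∑-*ʳ Gs (tot g) _) (cong (_* tot g) N-1)))
        bound : Traces.Bounded.𝔅 𝔽 𝔾 g c c-nn (Q full)
        bound = Detected.level2 𝔽 𝔾 g c c-nn s-big
          (≤-≡ (≡-≤ (cong (ι 3 *_) τ𝟙) (*-monoʳ (<⇒≤ N-pos ⊛ tot-nn Ig) κ-s))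
            (solve (κ ∷ s - ι 2 ∷ N ∷ tot g ∷ []) (v 0 :* (v 1 :* v 1) :* (v 2 :* v 3)) (v 0 :* v 2 :* v 3 :* (v 1 :* v 1)) refl))
          bs ds big
          (≤-≡ (≡-≤ (trans τ𝟙 (sym (*-identityˡ _))) (*-monoʳ (<⇒≤ N-pos ⊛ tot-nn Ig) κ-2))
            (solve (pow (ι 2) (length bs) ∷ κ ∷ N ∷ tot g ∷ []) (v 0 :* v 1 :* (v 2 :* v 3)) (v 0 :* (v 1 :* v 2 :* v 3)) refl))
        Y : F
        Y = ⟨ (Π full ⋆ f) ⋆ g , h ⟩
        QQ : ∀ x → ⟨ x , Q full ⋆ x ⟩ ≤ norm² x
        QQ x = ≡-≤ (sym (proj-norm (proj-Q big) x)) (Traces.proj-contract 𝔽 𝔾 g (proj-Q big) x)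
        ⟨⟩-neg : ∀ x → ⟨ x , h⁻ ⟩ ≡ - ⟨ x , h ⟩
        ⟨⟩-neg x = trans (∑-cong Gs λ y → solve (x y ∷ h y ∷ []) (v 0 :* (:- v 1)) (# 0 :- v 0 :* v 1) refl) (trans (∑-- Gs _ _) (trans (cong (_- ⟨ x , h ⟩) (∑-0 Gs)) (+-identityˡ _)))
        norm-neg : norm² h⁻ ≡ tot h
        norm-neg = trans (∑-cong Gs λ y → solve (h y ∷ []) (:- v 0 :* :- v 0) (v 0 :* v 0) refl) (norm-ind Ih)
        Y≤ : ⟨ f ⋆ g , h ⟩ ≡ 0# → ∀ λ′ → 0# < λ′ → ι 2 * Y ≤ λ′ * c * tot f + recip λ′ * tot h
        Y≤ free λ′ l = ≡-≤ (cong (ι 2 *_) (sym lhs)) (≤-trans (bound f h⁻ λ′ l)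
          (+-mono (*-monoˡ (<⇒≤ l ⊛ c-nn) (≤-≡ (QQ f) (norm-ind If))) (*-monoˡ (inv-nn l) (≤-≡ (QQ h⁻) norm-neg))))
          where
          lhs : ⟨ (Q full ⋆ f) ⋆ g , h⁻ ⟩ ≡ Y
          lhs = trans (⟨⟩-neg _) (trans (cong -_ (trans (⟨⟩-cong {_} {_} {h} {h} (≈-trans (⋆-congˡ (≈-trans (⋆-⊖ˡ 𝟙 (Π full) f) (⊖-cong (𝟙-⋆ f) ≈-refl))) (⋆-⊖ˡ f _ g)) ≈-refl)
            (trans (⟨⟩-⊖ˡ _ _ h) (cong (_- Y) free)))) (solve (Y ∷ []) (:- (# 0 :- v 0)) (v 0) refl))

      level-bound : ⟨ f ⋆ g , h ⟩ ≡ 0# → ∀ λ′ → 0# < λ′ →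
        ι 2 * (dens f * dens g * dens h + (nF - 1#) * recip (nF * nF * nF) * Σ³ (λ i j k → dev f j k * (dev g i j * dev h i k)))
          ≤ λ′ * κ * (dens f * dens g) + recip λ′ * dens h
      level-bound free λ′ l = ≡-≤ (cong (ι 2 *_) (sym Y-form)) (≡-≤ (solve (u ∷ Y ∷ []) (# 2 :* (v 0 :* v 0 :* v 1)) (v 0 :* v 0 :* (# 2 :* v 1)) refl)
        -- The parameter λ′/N converts the bound for counts into one for densities.
        (≤-≡ (*-monoˡ (u-nn ⊛ u-nn) (Y≤ free (λ′ * u) (*-pos l (inv-pos N-pos)))) (trans (cong₂ (λ a b → u * u * (λ′ * u * (κ * N * tot g) * a + b * tot h)) (tot-dens f)
            (inv-uniqueF {z = recip λ′ * N} (*-pos l (inv-pos N-pos)) (trans (solve (λ′ ∷ u ∷ recip λ′ ∷ N ∷ []) (v 0 :* v 1 :* (v 2 :* v 3)) (v 0 :* v 2 :* (v 3 :* v 1)) refl) (trans (cong₂ _*_ (*-inv⁺ l) Nu) (*-identityˡ 1#)))))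
          (trans (solve (u ∷ λ′ ∷ κ ∷ N ∷ tot g ∷ dens f ∷ recip λ′ ∷ tot h ∷ []) (v 0 :* v 0 :* (v 1 :* v 0 :* (v 2 :* v 3 :* v 4) :* (v 3 :* v 5) :+ v 6 :* v 3 :* v 7))
              (v 1 :* v 2 :* (v 5 :* (v 4 :* v 0)) :* (v 3 :* v 0) :* (v 3 :* v 0) :+ v 6 :* (v 7 :* v 0) :* (v 3 :* v 0)) refl)
          (trans (cong (λ z → λ′ * κ * (dens f * dens g) * z * z + recip λ′ * dens h * z) Nu) (solve (λ′ * κ * (dens f * dens g) ∷ recip λ′ * dens h ∷ []) (v 0 :* # 1 :* # 1 :+ v 1 :* # 1) (v 0 :+ v 1) refl))))))
        where
        u = recip N
        u-nn = inv-nn N-pos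
        Nu : N * u ≡ 1#
        Nu = *-inv⁺ N-pos
        n³ = nF * nF * nF
        n³-inv : n³ * recip n³ ≡ 1#
        n³-inv = *-inv⁺ (*-pos (*-pos (nF-pos big) (nF-pos big)) (nF-pos big))
        D = Σ³ (λ i j k → dev f j k * (dev g i j * dev h i k))
        X-form : Σ³ (λ i j k → P f j k * (P g i j * P h i k)) ≡ n³ * (u * u * u) * X₃ f g h
        X-form = trans (∑-cong Fs λ k → trans (∑-cong Fs λ j → trans (∑-cong Fs λ i → solve (nF ∷ u ∷ cnt f j k ∷ cnt g i j ∷ cnt h i k ∷ []) (v 0 :* (v 2 :* v 1) :* (v 0 :* (v 3 :* v 1) :* (v 0 :* (v 4 :* v 1)))) (v 0 :* v 0 :* v 0 :* (v 1 :* v 1 :* v 1) :* v 2 :* (v 3 :* v 4)) refl)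
            (trans (∑-*ˡ Fs _ _) (*-assoc _ _ _))) (∑-*ˡ Fs _ _)) (∑-*ˡ Fs _ _)
        αβδ = dens f * dens g * dens h
        Y-form : u * u * Y ≡ αβδ + (nF - 1#) * recip n³ * D
        Y-form = trans (sym (*1ˡ Nu)) (trans (solve (N ∷ u ∷ Y ∷ []) (v 0 :* v 1 :* (v 1 :* v 1 :* v 2)) (v 1 :* v 1 :* v 1 :* (v 0 :* v 2)) refl) (trans (cong (u * u * u *_) (T-Π big f g h))
          (trans (sym (*1ˡ n³-inv)) (trans (solve (n³ ∷ recip n³ ∷ u ∷ nF ∷ X₃ f g h ∷ tot f ∷ tot g ∷ tot h ∷ []) (v 0 :* v 1 :* (v 2 :* v 2 :* v 2 :* ((v 3 :- # 1) :* v 4 :- (v 3 :- # 2) :* (v 5 :* v 6 :* v 7))))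
              ((v 3 :- # 1) :* v 1 :* (v 0 :* (v 2 :* v 2 :* v 2) :* v 4) :- v 0 :* v 1 :* (v 3 :- # 2) :* (v 5 :* v 2 :* (v 6 :* v 2) :* (v 7 :* v 2))) refl)
          (trans (cong₂ (λ a b → (nF - 1#) * recip n³ * a - b * (nF - ι 2) * αβδ) (trans (sym X-form) (Σ³-P f g h)) n³-inv)
          (trans (solve (nF ∷ n³ ∷ recip n³ ∷ αβδ ∷ D ∷ []) ((v 0 :- # 1) :* v 2 :* (v 1 :* v 3 :+ v 4) :- # 1 :* (v 0 :- # 2) :* v 3) ((v 0 :- # 1) :* (v 1 :* v 2) :* v 3 :- (v 0 :- # 2) :* v 3 :+ (v 0 :- # 1) :* v 2 :* v 4) refl)
          (trans (cong (λ z → (nF - 1#) * z * αβδ - (nF - ι 2) * αβδ + (nF - 1#) * recip n³ * D) n³-inv)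
            (solve (nF ∷ recip n³ ∷ αβδ ∷ D ∷ []) ((v 0 :- # 1) :* # 1 :* v 2 :- (v 0 :- # 2) :* v 2 :+ (v 0 :- # 1) :* v 1 :* v 3) (v 2 :+ (v 0 :- # 1) :* v 1 :* v 3) refl))))))))

-- Positive parts and exchangeable pairs

module PositivePart (𝔽 : OrderedField) where
  open Sums 𝔽
  open Arithmetic 𝔽

  opaque
    infix 9 _⁺
    _⁺ : F → F
    x ⁺ with 0# ≤? x
    ... | yes _ = x
    ... | no  _ = 0#

    ⁺-yes : ∀ {x} → 0# ≤ x → x ⁺ ≡ x
    ⁺-yes {x} p with 0# ≤? x
    ... | yes _ = refl
    ... | no  q = ⊥-elim (q p)

    ⁺-no : ∀ {x} → x ≤ 0# → x ⁺ ≡ 0#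
    ⁺-no {x} p with 0# ≤? x
    ... | yes q = ≤-antisym p q
    ... | no  _ = refl

  ⁺-nn : ∀ x → 0# ≤ x ⁺
  ⁺-nn x with ≤-total 0# x
  ... | inj₁ p = ≤-≡ p (sym (⁺-yes p))
  ... | inj₂ p = ≤-reflexive (sym (⁺-no p))

  ≤-⁺ : ∀ x → x ≤ x ⁺
  ≤-⁺ x with ≤-total 0# x
  ... | inj₁ p = ≤-reflexive (sym (⁺-yes p))
  ... | inj₂ p = ≤-trans p (⁺-nn x)

  ⁺-least : ∀ {x y} → 0# ≤ y → x ≤ y → x ⁺ ≤ y
  ⁺-least {x} p q with ≤-total 0# x
  ... | inj₁ r = ≡-≤ (⁺-yes r) q
  ... | inj₂ r = ≡-≤ (⁺-no r) p

  *-⁺ : ∀ x → x * x ⁺ ≡ x ⁺ * x ⁺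
  *-⁺ x with ≤-total 0# x
  ... | inj₁ p = cong (_* x ⁺) (sym (⁺-yes p))
  ... | inj₂ p = trans (*0ʳ (⁺-no p)) (sym (*0ʳ (⁺-no p)))

  pow-diff : ∀ r {x y} → 0# ≤ y → y ≤ x → pow x (suc r) - pow y (suc r) ≤ ι (suc r) * ((x - y) * pow x r)
  pow-diff zero    {x} {y} p q = ≤-reflexive (solve (x ∷ y ∷ []) (v 0 :* # 1 :- v 1 :* # 1) (# 1 :* ((v 0 :- v 1) :* # 1)) refl)
  pow-diff (suc r) {x} {y} p q = ≤-trans
    (by (x ∷ y ∷ pow x (suc r) ∷ pow y (suc r) ∷ ι (suc r) * ((x - y) * pow x r) ∷ []) (v 0 :* v 2 :- v 1 :* v 3) ((v 0 :- v 1) :* v 2 :+ v 0 :* v 4)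
      (v 1 :* (v 4 :- (v 2 :- v 3)) :+ (v 0 :- v 1) :* v 4)
      (p ⊛ ⟪ pow-diff r p q ⟫ ⊹ ⟪ q ⟫ ⊛ (ι-nn (suc r) ⊛ (⟪ q ⟫ ⊛ pow-nn r (≤-trans p q)))) refl)
    (≤-reflexive (trans (solve (x ∷ y ∷ pow x r ∷ ι (suc r) ∷ []) ((v 0 :- v 1) :* (v 0 :* v 2) :+ v 0 :* (v 3 :* ((v 0 :- v 1) :* v 2))) ((# 1 :+ v 3) :* ((v 0 :- v 1) :* (v 0 :* v 2))) refl)
      (cong (_* ((x - y) * pow x (suc r))) (sym (ι-suc (suc r))))))

  private
    energy-≥ : ∀ r x y → y ≤ x → (x - y) * (pow (x ⁺) (suc r) - pow (y ⁺) (suc r)) ≤ ι (suc r) * ((x - y) ⁺ * (x - y) ⁺ * pow (x ⁺) r)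
    energy-≥ r x y p = ≤-≡ (*-monoˡ ⟪ p ⟫ (≤-trans (pow-diff r (⁺-nn y) (⁺-least (⁺-nn x) (≤-trans p (≤-⁺ x))))
        (*-monoˡ (ι-nn (suc r)) (*-monoʳ (pow-nn r (⁺-nn x)) diff))))
      (trans (cong (λ z → z * (ι (suc r) * ((x - y) * pow (x ⁺) r))) (sym d)) (trans (cong (λ z → (x - y) ⁺ * (ι (suc r) * (z * pow (x ⁺) r))) (sym d))
        (solve ((x - y) ⁺ ∷ ι (suc r) ∷ pow (x ⁺) r ∷ []) (v 0 :* (v 1 :* (v 0 :* v 2))) (v 1 :* (v 0 :* v 0 :* v 2)) refl)))
      where
      d : (x - y) ⁺ ≡ x - y
      d = ⁺-yes ⟪ p ⟫
      diff : x ⁺ - y ⁺ ≤ x - y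
      diff with ≤-total 0# x
      ... | inj₁ q = by (x ⁺ ∷ x ∷ y ∷ y ⁺ ∷ []) (v 0 :- v 3) (v 1 :- v 2) (v 1 :- v 0 :+ (v 3 :- v 2)) (⟪ ≤-reflexive (⁺-yes q) ⟫ ⊹ ⟪ ≤-⁺ y ⟫) refl
      ... | inj₂ q = ≡-≤ (trans (cong₂ _-_ (⁺-no q) (⁺-no (≤-trans p q))) (-‿inverseʳ 0#)) ⟪ p ⟫

  -- Mean value bound for the increasing function t ↦ (t⁺)^(r+1).
  energy : ∀ r x y → (x - y) * (pow (x ⁺) (suc r) - pow (y ⁺) (suc r)) ≤
    ι (suc r) * ((x - y) ⁺ * (x - y) ⁺ * pow (x ⁺) r) + ι (suc r) * ((y - x) ⁺ * (y - x) ⁺ * pow (y ⁺) r)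
  energy r x y = cases (≤-total y x)
    where
    a b : F
    a = ι (suc r) * ((x - y) ⁺ * (x - y) ⁺ * pow (x ⁺) r)
    b = ι (suc r) * ((y - x) ⁺ * (y - x) ⁺ * pow (y ⁺) r)
    cases : y ≤ x ⊎ x ≤ y → (x - y) * (pow (x ⁺) (suc r) - pow (y ⁺) (suc r)) ≤ a + b
    cases (inj₁ p) = ≤-trans (energy-≥ r x y p) (by (a ∷ b ∷ []) (v 0) (v 0 :+ v 1) (v 1) (ι-nn (suc r) ⊛ (sq-nn _ ⊛ pow-nn r (⁺-nn y))) refl)
    cases (inj₂ p) = ≡-≤ (solve (x ∷ y ∷ pow (x ⁺) (suc r) ∷ pow (y ⁺) (suc r) ∷ []) ((v 0 :- v 1) :* (v 2 :- v 3)) ((v 1 :- v 0) :* (v 3 :- v 2)) refl)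
      (≤-trans (energy-≥ r y x p) (by (a ∷ b ∷ []) (v 1) (v 0 :+ v 1) (v 0) (ι-nn (suc r) ⊛ (sq-nn _ ⊛ pow-nn r (⁺-nn x))) refl))

module Concentration (𝔽 : OrderedField) {n : ℕ} (𝔾 : PermGroup n) where
  open Sums 𝔽
  open Arithmetic 𝔽
  open PermGroup 𝔾
  open GroupAlgebra 𝔽 𝔾
  open Averages 𝔽 𝔾
  open Densities 𝔽 𝔾
  open ThreeCycles 𝔾
  open PositivePart 𝔽
  open Equality (fins n)

  Σ² : (Fin n → Fin n → F) → F
  Σ² s = ∑ Fs λ i → ∑ Fs (s i)

  Distinct : Fin n → Fin n → Fin n → Set
  Distinct i j k = i ≢ j × j ≢ k × i ≢ k

  distinct? : ∀ i j k → Dec (Distinct i j k)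
  distinct? i j k with i Fin.≟ j | j Fin.≟ k | i Fin.≟ k
  ... | no p  | no q  | no r  = yes (p , q , r)
  ... | yes p | _     | _     = no λ d → proj₁ d p
  ... | no _  | yes p | _     = no λ d → proj₁ (proj₂ d) p
  ... | no _  | no _  | yes p = no λ d → proj₂ (proj₂ d) p

  -- The indicator of distinct i, j, k, written as a product so that k can be summed out by
  -- expanding it, as in `Σw-pair`.
  w : Fin n → Fin n → Fin n → F
  w i j k = (1# - [ i == j ]) * (1# - [ j == k ]) * (1# - [ i == k ])

  1-== : ∀ i j → 0# ≤ 1# - [ i == j ]
  1-== i j = ⟪ []≤1 (i == j) ⟫

  w-nn : ∀ i j k → 0# ≤ w i j k
  w-nn i j k = 1-== i j ⊛ 1-== j k ⊛ 1-== i k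

  w-out : ∀ {i j k} → ¬ Distinct i j k → w i j k ≡ 0#
  w-out {i} {j} {k} d with i Fin.≟ j | j Fin.≟ k | i Fin.≟ k
  ... | yes refl | _        | _        = *0ˡ (*0ˡ (zero-at i))
    where zero-at : ∀ i → 1# - [ i == i ] ≡ 0#
          zero-at i = trans (cong (λ z → 1# - z) ([]-true (==-refl i))) (-‿inverseʳ 1#)
  ... | no _     | yes refl | _        = *0ˡ (*0ʳ (trans (cong (λ z → 1# - z) ([]-true (==-refl j))) (-‿inverseʳ 1#)))
  ... | no _     | no _     | yes refl = *0ʳ (trans (cong (λ z → 1# - z) ([]-true (==-refl i))) (-‿inverseʳ 1#))
  ... | no p     | no q     | no r     = ⊥-elim (d (p , q , r))

  w-guard : ∀ i j k {a b} → (Distinct i j k → a ≡ b) → w i j k * a ≡ w i j k * b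
  w-guard i j k p with distinct? i j k
  ... | yes d = cong (w i j k *_) (p d)
  ... | no  d = trans (*0ˡ (w-out d)) (sym (*0ˡ (w-out d)))

  w-guard≤ : ∀ i j k {a b} → (Distinct i j k → a ≤ b) → w i j k * a ≤ w i j k * b
  w-guard≤ i j k p with distinct? i j k
  ... | yes d = *-monoˡ (w-nn i j k) (p d)
  ... | no  d = ≤-reflexive (trans (*0ˡ (w-out d)) (sym (*0ˡ (w-out d))))

  w-rot : ∀ i j k → w i j k ≡ w k i j
  w-rot i j k = trans (cong₂ (λ a b → (1# - [ i == j ]) * (1# - [ a ]) * (1# - [ b ])) (==-sym j k) (==-sym i k))
    (solve ([ i == j ] ∷ [ k == j ] ∷ [ k == i ] ∷ []) ((# 1 :- v 0) :* (# 1 :- v 1) :* (# 1 :- v 2)) ((# 1 :- v 2) :* (# 1 :- v 0) :* (# 1 :- v 1)) refl)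

  w-flip : ∀ i j k → w i j k ≡ w i k j
  w-flip i j k = trans (cong (λ a → (1# - [ i == j ]) * (1# - [ a ]) * (1# - [ i == k ])) (==-sym j k))
    (solve ([ i == j ] ∷ [ k == j ] ∷ [ i == k ] ∷ []) ((# 1 :- v 0) :* (# 1 :- v 1) :* (# 1 :- v 2)) ((# 1 :- v 2) :* (# 1 :- v 1) :* (# 1 :- v 0)) refl)

  -- The value ε for coinciding points is a default; such triples have weight 0 in `Σw`.
  σ : Fin n → Fin n → Fin n → G
  σ i j k with distinct? i j k
  ... | yes (p , q , r) = Cycle.c (cycle p q r)
  ... | no  _           = ε

  σ-cycle : ∀ {i j k} → Distinct i j k → Σ (Cycle i j k) λ C → Cycle.c C ≡ σ i j k
  σ-cycle {i} {j} {k} d with distinct? i j k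
  ... | yes (p , q , r) = cycle p q r , refl
  ... | no  e           = ⊥-elim (e d)

  σ-inv : ∀ {i j k} → Distinct i j k → (σ i j k) ⁻¹ ≡ σ i k j
  σ-inv {i} {j} {k} d@(p , q , r) with σ-cycle d | σ-cycle {i} {k} {j} (r , (λ e → q (sym e)) , p)
  ... | C , e | C′ , e′ = trans (cong _⁻¹ (sym e)) (trans (faithful point) e′)
    where
    module C = Cycle C
    module C′ = Cycle C′
    point : ∀ l → C.c ⁻¹ ▹ l ≡ C′.c ▹ l
    point l with l Fin.≟ i | l Fin.≟ j | l Fin.≟ k
    ... | yes refl | _        | _        = trans (back C.c C.cz) (sym C′.cx)
    ... | no _     | yes refl | _        = trans (back C.c C.cx) (sym C′.cz)
    ... | no _     | no _     | yes refl = trans (back C.c C.cy) (sym C′.cy)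
    ... | no a     | no b     | no c     = trans (back C.c (C.cfix l a b c)) (sym (C′.cfix l a c b))

  Σw : (Fin n → Fin n → Fin n → F) → F
  Σw h = ∑ Fs λ i → ∑ Fs λ j → ∑ Fs λ k → w i j k * h i j k

  Σw-mono : ∀ {h h′} → (∀ i j k → Distinct i j k → h i j k ≤ h′ i j k) → Σw h ≤ Σw h′
  Σw-mono p = ∑-mono Fs λ i → ∑-mono Fs λ j → ∑-mono Fs λ k → w-guard≤ i j k (p i j k)

  Σw-cong : ∀ {h h′} → (∀ i j k → Distinct i j k → h i j k ≡ h′ i j k) → Σw h ≡ Σw h′
  Σw-cong p = ∑-cong Fs λ i → ∑-cong Fs λ j → ∑-cong Fs λ k → w-guard i j k (p i j k)

  Σw-+ : ∀ h h′ → Σw (λ i j k → h i j k + h′ i j k) ≡ Σw h + Σw h′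
  Σw-+ h h′ = trans (∑-cong Fs λ i → trans (∑-cong Fs λ j → trans (∑-cong Fs λ k → distribˡ _ _ _) (∑-+ Fs _ _)) (∑-+ Fs _ _)) (∑-+ Fs _ _)

  Σw-* : ∀ c h → Σw (λ i j k → c * h i j k) ≡ c * Σw h
  Σw-* c h = trans (∑-cong Fs λ i → trans (∑-cong Fs λ j → trans (∑-cong Fs λ k → solve (w i j k ∷ c ∷ h i j k ∷ []) (v 0 :* (v 1 :* v 2)) (v 1 :* (v 0 :* v 2)) refl) (∑-*ˡ Fs c _)) (∑-*ˡ Fs c _)) (∑-*ˡ Fs c _)

  Σw-rot : ∀ h → Σw (λ i j k → h j k i) ≡ Σw h
  Σw-rot h = trans (∑-swap Fs Fs _) (∑-cong Fs λ j → trans (∑-swap Fs Fs _) (∑-cong Fs λ k → ∑-cong Fs λ i → cong (_* h j k i) (trans (w-rot i j k) (w-rot k i j))))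

  Σw-flip : ∀ h → Σw (λ i j k → h i k j) ≡ Σw h
  Σw-flip h = ∑-cong Fs λ i → trans (∑-swap Fs Fs _) (∑-cong Fs λ k → ∑-cong Fs λ j → cong (_* h i k j) (w-flip i j k))

  Σw-pair : ∀ (h : Fin n → Fin n → F) → Σw (λ i j _ → h i j) ≡ (nF - ι 2) * ∑ Fs λ i → ∑ Fs λ j → (1# - [ i == j ]) * h i j
  Σw-pair h = trans (∑-cong Fs λ i → trans (∑-cong Fs λ j → trans (∑-cong Fs λ k → solve ([ i == j ] ∷ [ j == k ] ∷ [ i == k ] ∷ h i j ∷ [])
      ((# 1 :- v 0) :* (# 1 :- v 1) :* (# 1 :- v 2) :* v 3) ((# 1 :- v 0) :* v 3 :* (# 1 :- v 1 :- v 2 :+ v 2 :* v 1)) refl)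
      (trans (∑-*ˡ Fs _ _) (count i j))) (∑-*ˡ Fs _ _)) (∑-*ˡ Fs _ _)
    where
    point : ∀ i (f : Fin n → F) → ∑ Fs (λ k → [ i == k ] * f k) ≡ f i
    point i f = trans (∑-cong Fs λ k → cong (λ b → [ b ] * f k) (==-sym i k)) (∑-pointF i f)
    point1 : ∀ i → ∑ Fs (λ k → [ i == k ]) ≡ 1#
    point1 i = trans (∑-cong Fs λ k → sym (*-identityʳ _)) (point i (λ _ → 1#))
    count : ∀ i j → (1# - [ i == j ]) * h i j * ∑ Fs (λ k → 1# - [ j == k ] - [ i == k ] + [ i == k ] * [ j == k ]) ≡ (nF - ι 2) * ((1# - [ i == j ]) * h i j)
    count i j = trans (cong ((1# - [ i == j ]) * h i j *_) (trans (∑-+ Fs _ _) (cong₂ _+_ (trans (∑-- Fs _ _) (cong₂ _-_ (trans (∑-- Fs _ _) (cong₂ _-_ (trans (∑-const 1#) (*-identityʳ nF)) (point1 j))) (point1 i)))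
        (trans (point i (λ k → [ j == k ])) (cong [_] (==-sym j i))))))
      (trans (solve ([ i == j ] ∷ h i j ∷ nF ∷ []) ((# 1 :- v 0) :* v 1 :* (v 2 :- # 1 :- # 1 :+ v 0)) ((v 2 :- # 2) :* ((# 1 :- v 0) :* v 1) :+ v 1 :* (v 0 :- v 0 :* v 0)) refl)
        (trans (cong (λ z → (nF - ι 2) * ((1# - [ i == j ]) * h i j) + h i j * ([ i == j ] - z)) ([]-idem (i == j)))
          (solve ((nF - ι 2) * ((1# - [ i == j ]) * h i j) ∷ h i j ∷ [ i == j ] ∷ []) (v 0 :+ v 1 :* (v 2 :- v 2)) (v 0) refl)))

  -- Exchangeability: substitute π σ⁻¹ for π and use that the inverse of the cycle (i j k) is (i k
  -- j).
  reversible : ∀ (H : G → G → F) → ∑ Gs (λ π → Σw λ i j k → H π (π ∙ σ i j k)) ≡ ∑ Gs (λ π → Σw λ i j k → H (π ∙ σ i j k) π)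
  reversible H = trans (pull (λ π i j k → H π (π ∙ σ i j k))) (trans (Σw-cong λ i j k d → trans (sym (shiftʳ ((σ i j k) ⁻¹) _)) (∑-cong Gs λ π →
      trans (cong (H _) (cancelʳ′ (σ i j k) π)) (cong (λ z → H (π ∙ z) π) (σ-inv d)))) (trans (Σw-flip (λ i j k → ∑ Gs λ π → H (π ∙ σ i j k) π)) (sym (pull (λ π i j k → H (π ∙ σ i j k) π)))))
    where
    pull : ∀ (h : G → Fin n → Fin n → Fin n → F) → ∑ Gs (λ π → Σw (h π)) ≡ Σw (λ i j k → ∑ Gs λ π → h π i j k)
    pull h = trans (∑-swap Gs Fs _) (∑-cong Fs λ i → trans (∑-swap Gs Fs _) (∑-cong Fs λ j → trans (∑-swap Gs Fs _) (∑-cong Fs λ k → ∑-*ˡ Gs (w i j k) _)))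

  -- The method of exchangeable pairs, for the pair formed by π and π times a random 3-cycle.
  module Moments (φ : G → F) {Λ A₀ b : F} (Λ-pos : 0# < Λ) (A₀-nn : 0# ≤ A₀) (b-nn : 0# ≤ b)
    (drift : ∀ π → Σw (λ i j k → φ π - φ (π ∙ σ i j k)) ≡ Λ * φ π)
    (energy-bound : ∀ π → Σw (λ i j k → (φ π - φ (π ∙ σ i j k)) ⁺ * (φ π - φ (π ∙ σ i j k)) ⁺) ≤ Λ * (A₀ + b * φ π ⁺)) where

    M : ℕ → F
    M r = ∑ Gs λ π → pow (φ π ⁺) r

    -- By the drift, Λ M(r + 2) is half the sum of the increments of φ times those of (φ⁺)^(r+1),
    -- once symmetrised over the pair. `energy` bounds every term by squared increments weighted
    -- with (φ⁺)^r.
    moment-step : ∀ r → M (suc (suc r)) ≤ ι (suc r) * (A₀ * M r + b * M (suc r))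
    moment-step r = *-cancelˡ Λ-pos (*-cancelˡ (ι-pos 1) (≡-≤ (trans (cong (ι 2 *_) (sym lhs)) (solve (X ∷ []) (# 2 :* v 0) (v 0 :+ v 0) refl))
        (≡-≤ sym-X (≤-trans (∑-mono Gs λ π → Σw-mono λ i j k _ → energy r (φ π) (φ (π ∙ σ i j k))) (≡-≤ split (*-monoˡ (ι-nn 2) bound))))))
      where
      X = ∑ Gs λ π → Σw λ i j k → (φ π - φ (π ∙ σ i j k)) * pow (φ π ⁺) (suc r)
      Γ : G → G → F
      Γ π ρ = ι (suc r) * ((φ π - φ ρ) ⁺ * (φ π - φ ρ) ⁺ * pow (φ π ⁺) r)
      lhs : X ≡ Λ * M (suc (suc r))
      lhs = trans (∑-cong Gs λ π → trans (Σw-cong λ i j k _ → *-comm _ _) (trans (Σw-* (pow (φ π ⁺) (suc r)) _) (trans (cong (pow (φ π ⁺) (suc r) *_) (drift π))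
          (trans (solve (φ π ∷ φ π ⁺ ∷ pow (φ π ⁺) r ∷ Λ ∷ []) (v 1 :* v 2 :* (v 3 :* v 0)) (v 3 :* (v 0 :* v 1 :* v 2)) refl)
            (cong (Λ *_) (trans (cong (_* pow (φ π ⁺) r) (*-⁺ (φ π))) (*-assoc _ _ _))))))) (∑-*ˡ Gs Λ _)
      sym-X : X + X ≡ ∑ Gs (λ π → Σw λ i j k → (φ π - φ (π ∙ σ i j k)) * (pow (φ π ⁺) (suc r) - pow (φ (π ∙ σ i j k) ⁺) (suc r)))
      sym-X = trans (cong (X +_) (reversible (λ π ρ → (φ π - φ ρ) * pow (φ π ⁺) (suc r)))) (trans (sym (∑-+ Gs _ _)) (∑-cong Gs λ π → trans (sym (Σw-+ _ _)) (Σw-cong λ i j k _ →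
        solve (φ π ∷ φ (π ∙ σ i j k) ∷ pow (φ π ⁺) (suc r) ∷ pow (φ (π ∙ σ i j k) ⁺) (suc r) ∷ []) ((v 0 :- v 1) :* v 2 :+ (v 1 :- v 0) :* v 3) ((v 0 :- v 1) :* (v 2 :- v 3)) refl)))
      split : ∑ Gs (λ π → Σw λ i j k → Γ π (π ∙ σ i j k) + Γ (π ∙ σ i j k) π) ≡ ι 2 * ∑ Gs (λ π → Σw λ i j k → Γ π (π ∙ σ i j k))
      split = trans (∑-cong Gs λ π → Σw-+ _ _) (trans (∑-+ Gs _ _) (trans (cong (λ z → ∑ Gs (λ π → Σw λ i j k → Γ π (π ∙ σ i j k)) + z) (sym (reversible Γ))) (solve (∑ Gs (λ π → Σw λ i j k → Γ π (π ∙ σ i j k)) ∷ []) (v 0 :+ v 0) (# 2 :* v 0) refl)))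
      bound : ∑ Gs (λ π → Σw λ i j k → Γ π (π ∙ σ i j k)) ≤ Λ * (ι (suc r) * (A₀ * M r + b * M (suc r)))
      bound = ≤-≡ (∑-mono Gs λ π → ≡-≤ (trans (Σw-cong λ i j k _ → solve (ι (suc r) ∷ (φ π - φ (π ∙ σ i j k)) ⁺ ∷ pow (φ π ⁺) r ∷ []) (v 0 :* (v 1 :* v 1 :* v 2)) (v 0 :* v 2 :* (v 1 :* v 1)) refl) (Σw-* _ _))
          (≤-≡ (*-monoˡ (ι-nn (suc r) ⊛ pow-nn r (⁺-nn (φ π))) (energy-bound π)) (solve (ι (suc r) ∷ pow (φ π ⁺) r ∷ Λ ∷ A₀ ∷ b ∷ φ π ⁺ ∷ [])
            (v 0 :* v 1 :* (v 2 :* (v 3 :+ v 4 :* v 5))) (v 2 :* v 0 :* (v 3 :* v 1 :+ v 4 :* (v 5 :* v 1))) refl)))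
        (trans (∑-*ˡ Gs _ _) (trans (cong (Λ * ι (suc r) *_) (trans (∑-+ Gs _ _) (cong₂ _+_ (∑-*ˡ Gs _ _) (∑-*ˡ Gs _ _)))) (*-assoc _ _ _)))

    -- b r t^{r+1} ≤ ½ t^{r+2} + ½ (b r)² t^r absorbs the odd moment.
    moment-even : ∀ r → M (suc (suc r)) ≤ (ι (suc r) * ι (suc r) * (b * b) + ι 2 * (ι (suc r) * A₀)) * M r
    moment-even r = by (M (suc (suc r)) ∷ M (suc r) ∷ M r ∷ ι (suc r) ∷ A₀ ∷ b ∷ ∑ Gs amgm-terms ∷ []) (v 0) ((v 3 :* v 3 :* (v 5 :* v 5) :+ # 2 :* (v 3 :* v 4)) :* v 2)
        (# 2 :* (v 3 :* (v 4 :* v 2 :+ v 5 :* v 1) :- v 0) :+ (v 0 :- # 2 :* (v 3 :* v 5) :* v 1 :+ v 3 :* v 3 :* (v 5 :* v 5) :* v 2))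
        (ι-nn 2 ⊛ ⟪ moment-step r ⟫ ⊹ ≤-≡ (∑-nn Gs terms-nn) terms) refl
      where
      amgm-terms : G → F
      amgm-terms π = (φ π ⁺ - ι (suc r) * b) * (φ π ⁺ - ι (suc r) * b) * pow (φ π ⁺) r
      terms-nn : ∀ π → 0# ≤ amgm-terms π
      terms-nn π = sq-nn _ ⊛ pow-nn r (⁺-nn (φ π))
      terms : ∑ Gs amgm-terms ≡ M (suc (suc r)) - ι 2 * (ι (suc r) * b) * M (suc r) + ι (suc r) * ι (suc r) * (b * b) * M r
      terms = trans (∑-cong Gs λ π → solve (φ π ⁺ ∷ ι (suc r) ∷ b ∷ pow (φ π ⁺) r ∷ []) ((v 0 :- v 1 :* v 2) :* (v 0 :- v 1 :* v 2) :* v 3)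
          (v 0 :* (v 0 :* v 3) :- # 2 :* (v 1 :* v 2) :* (v 0 :* v 3) :+ v 1 :* v 1 :* (v 2 :* v 2) :* v 3) refl)
        (trans (∑-+ Gs _ _) (cong₂ _+_ (trans (∑-- Gs _ _) (cong (λ z → M (suc (suc r)) - z) (∑-*ˡ Gs _ _))) (∑-*ˡ Gs _ _)))

    -- A single K bounds all factors r + 1 of the recursion, so its constants collapse to one power.
    moment : ∀ k {K} → k ℕ.+ k ℕ.≤ K → M (k ℕ.+ k) ≤ pow (ι K * ι K * (b * b) + ι 2 * (ι K * A₀)) k * N
    moment zero    {K} _ = ≤-reflexive (trans N-1 (sym (*-identityˡ N)))
    moment (suc k) {K} p = subst (λ m → M m ≤ pow (ι K * ι K * (b * b) + ι 2 * (ι K * A₀)) (suc k) * N) (cong suc (sym (ℕ.+-suc k k))) (≤-trans (moment-even (k ℕ.+ k))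
        (≤-≡ (*-mono (ι-nn r ⊛ ι-nn r ⊛ sq-nn b ⊹ ι-nn 2 ⊛ (ι-nn r ⊛ A₀-nn)) (pow-nn k D-nn ⊛ <⇒≤ N-pos)
            (+-mono (*-monoʳ (sq-nn b) (*-mono (ι-nn r) (ι-nn K) r≤ r≤)) (*-monoˡ (ι-nn 2) (*-monoʳ A₀-nn r≤)))
            (moment k {K} (ℕ.≤-trans (ℕ.n≤1+n _) r≤K)))
          (sym (*-assoc _ _ _))))
      where
      r = suc (k ℕ.+ k)
      r≤K : suc (k ℕ.+ k) ℕ.≤ K
      r≤K = ℕ.≤-trans (ℕ.≤-trans (ℕ.≤-reflexive (sym (ℕ.+-suc k k))) (ℕ.n≤1+n _)) p
      r≤ : ι r ≤ ι K
      r≤ = ι-mono r≤K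
      D-nn : 0# ≤ ι K * ι K * (b * b) + ι 2 * (ι K * A₀)
      D-nn = ι-nn K ⊛ ι-nn K ⊛ sq-nn b ⊹ ι-nn 2 ⊛ (ι-nn K ⊛ A₀-nn)

    truncate : ∀ r {t λ′} → 0# ≤ t → 0# ≤ λ′ → t * pow λ′ r ≤ pow λ′ (suc r) + pow t (suc r)
    truncate r {t} {λ′} p q with ≤-total t λ′
    ... | inj₁ s = ≤-trans (*-monoʳ (pow-nn r q) s) (by (pow λ′ (suc r) ∷ pow t (suc r) ∷ []) (v 0) (v 0 :+ v 1) (v 1) (pow-nn (suc r) p) refl)
    ... | inj₂ s = ≤-trans (*-monoˡ p (pow-mono r q s)) (by (pow λ′ (suc r) ∷ pow t (suc r) ∷ []) (v 1) (v 0 :+ v 1) (v 0) (pow-nn (suc r) q) refl)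

    -- Where φ ≤ λ′ the pairing is at most λ′ tot f. The excess is paid by the moment of order 2k +
    -- 2: it is at most λ′^(2k+2) m^(-k-1) N, and N ≤ m^(k+1) tot f restores tot f.
    tail : ∀ k {f m λ′} → Indicator f → 0# < λ′ → 0# ≤ m → N ≤ pow m (suc k) * tot f →
      m * (ι (suc k ℕ.+ suc k) * ι (suc k ℕ.+ suc k) * (b * b) + ι 2 * (ι (suc k ℕ.+ suc k) * A₀)) ≤ λ′ * λ′ → ⟨ f , φ ⟩ ≤ ι 2 * (λ′ * tot f)
    tail k {f} {m} {λ′} (indicator s d) l m-nn N≤ D≤ = *-cancelˡ (pow-pos q l) (≤-trans (≡-≤ (sym (∑-*ˡ Gs _ _)) (∑-mono Gs each)) (≡-≤ (∑-+ Gs _ _)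
        (≤-≡ (+-mono (≤-reflexive (∑-*ˡ Gs _ _)) (≤-trans (moment (suc k) {K} ℕ.≤-refl) big)) (solve (λ′ ∷ pow λ′ q ∷ tot f ∷ []) (v 0 :* v 1 :* v 2 :+ v 0 :* v 1 :* v 2) (v 1 :* (# 2 :* (v 0 :* v 2))) refl))))
      where
      K = suc k ℕ.+ suc k
      q = k ℕ.+ suc k
      D = ι K * ι K * (b * b) + ι 2 * (ι K * A₀)
      D-nn : 0# ≤ D
      D-nn = ι-nn K ⊛ ι-nn K ⊛ sq-nn b ⊹ ι-nn 2 ⊛ (ι-nn K ⊛ A₀-nn)
      each : ∀ π → pow λ′ q * (f π * φ π) ≤ pow λ′ (suc q) * f π + pow (φ π ⁺) (suc q)
      each π = ≡-≤ (solve (pow λ′ q ∷ f π ∷ φ π ∷ []) (v 0 :* (v 1 :* v 2)) (v 1 :* (v 2 :* v 0)) refl)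
        (≤-trans (*-monoˡ f-nn (≤-trans (*-monoʳ (pow-nn q (<⇒≤ l)) (≤-⁺ (φ π))) (truncate q (⁺-nn (φ π)) (<⇒≤ l))))
        (by (f π ∷ pow λ′ (suc q) ∷ pow (φ π ⁺) (suc q) ∷ []) (v 0 :* (v 1 :+ v 2)) (v 1 :* v 0 :+ v 2) ((# 1 :- v 0) :* v 2) (⟪ ≡-≤ (d π) ([]≤1 _) ⟫ ⊛ pow-nn (suc q) (⁺-nn (φ π))) refl))
        where
        f-nn : 0# ≤ f π
        f-nn = ≤-≡ ([]-nn (s π)) (sym (d π))
      big : pow D (suc k) * N ≤ pow λ′ (suc q) * tot f
      big = ≤-trans (*-monoˡ (pow-nn (suc k) D-nn) N≤) (≡-≤ (trans (sym (*-assoc _ _ _)) (cong (_* tot f) (trans (*-comm _ _) (sym (pow-* m D (suc k))))))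
        (*-monoʳ (∑-nn Gs λ g → ≤-≡ ([]-nn (s g)) (sym (d g))) (≤-≡ (pow-mono (suc k) (m-nn ⊛ D-nn) D≤) (trans (pow-* λ′ λ′ (suc k)) (sym (pow-+ λ′ (suc k) (suc k)))))))

-- Tail bounds for linear statistics of a dense set

module Deviations (𝔽 : OrderedField) {n : ℕ} (𝔾 : PermGroup n) where
  open Sums 𝔽
  open Arithmetic 𝔽
  open PermGroup 𝔾
  open GroupAlgebra 𝔽 𝔾
  open Averages 𝔽 𝔾
  open Projections 𝔽 𝔾
  open Densities 𝔽 𝔾
  open ThreeCycles 𝔾
  open PositivePart 𝔽
  open Concentration 𝔽 𝔾
  open Equality (fins n)

  Matrix : Set
  Matrix = Fin n → Fin n → F

  Σ²-mono : ∀ {s t : Matrix} → (∀ i j → s i j ≤ t i j) → Σ² s ≤ Σ² t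
  Σ²-mono p = ∑-mono Fs λ i → ∑-mono Fs (p i)

  Σ²-cong : ∀ {s t : Matrix} → (∀ i j → s i j ≡ t i j) → Σ² s ≡ Σ² t
  Σ²-cong p = ∑-cong Fs λ i → ∑-cong Fs (p i)

  Σ²-nn : ∀ {s : Matrix} → (∀ i j → 0# ≤ s i j) → 0# ≤ Σ² s
  Σ²-nn p = ∑-nn Fs λ i → ∑-nn Fs (p i)

  Σ²-+ : ∀ (s t : Matrix) → Σ² (λ i j → s i j + t i j) ≡ Σ² s + Σ² t
  Σ²-+ s t = trans (∑-cong Fs λ i → ∑-+ Fs _ _) (∑-+ Fs _ _)

  Σ²-* : ∀ c (s : Matrix) → Σ² (λ i j → c * s i j) ≡ c * Σ² s
  Σ²-* c s = trans (∑-cong Fs λ i → ∑-*ˡ Fs c _) (∑-*ˡ Fs c _)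

  Σ²-- : ∀ (s t : Matrix) → Σ² (λ i j → s i j - t i j) ≡ Σ² s - Σ² t
  Σ²-- s t = trans (∑-cong Fs λ i → ∑-- Fs _ _) (∑-- Fs _ _)

  module Statistic (big : ι 3 < nF) (s : Matrix) where

    ψ φ : G → F
    ψ π = ∑ Fs λ i → s i (π ▹ i)
    φ π = nF * ψ π - Σ² s

    private
      n-2-pos : 0# < nF - ι 2
      n-2-pos p = big (by (nF ∷ []) (v 0) (# 3) (# 0 :- (v 0 :- # 2) :+ # 1) (⟪ p ⟫ ⊹ 0≤1) refl)

      n-pos : 0# < nF
      n-pos = nF-pos big

    -- A 3-cycle changes three summands, each ordered pair of points occurs with n - 2 third points,
    -- and φ carries a factor n.
    Λ : F
    Λ = ι 3 * (nF - ι 2) * nF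

    Λ-pos : 0# < Λ
    Λ-pos = *-pos (*-pos (ι-pos 2) n-2-pos) n-pos

    A : G → Fin n → Fin n → F
    A π a b = s a (π ▹ a) - s a (π ▹ b)

    diff : ∀ π {i j k} → Distinct i j k → ψ π - ψ (π ∙ σ i j k) ≡ A π i j + A π j k + A π k i
    diff π {i} {j} {k} d with σ-cycle d
    ... | C , e = trans (sym (∑-- Fs _ _)) (trans (∑-cong Fs λ m → trans (cong (λ z → s m (π ▹ m) - s m z) (trans (▹-∙ π _ m) (cong (λ g → π ▹ (g ▹ m)) (sym e)))) (each m))
        (trans (∑-+ Fs _ _) (cong₂ _+_ (trans (∑-+ Fs _ _) (cong₂ _+_ (∑-pointF i (λ _ → A π i j)) (∑-pointF j (λ _ → A π j k)))) (∑-pointF k (λ _ → A π k i)))))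
      where
      open Cycle C
      sum3 : ∀ m {x y z} → [ m == i ] ≡ x → [ m == j ] ≡ y → [ m == k ] ≡ z →
        [ m == i ] * A π i j + [ m == j ] * A π j k + [ m == k ] * A π k i ≡ x * A π i j + y * A π j k + z * A π k i
      sum3 m refl refl refl = refl
      each : ∀ m → s m (π ▹ m) - s m (π ▹ (c ▹ m)) ≡ [ m == i ] * A π i j + [ m == j ] * A π j k + [ m == k ] * A π k i
      each m with m Fin.≟ i | m Fin.≟ j | m Fin.≟ k
      ... | yes refl | _ | _ = trans (cong (λ z → s i (π ▹ i) - s i (π ▹ z)) cx) (sym (trans (sum3 i ([]-true (==-refl i)) ([]-false (≢⇒== x≢y)) ([]-false (≢⇒== x≢z)))
              (solve (A π i j ∷ A π j k ∷ A π k i ∷ []) (# 1 :* v 0 :+ # 0 :* v 1 :+ # 0 :* v 2) (v 0) refl)))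
      ... | no _ | yes refl | _ = trans (cong (λ z → s j (π ▹ j) - s j (π ▹ z)) cy) (sym (trans (sum3 j ([]-false (≢⇒== (λ q → x≢y (sym q)))) ([]-true (==-refl j)) ([]-false (≢⇒== y≢z)))
              (solve (A π i j ∷ A π j k ∷ A π k i ∷ []) (# 0 :* v 0 :+ # 1 :* v 1 :+ # 0 :* v 2) (v 1) refl)))
      ... | no _ | no _ | yes refl = trans (cong (λ z → s k (π ▹ k) - s k (π ▹ z)) cz) (sym (trans (sum3 k ([]-false (≢⇒== (λ q → x≢z (sym q)))) ([]-false (≢⇒== (λ q → y≢z (sym q)))) ([]-true (==-refl k)))
              (solve (A π i j ∷ A π j k ∷ A π k i ∷ []) (# 0 :* v 0 :+ # 0 :* v 1 :+ # 1 :* v 2) (v 2) refl)))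
      ... | no p | no q | no r = trans (cong (λ z → s m (π ▹ m) - s m (π ▹ z)) (cfix m p q r)) (sym (trans (sum3 m ([]-false (≢⇒== p)) ([]-false (≢⇒== q)) ([]-false (≢⇒== r)))
              (solve (A π i j ∷ A π j k ∷ A π k i ∷ s m (π ▹ m) ∷ []) (# 0 :* v 0 :+ # 0 :* v 1 :+ # 0 :* v 2) (v 3 :- v 3) refl)))

    φ-diff : ∀ π {i j k} → Distinct i j k → φ π - φ (π ∙ σ i j k) ≡ nF * (A π i j + A π j k + A π k i)
    φ-diff π d = trans (solve (nF ∷ ψ π ∷ ψ (π ∙ _) ∷ Σ² s ∷ []) (v 0 :* v 1 :- v 3 :- (v 0 :* v 2 :- v 3)) (v 0 :* (v 1 :- v 2)) refl) (cong (nF *_) (diff π d))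

    thrice : ∀ (h : Matrix) → Σw (λ i j k → h i j + h j k + h k i) ≡ ι 3 * Σw (λ i j _ → h i j)
    thrice h = trans (Σw-+ _ _) (trans (cong₂ _+_ (trans (Σw-+ _ _) (cong (Σw (λ i j _ → h i j) +_) (Σw-rot (λ i j _ → h i j)))) (trans (Σw-rot (λ i j k → h j k)) (Σw-rot (λ i j _ → h i j))))
      (solve (Σw (λ i j _ → h i j) ∷ []) (v 0 :+ v 0 :+ v 0) (# 3 :* v 0) refl))

    Σ²A : ∀ π → Σ² (A π) ≡ φ π
    Σ²A π = trans (Σ²-- _ _) (cong₂ _-_ (trans (∑-cong Fs λ i → ∑-const (s i (π ▹ i))) (∑-*ˡ Fs nF _)) (∑-cong Fs λ i → permute π (s i)))

    drift : ∀ π → Σw (λ i j k → φ π - φ (π ∙ σ i j k)) ≡ Λ * φ π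
    drift π = trans (Σw-cong λ i j k d → φ-diff π d) (trans (Σw-* nF _) (trans (cong (nF *_) (trans (thrice (A π)) (cong (ι 3 *_) (trans (Σw-pair (A π)) (cong ((nF - ι 2) *_) (trans (Σ²-cong diag) (Σ²A π)))))))
        (solve (nF ∷ φ π ∷ []) (v 0 :* (# 3 :* ((v 0 :- # 2) :* v 1))) (# 3 :* (v 0 :- # 2) :* v 0 :* v 1) refl)))
      where
      diag : ∀ i j → (1# - [ i == j ]) * A π i j ≡ A π i j
      diag i j with i Fin.≟ j
      ... | yes refl = trans (*0ʳ (-‿inverseʳ _)) (sym (-‿inverseʳ _))
      ... | no  p    = *1ˡ (trans (cong (λ z → 1# - z) ([]-false (≢⇒== p))) (solve [] (# 1 :- # 0) (# 1) refl))

    square : ∀ {x p q r} → 0# ≤ p → 0# ≤ q → 0# ≤ r → x ≤ nF * (p + q + r) → x ⁺ * x ⁺ ≤ ι 3 * (nF * nF) * (p * p + q * q + r * r)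
    square {x} {p} {q} {r} a b c le = ≤-trans (*-mono (⁺-nn x) nn bound bound)
        (by (nF ∷ p ∷ q ∷ r ∷ []) (v 0 :* (v 1 :+ v 2 :+ v 3) :* (v 0 :* (v 1 :+ v 2 :+ v 3))) (# 3 :* (v 0 :* v 0) :* (v 1 :* v 1 :+ v 2 :* v 2 :+ v 3 :* v 3))
          (v 0 :* v 0 :* ((v 1 :- v 2) :* (v 1 :- v 2) :+ (v 2 :- v 3) :* (v 2 :- v 3) :+ (v 1 :- v 3) :* (v 1 :- v 3))) (sq-nn nF ⊛ (sq-nn _ ⊹ sq-nn _ ⊹ sq-nn _)) refl)
      where
      nn : 0# ≤ nF * (p + q + r)
      nn = <⇒≤ n-pos ⊛ (a ⊹ b ⊹ c)
      bound : x ⁺ ≤ nF * (p + q + r)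
      bound = ⁺-least nn le

    Σw-pair≤ : ∀ (h : Matrix) → (∀ i j → 0# ≤ h i j) → Σw (λ i j _ → h i j) ≤ (nF - ι 2) * Σ² h
    Σw-pair≤ h p = ≡-≤ (Σw-pair h) (*-monoˡ (<⇒≤ n-2-pos) (Σ²-mono λ i j → by ([ i == j ] ∷ h i j ∷ []) ((# 1 :- v 0) :* v 1) (v 1) (v 0 :* v 1) ([]-nn _ ⊛ p i j) refl))

    pairing : ∀ f → ⟨ f , φ ⟩ ≡ N * Σ² (λ i j → dev f i j * s i j)
    pairing f = trans (∑-cong Gs λ π → solve (f π ∷ nF ∷ ψ π ∷ Σ² s ∷ []) (v 0 :* (v 1 :* v 2 :- v 3)) (v 1 :* (v 0 :* v 2) :- v 0 :* v 3) refl) (trans (∑-- Gs _ _) (trans (cong₂ _-_ (trans (∑-*ˡ Gs nF _) (cong (nF *_) counts)) (trans (∑-*ʳ Gs (Σ² s) f) (cong (_* Σ² s) (tot-dens f))))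
        (sym (trans (cong (N *_) (trans (Σ²-cong λ i j → solve (nF ∷ cnt f i j ∷ recip N ∷ dens f ∷ s i j ∷ []) ((v 0 :* (v 1 :* v 2) :- v 3) :* v 4) (v 0 :* v 2 :* (v 1 :* v 4) :- v 3 :* v 4) refl)
          (trans (Σ²-- _ _) (cong₂ _-_ (Σ²-* _ _) (Σ²-* _ _))))) (trans (solve (N ∷ nF ∷ recip N ∷ Σ² (λ i j → cnt f i j * s i j) ∷ dens f ∷ Σ² s ∷ []) (v 0 :* (v 1 :* v 2 :* v 3 :- v 4 :* v 5)) (v 1 :* (v 0 :* v 2 :* v 3) :- v 0 :* v 4 :* v 5) refl)
            (cong (λ z → nF * z - N * dens f * Σ² s) (*1ˡ (*-inv⁺ N-pos))))))))
      where
      counts : ∑ Gs (λ π → f π * ψ π) ≡ Σ² (λ i j → cnt f i j * s i j)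
      counts = trans (∑-cong Gs λ π → sym (∑-*ˡ Fs (f π) _)) (trans (∑-swap Gs Fs _) (∑-cong Fs λ i → trans (∑-cong Gs λ π → trans (cong (f π *_) (sym (∑-pointF (π ▹ i) (s i)))) (sym (∑-*ˡ Fs (f π) _)))
        (trans (∑-swap Gs Fs _) (∑-cong Fs λ j → trans (∑-cong Gs λ π → trans (cong (λ z → f π * ([ z ] * s i j)) (==-sym j (π ▹ i))) (sym (*-assoc _ _ _))) (∑-*ʳ Gs (s i j) _)))))

  module Tails (big : ι 3 < nF) {m : F} (k : ℕ) (m-big : ι 9 * (ι (suc k ℕ.+ suc k) * ι (suc k ℕ.+ suc k)) ≤ m) where

    private
      K = ι (suc k ℕ.+ suc k)
      K≥1 : 1# ≤ K
      K≥1 = ι-mono {1} {suc k ℕ.+ suc k} (ℕ.s≤s ℕ.z≤n)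
      K-nn : 0# ≤ K
      K-nn = ι-nn (suc k ℕ.+ suc k)
      n-pos = nF-pos big

    m-nn : 0# ≤ m
    m-nn = ≤-trans (ι-nn 9 ⊛ (K-nn ⊛ K-nn)) m-big

    9≤m : ι 9 ≤ m
    9≤m = ≤-trans (by (K ∷ []) (# 9) (# 9 :* (v 0 :* v 0)) (# 9 :* ((v 0 :- # 1) :* v 0 :+ (v 0 :- # 1))) (ι-nn 9 ⊛ (⟪ K≥1 ⟫ ⊛ K-nn ⊹ ⟪ K≥1 ⟫)) refl) m-big

    1≤m : 1# ≤ m
    1≤m = ≤-trans (ι-mono {1} {9} (ℕ.s≤s ℕ.z≤n)) 9≤m

    Dense : Alg → Set
    Dense f = N ≤ pow m (suc k) * tot f

    -- For 0 ≤ s ≤ 1 a decrease of φ is at most n times three of the entries s(i, π(i)), and their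
    -- squares are at most the entries again. So the energy is bounded through φ itself: b = 3n and
    -- A₀ = 3n Σ² s in `Moments`.
    upper : ∀ {f} → Indicator f → Dense f → ∀ (s : Matrix) → (∀ i j → 0# ≤ s i j) → (∀ i j → s i j ≤ 1#) → ∀ {λ′} → 0# < λ′ →
      m * m * (nF * nF + nF * Σ² s) ≤ λ′ * λ′ → Σ² (λ i j → dev f i j * s i j) ≤ ι 2 * (λ′ * dens f)
    upper {f} If Df s s-nn s≤1 {λ′} l h = *-cancelˡ N-pos (≡-≤ (sym (pairing f)) (≤-≡ (Moments.tail φ {Λ} {ι 3 * nF * Σ² s} {ι 3 * nF} Λ-pos
          (ι-nn 3 ⊛ <⇒≤ n-pos ⊛ Σ²-nn s-nn) (ι-nn 3 ⊛ <⇒≤ n-pos) drift energyU k {f} {m} {λ′} If l m-nn Df (≤-trans D≤ h))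
        (trans (cong (λ z → ι 2 * (λ′ * z)) (tot-dens f)) (solve (λ′ ∷ N ∷ dens f ∷ []) (# 2 :* (v 0 :* (v 1 :* v 2))) (v 1 :* (# 2 :* (v 0 :* v 2))) refl))))
      where
      open Statistic big s
      D≤ : m * (K * K * (ι 3 * nF * (ι 3 * nF)) + ι 2 * (K * (ι 3 * nF * Σ² s))) ≤ m * m * (nF * nF + nF * Σ² s)
      D≤ = by (m ∷ K ∷ nF ∷ Σ² s ∷ []) (v 0 :* (v 1 :* v 1 :* (# 3 :* v 2 :* (# 3 :* v 2)) :+ # 2 :* (v 1 :* (# 3 :* v 2 :* v 3)))) (v 0 :* v 0 :* (v 2 :* v 2 :+ v 2 :* v 3))
        (v 0 :* ((v 0 :- # 9 :* (v 1 :* v 1)) :* (v 2 :* v 2 :+ v 2 :* v 3) :+ v 2 :* v 3 :* (v 1 :* (# 6 :* (v 1 :- # 1)) :+ # 3 :* (v 1 :* v 1))))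
        (m-nn ⊛ (⟪ m-big ⟫ ⊛ (<⇒≤ n-pos ⊛ <⇒≤ n-pos ⊹ <⇒≤ n-pos ⊛ Σ²-nn s-nn) ⊹ <⇒≤ n-pos ⊛ Σ²-nn s-nn ⊛ (K-nn ⊛ (ι-nn 6 ⊛ ⟪ K≥1 ⟫) ⊹ ι-nn 3 ⊛ (K-nn ⊛ K-nn)))) refl
      energyU : ∀ π → Σw (λ i j k → (φ π - φ (π ∙ σ i j k)) ⁺ * (φ π - φ (π ∙ σ i j k)) ⁺) ≤ Λ * (ι 3 * nF * Σ² s + ι 3 * nF * φ π ⁺)
      energyU π = ≤-trans (Σw-mono λ i j k d → ≤-trans (square (s-nn i _) (s-nn j _) (s-nn k _) (≡-≤ (φ-diff π d) (*-monoˡ (<⇒≤ n-pos) (drop i j k))))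
            (*-monoˡ (ι-nn 3 ⊛ sq-nn nF) (+-mono (+-mono (sq≤ i) (sq≤ j)) (sq≤ k))))
          (≡-≤ (trans (Σw-* _ _) (cong (ι 3 * (nF * nF) *_) (thrice (λ i _ → s i (π ▹ i))))) (≤-trans (*-monoˡ (ι-nn 3 ⊛ sq-nn nF) (*-monoˡ (ι-nn 3) (Σw-pair≤ (λ i _ → s i (π ▹ i)) λ i _ → s-nn i _)))
          (≡-≤ (trans (cong (λ z → ι 3 * (nF * nF) * (ι 3 * ((nF - ι 2) * z))) (trans (∑-cong Fs λ i → ∑-const (s i (π ▹ i))) (∑-*ˡ Fs nF _)))
            (solve (nF ∷ ψ π ∷ Σ² s ∷ []) (# 3 :* (v 0 :* v 0) :* (# 3 :* ((v 0 :- # 2) :* (v 0 :* v 1)))) (# 3 :* (v 0 :- # 2) :* v 0 :* (# 3 :* v 0 :* v 2 :+ # 3 :* v 0 :* (v 0 :* v 1 :- v 2))) refl))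
            (*-monoˡ (<⇒≤ Λ-pos) (+-mono ≤-refl (*-monoˡ (ι-nn 3 ⊛ <⇒≤ n-pos) (≤-⁺ (φ π))))))))
        where
        drop : ∀ i j k → A π i j + A π j k + A π k i ≤ s i (π ▹ i) + s j (π ▹ j) + s k (π ▹ k)
        drop i j k = +-mono (+-mono (one i j) (one j k)) (one k i)
          where
          one : ∀ a b → A π a b ≤ s a (π ▹ a)
          one a b = by (s a (π ▹ a) ∷ s a (π ▹ b) ∷ []) (v 0 :- v 1) (v 0) (v 1) (s-nn a _) refl
        sq≤ : ∀ i → s i (π ▹ i) * s i (π ▹ i) ≤ s i (π ▹ i)
        sq≤ i = ≤-≡ (*-monoˡ (s-nn i _) (s≤1 i _)) (*-identityʳ _)

    -- An increase of φ is at most n times three new entries s(i, π(j)). Summed over all triples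
    -- their squares give Σ² s² whatever π is, so b = 0 and the tail is purely Gaussian.
    lower : ∀ {f} → Indicator f → Dense f → ∀ (s : Matrix) → (∀ i j → 0# ≤ s i j) → ∀ {λ′} → 0# < λ′ →
      m * m * (nF * Σ² (λ i j → s i j * s i j)) ≤ λ′ * λ′ → - Σ² (λ i j → dev f i j * s i j) ≤ ι 2 * (λ′ * dens f)
    lower {f} If Df s s-nn {λ′} l h = *-cancelˡ N-pos (≡-≤ (trans (sym (-‿distribʳ-* N _)) (trans (cong -_ (sym (pairing f))) (sym neg-pair))) (≤-≡ (Moments.tail (λ π → - φ π) {Λ} {ι 3 * nF * W} {0#} Λ-pos
          (ι-nn 3 ⊛ <⇒≤ n-pos ⊛ Σ²-nn λ i j → sq-nn (s i j)) ≤-refl drift′ energyL k {f} {m} {λ′} If l m-nn Df (≤-trans D≤ h))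
        (trans (cong (λ z → ι 2 * (λ′ * z)) (tot-dens f)) (solve (λ′ ∷ N ∷ dens f ∷ []) (# 2 :* (v 0 :* (v 1 :* v 2))) (v 1 :* (# 2 :* (v 0 :* v 2))) refl))))
      where
      open Statistic big s
      W = Σ² (λ i j → s i j * s i j)
      W-nn : 0# ≤ W
      W-nn = Σ²-nn λ i j → sq-nn (s i j)
      neg-pair : ⟨ f , (λ π → - φ π) ⟩ ≡ - ⟨ f , φ ⟩
      neg-pair = trans (∑-cong Gs λ π → solve (f π ∷ φ π ∷ []) (v 0 :* (:- v 1)) (# 0 :- v 0 :* v 1) refl) (trans (∑-- Gs _ _) (trans (cong (_- ⟨ f , φ ⟩) (∑-0 Gs)) (+-identityˡ _)))
      drift′ : ∀ π → Σw (λ i j k → - φ π - - φ (π ∙ σ i j k)) ≡ Λ * - φ π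
      drift′ π = trans (Σw-cong λ i j k _ → solve (φ π ∷ φ (π ∙ σ i j k) ∷ []) (:- v 0 :- (:- v 1)) ((:- # 1) :* (v 0 :- v 1)) refl) (trans (Σw-* (- 1#) _) (trans (cong (- 1# *_) (drift π))
        (solve (Λ ∷ φ π ∷ []) ((:- # 1) :* (v 0 :* v 1)) (v 0 :* (:- v 1)) refl)))
      D≤ : m * (K * K * (0# * 0#) + ι 2 * (K * (ι 3 * nF * W))) ≤ m * m * (nF * W)
      D≤ = by (m ∷ K ∷ nF ∷ W ∷ []) (v 0 :* (v 1 :* v 1 :* (# 0 :* # 0) :+ # 2 :* (v 1 :* (# 3 :* v 2 :* v 3)))) (v 0 :* v 0 :* (v 2 :* v 3))
        (v 0 :* (v 2 :* v 3) :* ((v 0 :- # 9 :* (v 1 :* v 1)) :+ (v 1 :* (# 6 :* (v 1 :- # 1)) :+ # 3 :* (v 1 :* v 1))))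
        (m-nn ⊛ (<⇒≤ n-pos ⊛ W-nn) ⊛ (⟪ m-big ⟫ ⊹ (K-nn ⊛ (ι-nn 6 ⊛ ⟪ K≥1 ⟫) ⊹ ι-nn 3 ⊛ (K-nn ⊛ K-nn)))) refl
      energyL : ∀ π → Σw (λ i j k → (- φ π - - φ (π ∙ σ i j k)) ⁺ * (- φ π - - φ (π ∙ σ i j k)) ⁺) ≤ Λ * (ι 3 * nF * W + 0# * (- φ π) ⁺)
      energyL π = ≤-trans (Σw-mono λ i j k d → square (s-nn i _) (s-nn j _) (s-nn k _) (≡-≤ (trans (solve (φ π ∷ φ (π ∙ σ i j k) ∷ []) (:- v 0 :- (:- v 1)) (:- (v 0 :- v 1)) refl) (cong -_ (φ-diff π d))) (drop i j k)))
          (≡-≤ (trans (Σw-* _ _) (cong (ι 3 * (nF * nF) *_) (thrice B²))) (≤-≡ (*-monoˡ (ι-nn 3 ⊛ sq-nn nF) (*-monoˡ (ι-nn 3) (Σw-pair≤ B² λ i j → sq-nn _)))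
          (trans (cong (λ z → ι 3 * (nF * nF) * (ι 3 * ((nF - ι 2) * z))) (∑-cong Fs λ i → permute π (λ j → s i j * s i j)))
            (solve (nF ∷ W ∷ (- φ π) ⁺ ∷ []) (# 3 :* (v 0 :* v 0) :* (# 3 :* ((v 0 :- # 2) :* v 1))) (# 3 :* (v 0 :- # 2) :* v 0 :* (# 3 :* v 0 :* v 1 :+ # 0 :* v 2)) refl))))
        where
        B² : Matrix
        B² a b = s a (π ▹ b) * s a (π ▹ b)
        drop : ∀ i j k → - (nF * (A π i j + A π j k + A π k i)) ≤ nF * (s i (π ▹ j) + s j (π ▹ k) + s k (π ▹ i))
        drop i j k = by (nF ∷ s i (π ▹ i) ∷ s i (π ▹ j) ∷ s j (π ▹ j) ∷ s j (π ▹ k) ∷ s k (π ▹ k) ∷ s k (π ▹ i) ∷ []) (:- (v 0 :* (v 1 :- v 2 :+ (v 3 :- v 4) :+ (v 5 :- v 6)))) (v 0 :* (v 2 :+ v 4 :+ v 6))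
          (v 0 :* (v 1 :+ v 3 :+ v 5)) (<⇒≤ n-pos ⊛ (s-nn i _ ⊹ s-nn j _ ⊹ s-nn k _)) refl

    dens-pos : ∀ {f} → Dense f → 0# < dens f
    dens-pos {f} D p = N-pos (≤-trans D (≡-≤ (cong (pow m (suc k) *_) (tot-dens f)) (≤-≡ (*-monoˡ (pow-nn (suc k) m-nn) (*-monoˡ (<⇒≤ N-pos) p))
      (solve (pow m (suc k) ∷ N ∷ []) (v 0 :* (v 1 :* # 0)) (# 0) refl))))

    -- Choosing λ = x / 4α turns a bound x ≤ 2λα into x ≤ x / 2.
    halve : ∀ {α} → 0# < α → ∃ λ q → (∀ {y} → 0# < y → 0# < y * q) × (∀ y → ι 2 * (y * q * α) * ι 2 ≡ y) × q * q * (ι 16 * (α * α)) ≡ 1#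
    halve {α} p = recip (ι 4 * α) , (λ y → *-pos y (inv-pos 4α)) , (λ y → trans (solve (y ∷ recip (ι 4 * α) ∷ α ∷ []) (# 2 :* (v 0 :* v 1 :* v 2) :* # 2) (v 0 :* (# 4 :* v 2 :* v 1)) refl) (*1ʳ (*-inv⁺ 4α))) ,
        trans (solve (recip (ι 4 * α) ∷ α ∷ []) (v 0 :* v 0 :* (# 16 :* (v 1 :* v 1))) (# 4 :* v 1 :* v 0 :* (# 4 :* v 1 :* v 0)) refl) (trans (cong₂ _*_ (*-inv⁺ 4α) (*-inv⁺ 4α)) (*-identityˡ 1#))
      where
      4α : 0# < ι 4 * α
      4α = *-pos (ι-pos 3) p

    half-neg : ∀ {x y} → y * ι 2 ≡ x → x ≤ y → x ≤ 0#
    half-neg {x} {y} e p = by (x ∷ y ∷ []) (v 0) (# 0) ((v 1 :- v 0) :+ (v 1 :- v 0) :+ (v 0 :- v 1 :* # 2)) (⟪ p ⟫ ⊹ ⟪ p ⟫ ⊹ ⟪ ≤-reflexive e ⟫) refl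

    neg : Alg → Matrix
    neg f i j = (- dev f i j) ⁺

    -- With s = `neg f` the left side of `lower` is W itself. If W exceeded 16 m² n α², the choice
    -- λ′ = W/4α would be allowed and yield W ≤ W/2.
    neg-norm : ∀ {f} → Indicator f → Dense f → Σ² (λ i j → neg f i j * neg f i j) ≤ ι 16 * (m * m * (nF * (dens f * dens f)))
    neg-norm {f} If Df with Σ² (λ i j → neg f i j * neg f i j) ≤? ι 16 * (m * m * (nF * (dens f * dens f)))
    ... | yes p = p
    ... | no  p = ⊥-elim (W-pos (half-neg (two W) (≡-≤ W-eq (lower If Df (neg f) (λ i j → ⁺-nn _) (scale W-pos) λ-big))))
      where
      α = dens f
      W = Σ² (λ i j → neg f i j * neg f i j)
      H = halve (dens-pos Df)
      q = proj₁ H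
      scale = λ {y} → proj₁ (proj₂ H) {y}
      two = proj₁ (proj₂ (proj₂ H))
      qq = proj₂ (proj₂ (proj₂ H))
      W-pos : 0# < W
      W-pos = ≤-<-trans (ι-nn 16 ⊛ (m-nn ⊛ m-nn ⊛ (<⇒≤ n-pos ⊛ sq-nn α))) p
      W-eq : W ≡ - Σ² (λ i j → dev f i j * neg f i j)
      W-eq = trans (Σ²-cong λ i j → trans (sym (*-⁺ (- dev f i j))) (solve (dev f i j ∷ neg f i j ∷ []) ((:- v 0) :* v 1) ((:- # 1) :* (v 0 :* v 1)) refl)) (trans (Σ²-* (- 1#) _) (trans (sym (-‿distribˡ-* 1# _)) (cong -_ (*-identityˡ _))))
      λ-big : m * m * (nF * W) ≤ W * q * (W * q)
      λ-big = ≡-≤ (trans (sym (*1ʳ qq)) (solve (m ∷ nF ∷ W ∷ q ∷ α ∷ []) (v 0 :* v 0 :* (v 1 :* v 2) :* (v 3 :* v 3 :* (# 16 :* (v 4 :* v 4)))) (v 2 :* (v 3 :* v 3) :* (# 16 :* (v 0 :* v 0 :* (v 1 :* (v 4 :* v 4))))) refl))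
        (≤-≡ (*-monoˡ (<⇒≤ W-pos ⊛ sq-nn q) (<⇒≤ p)) (solve (W ∷ q ∷ []) (v 0 :* (v 1 :* v 1) :* v 0) (v 0 :* v 1 :* (v 0 :* v 1)) refl))

    -- With X the size of J, `upper` at λ′ = tX/4α gives (tX)² ≤ 16 α² m² (n² + nX) by the same
    -- self-improvement. The cases tell which of n and X dominates; for X ≤ n the result is linear
    -- in t, whence the summand t on the right.
    level-set : ∀ {f} → Indicator f → Dense f → ∀ (J : Fin n → Fin n → Bool) {t} → 0# < t → (∀ i j → J i j ≡ true → t ≤ dev f i j) →
      t * t * Σ² (λ i j → [ J i j ]) ≤ ι 32 * (m * m * (nF * (dens f * (dens f + t))))
    level-set {f} If Df J {t} t-pos above = cases (≤-total nF X)
      where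
      α = dens f
      α-pos = dens-pos Df
      X = Σ² (λ i j → [ J i j ])
      X-nn : 0# ≤ X
      X-nn = Σ²-nn λ i j → []-nn _
      B = ι 16 * (α * α * (m * m * (nF * nF + nF * X)))
      mass : t * X ≤ Σ² (λ i j → dev f i j * [ J i j ])
      mass = ≡-≤ (sym (Σ²-* t _)) (Σ²-mono λ i j → each i j (bool (J i j)))
        where
        each : ∀ i j → J i j ≡ true ⊎ J i j ≡ false → t * [ J i j ] ≤ dev f i j * [ J i j ]
        each i j (inj₁ p) = *-monoʳ ([]-nn _) (above i j p)
        each i j (inj₂ p) = ≤-reflexive (trans (*0ʳ ([]-false p)) (sym (*0ʳ ([]-false p))))
      main : t * X * (t * X) ≤ B
      main with t * X * (t * X) ≤? B
      ... | yes p = p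
      ... | no  p = ⊥-elim (tX-pos (half-neg (two (t * X)) (≤-trans mass (upper If Df (λ i j → [ J i j ]) (λ i j → []-nn _) (λ i j → []≤1 _) (scale tX-pos) λ-big))))
        where
        H = halve α-pos
        q = proj₁ H
        scale = λ {y} → proj₁ (proj₂ H) {y}
        two = proj₁ (proj₂ (proj₂ H))
        qq = proj₂ (proj₂ (proj₂ H))
        tX-pos : 0# < t * X
        tX-pos r = p (≤-trans (≤-≡ (*-monoˡ (<⇒≤ t-pos ⊛ X-nn) r) (zeroʳ _)) (ι-nn 16 ⊛ (sq-nn α ⊛ (sq-nn m ⊛ (sq-nn nF ⊹ <⇒≤ n-pos ⊛ X-nn)))))
        λ-big : m * m * (nF * nF + nF * X) ≤ t * X * q * (t * X * q)
        λ-big = ≡-≤ (trans (sym (*1ʳ qq)) (solve (m ∷ nF ∷ X ∷ q ∷ α ∷ []) (v 0 :* v 0 :* (v 1 :* v 1 :+ v 1 :* v 2) :* (v 3 :* v 3 :* (# 16 :* (v 4 :* v 4)))) (v 3 :* v 3 :* (# 16 :* (v 4 :* v 4 :* (v 0 :* v 0 :* (v 1 :* v 1 :+ v 1 :* v 2))))) refl))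
          (≤-≡ (*-monoˡ (sq-nn q) (<⇒≤ p)) (solve (t * X ∷ q ∷ []) (v 1 :* v 1 :* (v 0 :* v 0)) (v 0 :* v 1 :* (v 0 :* v 1)) refl))
      cases : nF ≤ X ⊎ X ≤ nF → t * t * X ≤ ι 32 * (m * m * (nF * (α * (α + t))))
      cases (inj₁ p) = *-cancelˡ (<-≤-trans n-pos p) (≡-≤ (solve (t ∷ X ∷ []) (v 1 :* (v 0 :* v 0 :* v 1)) (v 0 :* v 1 :* (v 0 :* v 1)) refl) (≤-trans main
        (by (α ∷ m ∷ nF ∷ X ∷ t ∷ []) (# 16 :* (v 0 :* v 0 :* (v 1 :* v 1 :* (v 2 :* v 2 :+ v 2 :* v 3)))) (v 3 :* (# 32 :* (v 1 :* v 1 :* (v 2 :* (v 0 :* (v 0 :+ v 4))))))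
          (# 16 :* (v 0 :* v 0 :* (v 1 :* v 1 :* (v 2 :* (v 3 :- v 2)))) :+ # 32 :* (v 3 :* (v 1 :* v 1 :* (v 2 :* (v 0 :* v 4)))))
          (ι-nn 16 ⊛ (sq-nn α ⊛ (sq-nn m ⊛ (<⇒≤ n-pos ⊛ ⟪ p ⟫))) ⊹ ι-nn 32 ⊛ (X-nn ⊛ (sq-nn m ⊛ (<⇒≤ n-pos ⊛ (<⇒≤ α-pos ⊛ <⇒≤ t-pos))))) refl)))
      cases (inj₂ p) = ≡-≤ (*-assoc t t X) (≤-trans (*-monoˡ (<⇒≤ t-pos) tX≤)
          (by (α ∷ m ∷ nF ∷ t ∷ []) (v 3 :* (# 6 :* (m′ :* (v 2 :* v 0)))) (# 32 :* (v 1 :* v 1 :* (v 2 :* (v 0 :* (v 0 :+ v 3)))))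
            (# 6 :* (v 3 :* (v 2 :* v 0) :* (v 1 :* (v 1 :- # 1))) :+ # 26 :* (v 1 :* v 1 :* (v 2 :* (v 0 :* v 3))) :+ # 32 :* (v 1 :* v 1 :* (v 2 :* (v 0 :* v 0))))
            (ι-nn 6 ⊛ (<⇒≤ t-pos ⊛ (<⇒≤ n-pos ⊛ <⇒≤ α-pos) ⊛ (m-nn ⊛ ⟪ 1≤m ⟫)) ⊹ ι-nn 26 ⊛ (sq-nn m ⊛ (<⇒≤ n-pos ⊛ (<⇒≤ α-pos ⊛ <⇒≤ t-pos))) ⊹ ι-nn 32 ⊛ (sq-nn m ⊛ (<⇒≤ n-pos ⊛ sq-nn α))) refl))
        where
        m′ = v 1
        tX≤ : t * X ≤ ι 6 * (m * (nF * α))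
        tX≤ = sq-≤ (ι-nn 6 ⊛ (m-nn ⊛ (<⇒≤ n-pos ⊛ <⇒≤ α-pos))) (≤-trans main (by (α ∷ m ∷ nF ∷ X ∷ []) (# 16 :* (v 0 :* v 0 :* (v 1 :* v 1 :* (v 2 :* v 2 :+ v 2 :* v 3)))) (# 6 :* (v 1 :* (v 2 :* v 0)) :* (# 6 :* (v 1 :* (v 2 :* v 0))))
          (# 16 :* (v 0 :* v 0 :* (v 1 :* v 1 :* (v 2 :* (v 2 :- v 3)))) :+ # 4 :* (v 0 :* v 0 :* (v 1 :* v 1 :* (v 2 :* v 2)))) (ι-nn 16 ⊛ (sq-nn α ⊛ (sq-nn m ⊛ (<⇒≤ n-pos ⊛ ⟪ p ⟫))) ⊹ ι-nn 4 ⊛ (sq-nn α ⊛ (sq-nn m ⊛ sq-nn nF))) refl))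

-- Truncated deviation matrices and trilinear sums

module Truncation (𝔽 : OrderedField) where
  open Sums 𝔽
  open Arithmetic 𝔽
  open PositivePart 𝔽

  ∑-× : ∀ {A B : Set} (xs : List A) (ys : List B) (f : A × B → F) → ∑ (cartesianProduct xs ys) f ≡ ∑ xs λ x → ∑ ys λ y → f (x , y)
  ∑-× []       ys f = trans (∑-[] f) (sym (∑-[] _))
  ∑-× (x ∷ xs) ys f = trans (∑-++ (map (x ,_) ys) _ f) (trans (cong₂ _+_ (∑-map ys (x ,_) f) (∑-× xs ys f)) (sym (∑-∷ x xs _)))

  ⁺-split : ∀ x → x ≡ x ⁺ - (- x) ⁺
  ⁺-split x with ≤-total 0# x
  ... | inj₁ p = sym (trans (cong₂ _-_ (⁺-yes p) (⁺-no (≤-≡ (neg-mono p) -0#≈0#))) (solve (x ∷ []) (v 0 :- # 0) (v 0) refl))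
  ... | inj₂ p = sym (trans (cong₂ _-_ (⁺-no p) (⁺-yes (≡-≤ (sym -0#≈0#) (neg-mono p)))) (solve (x ∷ []) (# 0 :- (:- v 0)) (v 0) refl))

  opaque
    test : F → F → Bool
    test x y = does (x ≤? y)

    test-true : ∀ {x y} → x ≤ y → test x y ≡ true
    test-true {x} {y} = dec-true (x ≤? y)

    test-false : ∀ {x y} → ¬ x ≤ y → test x y ≡ false
    test-false {x} {y} = dec-false (x ≤? y)

    test-≤ : ∀ {x y} → test x y ≡ true → x ≤ y
    test-≤ {x} {y} t with x ≤? y
    ... | yes p = p

    test-≰ : ∀ {x y} → test x y ≡ false → y < x
    test-≰ {x} {y} t with x ≤? y
    ... | no p = p

  lo hi : F → F → F
  lo M x = [ test x M ] * x ⁺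
  hi M x = (1# - [ test x M ]) * x ⁺

  lo-nn : ∀ M x → 0# ≤ lo M x
  lo-nn M x = []-nn _ ⊛ ⁺-nn x

  hi-nn : ∀ M x → 0# ≤ hi M x
  hi-nn M x = ⟪ []≤1 _ ⟫ ⊛ ⁺-nn x

  lo+hi : ∀ M x → x ⁺ ≡ lo M x + hi M x
  lo+hi M x = solve ([ test x M ] ∷ x ⁺ ∷ []) (v 1) (v 0 :* v 1 :+ (# 1 :- v 0) :* v 1) refl

  lo-≤ : ∀ {M x} → x ≤ M → lo M x ≡ x ⁺
  lo-≤ p = *1ˡ ([]-true (test-true p))

  hi-≤ : ∀ {M x} → x ≤ M → hi M x ≡ 0#
  hi-≤ p = *0ˡ (trans (cong (λ z → 1# - z) ([]-true (test-true p))) (-‿inverseʳ 1#))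

  hi-⁺ : ∀ M x → hi M x ≤ x ⁺
  hi-⁺ M x = ≤-≡ (by (hi M x ∷ lo M x ∷ []) (v 0) (v 1 :+ v 0) (v 1) (lo-nn M x) refl) (sym (lo+hi M x))

  -- Expand the product of a = a⁺ − a⁻ etc.; only the terms with an odd number of negative parts survive, and each pair
  -- of positive parts is split at its own threshold.
  minus-product : ∀ {a b c α β δ} M₁ M₂ M₃ → (- a) ⁺ ≤ α → (- b) ⁺ ≤ β → (- c) ⁺ ≤ δ → - (a * (b * c)) ≤
    α * (hi M₁ b * hi M₁ c) + β * (hi M₂ a * hi M₂ c) + δ * (hi M₃ a * hi M₃ b)
      + ((- a) ⁺ * ((- b) ⁺ * (- c) ⁺) + ((- a) ⁺ * (lo M₁ b * c ⁺) + (- a) ⁺ * (b ⁺ * lo M₁ c))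
        + (lo M₂ a * ((- b) ⁺ * c ⁺) + a ⁺ * ((- b) ⁺ * lo M₂ c)) + (lo M₃ a * (b ⁺ * (- c) ⁺) + a ⁺ * (lo M₃ b * (- c) ⁺)))
  minus-product {a} {b} {c} {α} {β} {δ} M₁ M₂ M₃ p q r = ≡-≤ (cong -_ (cong₂ _*_ (⁺-split a) (cong₂ _*_ (⁺-split b) (⁺-split c)))) (≤-trans
      (by (a ⁺ ∷ b ⁺ ∷ c ⁺ ∷ (- a) ⁺ ∷ (- b) ⁺ ∷ (- c) ⁺ ∷ []) (:- ((v 0 :- v 3) :* ((v 1 :- v 4) :* (v 2 :- v 5))))
        (v 3 :* (v 4 :* v 5) :+ (v 3 :* (v 1 :* v 2) :+ v 4 :* (v 0 :* v 2) :+ v 5 :* (v 0 :* v 1)))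
        (v 0 :* (v 1 :* v 2) :+ v 0 :* (v 4 :* v 5) :+ v 3 :* (v 1 :* v 5) :+ v 3 :* (v 4 :* v 2))
        (⁺-nn a ⊛ (⁺-nn b ⊛ ⁺-nn c) ⊹ ⁺-nn a ⊛ (⁺-nn _ ⊛ ⁺-nn _) ⊹ ⁺-nn _ ⊛ (⁺-nn _ ⊛ ⁺-nn _) ⊹ ⁺-nn _ ⊛ (⁺-nn _ ⊛ ⁺-nn _)) refl)
    (≤-≡ (+-mono ≤-refl (+-mono (+-mono (one M₁ b c p) (one M₂ a c q)) (one M₃ a b r)))
      (solve ((- a) ⁺ ∷ (- b) ⁺ ∷ (- c) ⁺ ∷ α * (hi M₁ b * hi M₁ c) ∷ β * (hi M₂ a * hi M₂ c) ∷ δ * (hi M₃ a * hi M₃ b) ∷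
          lo M₁ b * c ⁺ ∷ b ⁺ * lo M₁ c ∷ lo M₂ a ∷ c ⁺ ∷ a ⁺ ∷ lo M₂ c ∷ lo M₃ a ∷ b ⁺ ∷ lo M₃ b ∷ [])
        (v 0 :* (v 1 :* v 2) :+ ((v 3 :+ (v 0 :* v 6 :+ v 0 :* v 7)) :+ (v 4 :+ (v 1 :* (v 8 :* v 9) :+ v 1 :* (v 10 :* v 11))) :+ (v 5 :+ (v 2 :* (v 12 :* v 13) :+ v 2 :* (v 10 :* v 14)))))
        (v 3 :+ v 4 :+ v 5 :+ (v 0 :* (v 1 :* v 2) :+ (v 0 :* v 6 :+ v 0 :* v 7) :+ (v 8 :* (v 1 :* v 9) :+ v 10 :* (v 1 :* v 11)) :+ (v 12 :* (v 13 :* v 2) :+ v 10 :* (v 14 :* v 2)))) refl)))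
    where
    one : ∀ M {x} y z {γ} → (- x) ⁺ ≤ γ → (- x) ⁺ * (y ⁺ * z ⁺) ≤ γ * (hi M y * hi M z) + ((- x) ⁺ * (lo M y * z ⁺) + (- x) ⁺ * (y ⁺ * lo M z))
    one M {x} y z {γ} s = ≡-≤ (cong ((- x) ⁺ *_) (cong₂ _*_ (lo+hi M y) (lo+hi M z))) (≤-trans
      (by (lo M y ∷ hi M y ∷ lo M z ∷ hi M z ∷ (- x) ⁺ ∷ γ ∷ []) (v 4 :* ((v 0 :+ v 1) :* (v 2 :+ v 3))) (v 5 :* (v 1 :* v 3) :+ (v 4 :* (v 0 :* (v 2 :+ v 3)) :+ v 4 :* ((v 0 :+ v 1) :* v 2)))
        ((v 5 :- v 4) :* (v 1 :* v 3) :+ v 4 :* (v 0 :* v 2)) (⟪ s ⟫ ⊛ (hi-nn M y ⊛ hi-nn M z) ⊹ ⁺-nn (- x) ⊛ (lo-nn M y ⊛ lo-nn M z)) refl)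
      (≤-reflexive (cong₂ (λ s t → γ * (hi M y * hi M z) + ((- x) ⁺ * (lo M y * s) + (- x) ⁺ * (t * lo M z))) (sym (lo+hi M z)) (sym (lo+hi M y)))))

module LevelSums (𝔽 : OrderedField) {n : ℕ} (𝔾 : PermGroup n) where
  open Sums 𝔽
  open Arithmetic 𝔽
  open PermGroup 𝔾
  open GroupAlgebra 𝔽 𝔾
  open Averages 𝔽 𝔾
  open Projections 𝔽 𝔾
  open Densities 𝔽 𝔾
  open PositivePart 𝔽
  open Truncation 𝔽
  open Concentration 𝔽 𝔾
  open Deviations 𝔽 𝔾
  open Equality (fins n)

  Σ³-mono : ∀ {s t : Fin n → Fin n → Fin n → F} → (∀ i j k → s i j k ≤ t i j k) → Σ³ s ≤ Σ³ t
  Σ³-mono p = ∑-mono Fs λ k → ∑-mono Fs λ j → ∑-mono Fs λ i → p i j k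

  Σ³-cong : ∀ {s t : Fin n → Fin n → Fin n → F} → (∀ i j k → s i j k ≡ t i j k) → Σ³ s ≡ Σ³ t
  Σ³-cong p = ∑-cong Fs λ k → ∑-cong Fs λ j → ∑-cong Fs λ i → p i j k

  Σ³-+ : ∀ (s t : Fin n → Fin n → Fin n → F) → Σ³ (λ i j k → s i j k + t i j k) ≡ Σ³ s + Σ³ t
  Σ³-+ s t = trans (∑-cong Fs λ k → trans (∑-cong Fs λ j → ∑-+ Fs _ _) (∑-+ Fs _ _)) (∑-+ Fs _ _)

  Σ³-* : ∀ c (s : Fin n → Fin n → Fin n → F) → Σ³ (λ i j k → c * s i j k) ≡ c * Σ³ s
  Σ³-* c s = trans (∑-cong Fs λ k → trans (∑-cong Fs λ j → ∑-*ˡ Fs c _) (∑-*ˡ Fs c _)) (∑-*ˡ Fs c _)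

  ‖_‖² : Matrix → F
  ‖ x ‖² = Σ² λ i j → x i j * x i j

  ‖‖-nn : ∀ x → 0# ≤ ‖ x ‖²
  ‖‖-nn x = Σ²-nn λ i j → sq-nn (x i j)

  tri : Matrix → Matrix → Matrix → F
  tri x y z = Σ³ λ i j k → x j k * (y i j * z i k)

  -- Cauchy-Schwarz over the pairs (k, j), and then over i inside the second factor.
  tri-cauchy : ∀ x y z → tri x y z * tri x y z ≤ ‖ x ‖² * (‖ y ‖² * ‖ z ‖²)
  tri-cauchy x y z = ≡-≤ (cong₂ _*_ flat flat) (≤-trans (cauchy pairs f g) (*-mono (∑-nn pairs λ p → sq-nn (f p)) (‖‖-nn y ⊛ ‖‖-nn z)
      (≤-reflexive (trans (∑-× Fs Fs _) (∑-swap Fs Fs _)))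
      (≡-≤ (∑-× Fs Fs _) (≤-≡ (∑-mono Fs λ k → ∑-mono Fs λ j → cauchy Fs (λ i → y i j) (λ i → z i k))
        (trans (∑-cong Fs λ k → ∑-*ʳ Fs _ _) (trans (∑-*ˡ Fs _ _) (cong₂ _*_ (∑-swap Fs Fs _) (∑-swap Fs Fs _))))))))
    where
    pairs = cartesianProduct Fs Fs
    f g : Fin n × Fin n → F
    f (k , j) = x j k
    g (k , j) = ∑ Fs λ i → y i j * z i k
    flat : tri x y z ≡ ∑ pairs (λ p → f p * g p)
    flat = trans (∑-cong Fs λ k → ∑-cong Fs λ j → ∑-*ˡ Fs (x j k) _) (sym (∑-× Fs Fs _))

  tri-bound : ∀ (x y z : Matrix) {A B C L X} → ‖ x ‖² ≤ A → ‖ y ‖² ≤ B → ‖ z ‖² ≤ C → 0# ≤ X → L * L * (A * (B * C)) ≤ X * X → L * tri x y z ≤ X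
  tri-bound x y z {A} {B} {C} {L} {X} a b c p q = sq-≤ p (≡-≤ (solve (L ∷ tri x y z ∷ []) (v 0 :* v 1 :* (v 0 :* v 1)) (v 0 :* v 0 :* (v 1 :* v 1)) refl)
    (≤-trans (*-monoˡ (sq-nn L) (≤-trans (tri-cauchy x y z) (*-mono (‖‖-nn x) (≤-trans (‖‖-nn y) b ⊛ ≤-trans (‖‖-nn z) c) a (*-mono (‖‖-nn y) (≤-trans (‖‖-nn z) c) b c)))) q))

  module _ (big : ι 3 < nF) where

    private
      big2 : ι 2 < nF
      big2 = ≤-<-trans (ι-mono {2} {3} (ℕ.n≤1+n 2)) big
      n-pos = nF-pos big

    ind-≤1 : ∀ {f} → Indicator f → ∀ g → f g ≤ 1#
    ind-≤1 (indicator s d) g = ≡-≤ (d g) ([]≤1 (s g))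

    ind-nn : ∀ {f} → Indicator f → ∀ g → 0# ≤ f g
    ind-nn (indicator s d) g = ≤-≡ ([]-nn (s g)) (sym (d g))

    dens-nn : ∀ {f} → Indicator f → 0# ≤ dens f
    dens-nn I = ∑-nn Gs (ind-nn I) ⊛ inv-nn N-pos

    dens≤1 : ∀ {f} → Indicator f → dens f ≤ 1#
    dens≤1 I = ≤-≡ (*-monoʳ (inv-nn N-pos) (≤-≡ (∑-mono Gs (ind-≤1 I)) N-1)) (*-inv⁺ N-pos)

    cnt-nn : ∀ {f} → Indicator f → ∀ i j → 0# ≤ cnt f i j
    cnt-nn I i j = ∑-nn Gs λ g → ind-nn I g ⊛ []-nn _

    P-nn : ∀ {f} → Indicator f → ∀ i j → 0# ≤ P f i j
    P-nn I i j = <⇒≤ n-pos ⊛ (cnt-nn I i j ⊛ inv-nn N-pos)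

    P≤1 : ∀ {f} → Indicator f → ∀ i j → P f i j ≤ 1#
    P≤1 {f} I i j = ≤-≡ (*-monoˡ (<⇒≤ n-pos) (≡-≤ (sym (∑-*ʳ Gs (recip N) _))
        (∑-mono Gs λ g → ≤-≡ (*-monoʳ (inv-nn N-pos) (≤-≡ (*-monoʳ ([]-nn _) (ind-≤1 I g)) (*-identityˡ _))) (trans (*-comm _ _) (cong (_* [ g ▹ i == j ]) (sym (e-full g)))))))
      (pr-in {full} {i} {j} refl refl big2)

    dev≤1 : ∀ {f} → Indicator f → ∀ i j → dev f i j ≤ 1#
    dev≤1 {f} I i j = ≤-trans (by (P f i j ∷ dens f ∷ []) (v 0 :- v 1) (v 0) (v 1) (dens-nn I) refl) (P≤1 I i j)

    neg-≤ : ∀ {f} → Indicator f → ∀ i j → (- dev f i j) ⁺ ≤ dens f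
    neg-≤ {f} I i j = ⁺-least (dens-nn I) (by (P f i j ∷ dens f ∷ []) (:- (v 0 :- v 1)) (v 1) (v 0) (P-nn I i j) refl)

    pos-≤ : ∀ {f} → Indicator f → ∀ i j → dev f i j ⁺ ≤ P f i j
    pos-≤ {f} I i j = ⁺-least (P-nn I i j) (by (P f i j ∷ dens f ∷ []) (v 0 :- v 1) (v 0) (v 1) (dens-nn I) refl)

    -- Translating j back to x leaves the stabiliser of x, under which the image of i is uniform on
    -- the other n - 1 points.
    pairs≤ : ∀ x i j k → i ≢ x → nF * ((nF - 1#) * (∑ Gs (λ g → [ g ▹ x == j ] * [ g ▹ i == k ]) * recip N)) ≤ 1#
    pairs≤ x i j k i≢x with k Fin.≟ j
    ... | yes refl = ≡-≤ (*0ʳ (*0ʳ (*0ˡ (trans (∑-cong Gs none) (∑-0 Gs))))) 0≤1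
      where
      none : ∀ g → [ g ▹ x == k ] * [ g ▹ i == k ] ≡ 0#
      none g with g ▹ x Fin.≟ k
      ... | no p     = *0ˡ ([]-false (≢⇒== p))
      ... | yes p    = *0ʳ ([]-false (≢⇒== λ q → i≢x (▹-inj g (trans q (sym p)))))
    ... | no k≢j with move {full} {x} {j} refl refl big2
    ...   | c , _ , cx = ≤-reflexive (trans (cong (λ z → nF * ((nF - 1#) * (z * recip N))) count)
            (trans (solve (nF ∷ nF - 1# ∷ ∣A∣ W ∷ pr W i l ∷ recip N ∷ []) (v 0 :* (v 1 :* (v 2 :* v 3 :* v 4))) (v 0 :* v 2 :* v 4 :* (v 1 :* v 3)) refl)
            (trans (cong₂ (λ a b → a * recip N * b) (A-index {full} {x} refl big2) (trans (cong (_* pr W i l) (sym W-size)) (pr-in {W} {i} {l} (∖-in {full} refl i≢x) (∖-in {full} refl l≢x) W-big)))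
            (trans (cong (_* 1#) (*-inv⁺ N-pos)) (*-identityˡ 1#)))))
      where
      W = full ∖ x
      l = c ⁻¹ ▹ k
      l≢x : l ≢ x
      l≢x e = k≢j (trans (sym (▹-⁻¹ʳ c k)) (trans (cong (c ▹_) e) cx))
      W-size : ∣ W ∣ ≡ nF - 1#
      W-size = card-∖ {full} {x} refl
      W-big : ι 2 < ∣ W ∣
      W-big q = big (by (nF ∷ []) (v 0) (# 3) (# 2 :- (v 0 :- # 1)) ⟪ ≡-≤ (sym W-size) q ⟫ refl)
      count : ∑ Gs (λ g → [ g ▹ x == j ] * [ g ▹ i == k ]) ≡ ∣A∣ W * pr W i l
      count = trans (sym (shiftˡ c _)) (trans (∑-cong Gs λ h → trans (cong₂ (λ a b → [ a ] * [ b ]) (trans (cong₂ _==_ (▹-∙ c h x) (sym cx)) (==-▹ c _ x)) (trans (cong₂ _==_ (▹-∙ c h i) (sym (▹-⁻¹ʳ c k))) (==-▹ c _ l)))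
          (trans (cong (λ b → [ b ] * [ h ▹ i == l ]) (sym (trans (inA-∖ {full} {x} {h} refl) (cong (_∧ (h ▹ x == x)) (inA-full h)))))
          (trans (sym (*1ˡ (*-inv⁺ (A-pos W)))) (trans (solve (∣A∣ W ∷ recip (∣A∣ W) ∷ [ inA W h ] ∷ [ h ▹ i == l ] ∷ []) (v 0 :* v 1 :* (v 2 :* v 3)) (v 0 :* (v 2 :* v 1 :* v 3)) refl)
            (cong (λ z → ∣A∣ W * (z * [ h ▹ i == l ])) (sym (e-def W h)))))))
        (∑-*ˡ Gs (∣A∣ W) _))

    module Levels {m : F} (k : ℕ) (m-big : ι 9 * (ι (suc k ℕ.+ suc k) * ι (suc k ℕ.+ suc k)) ≤ m) (R : ℕ) (R≤m : ι (suc R) ≤ m) (m≥128 : ι 128 ≤ m)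
      (n²≤ : nF * nF ≤ pow (ι 2) R) where
      open Tails big {m} k m-big public

      -- Dyadic levels from t₀ = α/n up to 1: entries below t₀ contribute at most n² t₀² = α², and
      -- each of the R levels at most 128 m² n α(α + M) by `level-set`. The count R and the
      -- constants disappear in m⁴.
      lo-norm : ∀ {f} → Indicator f → Dense f → 1# ≤ nF * dens f → ∀ {M} → 0# ≤ M →
        ‖ (λ i j → lo M (dev f i j)) ‖² ≤ pow m 4 * (nF * (dens f * (dens f + M)))
      lo-norm {f} If Df fat {M} M-nn = ≤-trans (Σ²-mono λ i j → point R (dev f i j) (≤-trans (dev≤1 If i j) top)) (≤-trans (total R) final)
        where
        α = dens f
        α-nn = dens-nn If
        t₀ : F
        t₀ = α * recip nF
        nt₀ : nF * t₀ ≡ α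
        nt₀ = trans (solve (nF ∷ α ∷ recip nF ∷ []) (v 0 :* (v 1 :* v 2)) (v 1 :* (v 0 :* v 2)) refl) (*1ʳ (*-inv⁺ n-pos))
        t : ℕ → F
        t r = pow (ι 2) r * t₀
        t-pos : ∀ r → 0# < t r
        t-pos r = *-pos (pow-pos r (ι-pos 1)) (*-pos (dens-pos Df) (inv-pos n-pos))
        -- This is where 2^R ≥ n² and nα ≥ 1 enter: R doublings lead from α/n past the largest
        -- possible deviation.
        top : 1# ≤ t R
        top = *-cancelˡ n-pos (≤-≡ (≤-trans (*-monoˡ (<⇒≤ n-pos) fat) (≡-≤ (sym (*-assoc _ _ _)) (*-monoʳ α-nn n²≤)))
          (trans (cong (pow (ι 2) R *_) (sym nt₀)) (solve (pow (ι 2) R ∷ nF ∷ t₀ ∷ []) (v 0 :* (v 1 :* v 2)) (v 1 :* (v 0 :* v 2)) refl)))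
        level : ℕ → F → Bool
        level r x = test (t r) x ∧ test x M
        maj : ℕ → F → F
        maj zero    x = t₀ * t₀
        maj (suc r) x = maj r x + ι 4 * (t r * t r) * [ level r x ]
        point : ∀ r x → x ≤ t r → lo M x * lo M x ≤ maj r x
        point zero    x p = *-mono (lo-nn M x) t-nn le le
          where
          t-nn = α-nn ⊛ inv-nn n-pos
          le : lo M x ≤ t₀
          le = ≤-trans (≤-≡ (*-monoʳ (⁺-nn x) ([]≤1 _)) (*-identityˡ _)) (⁺-least t-nn (≤-≡ p (*-identityˡ _)))
        point (suc r) x p = split (≤-total x (t r)) (bool (test x M))
          where
          step-nn : 0# ≤ ι 4 * (t r * t r) * [ level r x ]
          step-nn = ι-nn 4 ⊛ sq-nn (t r) ⊛ []-nn _
          maj-nn : ∀ r → 0# ≤ maj r x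
          maj-nn zero    = sq-nn t₀
          maj-nn (suc r) = maj-nn r ⊹ (ι-nn 4 ⊛ sq-nn (t r) ⊛ []-nn _)
          split : x ≤ t r ⊎ t r ≤ x → test x M ≡ true ⊎ test x M ≡ false → lo M x * lo M x ≤ maj r x + ι 4 * (t r * t r) * [ level r x ]
          split (inj₁ q) _ = ≤-trans (point r x q) (by (maj r x ∷ ι 4 * (t r * t r) * [ level r x ] ∷ []) (v 0) (v 0 :+ v 1) (v 1) step-nn refl)
          split (inj₂ q) (inj₂ s) = ≡-≤ (*0ˡ (*0ˡ ([]-false s))) (maj-nn (suc r))
          split (inj₂ q) (inj₁ s) = ≤-trans (*-mono (lo-nn M x) (ι-nn 2 ⊛ <⇒≤ (t-pos r)) le le)
              (≡-≤ (trans (solve (t r ∷ []) (# 2 :* v 0 :* (# 2 :* v 0)) (# 4 :* (v 0 :* v 0)) refl) (sym (*1ʳ ([]-true (cong₂ _∧_ (test-true q) s)))))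
                (by (maj r x ∷ ι 4 * (t r * t r) * [ level r x ] ∷ []) (v 1) (v 0 :+ v 1) (v 0) (maj-nn r) refl))
            where
            le : lo M x ≤ ι 2 * t r
            le = ≡-≤ (*1ˡ ([]-true s)) (⁺-least (ι-nn 2 ⊛ <⇒≤ (t-pos r)) (≤-≡ p (*-assoc _ _ _)))
        D : F
        D = nF * (α * (α + M))
        D-nn : 0# ≤ D
        D-nn = <⇒≤ n-pos ⊛ (α-nn ⊛ (α-nn ⊹ M-nn))
        total : ∀ r → Σ² (λ i j → maj r (dev f i j)) ≤ (1# + ι r * (ι 128 * (m * m))) * D
        total zero = ≡-≤ (trans (∑-cong Fs λ i → ∑-const _) (trans (∑-const _) (trans (solve (nF ∷ t₀ ∷ []) (v 0 :* (v 0 :* (v 1 :* v 1))) (v 0 :* v 1 :* (v 0 :* v 1)) refl) (cong₂ _*_ nt₀ nt₀))))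
          (by (α ∷ nF ∷ M ∷ m ∷ []) (v 0 :* v 0) ((# 1 :+ # 0 :* (# 128 :* (v 3 :* v 3))) :* (v 1 :* (v 0 :* (v 0 :+ v 2)))) ((v 1 :- # 1) :* (v 0 :* v 0) :+ v 1 :* (v 0 :* v 2))
            (⟪ ≤-trans (ι-mono {1} {3} (ℕ.s≤s ℕ.z≤n)) (<⇒≤ big) ⟫ ⊛ sq-nn α ⊹ <⇒≤ n-pos ⊛ (α-nn ⊛ M-nn)) refl)
        total (suc r) = ≡-≤ (trans (Σ²-+ _ _) (cong (Σ² (λ i j → maj r (dev f i j)) +_) (Σ²-* _ _))) (≤-≡ (+-mono (total r) (≡-≤ (*-assoc _ _ _) (*-monoˡ (ι-nn 4) bound)))
            (trans (solve (ι r ∷ m ∷ D ∷ []) ((# 1 :+ v 0 :* (# 128 :* (v 1 :* v 1))) :* v 2 :+ # 4 :* (# 32 :* (v 1 :* v 1 :* v 2))) ((# 1 :+ (# 1 :+ v 0) :* (# 128 :* (v 1 :* v 1))) :* v 2) refl)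
              (cong (λ z → (1# + z * (ι 128 * (m * m))) * D) (sym (ι-suc r)))))
          where
          bound : t r * t r * Σ² (λ i j → [ level r (dev f i j) ]) ≤ ι 32 * (m * m * D)
          bound with t r ≤? M
          ... | yes p = ≤-trans (level-set If Df (λ i j → level r (dev f i j)) (t-pos r) (λ i j q → test-≤ (proj₁ (∧-true q))))
                (*-monoˡ (ι-nn 32) (*-monoˡ (sq-nn m) (*-monoˡ (<⇒≤ n-pos) (*-monoˡ α-nn (+-mono ≤-refl p)))))
          ... | no  p = ≡-≤ (*0ʳ (trans (Σ²-cong λ i j → []-false (empty (dev f i j))) (trans (∑-cong Fs λ i → ∑-0 Fs) (∑-0 Fs)))) (ι-nn 32 ⊛ (sq-nn m ⊛ D-nn))
            where
            empty : ∀ x → level r x ≡ false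
            empty x with bool (test (t r) x) | bool (test x M)
            ... | inj₂ a | _      = cong (_∧ _) a
            ... | inj₁ a | inj₂ b = cong₂ _∧_ a b
            ... | inj₁ a | inj₁ b = ⊥-elim (p (≤-trans (test-≤ a) (test-≤ b)))
        final : (1# + ι R * (ι 128 * (m * m))) * D ≤ pow m 4 * D
        final = *-monoʳ D-nn (by (m ∷ ι R ∷ []) (# 1 :+ v 1 :* (# 128 :* (v 0 :* v 0))) (v 0 :* (v 0 :* (v 0 :* (v 0 :* # 1))))
          ((v 0 :- # 128) :* (v 0 :* v 0 :* v 0) :+ # 128 :* (v 0 :* v 0) :* (v 0 :- (# 1 :+ v 1)) :+ # 127 :* (v 0 :* v 0) :+ (v 0 :- # 1) :* v 0 :+ (v 0 :- # 1))
          (⟪ m≥128 ⟫ ⊛ (m-nn ⊛ m-nn ⊛ m-nn) ⊹ ι-nn 128 ⊛ sq-nn m ⊛ ⟪ ≡-≤ (sym (ι-suc R)) R≤m ⟫ ⊹ ι-nn 127 ⊛ sq-nn m ⊹ ⟪ 1≤m ⟫ ⊛ m-nn ⊹ ⟪ 1≤m ⟫) refl)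

      pos-norm : ∀ {f} → Indicator f → Dense f → 1# ≤ nF * dens f → ‖ (λ i j → dev f i j ⁺) ‖² ≤ ι 2 * (pow m 4 * (nF * dens f))
      pos-norm {f} If Df fat = ≡-≤ (Σ²-cong λ i j → cong₂ _*_ (sym (lo-≤ (dev≤1 If i j))) (sym (lo-≤ (dev≤1 If i j)))) (≤-trans (lo-norm If Df fat 0≤1)
        (by (pow m 4 ∷ nF ∷ dens f ∷ []) (v 0 :* (v 1 :* (v 2 :* (v 2 :+ # 1)))) (# 2 :* (v 0 :* (v 1 :* v 2))) (v 0 :* (v 1 :* v 2) :* (# 1 :- v 2))
          (pow-nn 4 m-nn ⊛ (<⇒≤ n-pos ⊛ dens-nn If) ⊛ ⟪ dens≤1 If ⟫) refl))

-- The trilinear inequality with thresholds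

module Regularity (𝔽 : OrderedField) {n : ℕ} (𝔾 : PermGroup n) where
  open Sums 𝔽
  open Arithmetic 𝔽
  open GroupAlgebra 𝔽 𝔾
  open Averages 𝔽 𝔾
  open Projections 𝔽 𝔾
  open Densities 𝔽 𝔾
  open PositivePart 𝔽
  open Truncation 𝔽
  open Concentration 𝔽 𝔾
  open Deviations 𝔽 𝔾
  open LevelSums 𝔽 𝔾
  open Equality (fins n)

  -- The numerical scales: m is the dominating small parameter, R counts dyadic levels, d is a lower bound for all
  -- densities, T and m⁴ control the thresholds and the error terms, and κ is the loss in the second-level estimate.
  record Scale : Set where
    field
      big     : ι 3 < nF
      m       : F
      k       : ℕ
      m-big   : ι 9 * (ι (suc k ℕ.+ suc k) * ι (suc k ℕ.+ suc k)) ≤ m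
      R       : ℕ
      R≤m     : ι (suc R) ≤ m
      m≥128   : ι 128 ≤ m
      n²≤     : nF * nF ≤ pow (ι 2) R
      T d     : F
      T-big   : ι 64 * (m * m * (pow m 4 * pow m 4 * (pow m 4 * pow m 4))) ≤ T
      d-dense : 1# ≤ pow m (suc k) * d
      d-fat   : ι 64 * (m * m * T) ≤ nF * d
      -- This and `κ-d` are the conditions that force densities above n^(-2/3). It is used in
      -- `light`, to make the set J of large entries sparse enough.
      d-pair  : ι 64 * m * (T * T) ≤ nF * nF * (d * d * d)
      s κ     : F
      s-big   : ι 9 < s
      κ-nn    : 0# ≤ κ
      κ-s     : ι 3 ≤ κ * ((s - ι 2) * (s - ι 2))
      bs      : List (Block s)
      ds      : AllPairs (λ b b′ → Disjoint (Block.U b) (Block.U b′)) bs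
      κ-2     : 1# ≤ pow (ι 2) (length bs) * κ
      κ-d     : κ * (pow m 4 * pow m 4) ≤ d * d * d

  module Gain (S : Scale) where
    open Scale S public
    open Levels big {m} k m-big R R≤m m≥128 n²≤ public

    n-pos : 0# < nF
    n-pos = nF-pos big

    n-nn : 0# ≤ nF
    n-nn = <⇒≤ n-pos

    m-pos : 0# < m
    m-pos = <-≤-trans 0<1 1≤m

    ℓ : F
    ℓ = pow m 4

    ℓ-pos : 0# < ℓ
    ℓ-pos = pow-pos 4 m-pos

    ℓ-nn : 0# ≤ ℓ
    ℓ-nn = <⇒≤ ℓ-pos

    1≤* : ∀ {x y} → 1# ≤ x → 1# ≤ y → 1# ≤ x * y
    1≤* p q = ≡-≤ (sym (*-identityˡ 1#)) (*-mono 0≤1 (≤-trans 0≤1 q) p q)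

    ≤-*ʳ : ∀ {x y} → 0# ≤ x → 1# ≤ y → x ≤ x * y
    ≤-*ʳ p q = ≡-≤ (sym (*-identityʳ _)) (*-monoˡ p q)

    1≤ℓ : 1# ≤ ℓ
    1≤ℓ = 1≤* 1≤m (1≤* 1≤m (1≤* 1≤m (1≤* 1≤m ≤-refl)))

    128≤ℓ : ι 128 ≤ ℓ
    128≤ℓ = ≤-trans m≥128 (≤-*ʳ m-nn (1≤* 1≤m (1≤* 1≤m (1≤* 1≤m ≤-refl))))

    1≤T : 1# ≤ T
    1≤T = ≤-trans (1≤* (ι-mono {1} {64} (ℕ.s≤s ℕ.z≤n)) (1≤* (1≤* 1≤m 1≤m) (1≤* (1≤* 1≤ℓ 1≤ℓ) (1≤* 1≤ℓ 1≤ℓ)))) T-big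

    T-pos : 0# < T
    T-pos = <-≤-trans 0<1 1≤T

    T-nn : 0# ≤ T
    T-nn = <⇒≤ T-pos

    d-pos : 0# < d
    d-pos p = 1≰0 (≤-trans d-dense (≤-≡ (*-monoˡ (pow-nn (suc k) m-nn) p) (zeroʳ _)))

    d-nn : 0# ≤ d
    d-nn = <⇒≤ d-pos

    record Large (f : Alg) : Set where
      constructor large
      field
        ind   : Indicator f
        above : d ≤ dens f
    open Large public

    dense : ∀ {f} → Large f → Dense f
    dense {f} (large _ p) = ≤-≡ (≤-≡ (≤-*ʳ (<⇒≤ N-pos) (≤-trans d-dense (*-monoˡ (pow-nn (suc k) m-nn) p)))
      (solve (N ∷ pow m (suc k) ∷ dens f ∷ []) (v 0 :* (v 1 :* v 2)) (v 1 :* (v 0 :* v 2)) refl)) (cong (pow m (suc k) *_) (sym (tot-dens f)))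

    dens⁺ : ∀ {f} → Large f → 0# < dens f
    dens⁺ (large _ p) = <-≤-trans d-pos p

    T≤ : ∀ {x} → d ≤ x → T ≤ nF * x
    T≤ {x} p = ≤-trans (≤-*ʳ T-nn (1≤* (ι-mono {1} {64} (ℕ.s≤s ℕ.z≤n)) (1≤* 1≤m 1≤m))) (≡-≤ (solve (T ∷ m ∷ []) (v 0 :* (# 64 :* (v 1 :* v 1))) (# 64 :* (v 1 :* v 1 :* v 0)) refl)
      (≤-trans d-fat (*-monoˡ n-nn p)))

    fat : ∀ {f} → Large f → 1# ≤ nF * dens f
    fat (large _ p) = ≤-trans 1≤T (T≤ p)

    thr : F → F → F
    thr β δ = nF * (β * δ) * recip T

    thr-nn : ∀ {β δ} → 0# ≤ β → 0# ≤ δ → 0# ≤ thr β δ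
    thr-nn p q = n-nn ⊛ (p ⊛ q) ⊛ inv-nn T-pos

    T-thr : ∀ β δ → T * thr β δ ≡ nF * (β * δ)
    T-thr β δ = trans (solve (T ∷ nF * (β * δ) ∷ recip T ∷ []) (v 0 :* (v 1 :* v 2)) (v 1 :* (v 0 :* v 2)) refl) (*1ʳ (*-inv⁺ T-pos))

    thr-sym : ∀ β δ → thr β δ ≡ thr δ β
    thr-sym β δ = cong (λ z → nF * z * recip T) (*-comm β δ)

    thr-mono : ∀ {β δ β′ δ′} → 0# ≤ β → 0# ≤ δ′ → β ≤ β′ → δ ≤ δ′ → thr β δ ≤ thr β′ δ′
    thr-mono p q r s = *-monoʳ (inv-nn T-pos) (*-monoˡ n-nn (*-mono p q r s))

    dens≤thr : ∀ {β δ} → 0# ≤ β → d ≤ δ → β ≤ thr β δ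
    dens≤thr {β} {δ} p q = *-cancelˡ T-pos (≤-≡ (*-monoʳ p (T≤ q)) (trans (solve (nF ∷ β ∷ δ ∷ []) (v 0 :* v 2 :* v 1) (v 0 :* (v 1 :* v 2)) refl) (sym (T-thr β δ))))

    -- The size which, by `deficit`, the negative trilinear sum must nearly reach if there are no
    -- solutions.
    X : F → F → F → F
    X α β δ = nF * nF * (α * β * δ)

    private
      -- Bounds for the squared norms of the negative part, the positive part and, below, the
      -- positive part cut off at M.
      A⁻ A⁺ : F → F
      A⁻ α = ι 16 * (m * m * (nF * (α * α)))
      A⁺ α = ι 2 * (ℓ * (nF * α))
      A° : F → F → F
      A° β M = ℓ * (nF * (β * (β + M)))

      -- Multiplication by T turns the threshold into nβδ, and T β ≤ nβδ as well. `T-big` is the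
      -- exact price of the remaining factor 64 m² ℓ⁴.
      err : ∀ {α β δ M} → 0# ≤ α → 0# ≤ β → d ≤ δ → M ≡ thr β δ → ℓ * ℓ * (A⁻ α * (A° β M * A⁺ δ)) ≤ X α β δ * X α β δ
      err {α} {β} {δ} {M} a b c refl = *-cancelˡ T-pos (≤-trans
        (≤-reflexive (trans (solve (T ∷ ℓ ∷ m ∷ nF ∷ α ∷ β ∷ δ ∷ M ∷ [])
            (v 0 :* (v 1 :* v 1 :* (# 16 :* (v 2 :* v 2 :* (v 3 :* (v 4 :* v 4))) :* (v 1 :* (v 3 :* (v 5 :* (v 5 :+ v 7))) :* (# 2 :* (v 1 :* (v 3 :* v 6)))))))
            (# 32 :* (v 2 :* v 2 :* (v 1 :* v 1 :* (v 1 :* v 1))) :* (v 3 :* (v 3 :* v 3) :* (v 4 :* v 4 :* (v 5 :* v 6))) :* (v 0 :* v 5 :+ v 0 :* v 7)) refl)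
          (cong (λ z → ι 32 * (m * m * (ℓ * ℓ * (ℓ * ℓ))) * (nF * (nF * nF) * (α * α * (β * δ))) * (T * β + z)) (T-thr β δ))))
        (≤-trans (*-monoˡ (ι-nn 32 ⊛ (sq-nn m ⊛ (sq-nn ℓ ⊛ sq-nn ℓ)) ⊛ (n-nn ⊛ sq-nn nF ⊛ (sq-nn α ⊛ (b ⊛ δ-nn)))) (+-mono (*-monoʳ b (T≤ c)) ≤-refl))
        (≡-≤ (solve (ℓ ∷ m ∷ nF ∷ α ∷ β ∷ δ ∷ [])
            (# 32 :* (v 1 :* v 1 :* (v 0 :* v 0 :* (v 0 :* v 0))) :* (v 2 :* (v 2 :* v 2) :* (v 3 :* v 3 :* (v 4 :* v 5))) :* (v 2 :* v 5 :* v 4 :+ v 2 :* (v 4 :* v 5)))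
            (# 64 :* (v 1 :* v 1 :* (v 0 :* v 0 :* (v 0 :* v 0))) :* (v 2 :* v 2 :* (v 3 :* v 4 :* v 5) :* (v 2 :* v 2 :* (v 3 :* v 4 :* v 5)))) refl)
          (*-monoʳ (sq-nn _) T-big))))
        where
        δ-nn = ≤-trans d-nn c

      -- Three negative parts give n³(αβδ)² against n⁴(αβδ)²; the spare factor n exceeds T.
      err₀ : ∀ {α β δ} → α ≤ 1# → d ≤ α → ℓ * ℓ * (A⁻ α * (A⁻ β * A⁻ δ)) ≤ X α β δ * X α β δ
      err₀ {α} {β} {δ} a b = ≤-trans
        (≤-reflexive (solve (ℓ ∷ m ∷ nF ∷ α ∷ β ∷ δ ∷ [])
            (v 0 :* v 0 :* (# 16 :* (v 1 :* v 1 :* (v 2 :* (v 3 :* v 3))) :* (# 16 :* (v 1 :* v 1 :* (v 2 :* (v 4 :* v 4))) :* (# 16 :* (v 1 :* v 1 :* (v 2 :* (v 5 :* v 5)))))))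
            (# 64 :* (v 1 :* v 1 :* (v 0 :* v 0)) :* (# 64 :* (v 1 :* v 1 :* (v 1 :* v 1))) :* (v 2 :* v 2 :* v 2 :* (v 3 :* v 4 :* v 5 :* (v 3 :* v 4 :* v 5)))) refl))
        (≤-≡ (*-monoʳ (n-nn ⊛ n-nn ⊛ n-nn ⊛ sq-nn _) (≤-trans (*-monoˡ (ι-nn 64 ⊛ (sq-nn m ⊛ sq-nn ℓ)) 64m⁴) (≡-≤ (solve (ℓ ∷ m ∷ []) (# 64 :* (v 1 :* v 1 :* (v 0 :* v 0)) :* (v 0 :* v 0)) (# 64 :* (v 1 :* v 1 :* (v 0 :* v 0 :* (v 0 :* v 0)))) refl)
            (≤-trans T-big (≤-trans (T≤ b) (≤-≡ (*-monoˡ n-nn a) (*-identityʳ nF)))))))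
          (solve (nF ∷ α * β * δ ∷ []) (v 0 :* (v 0 :* v 0 :* v 0 :* (v 1 :* v 1))) (v 0 :* v 0 :* v 1 :* (v 0 :* v 0 :* v 1)) refl))
        where
        64m⁴ : ι 64 * (m * m * (m * m)) ≤ ℓ * ℓ
        64m⁴ = ≡-≤ (solve (m ∷ []) (# 64 :* (v 0 :* v 0 :* (v 0 :* v 0))) (# 64 :* (v 0 :* (v 0 :* (v 0 :* (v 0 :* # 1))))) refl) (*-monoʳ ℓ-nn (≤-trans (ι-mono {64} {128} (ℕ.m≤m+n 64 64)) 128≤ℓ))

    big-dev : Alg → F → Matrix
    big-dev f M i j = hi M (dev f i j)

    -- Only the index i is restricted. In `Pair` the row i = x is computed exactly, and the other
    -- rows are estimated.
    weight : Points → (Fin n → Fin n → Fin n → F) → F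
    weight ρ s = Σ³ λ i j k → [ ρ i ] * s i j k

    heavy : (f g h : Alg) → Points → F
    heavy f g h ρ = dens f * weight ρ (λ i j k → big-dev g M₁ i j * big-dev h M₁ i k)
                  + dens g * weight ρ (λ i j k → big-dev f M₂ j k * big-dev h M₂ i k)
                  + dens h * weight ρ (λ i j k → big-dev f M₃ j k * big-dev g M₃ i j)
      where
      M₁ = thr (dens g) (dens h)
      M₂ = thr (dens f) (dens h)
      M₃ = thr (dens f) (dens g)

    triple : (f g h : Alg) → Fin n → Fin n → Fin n → F
    triple f g h i j k = dev f j k * (dev g i j * dev h i k)

    -- The three heavy terms of `minus-product` are kept. Each of the other seven has a negative
    -- part together with a truncated or a further negative one, and `tri-bound` makes it at most
    -- X/ℓ.
    gain : ∀ {f g h} → Large f → Large g → Large h → ∀ ρ →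
      ℓ * - weight ρ (triple f g h) ≤ ℓ * heavy f g h ρ + ι 7 * X (dens f) (dens g) (dens h)
    gain {f} {g} {h} Lf Lg Lh ρ = ≤-trans (*-monoˡ ℓ-nn (≡-≤ negate (≤-≡ (Σ³-mono pointwise) collect)))
        (≡-≤ (solve (ℓ ∷ heavy f g h ρ ∷ e₀ ∷ e₁ ∷ e₂ ∷ e₃ ∷ e₄ ∷ e₅ ∷ e₆ ∷ []) (v 0 :* (v 1 :+ (v 2 :+ (v 3 :+ v 4) :+ (v 5 :+ v 6) :+ (v 7 :+ v 8))))
            (v 0 :* v 1 :+ (v 0 :* v 2 :+ (v 0 :* v 3 :+ v 0 :* v 4) :+ (v 0 :* v 5 :+ v 0 :* v 6) :+ (v 0 :* v 7 :+ v 0 :* v 8))) refl)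
        (≤-≡ (+-mono ≤-refl (+-mono (+-mono (+-mono b₀ (+-mono b₁ b₂)) (+-mono b₃ b₄)) (+-mono b₅ b₆)))
          (solve (ℓ * heavy f g h ρ ∷ X α β δ ∷ []) (v 0 :+ (v 1 :+ (v 1 :+ v 1) :+ (v 1 :+ v 1) :+ (v 1 :+ v 1))) (v 0 :+ # 7 :* v 1) refl)))
      where
      α = dens f
      β = dens g
      δ = dens h
      If = ind Lf
      Ig = ind Lg
      Ih = ind Lh
      α-nn = dens-nn big If
      β-nn = dens-nn big Ig
      δ-nn = dens-nn big Ih
      M₁ = thr β δ
      M₂ = thr α δ
      M₃ = thr α β
      X-nn : 0# ≤ X α β δ
      X-nn = n-nn ⊛ n-nn ⊛ (α-nn ⊛ β-nn ⊛ δ-nn)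
      pos : Alg → Matrix
      pos f i j = dev f i j ⁺
      low : Alg → F → Matrix
      low f M i j = lo M (dev f i j)
      e₀ e₁ e₂ e₃ e₄ e₅ e₆ : F
      e₀ = tri (neg f) (neg g) (neg h)
      e₁ = tri (neg f) (low g M₁) (pos h)
      e₂ = tri (neg f) (pos g) (low h M₁)
      e₃ = tri (low f M₂) (neg g) (pos h)
      e₄ = tri (pos f) (neg g) (low h M₂)
      e₅ = tri (low f M₃) (pos g) (neg h)
      e₆ = tri (pos f) (low g M₃) (neg h)
      rest : Fin n → Fin n → Fin n → F
      rest i j k = neg f j k * (neg g i j * neg h i k) + (neg f j k * (low g M₁ i j * pos h i k) + neg f j k * (pos g i j * low h M₁ i k))
        + (low f M₂ j k * (neg g i j * pos h i k) + pos f j k * (neg g i j * low h M₂ i k)) + (low f M₃ j k * (pos g i j * neg h i k) + pos f j k * (low g M₃ i j * neg h i k))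
      rest-nn : ∀ i j k → 0# ≤ rest i j k
      rest-nn i j k = ⁺-nn _ ⊛ (⁺-nn _ ⊛ ⁺-nn _) ⊹ (⁺-nn _ ⊛ (lo-nn M₁ _ ⊛ ⁺-nn _) ⊹ ⁺-nn _ ⊛ (⁺-nn _ ⊛ lo-nn M₁ _))
        ⊹ (lo-nn M₂ _ ⊛ (⁺-nn _ ⊛ ⁺-nn _) ⊹ ⁺-nn _ ⊛ (⁺-nn _ ⊛ lo-nn M₂ _)) ⊹ (lo-nn M₃ _ ⊛ (⁺-nn _ ⊛ ⁺-nn _) ⊹ ⁺-nn _ ⊛ (lo-nn M₃ _ ⊛ ⁺-nn _))
      h₁ h₂ h₃ : Fin n → Fin n → Fin n → F
      h₁ i j k = big-dev g M₁ i j * big-dev h M₁ i k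
      h₂ i j k = big-dev f M₂ j k * big-dev h M₂ i k
      h₃ i j k = big-dev f M₃ j k * big-dev g M₃ i j
      negate : - weight ρ (triple f g h) ≡ Σ³ λ i j k → [ ρ i ] * - triple f g h i j k
      negate = trans (solve (weight ρ (triple f g h) ∷ []) (:- v 0) ((:- # 1) :* v 0) refl) (trans (sym (Σ³-* (- 1#) _)) (Σ³-cong λ i j k → solve ([ ρ i ] ∷ triple f g h i j k ∷ []) ((:- # 1) :* (v 0 :* v 1)) (v 0 :* (:- v 1)) refl))
      pointwise : ∀ i j k → [ ρ i ] * - triple f g h i j k ≤ α * ([ ρ i ] * h₁ i j k) + β * ([ ρ i ] * h₂ i j k) + δ * ([ ρ i ] * h₃ i j k) + rest i j k
      pointwise i j k = ≤-trans (*-monoˡ ([]-nn (ρ i)) (minus-product M₁ M₂ M₃ (neg-≤ big If j k) (neg-≤ big Ig i j) (neg-≤ big Ih i k)))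
        (by ([ ρ i ] ∷ α ∷ β ∷ δ ∷ h₁ i j k ∷ h₂ i j k ∷ h₃ i j k ∷ rest i j k ∷ []) (v 0 :* (v 1 :* v 4 :+ v 2 :* v 5 :+ v 3 :* v 6 :+ v 7)) (v 1 :* (v 0 :* v 4) :+ v 2 :* (v 0 :* v 5) :+ v 3 :* (v 0 :* v 6) :+ v 7)
          ((# 1 :- v 0) :* v 7) (⟪ []≤1 (ρ i) ⟫ ⊛ rest-nn i j k) refl)
      collect : Σ³ (λ i j k → α * ([ ρ i ] * h₁ i j k) + β * ([ ρ i ] * h₂ i j k) + δ * ([ ρ i ] * h₃ i j k) + rest i j k) ≡ heavy f g h ρ + (e₀ + (e₁ + e₂) + (e₃ + e₄) + (e₅ + e₆))
      collect = trans (Σ³-+ _ _) (cong₂ _+_ (trans (Σ³-+ _ _) (cong₂ _+_ (trans (Σ³-+ _ _) (cong₂ _+_ (Σ³-* α _) (Σ³-* β _))) (Σ³-* δ _)))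
        (trans (Σ³-+ _ _) (cong₂ _+_ (trans (Σ³-+ _ _) (cong₂ _+_ (trans (Σ³-+ _ _) (cong (e₀ +_) (Σ³-+ _ _))) (Σ³-+ _ _))) (Σ³-+ _ _))))
      nf = neg-norm If (dense Lf)
      ng = neg-norm Ig (dense Lg)
      nh = neg-norm Ih (dense Lh)
      pf = pos-norm If (dense Lf) (fat Lf)
      pg = pos-norm Ig (dense Lg) (fat Lg)
      ph = pos-norm Ih (dense Lh) (fat Lh)
      lof : ∀ {M} → 0# ≤ M → ‖ low f M ‖² ≤ A° α M
      lof = lo-norm If (dense Lf) (fat Lf)
      log : ∀ {M} → 0# ≤ M → ‖ low g M ‖² ≤ A° β M
      log = lo-norm Ig (dense Lg) (fat Lg)
      loh : ∀ {M} → 0# ≤ M → ‖ low h M ‖² ≤ A° δ M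
      loh = lo-norm Ih (dense Lh) (fat Lh)
      conv₃ : ∀ {a b c x} → (a * b * c ≡ α * β * δ) → ∀ {z} → z ≡ x → x ≤ X a b c * X a b c → z ≤ X α β δ * X α β δ
      conv₃ e refl p = ≤-≡ p (cong (λ z → nF * nF * z * (nF * nF * z)) e)
      LL = ℓ * ℓ
      b₀ : ℓ * e₀ ≤ X α β δ
      b₀ = tri-bound (neg f) (neg g) (neg h) nf ng nh X-nn (err₀ (dens≤1 big If) (above Lf))
      b₁ : ℓ * e₁ ≤ X α β δ
      b₁ = tri-bound (neg f) (low g M₁) (pos h) nf (log (thr-nn β-nn δ-nn)) ph X-nn (err α-nn β-nn (above Lh) refl)
      b₂ : ℓ * e₂ ≤ X α β δ
      b₂ = tri-bound (neg f) (pos g) (low h M₁) nf pg (loh (thr-nn β-nn δ-nn)) X-nn (conv₃ {α} {δ} {β} (solve (α ∷ β ∷ δ ∷ []) (v 0 :* v 2 :* v 1) (v 0 :* v 1 :* v 2) refl)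
        (solve (LL ∷ A⁻ α ∷ A⁺ β ∷ A° δ M₁ ∷ []) (v 0 :* (v 1 :* (v 2 :* v 3))) (v 0 :* (v 1 :* (v 3 :* v 2))) refl) (err α-nn δ-nn (above Lg) (thr-sym β δ)))
      b₃ : ℓ * e₃ ≤ X α β δ
      b₃ = tri-bound (low f M₂) (neg g) (pos h) (lof (thr-nn α-nn δ-nn)) ng ph X-nn (conv₃ {β} {α} {δ} (solve (α ∷ β ∷ δ ∷ []) (v 1 :* v 0 :* v 2) (v 0 :* v 1 :* v 2) refl)
        (solve (LL ∷ A° α M₂ ∷ A⁻ β ∷ A⁺ δ ∷ []) (v 0 :* (v 1 :* (v 2 :* v 3))) (v 0 :* (v 2 :* (v 1 :* v 3))) refl) (err β-nn α-nn (above Lh) refl))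
      b₄ : ℓ * e₄ ≤ X α β δ
      b₄ = tri-bound (pos f) (neg g) (low h M₂) pf ng (loh (thr-nn α-nn δ-nn)) X-nn (conv₃ {β} {δ} {α} (solve (α ∷ β ∷ δ ∷ []) (v 1 :* v 2 :* v 0) (v 0 :* v 1 :* v 2) refl)
        (solve (LL ∷ A⁺ α ∷ A⁻ β ∷ A° δ M₂ ∷ []) (v 0 :* (v 1 :* (v 2 :* v 3))) (v 0 :* (v 2 :* (v 3 :* v 1))) refl) (err β-nn δ-nn (above Lf) (thr-sym α δ)))
      b₅ : ℓ * e₅ ≤ X α β δ
      b₅ = tri-bound (low f M₃) (pos g) (neg h) (lof (thr-nn α-nn β-nn)) pg nh X-nn (conv₃ {δ} {α} {β} (solve (α ∷ β ∷ δ ∷ []) (v 2 :* v 0 :* v 1) (v 0 :* v 1 :* v 2) refl)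
        (solve (LL ∷ A° α M₃ ∷ A⁺ β ∷ A⁻ δ ∷ []) (v 0 :* (v 1 :* (v 2 :* v 3))) (v 0 :* (v 3 :* (v 1 :* v 2))) refl) (err δ-nn α-nn (above Lg) refl))
      b₆ : ℓ * e₆ ≤ X α β δ
      b₆ = tri-bound (pos f) (low g M₃) (neg h) pf (log (thr-nn α-nn β-nn)) nh X-nn (conv₃ {δ} {β} {α} (solve (α ∷ β ∷ δ ∷ []) (v 2 :* v 1 :* v 0) (v 0 :* v 1 :* v 2) refl)
        (solve (LL ∷ A⁺ α ∷ A° β M₃ ∷ A⁻ δ ∷ []) (v 0 :* (v 1 :* (v 2 :* v 3))) (v 0 :* (v 3 :* (v 2 :* v 1))) refl) (err δ-nn β-nn (above Lf) (thr-sym α β)))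

    -- At λ′ = δ/(κℓ) the right side of `level-bound` is αβδ/ℓ + κℓ, and `κ-d` makes the second
    -- summand no larger than the first.
    deficit : ∀ {f g h} → Large f → Large g → Large h → ⟨ f ⋆ g , h ⟩ ≡ 0# →
      (ℓ - 1#) * X (dens f) (dens g) (dens h) ≤ ℓ * - Σ³ (triple f g h)
    deficit {f} {g} {h} Lf Lg Lh free = *-cancelˡ c-pos (≤-trans cX (≤-trans
        (by (ℓ ∷ αβδ ∷ c ∷ D ∷ []) ((v 0 :- # 1) :* v 1) (v 2 :* (v 0 :* (:- v 3))) (v 1 :- v 0 :* (v 1 :+ v 2 :* v 3)) ⟪ key ⟫ refl) ≤-refl))
      where
      αβδ = dens f * dens g * dens h
      D = Σ³ (triple f g h)
      n³ = nF * nF * nF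
      n³-pos : 0# < n³
      n³-pos = *-pos (*-pos n-pos n-pos) n-pos
      c = (nF - 1#) * recip n³
      n-1-pos : 0# < nF - 1#
      n-1-pos p = big (by (nF ∷ []) (v 0) (# 3) (# 2 :+ (# 0 :- (v 0 :- # 1))) (ι-nn 2 ⊹ ⟪ p ⟫) refl)
      c-pos : 0# < c
      c-pos = *-pos n-1-pos (inv-pos n³-pos)
      αβδ-pos : 0# < αβδ
      αβδ-pos = *-pos (*-pos (dens⁺ Lf) (dens⁺ Lg)) (dens⁺ Lh)
      cX : c * ((ℓ - 1#) * X (dens f) (dens g) (dens h)) ≤ (ℓ - 1#) * αβδ
      cX = ≤-≡ (by (nF ∷ recip n³ ∷ ℓ ∷ αβδ ∷ []) ((v 0 :- # 1) :* v 1 :* ((v 2 :- # 1) :* (v 0 :* v 0 :* v 3))) ((v 2 :- # 1) :* v 3 :* (v 0 :* v 0 :* v 0 :* v 1)) ((v 2 :- # 1) :* v 3 :* (v 0 :* v 0 :* v 1))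
          (⟪ 1≤ℓ ⟫ ⊛ <⇒≤ αβδ-pos ⊛ (sq-nn nF ⊛ inv-nn n³-pos)) refl) (*1ʳ (*-inv⁺ n³-pos))
      κ-pos : 0# < κ
      κ-pos p = 1≰0 (≤-trans κ-2 (≤-≡ (*-monoˡ (pow-nn (length bs) (ι-nn 2)) p) (zeroʳ _)))
      κℓ-pos : 0# < κ * ℓ
      κℓ-pos = *-pos κ-pos ℓ-pos
      λ′ = dens h * recip (κ * ℓ)
      λ′-pos : 0# < λ′
      λ′-pos = *-pos (dens⁺ Lh) (inv-pos κℓ-pos)
      λ-inv : recip λ′ * dens h ≡ κ * ℓ
      λ-inv = trans (cong (recip λ′ *_) (sym (trans (solve (dens h ∷ recip (κ * ℓ) ∷ κ * ℓ ∷ []) (v 0 :* v 1 :* v 2) (v 0 :* (v 2 :* v 1)) refl) (*1ʳ (*-inv⁺ κℓ-pos))))) (trans (solve (recip λ′ ∷ λ′ ∷ κ * ℓ ∷ []) (v 0 :* (v 1 :* v 2)) (v 1 :* v 0 :* v 2) refl) (*1ˡ (*-inv⁺ λ′-pos)))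
      first : ℓ * (λ′ * κ * (dens f * dens g)) ≡ αβδ
      first = trans (solve (ℓ ∷ dens h ∷ recip (κ * ℓ) ∷ κ ∷ dens f ∷ dens g ∷ []) (v 0 :* (v 1 :* v 2 :* v 3 :* (v 4 :* v 5))) (v 3 :* v 0 :* v 2 :* (v 4 :* v 5 :* v 1)) refl) (*1ˡ (*-inv⁺ κℓ-pos))
      second : ℓ * (κ * ℓ) ≤ αβδ
      second = ≡-≤ (solve (ℓ ∷ κ ∷ []) (v 0 :* (v 1 :* v 0)) (v 1 :* (v 0 :* v 0)) refl) (≤-trans κ-d
        (*-mono (d-nn ⊛ d-nn) (<⇒≤ (dens⁺ Lh)) (*-mono d-nn (<⇒≤ (dens⁺ Lg)) (above Lf) (above Lg)) (above Lh)))
      key : ℓ * (αβδ + c * D) ≤ αβδ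
      key = *-cancelˡ (ι-pos 1) (≡-≤ (solve (ℓ ∷ αβδ + c * D ∷ []) (# 2 :* (v 0 :* v 1)) (v 0 :* (# 2 :* v 1)) refl)
        (≤-trans (*-monoˡ ℓ-nn (Counting.level-bound big s-big κ-nn κ-s bs ds κ-2 (ind Lf) (ind Lg) (ind Lh) free λ′ λ′-pos))
        (≡-≤ (trans (distribˡ ℓ _ _) (cong₂ (λ a b → a + ℓ * b) first λ-inv)) (≤-≡ (+-mono ≤-refl second) (solve (αβδ ∷ []) (v 0 :+ v 0) (# 2 :* v 0) refl)))))

    -- At most n entries exceed the threshold, by `level-set` and `d-fat`; `upper` with λ′ = 2mn
    -- then bounds their sum.
    heavy-mass : ∀ {h} → Large h → ∀ {α} → d ≤ α → Σ² (big-dev h (thr α (dens h))) ≤ ι 4 * (m * (nF * dens h))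
    heavy-mass {h} Lh {α} p = ≤-trans (Σ²-mono λ i j → each i j (bool (test (dev h i j) M))) (≤-trans
        (upper (ind Lh) (dense Lh) (λ i j → [ J i j ]) (λ i j → []-nn _) (λ i j → []≤1 _) {ι 2 * (m * nF)} (*-pos (ι-pos 1) (*-pos m-pos n-pos))
          (by (m ∷ nF ∷ #J ∷ []) (v 0 :* v 0 :* (v 1 :* v 1 :+ v 1 :* v 2)) (# 2 :* (v 0 :* v 1) :* (# 2 :* (v 0 :* v 1))) (v 0 :* v 0 :* (v 1 :* (v 1 :- v 2)) :+ # 2 :* (v 0 :* v 0 :* (v 1 :* v 1)))
            (sq-nn m ⊛ (n-nn ⊛ ⟪ #J≤n ⟫) ⊹ ι-nn 2 ⊛ (sq-nn m ⊛ sq-nn nF)) refl))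
        (≤-reflexive (solve (m ∷ nF ∷ δ ∷ []) (# 2 :* (# 2 :* (v 0 :* v 1) :* v 2)) (# 4 :* (v 0 :* (v 1 :* v 2))) refl)))
      where
      δ = dens h
      M = thr α δ
      α-pos = <-≤-trans d-pos p
      M-pos : 0# < M
      M-pos = *-pos (*-pos n-pos (*-pos α-pos (dens⁺ Lh))) (inv-pos T-pos)
      J : Fin n → Fin n → Bool
      J i j = not (test (dev h i j) M)
      #J = Σ² λ i j → [ J i j ]
      above-M : ∀ i j → J i j ≡ true → M ≤ dev h i j
      above-M i j q with bool (test (dev h i j) M)
      ... | inj₁ t = ⊥-elim (true≢false q (cong not t))
      ... | inj₂ t = <⇒≤ (test-≰ t)
      each : ∀ i j → test (dev h i j) M ≡ true ⊎ test (dev h i j) M ≡ false → big-dev h M i j ≤ dev h i j * [ J i j ]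
      each i j (inj₁ t) = ≤-reflexive (trans (hi-≤ (test-≤ t)) (sym (*0ʳ ([]-false (cong not t)))))
      each i j (inj₂ t) = ≤-≡ (hi-⁺ M _) (trans (⁺-yes (≤-trans (<⇒≤ M-pos) (<⇒≤ (test-≰ t)))) (sym (*1ʳ ([]-true (cong not t)))))
      δ≤M : δ ≤ M
      δ≤M = ≤-≡ (dens≤thr (<⇒≤ (dens⁺ Lh)) p) (thr-sym δ α)
      step : M * #J ≤ ι 64 * (m * m * (nF * δ))
      step = *-cancelˡ M-pos (≡-≤ (sym (*-assoc _ _ _)) (≤-trans (level-set (ind Lh) (dense Lh) J M-pos above-M)
        (by (m ∷ nF ∷ δ ∷ M ∷ []) (# 32 :* (v 0 :* v 0 :* (v 1 :* (v 2 :* (v 2 :+ v 3))))) (v 3 :* (# 64 :* (v 0 :* v 0 :* (v 1 :* v 2)))) (# 32 :* (v 0 :* v 0 :* (v 1 :* (v 2 :* (v 3 :- v 2)))))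
          (ι-nn 32 ⊛ (sq-nn m ⊛ (n-nn ⊛ (<⇒≤ (dens⁺ Lh) ⊛ ⟪ δ≤M ⟫)))) refl)))
      #J≤n : #J ≤ nF
      #J≤n = *-cancelˡ (*-pos (*-pos n-pos (dens⁺ Lh)) α-pos) (≡-≤ (trans (solve (nF ∷ δ ∷ α ∷ #J ∷ []) (v 0 :* v 1 :* v 2 :* v 3) (v 0 :* (v 2 :* v 1) :* v 3) refl) (trans (cong (_* #J) (sym (T-thr α δ))) (*-assoc _ _ _)))
        (≤-trans (*-monoˡ T-nn step) (≡-≤ (solve (T ∷ m ∷ nF ∷ δ ∷ []) (v 0 :* (# 64 :* (v 1 :* v 1 :* (v 2 :* v 3)))) (v 2 :* v 3 :* (# 64 :* (v 1 :* v 1 :* v 0))) refl)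
          (≤-≡ (*-monoˡ (n-nn ⊛ <⇒≤ (dens⁺ Lh)) (≤-trans d-fat (*-monoˡ n-nn p))) (solve (nF ∷ δ ∷ α ∷ []) (v 0 :* v 1 :* (v 0 :* v 2)) (v 0 :* v 1 :* v 2 :* v 0) refl)))))

-- Restricted sets and heavy rows

module Restriction (𝔽 : OrderedField) {n : ℕ} (𝔾 : PermGroup n) where
  open Sums 𝔽
  open Arithmetic 𝔽
  open PermGroup 𝔾
  open GroupAlgebra 𝔽 𝔾
  open Averages 𝔽 𝔾
  open Projections 𝔽 𝔾
  open Densities 𝔽 𝔾
  open PositivePart 𝔽
  open Concentration 𝔽 𝔾
  open Deviations 𝔽 𝔾
  open LevelSums 𝔽 𝔾
  open Regularity 𝔽 𝔾
  open Equality (fins n)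

  Free : Alg → Alg → Alg → Set
  Free f g h = ⟨ f ⋆ g , h ⟩ ≡ 0#

  infixl 7 _∩_
  _∩_ : Alg → (G → Bool) → Alg
  (f ∩ p) g = f g * [ p g ]

  ∩-ind : ∀ {f} → Indicator f → ∀ p → Indicator (f ∩ p)
  ∩-ind (indicator s e) p = indicator (λ g → s g ∧ p g) λ g → trans (cong (_* [ p g ]) (e g)) (sym ([]-∧ (s g) (p g)))

  infix 4 _≼_
  _≼_ : Alg → Alg → Set
  f ≼ g = ∀ x → f x ≤ g x

  dens-mono : ∀ {f g} → f ≼ g → dens f ≤ dens g
  dens-mono p = *-monoʳ (inv-nn N-pos) (∑-mono Gs p)

  dens-+ : ∀ f g → dens (f ⊕ g) ≡ dens f + dens g
  dens-+ f g = trans (cong (_* recip N) (∑-+ Gs f g)) (distribʳ _ _ _)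

  dens-∑ : ∀ {A : Set} (xs : List A) (f : A → Alg) → dens (λ g → ∑ xs λ a → f a g) ≡ ∑ xs λ a → dens (f a)
  dens-∑ xs f = trans (cong (_* recip N) (∑-swap Gs xs _)) (sym (∑-*ʳ xs (recip N) _))

  dens-* : ∀ c f → dens (c • f) ≡ c * dens f
  dens-* c f = trans (cong (_* recip N) (∑-*ˡ Gs c f)) (*-assoc _ _ _)

  ==-transport : ∀ y j (φ : Fin n → F) → φ y * [ y == j ] ≡ φ j * [ y == j ]
  ==-transport y j φ with y Fin.≟ j
  ... | yes refl = refl
  ... | no  p    = trans (*0ʳ ([]-false (≢⇒== p))) (sym (*0ʳ ([]-false (≢⇒== p))))

  P-row-∩ : ∀ f x (q : Fin n → Bool) j → P (f ∩ λ g → q (g ▹ x)) x j ≡ [ q j ] * P f x j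
  P-row-∩ f x q j = trans (cong (λ z → nF * (z * recip N)) (trans (∑-cong Gs λ g → trans (*-assoc _ _ _) (trans (cong (f g *_) (==-transport (g ▹ x) j (λ y → [ q y ])))
      (solve (f g ∷ [ q j ] ∷ [ g ▹ x == j ] ∷ []) (v 0 :* (v 1 :* v 2)) (v 1 :* (v 0 :* v 2)) refl))) (∑-*ˡ Gs [ q j ] _)))
    (solve (nF ∷ [ q j ] ∷ cnt f x j ∷ recip N ∷ []) (v 0 :* (v 1 :* v 2 :* v 3)) (v 1 :* (v 0 :* (v 2 :* v 3))) refl)

  row-mass : ∀ f x (q : Fin n → Bool) → ∑ Fs (λ j → [ q j ] * P f x j) ≡ nF * dens (f ∩ λ g → q (g ▹ x))
  row-mass f x q = trans (∑-cong Fs λ j → sym (P-row-∩ f x q j)) (P-row _ x)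

  free-mono : ∀ {f f′ g g′ h h′} → (∀ x → 0# ≤ f′ x) → (∀ x → 0# ≤ g′ x) → (∀ x → 0# ≤ h′ x) → f′ ≼ f → g′ ≼ g → h′ ≼ h → Free f g h → Free f′ g′ h′
  free-mono {f} {f′} {g} {g′} {h} {h′} f-nn g-nn h-nn p q r e = ≤-antisym
    (≤-≡ (≡-≤ (conv f′ g′ h′) (≤-≡ (∑-mono Gs λ a → *-mono (f-nn a) (∑-nn Gs λ b → ≤-trans (g-nn b) (q b) ⊛ ≤-trans (h-nn _) (r _)) (p a)
        (∑-mono Gs λ b → *-mono (g-nn b) (≤-trans (h-nn _) (r _)) (q b) (r _))) (sym (conv f g h)))) e)
    (≤-≡ (∑-nn Gs λ a → f-nn a ⊛ ∑-nn Gs λ b → g-nn b ⊛ h-nn _) (sym (conv f′ g′ h′)))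

  free-† : ∀ {f} → Free f f f → Free (f †) (f †) (f †)
  free-† {f} e = trans (conv (f †) (f †) (f †)) (trans (sym (flipG _)) (trans (∑-cong Gs λ a → cong₂ (λ u w → f u * w) (⁻¹-invol a) (trans (sym (flipG _)) (∑-cong Gs λ b →
      cong₂ (λ u w → f u * f w) (⁻¹-invol b) (trans (⁻¹-∙ (a ⁻¹) (b ⁻¹)) (cong₂ _∙_ (⁻¹-invol b) (⁻¹-invol a))))))
    (trans (trans (∑-cong Gs λ a → sym (∑-*ˡ Gs (f a) _)) (trans (∑-swap Gs Gs _) (∑-cong Gs λ b → trans (∑-cong Gs λ a → solve (f a ∷ f b ∷ f (b ∙ a) ∷ []) (v 0 :* (v 1 :* v 2)) (v 1 :* (v 0 :* v 2)) refl) (∑-*ˡ Gs (f b) _))))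
      (trans (sym (conv f f f)) e))))

  dens-† : ∀ f → dens (f †) ≡ dens f
  dens-† f = cong (_* recip N) (flipG f)

  dev-† : ∀ f i j → dev (f †) i j ≡ dev f j i
  dev-† f i j = cong₂ _-_ (cong (λ z → nF * (z * recip N)) (trans (sym (flipG _)) (∑-cong Gs λ g → cong₂ (λ u b → f u * [ b ]) (⁻¹-invol g) (trans (==-sym _ j) (sym (==-⁻¹ g j i)))))) (dens-† f)

  †-ind : ∀ {f} → Indicator f → Indicator (f †)
  †-ind (indicator s e) = indicator (λ g → s (g ⁻¹)) λ g → e (g ⁻¹)

  inFamily : Points → Fin n → G → Bool
  inFamily I x g = I (g ▹ x) ∧ all (λ i → not (I i ∧ I (g ▹ i))) Fs

module HeavyLines (𝔽 : OrderedField) {n : ℕ} (𝔾 : PermGroup n) (scale : Regularity.Scale 𝔽 𝔾) where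
  open Sums 𝔽
  open Arithmetic 𝔽
  open GroupAlgebra 𝔽 𝔾
  open Projections 𝔽 𝔾
  open Densities 𝔽 𝔾
  open PositivePart 𝔽
  open Truncation 𝔽
  open Concentration 𝔽 𝔾
  open Deviations 𝔽 𝔾
  open LevelSums 𝔽 𝔾
  open Regularity 𝔽 𝔾
  open Restriction 𝔽 𝔾
  open Gain scale public
  open Equality (fins n)

  X-pos : ∀ {f g h} → Large f → Large g → Large h → 0# < X (dens f) (dens g) (dens h)
  X-pos Lf Lg Lh = *-pos (*-pos n-pos n-pos) (*-pos (*-pos (dens⁺ Lf) (dens⁺ Lg)) (dens⁺ Lh))

  weight-full : ∀ s → weight full s ≡ Σ³ s
  weight-full s = Σ³-cong λ i j k → *1ˡ ([]-true refl)

  -- `deficit` and `gain` leave at least (1 - 8/ℓ) X for the heavy terms, and ℓ ≥ 128. The weaker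
  -- 12/25 is what three terms of at most 4X/25 add up to in `heavy-line`.
  heavy-exists : ∀ {f g h} → Large f → Large g → Large h → Free f g h → ¬ ι 25 * heavy f g h full ≤ ι 12 * X (dens f) (dens g) (dens h)
  heavy-exists {f} {g} {h} Lf Lg Lh free p = X-pos Lf Lg Lh (*-cancelˡ room (≤-trans
      (by (ℓ ∷ Y ∷ H ∷ []) ((# 13 :* v 0 :- # 200) :* v 1) (# 0) (# 25 :* (v 0 :* v 2 :+ # 7 :* v 1 :- (v 0 :- # 1) :* v 1) :+ v 0 :* (# 12 :* v 1 :- # 25 :* v 2)) (ι-nn 25 ⊛ ⟪ total ⟫ ⊹ ℓ-nn ⊛ ⟪ p ⟫) refl)
      (≤-reflexive (sym (zeroʳ _)))))
    where
    Y = X (dens f) (dens g) (dens h)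
    H = heavy f g h full
    total : (ℓ - 1#) * Y ≤ ℓ * H + ι 7 * Y
    total = ≤-trans (deficit Lf Lg Lh free) (≡-≤ (cong (λ z → ℓ * - z) (sym (weight-full (triple f g h)))) (gain Lf Lg Lh full))
    room : 0# < ι 13 * ℓ - ι 200
    room q = 1≰0 (by (ℓ ∷ []) (# 1) (# 0) ((# 0 :- (# 13 :* v 0 :- # 200)) :+ # 13 :* (v 0 :- # 128) :+ # 1463) (⟪ q ⟫ ⊹ ι-nn 13 ⊛ ⟪ 128≤ℓ ⟫ ⊹ ι-nn 1463) refl)

  HeavyRow : Alg → Fin n → Set
  HeavyRow f x = nF * dens f ≤ ι 25 * (m * ∑ Fs (big-dev f (thr (dens f) (dens f)) x))

  -- If all rows and columns had heavy sums at most ω = nα/25m, each heavy term would be at most α ω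
  -- W, where W ≤ 4mnα is the total heavy mass. The first term uses the rows, the other two the
  -- columns. A heavy column of f is a heavy row of f†.
  heavy-line : ∀ {f} → Large f → Free f f f → ∃ λ x → HeavyRow f x ⊎ HeavyRow (f †) x
  heavy-line {f} Lf free with Fin.any? (λ x → nF * dens f ≤? ι 25 * (m * ∑ Fs (big-dev f (thr (dens f) (dens f)) x)))
                            | Fin.any? (λ x → nF * dens f ≤? ι 25 * (m * ∑ Fs (λ i → big-dev f (thr (dens f) (dens f)) i x)))
  ... | yes (x , p) | _           = x , inj₁ p
  ... | no _        | yes (x , p) = x , inj₂ (subst₂ _≤_ (cong (nF *_) (sym (dens-† f))) (cong (λ z → ι 25 * (m * z)) (∑-cong Fs λ i →
                                      cong₂ hi (cong₂ thr (sym (dens-† f)) (sym (dens-† f))) (sym (dev-† f x i)))) p)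
  ... | no p        | no q        = ⊥-elim (heavy-exists Lf Lf Lf free (≡-≤ (cong (λ z → ι 25 * z) (cong₂ _+_ (cong₂ _+_ (cong (α *_) (weight-full _)) (cong (α *_) (weight-full _))) (cong (α *_) (weight-full _))))
      (*-cancelˡ m-pos (≤-trans (*-monoˡ m-nn (*-monoˡ (ι-nn 25) (+-mono (+-mono (*-monoˡ α-nn t₁) (*-monoˡ α-nn t₂)) (*-monoˡ α-nn t₃))))
      (≡-≤ (solve (m ∷ α ∷ ω ∷ W ∷ []) (v 0 :* (# 25 :* (v 1 :* (v 2 :* v 3) :+ v 1 :* (v 2 :* v 3) :+ v 1 :* (v 2 :* v 3)))) (# 3 :* v 1 :* (# 25 :* (v 0 :* v 2)) :* v 3) refl)
      (≡-≤ (cong (λ z → ι 3 * α * z * W) ω-eq) (≤-≡ (*-monoˡ (ι-nn 3 ⊛ α-nn ⊛ (n-nn ⊛ α-nn)) (heavy-mass Lf (above Lf)))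
        (solve (m ∷ nF ∷ α ∷ []) (# 3 :* v 2 :* (v 1 :* v 2) :* (# 4 :* (v 0 :* (v 1 :* v 2)))) (v 0 :* (# 12 :* (v 1 :* v 1 :* (v 2 :* v 2 :* v 2)))) refl))))))))
    where
    α = dens f
    α-nn = <⇒≤ (dens⁺ Lf)
    H = big-dev f (thr α α)
    H-nn : ∀ i j → 0# ≤ H i j
    H-nn i j = hi-nn _ _
    W = Σ² H
    ω = nF * α * recip (ι 25 * m)
    25m-pos = *-pos (ι-pos 24) m-pos
    ω-eq : ι 25 * (m * ω) ≡ nF * α
    ω-eq = trans (solve (m ∷ nF * α ∷ recip (ι 25 * m) ∷ []) (# 25 :* (v 0 :* (v 1 :* v 2))) (v 1 :* (# 25 :* v 0 :* v 2)) refl) (*1ʳ (*-inv⁺ 25m-pos))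
    small : ∀ {y} → ¬ nF * α ≤ ι 25 * (m * y) → y ≤ ω
    small {y} r = *-cancelˡ 25m-pos (≡-≤ (*-assoc _ _ _) (≤-≡ (<⇒≤ r) (trans (sym ω-eq) (sym (*-assoc _ _ _)))))
    row : ∀ i → ∑ Fs (H i) ≤ ω
    row i = small λ r → p (i , r)
    col : ∀ j → ∑ Fs (λ i → H i j) ≤ ω
    col j = small λ r → q (j , r)
    t₁ : Σ³ (λ i j k → H i j * H i k) ≤ ω * W
    t₁ = ≤-≡ (∑-mono Fs λ k → ≡-≤ (trans (∑-swap Fs Fs _) (∑-cong Fs λ i → ∑-*ʳ Fs (H i k) (H i))) (≤-≡ (∑-mono Fs λ i → *-monoʳ (H-nn i k) (row i)) (∑-*ˡ Fs ω _)))
      (trans (∑-*ˡ Fs ω _) (cong (ω *_) (∑-swap Fs Fs _)))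
    t₂ : Σ³ (λ i j k → H j k * H i k) ≤ ω * W
    t₂ = ≤-≡ (∑-mono Fs λ k → ∑-mono Fs λ j → ≡-≤ (∑-*ˡ Fs (H j k) _) (≤-≡ (*-monoˡ (H-nn j k) (col k)) (*-comm _ ω)))
      (trans (∑-cong Fs λ k → ∑-*ˡ Fs ω _) (trans (∑-*ˡ Fs ω _) (cong (ω *_) (∑-swap Fs Fs _))))
    t₃ : Σ³ (λ i j k → H j k * H i j) ≤ ω * W
    t₃ = ≤-≡ (∑-mono Fs λ k → ∑-mono Fs λ j → ≡-≤ (∑-*ˡ Fs (H j k) _) (≤-≡ (*-monoˡ (H-nn j k) (col j)) (*-comm _ ω)))
      (trans (∑-cong Fs λ k → ∑-*ˡ Fs ω _) (trans (∑-*ˡ Fs ω _) (cong (ω *_) (∑-swap Fs Fs _))))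

-- The large entries of a heavy row

module Rows (𝔽 : OrderedField) {n : ℕ} (𝔾 : PermGroup n) (scale : Regularity.Scale 𝔽 𝔾) where
  open Sums 𝔽
  open Arithmetic 𝔽
  open PermGroup 𝔾
  open GroupAlgebra 𝔽 𝔾
  open Averages 𝔽 𝔾
  open Projections 𝔽 𝔾
  open Densities 𝔽 𝔾
  open PositivePart 𝔽
  open Truncation 𝔽
  open Concentration 𝔽 𝔾
  open Deviations 𝔽 𝔾
  open LevelSums 𝔽 𝔾
  open Regularity 𝔽 𝔾
  open Restriction 𝔽 𝔾
  open HeavyLines 𝔽 𝔾 scale public
  open Equality (fins n)

  module Row {f : Alg} (If : Indicator f) (free : Free f f f) (α≥ : ι 32 * (m * d) ≤ dens f) (x : Fin n) (heavy-x : HeavyRow f x) where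

    α : F
    α = dens f

    d≤α : d ≤ α
    d≤α = ≤-trans (≤-≡ (≤-*ʳ d-nn (1≤* (ι-mono {1} {32} (ℕ.s≤s ℕ.z≤n)) 1≤m)) (solve (d ∷ m ∷ []) (v 0 :* (# 32 :* v 1)) (# 32 :* (v 1 :* v 0)) refl)) α≥

    Lf : Large f
    Lf = large If d≤α

    α-nn : 0# ≤ α
    α-nn = <⇒≤ (dens⁺ Lf)

    32m-pos : 0# < ι 32 * m
    32m-pos = *-pos (ι-pos 31) m-pos

    -- The division by 32m anticipates `mass₁`: from α ≤ 32 m α₁ it follows that M₀ lies below the
    -- threshold belonging to α₁ and f₂ in `mass₂`.
    M₀ : F
    M₀ = thr α d * recip (ι 32 * m)

    M₀-eq : ι 32 * m * M₀ ≡ thr α d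
    M₀-eq = trans (solve (ι 32 * m ∷ thr α d ∷ recip (ι 32 * m) ∷ []) (v 0 :* (v 1 :* v 2)) (v 1 :* (v 0 :* v 2)) refl) (*1ʳ (*-inv⁺ 32m-pos))

    M₀-pos : 0# < M₀
    M₀-pos = *-pos (*-pos (*-pos n-pos (*-pos (dens⁺ Lf) d-pos)) (inv-pos T-pos)) (inv-pos 32m-pos)

    -- Leaving out x gives `P f₁ x x` = 0, which removes the term i = j = x in `mass₂`. The
    -- permutations that fix x have density at most 1/n and are discarded in `fixed`.
    J : Points
    J j = not (j == x) ∧ test M₀ (P f x j)

    J-out : J x ≡ false
    J-out = cong (λ b → not b ∧ test M₀ (P f x x)) (==-refl x)

    outside : Points
    outside j = not (J j) ∧ not (j == x)

    _∣_ : Alg → Points → Alg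
    h ∣ q = h ∩ λ g → q (g ▹ x)

    ∣-ind : ∀ q → Indicator (f ∣ q)
    ∣-ind q = ∩-ind If (λ g → q (g ▹ x))

    ∣-≼ : ∀ q → f ∣ q ≼ f
    ∣-≼ q g = ≤-≡ (*-monoˡ (ind-nn big If g) ([]≤1 _)) (*-identityʳ _)

    f₁ f₂ : Alg
    f₁ = f ∣ J
    f₂ = f ∣ outside

    α₁ : F
    α₁ = dens f₁

    J-P : ∀ j → M₀ * [ J j ] ≤ [ J j ] * P f x j
    J-P j with bool (J j)
    ... | inj₁ t = ≡-≤ (*1ʳ ([]-true t)) (≤-≡ (test-≤ (proj₂ (∧-true {not (j == x)} t))) (sym (*1ˡ ([]-true t))))
    ... | inj₂ t = ≤-reflexive (trans (*0ʳ ([]-false t)) (sym (*0ˡ ([]-false t))))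

    M₀∣J∣ : M₀ * ∣ J ∣ ≤ nF * α
    M₀∣J∣ = ≡-≤ (sym (∑-*ˡ Fs M₀ _)) (≤-≡ (∑-mono Fs λ j → ≤-trans (J-P j) (≤-≡ (*-monoʳ (P-nn big If x j) ([]≤1 (J j))) (*-identityˡ _))) (P-row f x))

    128m≤ : ∀ {y} → d ≤ y → ι 128 * m ≤ nF * y
    128m≤ p = ≤-trans (*-monoʳ m-nn m≥128) (≤-trans (≤-*ʳ (sq-nn m) (1≤* (ι-mono {1} {64} (ℕ.s≤s ℕ.z≤n)) 1≤T)) (≡-≤ (solve (m ∷ T ∷ []) (v 0 :* v 0 :* (# 64 :* v 1)) (# 64 :* (v 0 :* v 0 :* v 1)) refl) (≤-trans d-fat (*-monoˡ n-nn p))))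

    M₀≤thr : M₀ ≤ thr α α
    M₀≤thr = ≤-trans (≤-≡ (≤-*ʳ (<⇒≤ M₀-pos) (1≤* (ι-mono {1} {32} (ℕ.s≤s ℕ.z≤n)) 1≤m)) (trans (*-comm _ _) M₀-eq)) (thr-mono α-nn α-nn ≤-refl d≤α)

    -- Heavy entries of row x exceed the threshold for α and α, which is at least M₀, so they lie in
    -- J, except for a possible one at x. That one is at most 1, and 128 m ≤ nα pays for it.
    mass₁ : α ≤ ι 32 * m * α₁
    mass₁ = *-cancelˡ n-pos (*-cancelˡ (ι-pos 24) (by (nF ∷ α ∷ m ∷ α₁ ∷ Y ∷ []) (# 25 :* (v 0 :* v 1)) (# 25 :* (v 0 :* (# 32 :* v 2 :* v 3)))
        (# 32 :* (# 25 :* (v 2 :* v 4) :- v 0 :* v 1) :+ # 7 :* (v 0 :* v 1 :- # 128 :* v 2) :+ # 96 :* v 2 :+ # 800 :* v 2 :* (v 0 :* v 3 :+ # 1 :- v 4))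
        (ι-nn 32 ⊛ ⟪ heavy-x ⟫ ⊹ ι-nn 7 ⊛ ⟪ 128m≤ d≤α ⟫ ⊹ ι-nn 96 ⊛ m-nn ⊹ ι-nn 800 ⊛ m-nn ⊛ ⟪ Y≤ ⟫) refl))
      where
      M = thr α α
      Y = ∑ Fs (big-dev f M x)
      each : ∀ j → big-dev f M x j ≤ [ J j ] * P f x j + [ j == x ]
      each j with bool (j == x) | bool (test M₀ (P f x j))
      ... | inj₁ t | _ = ≤-trans (≤-trans (hi-⁺ M _) (≤-trans (pos-≤ big If x j) (P≤1 big If x j))) (≡-≤ (sym ([]-true t))
              (by ([ J j ] * P f x j ∷ [ j == x ] ∷ []) (v 1) (v 0 :+ v 1) (v 0) ([]-nn _ ⊛ P-nn big If x j) refl))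
      ... | inj₂ t | inj₁ u = ≤-trans (hi-⁺ M _) (≤-trans (pos-≤ big If x j) (≡-≤ (sym (*1ˡ ([]-true (cong₂ (λ a b → not a ∧ b) t u))))
              (by ([ J j ] * P f x j ∷ [ j == x ] ∷ []) (v 0) (v 0 :+ v 1) (v 1) ([]-nn _) refl)))
      ... | inj₂ t | inj₂ u = ≡-≤ (hi-≤ (≤-trans (by (P f x j ∷ α ∷ []) (v 0 :- v 1) (v 0) (v 1) α-nn refl) (≤-trans (<⇒≤ (test-≰ u)) M₀≤thr)))
              ([]-nn _ ⊛ P-nn big If x j ⊹ []-nn _)
      Y≤ : Y ≤ nF * α₁ + 1#
      Y≤ = ≤-≡ (∑-mono Fs each) (trans (∑-+ Fs _ _) (cong₂ _+_ (row-mass f x J) (∑-point1 x)))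

    d≤α₁ : d ≤ α₁
    d≤α₁ = *-cancelˡ 32m-pos (≡-≤ (*-assoc _ _ _) (≤-trans α≥ mass₁))

    L₁ : Large f₁
    L₁ = large (∣-ind J) d≤α₁

    -- J has few elements, so a set of permutations with π(x) ∈ J is spread out in every other row.
    light : ∀ {h} → Indicator h → (∀ g → h g ≤ [ J (g ▹ x) ]) → ∀ {i} → i ≢ x → ∀ k′ → dev h i k′ ≤ thr d d
    light {h} Ih sup {i} i≢x k′ = ≤-trans (by (p ∷ dens h ∷ []) (v 0 :- v 1) (v 0) (v 1) (dens-nn big Ih) refl)
        (*-cancelˡ T-pos (*-cancelˡ (*-pos n-pos d-pos) (≤-trans
          (≤-trans (by (nF ∷ d ∷ T ∷ p ∷ []) (v 0 :* v 1 :* (v 2 :* v 3)) (# 2 :* (v 2 :* (v 1 :* ((v 0 :- # 1) :* v 3)))) (v 2 :* v 1 :* v 3 :* (v 0 :- # 2)) (T-nn ⊛ d-nn ⊛ p-nn ⊛ ⟪ 2≤n ⟫) refl)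
            (*-monoˡ (ι-nn 2) (*-monoˡ T-nn few)))
          (≡-≤ (solve (m ∷ T ∷ []) (# 2 :* (v 1 :* (# 32 :* m′ :* v 1))) (# 64 :* v 0 :* (v 1 :* v 1)) refl) (≤-trans d-pair (≤-reflexive
            (trans (solve (nF ∷ d ∷ []) (v 0 :* v 0 :* (v 1 :* v 1 :* v 1)) (v 0 :* v 1 :* (v 0 :* (v 1 :* v 1))) refl) (cong (nF * d *_) (sym (T-thr d d))))))))))
      where
      m′ = v 0
      p = P h i k′
      p-nn = P-nn big Ih i k′
      2≤n : ι 2 ≤ nF
      2≤n = ≤-trans (ι-mono {2} {3} (ℕ.n≤1+n 2)) (<⇒≤ big)
      n-1-nn : 0# ≤ nF - 1#
      n-1-nn = ⟪ ≤-trans (ι-mono {1} {2} (ℕ.s≤s ℕ.z≤n)) 2≤n ⟫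
      both : Fin n → F
      both j = ∑ Gs λ g → [ g ▹ x == j ] * [ g ▹ i == k′ ]
      count : cnt h i k′ ≤ ∑ Fs λ j → [ J j ] * both j
      count = ≤-≡ (∑-mono Gs λ g → *-monoʳ ([]-nn _) (sup g)) (trans (∑-cong Gs λ g → cong (_* [ g ▹ i == k′ ]) (sym (∑-pointF (g ▹ x) (λ j → [ J j ]))))
        (trans (∑-cong Gs λ g → trans (sym (∑-*ʳ Fs [ g ▹ i == k′ ] _)) (∑-cong Fs λ j → trans (cong (λ b → [ b ] * [ J j ] * [ g ▹ i == k′ ]) (==-sym j (g ▹ x)))
            (solve ([ g ▹ x == j ] ∷ [ J j ] ∷ [ g ▹ i == k′ ] ∷ []) (v 0 :* v 1 :* v 2) (v 1 :* (v 0 :* v 2)) refl)))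
          (trans (∑-swap Gs Fs _) (∑-cong Fs λ j → ∑-*ˡ Gs [ J j ] _))))
      size : (nF - 1#) * p ≤ ∣ J ∣
      size = ≤-trans (*-monoˡ n-1-nn (*-monoˡ n-nn (*-monoʳ (inv-nn N-pos) count))) (≡-≤ (trans
          (solve (nF ∷ recip N ∷ ∑ Fs (λ j → [ J j ] * both j) ∷ []) ((v 0 :- # 1) :* (v 0 :* (v 2 :* v 1))) ((v 0 :- # 1) :* v 0 :* v 1 :* v 2) refl) (sym (∑-*ˡ Fs _ _)))
        (∑-mono Fs λ j → ≡-≤ (solve (nF ∷ recip N ∷ [ J j ] ∷ both j ∷ []) ((v 0 :- # 1) :* v 0 :* v 1 :* (v 2 :* v 3)) (v 2 :* (v 0 :* ((v 0 :- # 1) :* (v 3 :* v 1)))) refl)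
          (≤-≡ (*-monoˡ ([]-nn _) (pairs≤ big x i j k′ i≢x)) (*-identityʳ _))))
      few : d * ((nF - 1#) * p) ≤ ι 32 * m * T
      few = *-cancelˡ (*-pos n-pos (dens⁺ Lf)) (≡-≤ (trans (solve (nF ∷ α ∷ d ∷ (nF - 1#) * p ∷ []) (v 0 :* v 1 :* (v 2 :* v 3)) (v 0 :* (v 1 :* v 2) :* v 3) refl)
            (cong (_* ((nF - 1#) * p)) (trans (sym (T-thr α d)) (cong (T *_) (sym M₀-eq)))))
          (≡-≤ (solve (T ∷ ι 32 * m ∷ M₀ ∷ (nF - 1#) * p ∷ []) (v 0 :* (v 1 :* v 2) :* v 3) (v 1 :* v 0 :* (v 2 :* v 3)) refl)
          (≤-≡ (*-monoˡ (<⇒≤ 32m-pos ⊛ T-nn) (≤-trans (*-monoˡ (<⇒≤ M₀-pos) size) M₀∣J∣)) (*-comm _ _))))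

    light-hi : ∀ {h} → Indicator h → (∀ g → h g ≤ [ J (g ▹ x) ]) → ∀ {β δ} → d ≤ β → d ≤ δ → ∀ {i} → i ≢ x → ∀ k′ → big-dev h (thr β δ) i k′ ≡ 0#
    light-hi Ih sup p q i≢x k′ = hi-≤ (≤-trans (light Ih sup i≢x k′) (thr-mono d-nn (≤-trans d-nn q) p q))

    ind-sup : ∀ q → (∀ j → [ q j ] ≤ [ J j ]) → ∀ g → (f ∣ q) g ≤ [ J (g ▹ x) ]
    ind-sup q p g = ≤-trans (*-monoʳ ([]-nn _) (ind-≤1 big If g)) (≡-≤ (*-identityˡ _) (p _))

    -- Otherwise f₁, f₁, f₂ would need a large heavy sum. But f₁ has heavy entries in row x only,
    -- and f₂ has none there, so the first and third terms vanish. The second is at most α₁ times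
    -- the heavy mass 4mnδ of f₂, far below n² α₁² δ.
    mass₂ : dens f₂ ≤ d
    mass₂ with d ≤? dens f₂
    ... | no  p = <⇒≤ p
    ... | yes p = ⊥-elim (heavy-exists L₁ L₁ L₂ (free-mono (ind-nn big (∣-ind J)) (ind-nn big (∣-ind J)) (ind-nn big (∣-ind outside)) (∣-≼ J) (∣-≼ J) (∣-≼ outside) free) bound)
      where
      L₂ : Large f₂
      L₂ = large (∣-ind outside) p
      δ = dens f₂
      δ-nn = <⇒≤ (dens⁺ L₂)
      α₁-nn = <⇒≤ (dens⁺ L₁)
      M = thr α₁ δ
      M₃ = thr α₁ α₁
      H H₂ H₃ : Matrix
      H = big-dev f₁ M
      H₂ = big-dev f₂ M
      H₃ = big-dev f₁ M₃
      sup : ∀ g → f₁ g ≤ [ J (g ▹ x) ]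
      sup = ind-sup J (λ _ → ≤-refl)
      M₀≤M : M₀ ≤ M
      M₀≤M = *-cancelˡ 32m-pos (≡-≤ M₀-eq (≤-trans (thr-mono α-nn δ-nn mass₁ p) (≤-reflexive
        (solve (nF ∷ ι 32 * m ∷ α₁ ∷ δ ∷ recip T ∷ []) (v 0 :* (v 1 :* v 2 :* v 3) :* v 4) (v 1 :* (v 0 :* (v 2 :* v 3) :* v 4)) refl))))
      row₂ : ∀ k′ → H₂ x k′ ≡ 0#
      row₂ k′ = hi-≤ (≤-trans (by (P f₂ x k′ ∷ δ ∷ []) (v 0 :- v 1) (v 0) (v 1) δ-nn refl) (≤-trans (≡-≤ (P-row-∩ f x outside k′) cases) M₀≤M))
        where
        cases : [ outside k′ ] * P f x k′ ≤ M₀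
        cases with bool (k′ == x) | bool (test M₀ (P f x k′))
        ... | inj₁ t | _ = ≡-≤ (*0ˡ ([]-false (trans (cong (λ b → not (J k′) ∧ not b) t) (Bool.∧-zeroʳ _)))) (<⇒≤ M₀-pos)
        ... | inj₂ t | inj₁ u = ≡-≤ (*0ˡ ([]-false (cong (λ b → not b ∧ not (k′ == x)) (cong₂ (λ a b → not a ∧ b) t u)))) (<⇒≤ M₀-pos)
        ... | inj₂ t | inj₂ u = ≤-trans (≤-≡ (*-monoʳ (P-nn big If x k′) ([]≤1 _)) (*-identityˡ _)) (<⇒≤ (test-≰ u))
      H≤ : ∀ j k′ → H j k′ ≤ [ j == x ]
      H≤ j k′ with j Fin.≟ x
      ... | yes refl = ≤-≡ (≤-trans (hi-⁺ M _) (≤-trans (pos-≤ big (∣-ind J) j k′) (P≤1 big (∣-ind J) j k′))) (sym ([]-true (==-refl j)))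
      ... | no  q    = ≡-≤ (light-hi (∣-ind J) sup d≤α₁ p q k′) ([]-nn _)
      t₁ : Σ³ (λ i j k′ → H i j * H₂ i k′) ≡ 0#
      t₁ = trans (Σ³-cong zero-at) (trans (∑-cong Fs λ _ → trans (∑-cong Fs λ _ → ∑-0 Fs) (∑-0 Fs)) (∑-0 Fs))
        where
        zero-at : ∀ i j k′ → H i j * H₂ i k′ ≡ 0#
        zero-at i j k′ with i Fin.≟ x
        ... | yes refl = *0ʳ (row₂ k′)
        ... | no  q    = *0ˡ (light-hi (∣-ind J) sup d≤α₁ p q j)
      t₂ : Σ³ (λ i j k′ → H j k′ * H₂ i k′) ≤ ι 4 * (m * (nF * δ))
      t₂ = ≤-trans (Σ³-mono λ i j k′ → *-monoʳ (hi-nn M _) (H≤ j k′)) (≡-≤ (trans (∑-cong Fs λ k′ → trans (∑-cong Fs λ j → ∑-*ˡ Fs [ j == x ] _) (∑-pointF x (λ _ → ∑ Fs λ i → H₂ i k′))) (∑-swap Fs Fs _))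
        (heavy-mass L₂ d≤α₁))
      t₃ : Σ³ (λ i j k′ → H₃ j k′ * H₃ i j) ≡ 0#
      t₃ = trans (Σ³-cong zero-at) (trans (∑-cong Fs λ _ → trans (∑-cong Fs λ _ → ∑-0 Fs) (∑-0 Fs)) (∑-0 Fs))
        where
        zero-at : ∀ i j k′ → H₃ j k′ * H₃ i j ≡ 0#
        zero-at i j k′ with j Fin.≟ x | i Fin.≟ x
        ... | no  q    | _        = *0ˡ (light-hi (∣-ind J) sup d≤α₁ d≤α₁ q k′)
        ... | yes _    | no q     = *0ʳ (light-hi (∣-ind J) sup d≤α₁ d≤α₁ q j)
        ... | yes refl | yes refl = *0ʳ (hi-≤ (≤-trans (by (P f₁ i i ∷ α₁ ∷ []) (v 0 :- v 1) (v 0) (v 1) α₁-nn refl) (≡-≤ (trans (P-row-∩ f i J i) (*0ˡ ([]-false J-out))) (thr-nn α₁-nn α₁-nn))))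
      bound : ι 25 * heavy f₁ f₁ f₂ full ≤ ι 12 * X α₁ α₁ δ
      bound = ≡-≤ (cong (ι 25 *_) (cong₂ _+_ (cong₂ _+_ (*0ʳ (trans (weight-full _) t₁)) (cong (α₁ *_) (weight-full _))) (*0ʳ (trans (weight-full _) t₃))))
        (≤-trans (*-monoˡ (ι-nn 25) (+-mono (+-mono ≤-refl (*-monoˡ α₁-nn t₂)) ≤-refl))
          (by (nF ∷ α₁ ∷ δ ∷ m ∷ []) (# 25 :* (# 0 :+ v 1 :* (# 4 :* (v 3 :* (v 0 :* v 2))) :+ # 0)) (# 12 :* (v 0 :* v 0 :* (v 1 :* v 1 :* v 2)))
            (v 0 :* v 1 :* v 2 :* (# 12 :* (v 0 :* v 1 :- # 128 :* v 3) :+ # 1436 :* v 3))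
            (n-nn ⊛ α₁-nn ⊛ δ-nn ⊛ (ι-nn 12 ⊛ ⟪ 128m≤ d≤α₁ ⟫ ⊹ ι-nn 1436 ⊛ m-nn)) refl))

any-intro : ∀ {A : Set} (p : A → Bool) {x xs} → x ∈ xs → p x ≡ true → any p xs ≡ true
any-intro p {xs = y ∷ xs} (here refl) e = cong (_∨ any p xs) e
any-intro p {xs = y ∷ xs} (there i)   e = trans (cong (p y ∨_) (any-intro p i e)) (Bool.∨-zeroʳ (p y))

any-elim : ∀ {A : Set} (p : A → Bool) xs → any p xs ≡ true → ∃ λ x → x ∈ xs × p x ≡ true
any-elim p (x ∷ xs) e with p x in q
... | true  = x , here refl , q
... | false with any-elim p xs e
...   | y , i , r = y , there i , r

all-elim : ∀ {A : Set} (p : A → Bool) xs → all (λ x → not (p x)) xs ≡ false → ∃ λ x → p x ≡ true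
all-elim p (x ∷ xs) e with p x in q
... | true  = x , q
... | false = all-elim p xs e

-- Dyadic classes of the heavy row and the set I

module RowStructure (𝔽 : OrderedField) {n : ℕ} (𝔾 : PermGroup n) (scale : Regularity.Scale 𝔽 𝔾) where
  open Sums 𝔽
  open Arithmetic 𝔽
  open PermGroup 𝔾
  open GroupAlgebra 𝔽 𝔾
  open Averages 𝔽 𝔾
  open Projections 𝔽 𝔾
  open Densities 𝔽 𝔾
  open PositivePart 𝔽
  open Truncation 𝔽
  open Concentration 𝔽 𝔾
  open Deviations 𝔽 𝔾
  open LevelSums 𝔽 𝔾
  open Regularity 𝔽 𝔾
  open Restriction 𝔽 𝔾
  open Rows 𝔽 𝔾 scale public
  open Equality (fins n)

  module Dyadic {f : Alg} (If : Indicator f) (free : Free f f f) (α≥ : ι 32 * (m * d) ≤ dens f) (x : Fin n) (heavy-x : HeavyRow f x) where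
    open Row If free α≥ x heavy-x

    μ : ℕ → F
    μ r = pow (ι 2) r * M₀

    μ-pos : ∀ r → 0# < μ r
    μ-pos r = *-pos (pow-pos r (ι-pos 1)) M₀-pos

    μ-nn : ∀ r → 0# ≤ μ r
    μ-nn r = <⇒≤ (μ-pos r)

    cl : ℕ → Points
    cl r j = J j ∧ (test (μ r) (P f x j) ∧ not (test (μ (suc r)) (P f x j)))

    cl⊆J : ∀ r j → [ cl r j ] ≤ [ J j ]
    cl⊆J r j = ≡-≤ ([]-∧ (J j) _) (≤-≡ (*-monoˡ ([]-nn _) ([]≤1 _)) (*-identityʳ _))

    -- As `P f` is at most 1, the R dyadic classes above M₀ exhaust J.
    top : 1# < μ R
    top p = *-pos m-pos T-pos (*-cancelˡ (ι-pos 31) (by (m ∷ T ∷ nF ∷ α ∷ d ∷ []) (# 32 :* (v 0 :* v 1)) (# 32 :* # 0)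
        ((# 32 :* v 0 :* v 1 :- v 2 :* v 2 :* (v 2 :* (v 3 :* v 4))) :+ (v 2 :* v 4 :- # 64 :* (v 0 :* v 0 :* v 1)) :* (v 2 :* v 3 :* v 2) :+ # 64 :* (v 0 :* v 0 :* v 1) :* (v 2 :* v 3 :* v 2 :- # 1) :+ # 64 :* (v 0 :* (v 0 :- # 1) :* v 1))
        (⟪ upper-n ⟫ ⊹ ⟪ d-fat ⟫ ⊛ (n-nn ⊛ α-nn ⊛ n-nn) ⊹ ι-nn 64 ⊛ (m-nn ⊛ m-nn ⊛ T-nn) ⊛ ⟪ 1≤* (fat Lf) 1≤n ⟫ ⊹ ι-nn 64 ⊛ (m-nn ⊛ ⟪ 1≤m ⟫ ⊛ T-nn)) refl))
      where
      1≤n : 1# ≤ nF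
      1≤n = ≤-trans (ι-mono {1} {3} (ℕ.s≤s ℕ.z≤n)) (<⇒≤ big)
      upper-n : nF * nF * (nF * (α * d)) ≤ ι 32 * m * T
      upper-n = ≡-≤ (trans (cong (nF * nF *_) (trans (sym (T-thr α d)) (cong (T *_) (sym M₀-eq)))) (solve (nF ∷ T ∷ ι 32 * m ∷ M₀ ∷ []) (v 0 :* v 0 :* (v 1 :* (v 2 :* v 3))) (v 2 :* v 1 :* (v 0 :* v 0 :* v 3)) refl))
        (≤-≡ (*-monoˡ (<⇒≤ 32m-pos ⊛ T-nn) (≤-trans (*-monoʳ (<⇒≤ M₀-pos) n²≤) p)) (*-identityʳ _))

    cover : ∀ {j} → J j ≡ true → ∃ λ r → r ∈ upTo R × cl r j ≡ true
    cover {j} t = finish (search R (λ p → top (≤-trans p (P≤1 big If x j))))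
      where
      p = P f x j
      search : ∀ r → ¬ μ r ≤ p → ∃ λ s → s ℕ.< r × μ s ≤ p × ¬ μ (suc s) ≤ p
      search zero    q = ⊥-elim (q (≡-≤ (*-identityˡ _) (test-≤ (proj₂ (∧-true {not (j == x)} t)))))
      search (suc r) q with μ r ≤? p
      ... | yes s = r , ℕ.≤-refl , s , q
      ... | no  s with search r s
      ...   | u , l , a , b = u , ℕ.m≤n⇒m≤1+n l , a , b
      finish : (∃ λ s → s ℕ.< R × μ s ≤ p × ¬ μ (suc s) ≤ p) → ∃ λ r → r ∈ upTo R × cl r j ≡ true
      finish (r , l , a , b) = r , ∈-upTo⁺ l , cong₂ _∧_ t (cong₂ (λ u w → u ∧ not w) (test-true a) (test-false b))

    module Class (r : ℕ) (G≥ : d ≤ dens (f ∣ cl r)) where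
      g : Alg
      g = f ∣ cl r
      β size : F
      β = dens g
      size = ∣ cl r ∣
      Lg : Large g
      Lg = large (∣-ind (cl r)) G≥
      sup : ∀ π → g π ≤ [ J (π ▹ x) ]
      sup = ind-sup (cl r) (cl⊆J r)
      p : Fin n → F
      p = P g x
      p-nn : ∀ j → 0# ≤ p j
      p-nn = P-nn big (∣-ind (cl r)) x
      lower-p : ∀ j → μ r * [ cl r j ] ≤ p j
      lower-p j with bool (cl r j)
      ... | inj₁ t = ≡-≤ (*1ʳ ([]-true t)) (≤-≡ (test-≤ (proj₁ (∧-true (proj₂ (∧-true {J j} t))))) (sym (trans (P-row-∩ f x (cl r) j) (*1ˡ ([]-true t)))))
      ... | inj₂ t = ≡-≤ (*0ʳ ([]-false t)) (p-nn j)
      upper-p : ∀ j → p j ≤ ι 2 * μ r * [ cl r j ]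
      upper-p j with bool (cl r j)
      ... | inj₂ t = ≤-reflexive (trans (trans (P-row-∩ f x (cl r) j) (*0ˡ ([]-false t))) (sym (*0ʳ ([]-false t))))
      ... | inj₁ t = ≡-≤ (trans (P-row-∩ f x (cl r) j) (*1ˡ ([]-true t))) (≤-≡ (<⇒≤ (test-≰ (not-true (proj₂ (∧-true {test (μ r) (P f x j)} (proj₂ (∧-true {J j} t)))))))
            (trans (*-assoc _ _ _) (sym (*1ʳ ([]-true t)))))
        where
        not-true : ∀ {b} → not b ≡ true → b ≡ false
        not-true {false} _ = refl
      sum-p : ∑ Fs p ≡ nF * β
      sum-p = P-row g x
      size-≤ : μ r * size ≤ nF * β
      size-≤ = ≡-≤ (sym (∑-*ˡ Fs (μ r) _)) (≤-≡ (∑-mono Fs lower-p) sum-p)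
      size-≥ : nF * β ≤ ι 2 * μ r * size
      size-≥ = ≡-≤ (sym sum-p) (≤-≡ (∑-mono Fs upper-p) (∑-*ˡ Fs _ _))
      squares : ∑ Fs (λ j → p j * p j) ≤ ι 2 * μ r * (nF * β)
      squares = ≤-≡ (∑-mono Fs λ j → *-monoʳ (p-nn j) (≤-trans (upper-p j) (≤-≡ (*-monoˡ (ι-nn 2 ⊛ μ-nn r) ([]≤1 _)) (*-identityʳ _)))) (trans (∑-*ˡ Fs _ p) (cong (ι 2 * μ r *_) sum-p))

    hit : ℕ → ℕ → G → Bool
    hit r r′ g = any (λ i → cl r i ∧ cl r′ (g ▹ i)) Fs

    module Pair (r r′ : ℕ) (G≥ : d ≤ dens (f ∣ cl r)) (H≥ : d ≤ dens (f ∣ cl r′)) (D≥ : d ≤ dens (f ∩ hit r r′)) where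
      module C₁ = Class r G≥
      module C₂ = Class r′ H≥
      open C₁ using (g; β)
      open C₂ using () renaming (g to h; β to δ)
      D : Alg
      D = f ∩ hit r r′
      ID : Indicator D
      ID = ∩-ind If (hit r r′)
      LD : Large D
      LD = large ID D≥
      D≼f : D ≼ f
      D≼f y = ≤-≡ (*-monoˡ (ind-nn big If y) ([]≤1 _)) (*-identityʳ _)
      a Z Pos Xₓ : F
      a = dens D
      Z = nF * β * (nF * δ)
      Pos = ∑ Fs λ k′ → ∑ Fs λ j → P D j k′ * (P g x j * P h x k′)
      Xₓ = X a β δ
      a-nn = <⇒≤ (dens⁺ LD)
      β-nn = <⇒≤ (dens⁺ C₁.Lg)
      δ-nn = <⇒≤ (dens⁺ C₂.Lg)
      Z-pos : 0# < Z
      Z-pos = *-pos (*-pos n-pos (dens⁺ C₁.Lg)) (*-pos n-pos (dens⁺ C₂.Lg))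
      X-pos′ : 0# < Xₓ
      X-pos′ = X-pos LD C₁.Lg C₂.Lg
      PP-nn : ∀ j k′ → 0# ≤ P g x j * P h x k′
      PP-nn j k′ = C₁.p-nn j ⊛ C₂.p-nn k′
      Σ²-PP : Σ² (λ j k′ → P g x j * P h x k′) ≡ Z
      Σ²-PP = trans (∑∑-* Fs Fs (P g x) (P h x)) (cong₂ _*_ C₁.sum-p C₂.sum-p)
      Pos-form : Pos ≡ Σ² (λ j k′ → P D j k′ * (P g x j * P h x k′))
      Pos-form = ∑-swap Fs Fs _

      -- Row x needs no estimate: apart from `Pos`, only row and column sums of `P` occur in the
      -- expansion, and these are known.
      row-x : ∑ Fs (λ k′ → ∑ Fs λ j → triple D g h x j k′) ≡ Pos - Xₓ
      row-x = trans (∑-swap Fs Fs _) (trans (Σ²-cong λ j k′ → solve (P D j k′ ∷ P g x j ∷ P h x k′ ∷ a ∷ β ∷ δ ∷ []) ((v 0 :- v 3) :* ((v 1 :- v 4) :* (v 2 :- v 5)))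
          (v 0 :* (v 1 :* v 2) :+ v 4 :* v 5 :* v 0 :- (v 4 :* (v 0 :* v 2) :+ v 5 :* (v 0 :* v 1)) :- v 3 :* ((v 1 :- v 4) :* (v 2 :- v 5))) refl)
        (trans (Σ²-- _ _) (trans (cong₂ _-_ (trans (Σ²-- _ _) (cong₂ _-_ (trans (Σ²-+ _ _) (cong₂ _+_ (sym Pos-form) (trans (Σ²-* (β * δ) _) (cong (β * δ *_) all-P))))
            (trans (Σ²-+ _ _) (cong₂ _+_ (trans (Σ²-* β _) (cong (β *_) col-P)) (trans (Σ²-* δ _) (cong (δ *_) row-P))))))
            (trans (Σ²-* a _) (*0ʳ (trans (∑∑-* Fs Fs (dev g x) (dev h x)) (*0ˡ (dev-row g x))))))
          (solve (Pos ∷ nF ∷ a ∷ β ∷ δ ∷ []) (v 0 :+ v 3 :* v 4 :* (v 1 :* (v 1 :* v 2)) :- (v 3 :* (v 1 :* v 2 :* (v 1 :* v 4)) :+ v 4 :* (v 1 :* v 2 :* (v 1 :* v 3))) :- # 0) (v 0 :- v 1 :* v 1 :* (v 2 :* v 3 :* v 4)) refl))))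
        where
        all-P : Σ² (P D) ≡ nF * (nF * a)
        all-P = trans (∑-cong Fs λ j → P-row D j) (∑-const _)
        row-P : Σ² (λ j k′ → P D j k′ * P g x j) ≡ nF * a * (nF * β)
        row-P = trans (∑-cong Fs λ j → trans (∑-*ʳ Fs (P g x j) _) (cong (_* P g x j) (P-row D j))) (trans (∑-*ˡ Fs _ _) (cong (nF * a *_) C₁.sum-p))
        col-P : Σ² (λ j k′ → P D j k′ * P h x k′) ≡ nF * a * (nF * δ)
        col-P = trans (∑-swap Fs Fs _) (trans (∑-cong Fs λ k′ → trans (∑-*ʳ Fs (P h x k′) _) (cong (_* P h x k′) (P-col D k′))) (trans (∑-*ˡ Fs _ _) (cong (nF * a *_) C₂.sum-p)))

      ρ : Points
      ρ = full ∖ x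

      weight-ρ : weight ρ (triple D g h) ≡ Σ³ (triple D g h) - (Pos - Xₓ)
      weight-ρ = trans (∑-cong Fs λ k′ → trans (∑-cong Fs λ j → trans (∑-cong Fs λ i → trans (cong (_* triple D g h i j k′) (trans ([]-∖ full x i) (cong₂ (λ u w → u - u * w) ([]-true refl) refl)))
          (solve ([ i == x ] ∷ triple D g h i j k′ ∷ []) ((# 1 :- # 1 :* v 0) :* v 1) (v 1 :- v 0 :* v 1) refl)) (trans (∑-- Fs _ _) (cong (λ z → ∑ Fs (λ i → triple D g h i j k′) - z) (∑-pointF x (λ i → triple D g h i j k′))))) (∑-- Fs _ _))
        (trans (∑-- Fs _ _) (cong (λ z → Σ³ (triple D g h) - z) row-x))

      -- Every heavy product contains an entry of g or h in row i, and for i ≠ x those entries are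
      -- below the threshold by `light`.
      no-heavy : heavy D g h ρ ≡ 0#
      no-heavy = trans (cong₂ _+_ (cong₂ _+_ (*0ʳ (vanish (λ i≢x j k′ → *0ˡ (light-hi (∣-ind (cl r)) C₁.sup G≥ H≥ i≢x j)))) (*0ʳ (vanish (λ i≢x j k′ → *0ʳ (light-hi (∣-ind (cl r′)) C₂.sup D≥ H≥ i≢x k′)))))
          (*0ʳ (vanish (λ i≢x j k′ → *0ʳ (light-hi (∣-ind (cl r)) C₁.sup D≥ G≥ i≢x j))))) (solve [] (# 0 :+ # 0 :+ # 0) (# 0) refl)
        where
        vanish : ∀ {s : Fin n → Fin n → Fin n → F} → (∀ {i} → i ≢ x → ∀ j k′ → s i j k′ ≡ 0#) → weight ρ s ≡ 0#
        vanish {s} z = trans (Σ³-cong at0) (trans (∑-cong Fs λ _ → trans (∑-cong Fs λ _ → ∑-0 Fs) (∑-0 Fs)) (∑-0 Fs))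
          where
          at0 : ∀ i j k′ → [ ρ i ] * s i j k′ ≡ 0#
          at0 i j k′ with i Fin.≟ x
          ... | yes refl = *0ˡ ([]-false (∖-out full x))
          ... | no  q    = *0ʳ (z q j k′)

      -- `deficit` makes the full negative sum at least (1 - 1/ℓ) X, while the rows other than x
      -- supply at most 7X/ℓ. So row x must supply nearly X, and it supplies X - Pos.
      few : ℓ * Pos ≤ ι 8 * Xₓ
      few = by (ℓ ∷ Pos ∷ Xₓ ∷ Σ³ (triple D g h) ∷ []) (v 0 :* v 1) (# 8 :* v 2)
          ((v 0 :* # 0 :+ # 7 :* v 2 :- v 0 :* (:- (v 3 :- (v 1 :- v 2)))) :+ (v 0 :* (:- v 3) :- (v 0 :- # 1) :* v 2))
          (⟪ ≡-≤ (cong (λ z → ℓ * - z) (sym weight-ρ)) (≤-≡ (gain LD C₁.Lg C₂.Lg ρ) (cong (λ z → ℓ * z + ι 7 * Xₓ) no-heavy)) ⟫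
            ⊹ ⟪ deficit LD C₁.Lg C₂.Lg (free-mono (ind-nn big ID) (ind-nn big (∣-ind (cl r))) (ind-nn big (∣-ind (cl r′))) D≼f (∣-≼ (cl r)) (∣-≼ (cl r′)) free) ⟫) refl

      -- Every permutation in D maps a point of the first class into the second.
      hits : nF * a ≤ Σ² λ j k′ → P D j k′ * ([ cl r j ] * [ cl r′ k′ ])
      hits = ≡-≤ (solve (nF ∷ tot D ∷ recip N ∷ []) (v 0 :* (v 1 :* v 2)) (v 0 :* v 2 :* v 1) refl) (≤-≡ (*-monoˡ (n-nn ⊛ inv-nn N-pos) (∑-mono Gs each))
          (trans (cong (nF * recip N *_) (trans (∑-cong Gs λ π → sym (∑-*ˡ Fs (D π) _)) (trans (∑-swap Gs Fs _) (∑-cong Fs λ j →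
              trans (∑-cong Gs λ π → trans (cong (λ z → D π * ([ cl r j ] * z)) (sym (trans (∑-cong Fs λ k′ → cong (λ b → [ b ] * [ cl r′ k′ ]) (==-sym (π ▹ j) k′)) (∑-pointF (π ▹ j) (λ k′ → [ cl r′ k′ ])))))
                (trans (sym (*-assoc _ _ _)) (sym (∑-*ˡ Fs _ _)))) (∑-swap Gs Fs _)))))
            (trans (sym (Σ²-* _ _)) (Σ²-cong λ j k′ → trans (cong (nF * recip N *_) (trans (∑-cong Gs λ π → solve (D π ∷ [ cl r j ] ∷ [ π ▹ j == k′ ] ∷ [ cl r′ k′ ] ∷ []) (v 0 :* v 1 :* (v 2 :* v 3)) (v 0 :* v 2 :* (v 1 :* v 3)) refl) (∑-*ʳ Gs _ _)))
              (solve (nF ∷ recip N ∷ cnt D j k′ ∷ [ cl r j ] * [ cl r′ k′ ] ∷ []) (v 0 :* v 1 :* (v 2 :* v 3)) (v 0 :* (v 2 :* v 1) :* v 3) refl)))))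
        where
        each : ∀ π → D π ≤ D π * ∑ Fs λ j → [ cl r j ] * [ cl r′ (π ▹ j) ]
        each π with bool (hit r r′ π)
        ... | inj₂ t = ≤-reflexive (trans (*0ʳ ([]-false t)) (sym (*0ˡ (*0ʳ ([]-false t)))))
        ... | inj₁ t with any-elim (λ i → cl r i ∧ cl r′ (π ▹ i)) Fs t
        ...   | i , _ , u = ≤-*ʳ (ind-nn big ID π) (≡-≤ (sym (trans (sym ([]-∧ (cl r i) _)) ([]-true u))) (∑-term (fins n) i (λ j → [ cl r j ] * [ cl r′ (π ▹ j) ]) (λ j → []-nn _ ⊛ []-nn _)))

      -- On their classes the entries of g and h in row x are at least μ and μ′, so Pos ≥ μμ′na by
      -- `hits`. On the other hand nβ and nδ are at most 2μ and 2μ′ times the class sizes.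
      many : nF * Xₓ ≤ ι 4 * (C₁.size * C₂.size) * Pos
      many = ≡-≤ (solve (nF ∷ a ∷ β ∷ δ ∷ []) (v 0 :* (v 0 :* v 0 :* (v 1 :* v 2 :* v 3))) (v 0 :* v 2 :* (v 0 :* v 3) :* (v 0 :* v 1)) refl)
        (≤-trans (*-monoʳ (n-nn ⊛ a-nn) (*-mono (n-nn ⊛ β-nn) (≤-trans (n-nn ⊛ δ-nn) C₂.size-≥) C₁.size-≥ C₂.size-≥))
        (≡-≤ (solve (μ r ∷ μ r′ ∷ C₁.size ∷ C₂.size ∷ nF * a ∷ []) (# 2 :* v 0 :* v 2 :* (# 2 :* v 1 :* v 3) :* v 4) (# 4 :* (v 2 :* v 3) :* (v 0 :* v 1 :* v 4)) refl)
          (*-monoˡ (ι-nn 4 ⊛ (size-nn r ⊛ size-nn r′)) (≤-trans (*-monoˡ (μ-nn r ⊛ μ-nn r′) hits) (≡-≤ (sym (Σ²-* _ _)) (≤-≡ (Σ²-mono each) (sym Pos-form)))))))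
        where
        size-nn : ∀ r → 0# ≤ ∣ cl r ∣
        size-nn r = ∑-nn Fs λ j → []-nn _
        each : ∀ j k′ → μ r * μ r′ * (P D j k′ * ([ cl r j ] * [ cl r′ k′ ])) ≤ P D j k′ * (P g x j * P h x k′)
        each j k′ = ≡-≤ (solve (μ r ∷ μ r′ ∷ P D j k′ ∷ [ cl r j ] ∷ [ cl r′ k′ ] ∷ []) (v 0 :* v 1 :* (v 2 :* (v 3 :* v 4))) (v 2 :* (v 0 :* v 3 :* (v 1 :* v 4))) refl)
          (*-monoˡ (P-nn big ID j k′) (*-mono (μ-nn r ⊛ []-nn _) (C₂.p-nn k′) (C₁.lower-p j) (C₂.lower-p k′)))

      -- `lower` for the matrix s(j, k) = P g x j · P h x k keeps Pos above half of its mean aZ = X.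
      -- With λ′ = Z/4 it requires 16 m² n ‖s‖² ≤ Z²; as ‖s‖² ≤ 4μμ′Z and μμ′ times the sizes is at
      -- most Z, the assumed product of sizes is what it takes.
      spread : ι 64 * (m * m * nF) ≤ C₁.size * C₂.size → Xₓ ≤ ι 2 * Pos
      spread wide = ≡-≤ (solve (nF ∷ a ∷ β ∷ δ ∷ []) (v 0 :* v 0 :* (v 1 :* v 2 :* v 3)) (v 1 :* (v 0 :* v 2 :* (v 0 :* v 3))) refl)
          (by (a * Z ∷ Pos ∷ E₁ ∷ []) (v 0) (# 2 :* v 1) (v 0 :- # 2 :* (:- v 2) :+ # 2 :* (v 1 :- (v 2 :+ v 0))) (⟪ half ⟫ ⊹ ι-nn 2 ⊛ ⟪ ≤-reflexive (sym split) ⟫) refl)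
        where
        q = recip (ι 4)
        4q : ι 4 * q ≡ 1#
        4q = *-inv⁺ (ι-pos 3)
        E₁ S₁ : F
        E₁ = Σ² λ j k′ → dev D j k′ * (P g x j * P h x k′)
        S₁ = Σ² λ j k′ → P g x j * P h x k′ * (P g x j * P h x k′)
        split : Pos ≡ E₁ + a * Z
        split = trans Pos-form (trans (Σ²-cong λ j k′ → solve (P D j k′ ∷ a ∷ P g x j * P h x k′ ∷ []) (v 0 :* v 2) ((v 0 :- v 1) :* v 2 :+ v 1 :* v 2) refl) (trans (Σ²-+ _ _) (cong (E₁ +_) (trans (Σ²-* a _) (cong (a *_) Σ²-PP)))))
        sizes-pos : 0# < C₁.size * C₂.size
        sizes-pos = <-≤-trans (*-pos (ι-pos 63) (*-pos (*-pos m-pos m-pos) n-pos)) wide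
        S₁≤ : S₁ ≤ ι 2 * μ r * (nF * β) * (ι 2 * μ r′ * (nF * δ))
        S₁≤ = ≡-≤ (trans (Σ²-cong λ j k′ → solve (P g x j ∷ P h x k′ ∷ []) (v 0 :* v 1 :* (v 0 :* v 1)) (v 0 :* v 0 :* (v 1 :* v 1)) refl) (∑∑-* Fs Fs _ _))
          (*-mono (∑-nn Fs λ j → sq-nn _) (ι-nn 2 ⊛ μ-nn r′ ⊛ (n-nn ⊛ δ-nn)) C₁.squares C₂.squares)
        variance : ι 16 * (m * m * (nF * S₁)) ≤ Z * Z
        variance = *-cancelˡ sizes-pos (≤-trans (*-monoˡ (<⇒≤ sizes-pos) (*-monoˡ (ι-nn 16) (*-monoˡ (sq-nn m) (*-monoˡ n-nn S₁≤))))
          (≡-≤ (solve (C₁.size ∷ C₂.size ∷ m ∷ nF ∷ μ r ∷ μ r′ ∷ β ∷ δ ∷ [])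
              (v 0 :* v 1 :* (# 16 :* (v 2 :* v 2 :* (v 3 :* (# 2 :* v 4 :* (v 3 :* v 6) :* (# 2 :* v 5 :* (v 3 :* v 7)))))))
              (# 64 :* (v 2 :* v 2 :* v 3) :* (v 3 :* v 6 :* (v 3 :* v 7)) :* (v 4 :* v 0 :* (v 5 :* v 1))) refl)
          (≤-≡ (*-mono (ι-nn 64 ⊛ (sq-nn m ⊛ n-nn) ⊛ <⇒≤ Z-pos) (<⇒≤ Z-pos) (*-monoʳ (<⇒≤ Z-pos) wide) (*-mono (μ-nn r ⊛ ∑-nn Fs (λ j → []-nn _)) (n-nn ⊛ δ-nn) C₁.size-≤ C₂.size-≤))
            (*-assoc _ _ _))))
        half : ι 2 * - E₁ ≤ a * Z
        half = ≤-≡ (*-monoˡ (ι-nn 2) (lower ID (dense LD) (λ j k′ → P g x j * P h x k′) PP-nn {q * Z} (*-pos (inv-pos (ι-pos 3)) Z-pos)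
            (*-cancelˡ (ι-pos 15) (≤-≡ variance (trans (sym (*1ˡ (trans (cong₂ _*_ 4q 4q) (*-identityˡ 1#)))) (solve (q ∷ Z ∷ []) (# 4 :* v 0 :* (# 4 :* v 0) :* (v 1 :* v 1)) (# 16 :* (v 0 :* v 1 :* (v 0 :* v 1))) refl))))))
          (trans (solve (q ∷ Z ∷ a ∷ []) (# 2 :* (# 2 :* (v 0 :* v 1 :* v 2))) (# 4 :* v 0 :* (v 2 :* v 1)) refl) (*1ˡ 4q))

      -- Small classes give X ≤ 256 m² Pos ≤ 2048 X/m² with m ≥ 128; large ones give X ≤ 2 Pos ≤ 16
      -- X/ℓ with ℓ ≥ 128.
      contradictory : ⊥
      contradictory with ≤-total (C₁.size * C₂.size) (ι 64 * (m * m * nF))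
      ... | inj₁ narrow = *-pos (*-pos m-pos m-pos) X-pos′ (*-cancelˡ (ι-pos 0) (by (m ∷ Pos ∷ Xₓ ∷ []) (# 1 :* (v 0 :* v 0 :* v 2)) (# 1 :* # 0)
            (ℓ′ :* (# 256 :* (v 0 :* v 0) :* v 1 :- v 2) :+ # 256 :* (v 0 :* v 0) :* (# 8 :* v 2 :- ℓ′ :* v 1) :+ v 0 :* v 0 :* v 2 :* (v 0 :* (v 0 :- # 128) :+ # 128 :* (v 0 :- # 128) :+ # 14335))
            (ℓ-nn ⊛ ⟪ bound ⟫ ⊹ ι-nn 256 ⊛ sq-nn m ⊛ ⟪ few ⟫ ⊹ sq-nn m ⊛ <⇒≤ X-pos′ ⊛ (m-nn ⊛ ⟪ m≥128 ⟫ ⊹ ι-nn 128 ⊛ ⟪ m≥128 ⟫ ⊹ ι-nn 14335)) refl))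
        where
        ℓ′ = v 0 :* (v 0 :* (v 0 :* (v 0 :* # 1)))
        Pos-nn : 0# ≤ Pos
        Pos-nn = ∑-nn Fs λ k′ → ∑-nn Fs λ j → P-nn big ID j k′ ⊛ PP-nn j k′
        bound : Xₓ ≤ ι 256 * (m * m) * Pos
        bound = *-cancelˡ n-pos (≤-trans many (≤-≡ (*-monoʳ Pos-nn (*-monoˡ (ι-nn 4) narrow)) (solve (m ∷ nF ∷ Pos ∷ []) (# 4 :* (# 64 :* (v 0 :* v 0 :* v 1)) :* v 2) (v 1 :* (# 256 :* (v 0 :* v 0) :* v 2)) refl)))
      ... | inj₂ wide = X-pos′ (*-cancelˡ (ι-pos 0) (by (ℓ ∷ Pos ∷ Xₓ ∷ []) (# 1 :* v 2) (# 1 :* # 0)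
            (v 0 :* (# 2 :* v 1 :- v 2) :+ # 2 :* (# 8 :* v 2 :- v 0 :* v 1) :+ (v 0 :- # 128) :* v 2 :+ # 111 :* v 2)
            (ℓ-nn ⊛ ⟪ spread wide ⟫ ⊹ ι-nn 2 ⊛ ⟪ few ⟫ ⊹ ⟪ 128≤ℓ ⟫ ⊛ <⇒≤ X-pos′ ⊹ ι-nn 111 ⊛ <⇒≤ X-pos′) refl))

    good : ℕ → Bool
    good r = test d (dens (f ∣ cl r))

    I : Points
    I j = any (λ r → good r ∧ cl r j) (upTo R)

    rare : ∀ r r′ → [ good r ] * [ good r′ ] * dens (f ∩ hit r r′) ≤ d
    rare r r′ with bool (good r) | bool (good r′) | ≤-total d (dens (f ∩ hit r r′))
    ... | inj₂ a | _      | _      = ≡-≤ (*0ˡ (*0ˡ ([]-false a))) d-nn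
    ... | inj₁ _ | inj₂ b | _      = ≡-≤ (*0ˡ (*0ʳ ([]-false b))) d-nn
    ... | inj₁ a | inj₁ b | inj₁ p = ⊥-elim (Pair.contradictory r r′ (test-≤ a) (test-≤ b) p)
    ... | inj₁ a | inj₁ b | inj₂ p = ≡-≤ (trans (cong₂ (λ u w → u * w * dens (f ∩ hit r r′)) ([]-true a) ([]-true b)) (trans (cong (_* dens (f ∩ hit r r′)) (*-identityˡ 1#)) (*-identityˡ _))) p

    sparse : ∀ r → [ not (good r) ] * dens (f ∣ cl r) ≤ d
    sparse r with bool (good r)
    ... | inj₁ a = ≡-≤ (*0ˡ ([]-false (cong not a))) d-nn
    ... | inj₂ a = ≡-≤ (*1ˡ ([]-true (cong not a))) (<⇒≤ (test-≰ a))

    fixed : Alg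
    fixed = f ∣ (_== x)

    -- The single entry `P f x x` ≤ 1 bounds the density by 1/n, and nd ≥ T ≥ 1.
    fixed-≤ : dens fixed ≤ d
    fixed-≤ = *-cancelˡ n-pos (≡-≤ (trans (sym (row-mass f x (_== x))) (∑-pointF x (P f x))) (≤-trans (P≤1 big If x x) (≤-trans 1≤T (T≤ ≤-refl))))

    bad₁ bad₂ : Alg
    bad₁ π = ∑ (upTo R) λ r → [ not (good r) ] * (f ∣ cl r) π
    bad₂ π = ∑ (upTo R) λ r → ∑ (upTo R) λ r′ → [ good r ] * [ good r′ ] * (f ∩ hit r r′) π

    ∑-≤ : ∀ (h : ℕ → F) {c} → (∀ r → h r ≤ c) → ∑ (upTo R) h ≤ ι R * c
    ∑-≤ h {c} p = ≤-≡ (∑-mono (upTo R) {h} {λ _ → 1# * c} (λ r → ≤-≡ (p r) (sym (*-identityˡ c))))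
      (trans (∑-*ʳ (upTo R) c (λ _ → 1#)) (cong (_* c) (trans (∑-1 (upTo R)) (cong ι (length-upTo R)))))

    bad₁-≤ : dens bad₁ ≤ ι R * d
    bad₁-≤ = ≡-≤ (trans (dens-∑ (upTo R) _) (∑-cong (upTo R) λ r → dens-* _ (f ∣ cl r))) (∑-≤ _ sparse)

    bad₂-≤ : dens bad₂ ≤ ι R * (ι R * d)
    bad₂-≤ = ≡-≤ (trans (dens-∑ (upTo R) _) (∑-cong (upTo R) λ r → trans (dens-∑ (upTo R) _) (∑-cong (upTo R) λ r′ → dens-* _ (f ∩ hit r r′)))) (∑-≤ _ λ r → ∑-≤ _ (rare r))

    rest : Alg
    rest = f ∩ λ π → not (inFamily I x π)

    -- Four ways to leave the family: π(x) lies neither in J nor at x, π(x) = x, π(x) lies in a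
    -- negligible class, or π maps a point of one kept class into a kept class.
    rest-≼ : rest ≼ f₂ ⊕ fixed ⊕ bad₁ ⊕ bad₂
    rest-≼ π = cases (bool (inFamily I x π)) (bool (π ▹ x == x)) (bool (J (π ▹ x)))
      where
      fπ-nn = ind-nn big If π
      b₁-nn : ∀ r → 0# ≤ [ not (good r) ] * (f ∣ cl r) π
      b₁-nn r = []-nn _ ⊛ (fπ-nn ⊛ []-nn _)
      b₂-nn : ∀ r r′ → 0# ≤ [ good r ] * [ good r′ ] * (f ∩ hit r r′) π
      b₂-nn r r′ = []-nn _ ⊛ []-nn _ ⊛ (fπ-nn ⊛ []-nn _)
      n₁ : 0# ≤ f₂ π
      n₁ = fπ-nn ⊛ []-nn _
      n₂ : 0# ≤ fixed π
      n₂ = fπ-nn ⊛ []-nn _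
      n₃ : 0# ≤ bad₁ π
      n₃ = ∑-nn (upTo R) b₁-nn
      n₄ : 0# ≤ bad₂ π
      n₄ = ∑-nn (upTo R) λ r → ∑-nn (upTo R) (b₂-nn r)
      ρ = f₂ π ∷ fixed π ∷ bad₁ π ∷ bad₂ π ∷ []
      rest≤ : rest π ≤ f π
      rest≤ = ≤-≡ (*-monoˡ fπ-nn ([]≤1 _)) (*-identityʳ _)
      via : ∀ {b z} → b ≡ true → f π * [ b ] ≤ z → rest π ≤ z
      via t p = ≤-trans rest≤ (≡-≤ (sym (*1ʳ ([]-true t))) p)
      hit-case : (∃ λ i → I i ∧ I (π ▹ i) ≡ true) → rest π ≤ bad₂ π
      hit-case (i , t) with any-elim (λ r → good r ∧ cl r i) (upTo R) (proj₁ (∧-true t)) | any-elim (λ r → good r ∧ cl r (π ▹ i)) (upTo R) (proj₂ (∧-true {I i} t))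
      ... | r , m₁ , a | r′ , m₂ , b = via (any-intro (λ i → cl r i ∧ cl r′ (π ▹ i)) (∈-allFin i) (cong₂ _∧_ (proj₂ (∧-true {good r} a)) (proj₂ (∧-true {good r′} b))))
          (≡-≤ (sym (trans (cong (_* (f ∩ hit r r′) π) (trans (cong₂ _*_ ([]-true (proj₁ (∧-true {good r} a))) ([]-true (proj₁ (∧-true {good r′} b)))) (*-identityˡ 1#))) (*-identityˡ _)))
          (≤-trans (∑-∈ (upTo R) {λ r′ → [ good r ] * [ good r′ ] * (f ∩ hit r r′) π} m₂ (b₂-nn r)) (∑-∈ (upTo R) {λ r → ∑ (upTo R) λ r′ → [ good r ] * [ good r′ ] * (f ∩ hit r r′) π} m₁ λ r → ∑-nn (upTo R) (b₂-nn r))))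
      class-case : inFamily I x π ≡ false → (∃ λ r → r ∈ upTo R × cl r (π ▹ x) ≡ true) → rest π ≤ bad₁ π + bad₂ π
      class-case e (r , i , t) with bool (good r)
      ... | inj₂ q = ≤-trans (via t (≡-≤ (sym (*1ˡ ([]-true (cong not q)))) (∑-∈ (upTo R) {λ r → [ not (good r) ] * (f ∣ cl r) π} i b₁-nn))) (by ρ (v 2) (v 2 :+ v 3) (v 3) n₄ refl)
      ... | inj₁ q = ≤-trans (hit-case (all-elim (λ i → I i ∧ I (π ▹ i)) Fs (trans (cong (_∧ all (λ i → not (I i ∧ I (π ▹ i))) Fs) (sym (any-intro (λ r → good r ∧ cl r (π ▹ x)) i (cong₂ _∧_ q t)))) e)))
            (by ρ (v 3) (v 2 :+ v 3) (v 2) n₃ refl)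
      cases : inFamily I x π ≡ true ⊎ inFamily I x π ≡ false → (π ▹ x == x) ≡ true ⊎ (π ▹ x == x) ≡ false → J (π ▹ x) ≡ true ⊎ J (π ▹ x) ≡ false → rest π ≤ f₂ π + fixed π + bad₁ π + bad₂ π
      cases (inj₁ e) _        _        = ≡-≤ (*0ʳ ([]-false (cong not e))) (n₁ ⊹ n₂ ⊹ n₃ ⊹ n₄)
      cases (inj₂ e) (inj₁ a) _        = ≤-trans (via a ≤-refl) (by ρ (v 1) (v 0 :+ v 1 :+ v 2 :+ v 3) (v 0 :+ v 2 :+ v 3) (n₁ ⊹ n₃ ⊹ n₄) refl)
      cases (inj₂ e) (inj₂ a) (inj₂ b) = ≤-trans (via (cong₂ (λ u w → not u ∧ not w) b a) ≤-refl) (by ρ (v 0) (v 0 :+ v 1 :+ v 2 :+ v 3) (v 1 :+ v 2 :+ v 3) (n₂ ⊹ n₃ ⊹ n₄) refl)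
      cases (inj₂ e) (inj₂ a) (inj₁ b) = ≤-trans (class-case e (cover b)) (by ρ (v 2 :+ v 3) (v 0 :+ v 1 :+ v 2 :+ v 3) (v 0 :+ v 1) (n₁ ⊹ n₂) refl)

    rest-≤ : dens rest ≤ ι 2 * (m * m * d)
    rest-≤ = ≤-trans (dens-mono rest-≼) (≡-≤ (trans (dens-+ _ _) (cong (_+ dens bad₂) (trans (dens-+ _ _) (cong (_+ dens bad₁) (dens-+ _ _)))))
        (≤-trans (+-mono (+-mono (+-mono mass₂ fixed-≤) bad₁-≤) bad₂-≤)
          (by (m ∷ d ∷ ι R ∷ []) (v 1 :+ v 1 :+ v 2 :* v 1 :+ v 2 :* (v 2 :* v 1)) (# 2 :* (v 0 :* v 0 :* v 1))
            (v 1 :* (# 2 :* ((v 0 :- (# 1 :+ v 2)) :* v 0 :+ (# 1 :+ v 2) :* (v 0 :- (# 1 :+ v 2))) :+ v 2 :* v 2 :+ # 3 :* v 2))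
            (d-nn ⊛ (ι-nn 2 ⊛ (⟪ R≤ ⟫ ⊛ m-nn ⊹ (0≤1 ⊹ ι-nn R) ⊛ ⟪ R≤ ⟫) ⊹ ι-nn R ⊛ ι-nn R ⊹ ι-nn 3 ⊛ ι-nn R)) refl)))
      where
      R≤ : 1# + ι R ≤ m
      R≤ = ≡-≤ (sym (ι-suc R)) R≤m

  row-structure : ∀ {f} → Indicator f → Free f f f → ι 32 * (m * d) ≤ dens f → ∀ x → HeavyRow f x →
    Σ Points λ I → dens (f ∩ λ π → not (inFamily I x π)) ≤ ι 2 * (m * m * d)
  row-structure If free α≥ x hx = Dyadic.I If free α≥ x hx , Dyadic.rest-≤ If free α≥ x hx

  structure : ∀ {f} → Indicator f → Free f f f → ι 32 * (m * d) ≤ dens f → ∃ λ x → Σ Points λ I →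
    dens (f ∩ λ π → not (inFamily I x π)) ≤ ι 2 * (m * m * d) ⊎ dens (f † ∩ λ π → not (inFamily I x π)) ≤ ι 2 * (m * m * d)
  structure {f} If free α≥ = cases (heavy-line (large If d≤) free)
    where
    d≤ : d ≤ dens f
    d≤ = ≤-trans (≤-≡ (≤-*ʳ d-nn (1≤* (ι-mono {1} {32} (ℕ.s≤s ℕ.z≤n)) 1≤m)) (solve (d ∷ m ∷ []) (v 0 :* (# 32 :* v 1)) (# 32 :* (v 1 :* v 0)) refl)) α≥
    cases : (∃ λ x → HeavyRow f x ⊎ HeavyRow (f †) x) → ∃ λ x → Σ Points λ I →
      dens (f ∩ λ π → not (inFamily I x π)) ≤ ι 2 * (m * m * d) ⊎ dens (f † ∩ λ π → not (inFamily I x π)) ≤ ι 2 * (m * m * d)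
    cases (x , inj₁ hx) = x , proj₁ res , inj₁ (proj₂ res)
      where res = row-structure If free α≥ x hx
    cases (x , inj₂ hx) = x , proj₁ res , inj₂ (proj₂ res)
      where res = row-structure (†-ind If) (free-† free) (subst (ι 32 * (m * d) ≤_) (sym (dens-† f)) α≥) x hx

-- Tables of values and the parity of permutations

module Tables where

  private
    variable
      A : Set
      n : ℕ

  all-intro : ∀ (p : A → Bool) xs → (∀ x → p x ≡ true) → all p xs ≡ true
  all-intro p []       h = refl
  all-intro p (x ∷ xs) h = cong₂ _∧_ (h x) (all-intro p xs h)

  all-∈ : ∀ (p : A → Bool) {x xs} → all p xs ≡ true → x ∈ xs → p x ≡ true
  all-∈ p {xs = y ∷ xs} e i with p y in q
  all-∈ p {xs = y ∷ xs} e (here refl) | true = q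
  all-∈ p {xs = y ∷ xs} e (there i)   | true = all-∈ p e i

  Injective : Tab n → Set
  Injective t = ∀ {i j} → lookup t i ≡ lookup t j → i ≡ j

  isPerm⇒injective : ∀ (t : Tab n) → isPerm t ≡ true → Injective t
  isPerm⇒injective t e {i} {j} p with i Fin.≟ j | all-∈ _ (all-∈ _ e (∈-allFin i)) (∈-allFin j)
  ... | yes q | _ = q
  ... | no  _ | r with lookup t i Fin.≟ lookup t j
  ...   | no q = ⊥-elim (q p)

  injective⇒isPerm : ∀ (t : Tab n) → Injective t → isPerm t ≡ true
  injective⇒isPerm {n} t inj = all-intro _ (allFin n) λ i → all-intro _ (allFin n) λ j → each i j
    where
    each : ∀ i j → (if ⌊ i Fin.≟ j ⌋ then true else not ⌊ lookup t i Fin.≟ lookup t j ⌋) ≡ true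
    each i j with i Fin.≟ j
    ... | yes _ = refl
    ... | no  p with lookup t i Fin.≟ lookup t j
    ...   | yes q = ⊥-elim (p (inj q))
    ...   | no  _ = refl

  surjective : ∀ (t : Tab n) → Injective t → ∀ j → ∃ λ i → lookup t i ≡ j
  surjective {suc n} t inj j with Fin.any? (λ i → lookup t i Fin.≟ j)
  ... | yes p = p
  ... | no  p = ⊥-elim (clash (Fin.pigeonhole (ℕ.n<1+n n) λ i → punchOut (λ e → p (i , sym e))))
    where
    clash : ¬ (∃ λ a → ∃ λ b → a Fin.< b × punchOut (λ e → p (a , sym e)) ≡ punchOut (λ e → p (b , sym e)))
    clash (a , b , l , e) = Fin.<⇒≢ l (inj (Fin.punchOut-injective {i = j} _ _ e))

  -- The search loop inside preimage is local to Defs; unification recovers it.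
  mutual
    search : (t : Tab n) → Fin n → List (Fin n) → Fin n
    search = _

    preimage-search : ∀ (t : Tab n) j xs → xs ≡ allFin n → search t j xs ≡ preimage t j
    preimage-search {n} t j xs e with allFin n | e
    ... | _ | refl = refl

  search-finds : ∀ (t : Tab n) {j i} xs → i ∈ xs → lookup t i ≡ j → lookup t (search t j xs) ≡ j
  search-finds t {j} (k ∷ xs) m e with lookup t k Fin.≟ j
  ... | yes q = q
  search-finds t (k ∷ xs) (here refl) e | no q = ⊥-elim (q e)
  search-finds t (k ∷ xs) (there m)   e | no q = search-finds t xs m e

  lookup-inv : ∀ (t : Tab n) → Injective t → ∀ j → lookup t (lookup (inv t) j) ≡ j
  lookup-inv {n} t inj j = trans (cong (lookup t) (trans (Vec.lookup∘tabulate (preimage t) j) (sym (preimage-search t j (allFin n) refl))))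
    (search-finds t (allFin n) (∈-allFin _) (proj₂ (surjective t inj j)))

  inv-lookup : ∀ (t : Tab n) → Injective t → ∀ i → lookup (inv t) (lookup t i) ≡ i
  inv-lookup t inj i = inj (lookup-inv t inj (lookup t i))

  lookup-· : ∀ (a b : Tab n) i → lookup (a · b) i ≡ lookup a (lookup b i)
  lookup-· a b i = Vec.lookup-map i (lookup a) b

  allVecs≡ : ∀ n k → allVecs n (suc k) ≡ cartesianProductWith _∷_ (allFin n) (allVecs n k)
  allVecs≡ n k = go (allFin n)
    where
    go : ∀ xs → concatMap (λ x → map (x ∷_) (allVecs n k)) xs ≡ cartesianProductWith _∷_ xs (allVecs n k)
    go []       = refl
    go (x ∷ xs) = cong (map (x ∷_) (allVecs n k) ++_) (go xs)

  allVecs-unique : ∀ n k → Unique (allVecs n k)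
  allVecs-unique n zero    = [] ∷ []
  allVecs-unique n (suc k) = subst Unique (sym (allVecs≡ n k)) (cartesianProductWith⁺ _∷_ Vec.∷-injective (allFin⁺ n) (allVecs-unique n k))

  allVecs-complete : ∀ n k (t : Vec (Fin n) k) → t ∈ allVecs n k
  allVecs-complete n zero    []      = here refl
  allVecs-complete n (suc k) (x ∷ t) = subst (x ∷ t ∈_) (sym (allVecs≡ n k)) (∈-cartesianProductWith⁺ _∷_ (∈-allFin x) (allVecs-complete n k t))

  module Filtered {A : Set} (p : A → Bool) where

    Element : Set
    Element = Σ A λ x → p x ≡ true

    element-≡ : ∀ {a b : Element} → proj₁ a ≡ proj₁ b → a ≡ b
    element-≡ {x , e} {_ , e′} refl = cong (x ,_) (Decidable⇒UIP.≡-irrelevant Bool._≟_ e e′)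

    -- The value of p x comes as a separate boolean with an equation, so that later proofs can split
    -- on it while the membership proof for x remains available.
    cons : ∀ x b → p x ≡ b → List Element → List Element
    cons x true  e xs = (x , e) ∷ xs
    cons x false e xs = xs

    attach : List A → List Element
    attach []       = []
    attach (x ∷ xs) = cons x (p x) refl (attach xs)

    cons-here : ∀ {x} b (q : p x ≡ b) (e : p x ≡ true) xs → (x , e) ∈ cons x b q xs
    cons-here true  q e xs = here (element-≡ refl)
    cons-here false q e xs = ⊥-elim (Bool.not-¬ e q)

    cons-there : ∀ {x y} b (q : p x ≡ b) {xs} → y ∈ xs → y ∈ cons x b q xs
    cons-there true  q m = there m
    cons-there false q m = m

    attach-∈ : ∀ {x} xs (e : p x ≡ true) → x ∈ xs → (x , e) ∈ attach xs
    attach-∈ (y ∷ xs) e (here refl) = cons-here (p y) refl e (attach xs)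
    attach-∈ (y ∷ xs) e (there m)   = cons-there (p y) refl (attach-∈ xs e m)

    attach-All : ∀ {P : A → Set} xs → All P xs → All (λ y → P (proj₁ y)) (attach xs)
    attach-All []       []      = []
    attach-All {P} (x ∷ xs) (a ∷ b) = go (p x) refl
      where
      go : ∀ b q → All (λ y → P (proj₁ y)) (cons x b q (attach xs))
      go true  q = a ∷ attach-All xs b
      go false q = attach-All xs b

    attach-unique : ∀ xs → Unique xs → Unique (attach xs)
    attach-unique []       []      = []
    attach-unique (x ∷ xs) (a ∷ u) = go (p x) refl
      where
      go : ∀ b q → Unique (cons x b q (attach xs))
      go true  q = All.map (λ r s → r (cong proj₁ s)) (attach-All xs a) ∷ attach-unique xs u
      go false q = attach-unique xs u

    filter-true : ∀ {x xs} → p x ≡ true → filterᵇ p (x ∷ xs) ≡ x ∷ filterᵇ p xs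
    filter-true {x} q with p x | q
    ... | _ | refl = refl

    filter-false : ∀ {x xs} → p x ≡ false → filterᵇ p (x ∷ xs) ≡ filterᵇ p xs
    filter-false {x} q with p x | q
    ... | _ | refl = refl

    module Count (𝔽 : OrderedField) where
      open Sums 𝔽
      open Arithmetic 𝔽

      ∑-filter : ∀ (r : A → Bool) xs → ι (length (filterᵇ r xs)) ≡ ∑ xs λ x → [ r x ]
      ∑-filter r []       = sym (∑-[] _)
      ∑-filter r (x ∷ xs) with r x in q
      ... | true  = trans (ι-suc (length (filterᵇ r xs))) (sym (trans (∑-∷ x xs _) (cong₂ _+_ ([]-true q) (sym (∑-filter r xs)))))
      ... | false = sym (trans (∑-∷ x xs _) (trans (cong₂ _+_ ([]-false q) (sym (∑-filter r xs))) (+-identityˡ _)))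

      ∑-attach : ∀ xs (f : A → F) → ∑ (attach xs) (λ y → f (proj₁ y)) ≡ ∑ (filterᵇ p xs) f
      ∑-attach []       f = trans (∑-[] _) (sym (∑-[] f))
      ∑-attach (x ∷ xs) f = go (p x) refl
        where
        go : ∀ b (q : p x ≡ b) → ∑ (cons x b q (attach xs)) (λ y → f (proj₁ y)) ≡ ∑ (filterᵇ p (x ∷ xs)) f
        go true  q = trans (∑-∷ _ _ _) (trans (cong (f x +_) (∑-attach xs f)) (trans (sym (∑-∷ x _ f)) (cong (λ ys → ∑ ys f) (sym (filter-true q)))))
        go false q = trans (∑-attach xs f) (cong (λ ys → ∑ ys f) (sym (filter-false q)))

  open Filtered using (element-≡)

  AltElement : ℕ → Set
  AltElement n = Filtered.Element (isAlt {n})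

  alt-finite : ∀ n → Finite (AltElement n)
  alt-finite n = record
    { elems    = Filtered.attach isAlt (allVecs n n)
    ; unique   = Filtered.attach-unique isAlt _ (allVecs-unique n n)
    ; complete = λ (t , e) → Filtered.attach-∈ isAlt _ e (allVecs-complete n n t)
    ; _≟_      = λ a b → dec a b (Vec.≡-dec Fin._≟_ (proj₁ a) (proj₁ b)) }
    where
    dec : ∀ a b → Dec (proj₁ a ≡ proj₁ b) → Dec (a ≡ b)
    dec a b (yes p) = yes (element-≡ isAlt p)
    dec a b (no  p) = no λ q → p (cong proj₁ q)

  lt : Fin n → Fin n → Bool
  lt i j = ⌊ i Fin.<? j ⌋

  lt-true : ∀ {i j : Fin n} → i Fin.< j → lt i j ≡ true
  lt-true {i = i} {j} p with i Fin.<? j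
  ... | yes _ = refl
  ... | no  q = ⊥-elim (q p)

  lt-false : ∀ {i j : Fin n} → ¬ i Fin.< j → lt i j ≡ false
  lt-false {i = i} {j} p with i Fin.<? j
  ... | yes q = ⊥-elim (p q)
  ... | no  _ = refl

  -- Whether t reverses the order of i and j. For injective t this is symmetric in i and j, unlike
  -- the test inside `inversions`, so both indices can be moved along a permutation.
  turn : (Fin n → Fin n) → Fin n → Fin n → Bool
  turn t i j = lt i j xor lt (t i) (t j)

  module Parity (𝔽 : OrderedField) where
    open Sums 𝔽
    open Arithmetic 𝔽

    private
      Fs : List (Fin n)
      Fs {n} = allFin n

    ι-injective : ∀ {a b} → ι a ≡ ι b → a ≡ b
    ι-injective {a} {b} e with ℕ.<-cmp a b
    ... | tri< l _ _ = ⊥-elim (ι-mono-< l (≤-reflexive (sym e)))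
    ... | tri≈ _ q _ = q
    ... | tri> _ _ l = ⊥-elim (ι-mono-< l (≤-reflexive e))

    ι-sum : ∀ {A : Set} (f : A → ℕ) xs → ι (ListAction.sum (map f xs)) ≡ ∑ xs λ x → ι (f x)
    ι-sum f []       = sym (∑-[] _)
    ι-sum f (x ∷ xs) = trans (ι-+ (f x) _) (trans (cong (ι (f x) +_) (ι-sum f xs)) (sym (∑-∷ x xs _)))

    pairs : (Fin n → Fin n → Bool) → ℕ
    pairs {n} b = ListAction.sum (map (λ i → length (filterᵇ (b i) (allFin n))) (allFin n))

    ι-pairs : ∀ (b : Fin n → Fin n → Bool) → ι (pairs b) ≡ ∑ Fs λ i → ∑ Fs λ j → [ b i j ]
    ι-pairs b = trans (ι-sum _ Fs) (∑-cong Fs λ i → Filtered.Count.∑-filter (b i) 𝔽 (b i) Fs)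

    -- Every unordered pair is counted twice by a symmetric relation.
    double : ∀ (b : Fin n → Fin n → Bool) → (∀ i j → b i j ≡ b j i) → (∀ i → b i i ≡ false) →
      ∑ Fs (λ i → ∑ Fs λ j → [ b i j ]) ≡ ι 2 * ι (pairs λ i j → lt i j ∧ b i j)
    double b s z = trans (∑-cong Fs λ i → trans (∑-cong Fs (each i)) (∑-+ Fs _ _)) (trans (∑-+ Fs _ _) (trans (cong (U +_) (∑-swap Fs Fs _))
        (trans (cong (λ x → x + x) (sym (ι-pairs λ i j → lt i j ∧ b i j))) (solve (ι (pairs λ i j → lt i j ∧ b i j) ∷ []) (v 0 :+ v 0) (# 2 :* v 0) refl))))
      where
      U = ∑ Fs (λ i → ∑ Fs λ j → [ lt i j ∧ b i j ])
      each : ∀ i j → [ b i j ] ≡ [ lt i j ∧ b i j ] + [ lt j i ∧ b j i ]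
      each i j with Fin.<-cmp i j
      ... | tri< l _ g = sym (trans (cong₂ _+_ (cong (λ c → [ c ∧ b i j ]) (lt-true l)) ([]-false (cong (_∧ b j i) (lt-false g)))) (+-identityʳ _))
      ... | tri> g _ l = sym (trans (cong₂ _+_ ([]-false (cong (_∧ b i j) (lt-false g))) (cong (λ c → [ c ∧ b j i ]) (lt-true l))) (trans (+-identityˡ _) (cong [_] (s j i))))
      ... | tri≈ g refl h = trans ([]-false (z i)) (sym (trans (cong₂ _+_ ([]-false (cong (_∧ b i i) (lt-false g))) ([]-false (cong (_∧ b i i) (lt-false g)))) (+-identityˡ 0#)))

    turn-sym : ∀ (t : Fin n → Fin n) → (∀ {i j} → t i ≡ t j → i ≡ j) → ∀ i j → turn t i j ≡ turn t j i
    turn-sym t inj i j with Fin.<-cmp i j | Fin.<-cmp (t i) (t j)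
    ... | tri≈ _ refl _ | _             = refl
    ... | tri< _ p _    | tri≈ _ q _    = ⊥-elim (p (inj q))
    ... | tri> _ p _    | tri≈ _ q _    = ⊥-elim (p (inj q))
    ... | tri< a _ b    | tri< c _ d    = trans (cong₂ _xor_ (lt-true a) (lt-true c)) (sym (cong₂ _xor_ (lt-false b) (lt-false d)))
    ... | tri< a _ b    | tri> c _ d    = trans (cong₂ _xor_ (lt-true a) (lt-false c)) (sym (cong₂ _xor_ (lt-false b) (lt-true d)))
    ... | tri> a _ b    | tri< c _ d    = trans (cong₂ _xor_ (lt-false a) (lt-true c)) (sym (cong₂ _xor_ (lt-true b) (lt-false d)))
    ... | tri> a _ b    | tri> c _ d    = trans (cong₂ _xor_ (lt-false a) (lt-false c)) (sym (cong₂ _xor_ (lt-true b) (lt-true d)))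

    turn-refl : ∀ (t : Fin n → Fin n) i → turn t i i ≡ false
    turn-refl t i = cong₂ _xor_ (lt-false {i = i} (ℕ.<-irrefl refl)) (lt-false {i = t i} (ℕ.<-irrefl refl))

    turns : (Fin n → Fin n) → F
    turns t = ∑ Fs λ i → ∑ Fs λ j → [ turn t i j ]

    twice : ∀ (t : Tab n) → Injective t → ι 2 * ι (inversions t) ≡ turns (lookup t)
    twice {n} t inj = trans (cong (ι 2 *_) (trans (ι-pairs {n} (λ i j → lt i j ∧ lt (lookup t j) (lookup t i))) (trans (∑-cong Fs λ i → ∑-cong Fs λ j → cong [_] (same i j)) (sym (ι-pairs {n} (λ i j → lt i j ∧ turn (lookup t) i j))))))
        (sym (double (turn (lookup t)) (turn-sym (lookup t) inj) (turn-refl (lookup t))))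
      where
      same : ∀ i j → lt i j ∧ lt (lookup t j) (lookup t i) ≡ lt i j ∧ turn (lookup t) i j
      same i j with Fin.<-cmp i j | Fin.<-cmp (lookup t i) (lookup t j)
      ... | tri≈ a _ _ | _          = trans (cong (_∧ lt (lookup t j) (lookup t i)) (lt-false a)) (sym (cong (_∧ turn (lookup t) i j) (lt-false a)))
      ... | tri> a _ _ | _          = trans (cong (_∧ lt (lookup t j) (lookup t i)) (lt-false a)) (sym (cong (_∧ turn (lookup t) i j) (lt-false a)))
      ... | tri< _ p _ | tri≈ _ q _ = ⊥-elim (p (inj q))
      ... | tri< a _ _ | tri< c _ d = cong₂ _∧_ {lt i j} refl (trans (lt-false d) (sym (cong₂ _xor_ (lt-true a) (lt-true c))))
      ... | tri< a _ _ | tri> c _ d = cong₂ _∧_ {lt i j} refl (trans (lt-true d) (sym (cong₂ _xor_ (lt-true a) (lt-false c))))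

    []-xor : ∀ a b → [ a xor b ] ≡ [ a ] + [ b ] - ι 2 * [ a ∧ b ]
    []-xor false b     = trans (solve ([ b ] ∷ []) (v 0) (# 0 :+ v 0 :- # 2 :* # 0) refl) (sym (cong₂ (λ x y → x + [ b ] - ι 2 * y) ([]-false refl) ([]-false refl)))
    []-xor true  true  = trans ([]-false refl) (trans (solve [] (# 0) (# 1 :+ # 1 :- # 2 :* # 1) refl) (sym (cong (λ x → x + x - ι 2 * x) ([]-true refl))))
    []-xor true  false = trans ([]-true refl) (trans (solve [] (# 1) (# 1 :+ # 0 :- # 2 :* # 0) refl) (sym (cong₂ (λ x y → x + y - ι 2 * y) ([]-true refl) ([]-false refl))))

    -- The pairs reversed by both factors are counted twice, so inversions add up modulo 2.
    parity : ∀ (a b : Tab n) → Injective a → Injective b → ∃ λ z → inversions (a · b) ℕ.+ z ℕ.* 2 ≡ inversions a ℕ.+ inversions b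
    parity {n} a b ia ib = z , ι-injective (trans (ι-+ (inversions (a · b)) (z ℕ.* 2)) (trans (cong (ι (inversions (a · b)) +_) (ι-* z 2)) (trans (halve eq) (sym (ι-+ (inversions a) (inversions b))))))
      where
      f = lookup a
      g = lookup b
      both : Fin n → Fin n → Bool
      both i j = turn g i j ∧ turn f (g i) (g j)
      z = pairs (λ i j → lt i j ∧ both i j)
      ab-inj : Injective (a · b)
      ab-inj {i} {j} e = ib (ia (trans (sym (lookup-· a b i)) (trans e (lookup-· a b j))))
      chain : ∀ x y w → x xor w ≡ (x xor y) xor (y xor w)
      chain true  true  w     = refl
      chain true  false w     = refl
      chain false true  true  = refl
      chain false true  false = refl
      chain false false w     = refl
      term : ∀ i j → [ turn (lookup (a · b)) i j ] ≡ [ turn g i j ] + [ turn f (g i) (g j) ] - ι 2 * [ both i j ]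
      term i j = trans (cong [_] (trans (cong₂ (λ x y → lt i j xor lt x y) (lookup-· a b i) (lookup-· a b j)) (chain (lt i j) (lt (g i) (g j)) (lt (f (g i)) (f (g j)))))) ([]-xor _ _)
      moved : ∑ Fs (λ i → ∑ Fs λ j → [ turn f (g i) (g j) ]) ≡ turns f
      moved = trans (∑-cong Fs λ i → re (λ y → [ turn f (g i) y ])) (re (λ x → ∑ Fs λ y → [ turn f x y ]))
        where
        re : ∀ (h : Fin n → F) → ∑ Fs (λ j → h (g j)) ≡ ∑ Fs h
        re = ∑-reindex (fins n) (fins n) g (lookup (inv b)) (lookup-inv b ib) (inv-lookup b ib)
      eq : ι 2 * ι (inversions (a · b)) ≡ ι 2 * ι (inversions b) + ι 2 * ι (inversions a) - ι 2 * (ι 2 * ι z)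
      eq = trans (twice (a · b) ab-inj) (trans (∑-cong Fs λ i → trans (∑-cong Fs (term i)) (trans (∑-- Fs _ _) (cong₂ _-_ (∑-+ Fs _ _) (∑-*ˡ Fs (ι 2) _))))
        (trans (∑-- Fs _ _) (cong₂ _-_ (trans (∑-+ Fs _ _) (cong₂ _+_ (sym (twice b ib)) (trans moved (sym (twice a ia))))) (trans (∑-*ˡ Fs (ι 2) _) (cong (ι 2 *_) (double both
          (λ i j → cong₂ _∧_ (turn-sym g ib i j) (turn-sym f ia (g i) (g j))) (λ i → cong (_∧ turn f (g i) (g i)) (turn-refl g i))))))))
      halve : ∀ {x y u w} → ι 2 * x ≡ ι 2 * y + ι 2 * u - ι 2 * (ι 2 * w) → x + w * ι 2 ≡ u + y
      halve {x} {y} {u} {w} e = ≤-antisym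
        (*-cancelˡ (ι-pos 1) (≤-reflexive (trans (solve (x ∷ w ∷ []) (# 2 :* (v 0 :+ v 1 :* # 2)) (# 2 :* v 0 :+ # 4 :* v 1) refl) (trans (cong (_+ ι 4 * w) e) (solve (y ∷ u ∷ w ∷ []) (# 2 :* v 0 :+ # 2 :* v 1 :- # 2 :* (# 2 :* v 2) :+ # 4 :* v 2) (# 2 :* (v 1 :+ v 0)) refl)))))
        (*-cancelˡ (ι-pos 1) (≤-reflexive (sym (trans (solve (x ∷ w ∷ []) (# 2 :* (v 0 :+ v 1 :* # 2)) (# 2 :* v 0 :+ # 4 :* v 1) refl) (trans (cong (_+ ι 4 * w) e) (solve (y ∷ u ∷ w ∷ []) (# 2 :* v 0 :+ # 2 :* v 1 :- # 2 :* (# 2 :* v 2) :+ # 4 :* v 2) (# 2 :* (v 1 :+ v 0)) refl))))))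

    Even : Tab n → Set
    Even t = inversions t % 2 ≡ 0

    private
      mod₁ : ∀ {x y w} → (∃ λ z → x ℕ.+ z ℕ.* 2 ≡ y ℕ.+ w) → y % 2 ≡ 0 → w % 2 ≡ 0 → x % 2 ≡ 0
      mod₁ {x} {y} {w} (z , e) p q = trans (sym ([m+kn]%n≡m%n x z 2)) (trans (cong (_% 2) e) (trans (%-distribˡ-+ y w 2) (cong₂ (λ a b → (a ℕ.+ b) % 2) p q)))

      mod₂ : ∀ {x y} → (∃ λ z → x ℕ.+ z ℕ.* 2 ≡ y ℕ.+ y) → x % 2 ≡ 0
      mod₂ {x} {y} (z , e) = trans (sym ([m+kn]%n≡m%n x z 2)) (trans (cong (_% 2) (trans e (trans (cong (y ℕ.+_) (sym (ℕ.*-identityʳ y))) (sym (ℕ.*-suc y 1))))) ([m+kn]%n≡m%n 0 y 2))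

      mod₃ : ∀ {x y w} → (∃ λ z → x ℕ.+ z ℕ.* 2 ≡ y ℕ.+ w) → x % 2 ≡ 0 → w % 2 ≡ 0 → y % 2 ≡ 0
      mod₃ {x} {y} {w} (z , e) p q = trans (sym (trans (%-distribˡ-+ y w 2) (trans (cong (λ a → (y % 2 ℕ.+ a) % 2) q) (trans (cong (_% 2) (ℕ.+-identityʳ (y % 2))) (m%n%n≡m%n y 2)))))
        (trans (cong (_% 2) (sym e)) (trans ([m+kn]%n≡m%n x z 2) p))

    even-· : ∀ (a b : Tab n) → Injective a → Injective b → Even a → Even b → Even (a · b)
    even-· a b ia ib = mod₁ {inversions (a · b)} {inversions a} {inversions b} (parity a b ia ib)

    even-square : ∀ (a : Tab n) → Injective a → Even (a · a)
    even-square a ia = mod₂ {inversions (a · a)} {inversions a} (parity a a ia ia)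

    even-identity : ∀ (t : Tab n) → (∀ i → lookup t i ≡ i) → Even t
    even-identity t id = cong (_% 2) (ι-injective {inversions t} {0} (≤-antisym (*-cancelˡ (ι-pos 1) (≤-reflexive (trans (twice t λ {i} {j} e → trans (sym (id i)) (trans e (id j)))
        (trans (trans (∑-cong Fs λ i → trans (∑-cong Fs λ j → []-false (trans (cong₂ (λ x y → lt i j xor lt x y) (id i) (id j)) (self (lt i j)))) (∑-0 Fs)) (∑-0 Fs)) (sym (zeroʳ _)))))) (ι-nn (inversions t))))
      where
      self : ∀ x → x xor x ≡ false
      self true  = refl
      self false = refl

    even-inverse : ∀ (a b : Tab n) → Injective a → Injective b → (∀ i → lookup a (lookup b i) ≡ i) → Even b → Even a
    even-inverse a b ia ib h eb = mod₃ {inversions (a · b)} {inversions a} {inversions b} (parity a b ia ib) (even-identity (a · b) (λ i → trans (lookup-· a b i) (h i))) eb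

    -- The other points l contribute turn(l,y) = turn(l,z) and the pair {y,z} contributes once.
    swap-odd : ∀ (t : Tab n) → Injective t → ∀ {y z} → y ≢ z → lookup t y ≡ z → lookup t z ≡ y → (∀ l → l ≢ y → l ≢ z → lookup t l ≡ l) → ¬ Even t
    swap-odd {n} t inj {y} {z} y≢z ty tz fix ev = odd (trans (sym (trans (cong (_% 2) count) ([m+kn]%n≡m%n 1 u 2))) ev)
      where
      open Equality (fins n)
      f = lookup t
      odd : ¬ (1 % 2 ≡ 0)
      odd ()
      other : Fin n → Bool
      other l = not (l == y) ∧ (not (l == z) ∧ turn f l y)
      u = length (filterᵇ other Fs)
      xor-comm : ∀ a b → a xor b ≡ b xor a
      xor-comm true  true  = refl
      xor-comm true  false = refl
      xor-comm false true  = refl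
      xor-comm false false = refl
      ly : ∀ l → l ≢ y → l ≢ z → turn f l z ≡ turn f l y
      ly l p q = trans (cong₂ (λ a b → lt l z xor lt a b) (fix l p q) tz) (trans (xor-comm (lt l z) (lt l y)) (sym (cong₂ (λ a b → lt l y xor lt a b) (fix l p q) ty)))
      other-in : ∀ {l} → l ≢ y → l ≢ z → other l ≡ turn f l y
      other-in p q = cong₂ (λ a b → not a ∧ (not b ∧ turn f _ y)) (≢⇒== p) (≢⇒== q)
      other-y : other y ≡ false
      other-y = cong (λ a → not a ∧ (not (y == z) ∧ turn f y y)) (==-refl y)
      other-z : other z ≡ false
      other-z = trans (cong (λ a → not (z == y) ∧ (not a ∧ turn f z y)) (==-refl z)) (Bool.∧-zeroʳ _)
      opposite : lt y z xor lt z y ≡ true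
      opposite with Fin.<-cmp y z
      ... | tri< a _ b = cong₂ _xor_ (lt-true a) (lt-false b)
      ... | tri≈ _ q _ = ⊥-elim (y≢z q)
      ... | tri> a _ b = cong₂ _xor_ (lt-false a) (lt-true b)
      yz : turn f y z ≡ true
      yz = trans (cong₂ (λ a b → lt y z xor lt a b) ty tz) opposite
      flip : ∀ i j → turn f i j ≡ turn f j i
      flip = turn-sym f inj
      self : ∀ x → x xor x ≡ false
      self true  = refl
      self false = refl
      -- `other` marks the points strictly between y and z. A pair is turned if it is {y, z} or
      -- joins y or z to such a point; as a polynomial in brackets this makes the double sum factor.
      B : (oi oj iy iz jy jz : F) → F
      B oi oj iy iz jy jz = oi * (jy + jz) + (iy + iz) * oj + iy * jz + iz * jy
      B-cong : ∀ {a b c d e g a′ b′ c′ d′ e′ g′} → a ≡ a′ → b ≡ b′ → c ≡ c′ → d ≡ d′ → e ≡ e′ → g ≡ g′ → B a b c d e g ≡ B a′ b′ c′ d′ e′ g′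
      B-cong refl refl refl refl refl refl = refl
      o0 : ∀ {l} → other l ≡ false → [ other l ] ≡ 0#
      o0 = []-false
      on : ∀ {l m} → l ≡ m → [ l == m ] ≡ 1#
      on {l} refl = []-true (==-refl l)
      off : ∀ {l m} → l ≢ m → [ l == m ] ≡ 0#
      off p = []-false (≢⇒== p)
      z≢y : z ≢ y
      z≢y q = y≢z (sym q)
      poly-B : Expr → Expr → Expr → Expr → Expr → Expr → Expr
      poly-B oi oj iy iz jy jz = oi :* (jy :+ jz) :+ (iy :+ iz) :* oj :+ iy :* jz :+ iz :* jy
      term : ∀ i j → [ turn f i j ] ≡ B [ other i ] [ other j ] [ i == y ] [ i == z ] [ j == y ] [ j == z ]
      term i j with i Fin.≟ y | i Fin.≟ z | j Fin.≟ y | j Fin.≟ z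
      ... | yes refl | yes q    | _        | _        = ⊥-elim (y≢z q)
      ... | _        | _        | yes refl | yes q    = ⊥-elim (y≢z q)
      ... | yes refl | no _     | yes refl | no _     = trans ([]-false (turn-refl f i)) (trans (solve [] (# 0) (poly-B (# 0) (# 0) (# 1) (# 0) (# 1) (# 0)) refl)
          (sym (B-cong (o0 other-y) (o0 other-y) (on refl) (off y≢z) (on refl) (off y≢z))))
      ... | yes refl | no _     | no _     | yes refl = trans ([]-true yz) (trans (solve [] (# 1) (poly-B (# 0) (# 0) (# 1) (# 0) (# 0) (# 1)) refl)
          (sym (B-cong (o0 other-y) (o0 other-z) (on refl) (off y≢z) (off z≢y) (on refl))))
      ... | yes refl | no _     | no p     | no q     = trans (cong [_] (flip i j)) (trans (solve ([ turn f j i ] ∷ []) (v 0) (poly-B (# 0) (v 0) (# 1) (# 0) (# 0) (# 0)) refl)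
          (sym (B-cong (o0 other-y) (cong [_] (other-in p q)) (on refl) (off y≢z) (off p) (off q))))
      ... | no _     | yes refl | yes refl | no _     = trans ([]-true (trans (flip i j) yz)) (trans (solve [] (# 1) (poly-B (# 0) (# 0) (# 0) (# 1) (# 1) (# 0)) refl)
          (sym (B-cong (o0 other-z) (o0 other-y) (off z≢y) (on refl) (on refl) (off y≢z))))
      ... | no _     | yes refl | no _     | yes refl = trans ([]-false (turn-refl f i)) (trans (solve [] (# 0) (poly-B (# 0) (# 0) (# 0) (# 1) (# 0) (# 1)) refl)
          (sym (B-cong (o0 other-z) (o0 other-z) (off z≢y) (on refl) (off z≢y) (on refl))))
      ... | no _     | yes refl | no p     | no q     = trans (cong [_] (trans (flip i j) (ly j p q))) (trans (solve ([ turn f j y ] ∷ []) (v 0) (poly-B (# 0) (v 0) (# 0) (# 1) (# 0) (# 0)) refl)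
          (sym (B-cong (o0 other-z) (cong [_] (other-in p q)) (off z≢y) (on refl) (off p) (off q))))
      ... | no p     | no q     | yes refl | no _     = trans (solve ([ turn f i j ] ∷ []) (v 0) (poly-B (v 0) (# 0) (# 0) (# 0) (# 1) (# 0)) refl)
          (sym (B-cong (cong [_] (other-in p q)) (o0 other-y) (off p) (off q) (on refl) (off y≢z)))
      ... | no p     | no q     | no _     | yes refl = trans (cong [_] (ly i p q)) (trans (solve ([ turn f i y ] ∷ []) (v 0) (poly-B (v 0) (# 0) (# 0) (# 0) (# 0) (# 1)) refl)
          (sym (B-cong (cong [_] (other-in p q)) (o0 other-z) (off p) (off q) (off z≢y) (on refl))))
      ... | no p     | no q     | no r     | no s     = trans ([]-false (trans (cong₂ (λ a b → lt i j xor lt a b) (fix i p q) (fix j r s)) (self (lt i j))))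
          (trans (solve ([ turn f i y ] ∷ [ turn f j y ] ∷ []) (# 0) (poly-B (v 0) (v 1) (# 0) (# 0) (# 0) (# 0)) refl) (sym (B-cong (cong [_] (other-in p q)) (cong [_] (other-in r s)) (off p) (off q) (off r) (off s))))
      point1 : ∀ k → ∑ Fs (λ i → [ i == k ]) ≡ 1#
      point1 k = trans (∑-cong Fs λ i → sym (*-identityʳ _)) (∑-point (fins n) k (λ _ → 1#))
      U : F
      U = ∑ Fs λ l → [ other l ]
      two : ∑ Fs (λ l → [ l == y ] + [ l == z ]) ≡ ι 2
      two = trans (∑-+ Fs _ _) (cong₂ _+_ (point1 y) (point1 z))
      total : turns f ≡ ι 2 * (1# + U * ι 2)
      total = trans (∑-cong Fs λ i → trans (∑-cong Fs (term i)) (trans (∑-+ Fs _ _) (cong₂ _+_ (trans (∑-+ Fs _ _) (cong₂ _+_ (∑-+ Fs _ _) refl)) refl)))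
        (trans (∑-+ Fs _ _) (trans (cong₂ _+_ (trans (∑-+ Fs _ _) (cong₂ _+_ (trans (∑-+ Fs _ _) (cong₂ _+_ (trans (∑∑-* Fs Fs _ _) (cong (U *_) two)) (trans (∑∑-* Fs Fs _ _) (cong (_* U) two))))
          (trans (∑∑-* Fs Fs _ _) (cong₂ _*_ (point1 y) (point1 z))))) (trans (∑∑-* Fs Fs _ _) (cong₂ _*_ (point1 z) (point1 y))))
          (solve (U ∷ []) (v 0 :* # 2 :+ # 2 :* v 0 :+ # 1 :* # 1 :+ # 1 :* # 1) (# 2 :* (# 1 :+ v 0 :* # 2)) refl)))
      count : inversions t ≡ 1 ℕ.+ u ℕ.* 2
      count = ι-injective {inversions t} {1 ℕ.+ u ℕ.* 2} (trans (≤-antisym (*-cancelˡ (ι-pos 1) (≤-reflexive same)) (*-cancelˡ (ι-pos 1) (≤-reflexive (sym same))))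
          (sym (trans (ι-suc (u ℕ.* 2)) (cong (1# +_) (trans (ι-* u 2) (cong (_* ι 2) (Filtered.Count.∑-filter other 𝔽 other Fs)))))))
        where
        same : ι 2 * ι (inversions t) ≡ ι 2 * (1# + U * ι 2)
        same = trans (twice t inj) total

open Tables

-- Even tables form the alternating group

module AltGroup (𝔽 : OrderedField) where
  private
    variable
      n : ℕ

  open Parity 𝔽

  isAlt⇒ : ∀ (t : Tab n) → isAlt t ≡ true → Injective t × Even t
  isAlt⇒ t e with isPerm t in p | inversions t % 2 ℕ.≟ 0 in q
  ... | true | yes r = isPerm⇒injective t p , r
  isAlt⇒ t () | true  | no _
  isAlt⇒ t () | false | _

  ⇒isAlt : ∀ (t : Tab n) → Injective t → Even t → isAlt t ≡ true
  ⇒isAlt t i e = cong₂ _∧_ (injective⇒isPerm t i) (even (inversions t % 2 ℕ.≟ 0))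
    where
    even : (d : Dec (inversions t % 2 ≡ 0)) → ⌊ d ⌋ ≡ true
    even (yes _) = refl
    even (no  q) = ⊥-elim (q e)

  inj : ∀ (g : AltElement n) → Injective (proj₁ g)
  inj (t , e) = proj₁ (isAlt⇒ t e)

  ev : ∀ (g : AltElement n) → Even (proj₁ g)
  ev (t , e) = proj₂ (isAlt⇒ t e)

  ·-injective : ∀ (a b : Tab n) → Injective a → Injective b → Injective (a · b)
  ·-injective a b ia ib {i} {j} e = ib (ia (trans (sym (lookup-· a b i)) (trans e (lookup-· a b j))))

  allFin-injective : Injective (Vec.allFin n)
  allFin-injective {n} {i} {j} e = trans (sym (Vec.lookup-allFin i)) (trans e (Vec.lookup-allFin j))

  inv-injective : ∀ (t : Tab n) → Injective t → Injective (inv t)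
  inv-injective t it {i} {j} e = trans (sym (lookup-inv t it i)) (trans (cong (lookup t) e) (lookup-inv t it j))

  ·-alt : ∀ (a b : Tab n) → isAlt a ≡ true → isAlt b ≡ true → isAlt (a · b) ≡ true
  ·-alt a b p q = ⇒isAlt (a · b) (·-injective a b ia ib) (even-· a b ia ib (proj₂ (isAlt⇒ a p)) (proj₂ (isAlt⇒ b q)))
    where
    ia : Injective a
    ia = proj₁ (isAlt⇒ a p)
    ib : Injective b
    ib = proj₁ (isAlt⇒ b q)

  identity-alt : isAlt (Vec.allFin n) ≡ true
  identity-alt {n} = ⇒isAlt (Vec.allFin n) (allFin-injective {n}) (even-identity (Vec.allFin n) Vec.lookup-allFin)

  inv-alt : ∀ (t : Tab n) → isAlt t ≡ true → isAlt (inv t) ≡ true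
  inv-alt t p = ⇒isAlt (inv t) (inv-injective t it) (even-inverse (inv t) t (inv-injective t it) it (inv-lookup t it) (proj₂ (isAlt⇒ t p)))
    where
    it : Injective t
    it = proj₁ (isAlt⇒ t p)

  infixl 7 _∙_
  opaque
    _∙_ : AltElement n → AltElement n → AltElement n
    (a , p) ∙ (b , q) = a · b , ·-alt a b p q

    proj-∙ : ∀ (g h : AltElement n) → proj₁ (g ∙ h) ≡ proj₁ g · proj₁ h
    proj-∙ g h = refl

    identity : AltElement n
    identity {n} = Vec.allFin n , identity-alt {n}

    identity-lookup : ∀ (i : Fin n) → lookup (proj₁ (identity {n})) i ≡ i
    identity-lookup = Vec.lookup-allFin

    inverse : AltElement n → AltElement n
    inverse (t , p) = inv t , inv-alt t p

    proj-inverse : ∀ (g : AltElement n) → proj₁ (inverse g) ≡ inv (proj₁ g)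
    proj-inverse g = refl

  module ThreeCycle {i j k : Fin n} (i≢j : i ≢ j) (j≢k : j ≢ k) (i≢k : i ≢ k) where

    rot : Fin n → Fin n
    rot l with l Fin.≟ i | l Fin.≟ j | l Fin.≟ k
    ... | yes _ | _     | _     = j
    ... | no _  | yes _ | _     = k
    ... | no _  | no _  | yes _ = i
    ... | no _  | no _  | no _  = l

    rot-i : rot i ≡ j
    rot-i with i Fin.≟ i
    ... | yes _ = refl
    ... | no  p = ⊥-elim (p refl)

    rot-j : rot j ≡ k
    rot-j with j Fin.≟ i | j Fin.≟ j
    ... | yes p | _     = ⊥-elim (i≢j (sym p))
    ... | no _  | yes _ = refl
    ... | no _  | no p  = ⊥-elim (p refl)

    rot-k : rot k ≡ i
    rot-k with k Fin.≟ i | k Fin.≟ j | k Fin.≟ k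
    ... | yes p | _     | _     = ⊥-elim (i≢k (sym p))
    ... | no _  | yes p | _     = ⊥-elim (j≢k (sym p))
    ... | no _  | no _  | yes _ = refl
    ... | no _  | no _  | no p  = ⊥-elim (p refl)

    rot-l : ∀ l → l ≢ i → l ≢ j → l ≢ k → rot l ≡ l
    rot-l l p q r with l Fin.≟ i | l Fin.≟ j | l Fin.≟ k
    ... | yes e | _     | _     = ⊥-elim (p e)
    ... | no _  | yes e | _     = ⊥-elim (q e)
    ... | no _  | no _  | yes e = ⊥-elim (r e)
    ... | no _  | no _  | no _  = refl

    rot³ : ∀ l → rot (rot (rot l)) ≡ l
    rot³ l with l Fin.≟ i | l Fin.≟ j | l Fin.≟ k
    ... | yes refl | _        | _        = trans (cong rot rot-j) rot-k
    ... | no _     | yes refl | _        = trans (cong rot rot-k) rot-i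
    ... | no _     | no _     | yes refl = trans (cong rot rot-i) rot-j
    ... | no p     | no q     | no r     = trans (cong rot (rot-l l p q r)) (rot-l l p q r)

    c : Tab n
    c = tabulate rot

    lookup-c : ∀ l → lookup c l ≡ rot l
    lookup-c = Vec.lookup∘tabulate rot

    c-inj : Injective c
    c-inj {a} {b} e = trans (sym (rot³ a)) (trans (cong (λ z → rot (rot z)) (trans (sym (lookup-c a)) (trans e (lookup-c b)))) (rot³ b))

    -- c = c⁴ is the square of a permutation.
    c-even : Even c
    c-even = subst Even (trans (sym (Vec.tabulate∘lookup ((c · c) · (c · c)))) (Vec.tabulate-cong λ l → trans (lookup-· (c · c) (c · c) l) (trans (cc _) (trans (cong (λ z → rot (rot z)) (cc l)) (rot³ (rot l))))))
        (even-square (c · c) (·-injective c c c-inj c-inj))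
      where
      cc : ∀ l → lookup (c · c) l ≡ rot (rot l)
      cc l = trans (lookup-· c c l) (trans (lookup-c _) (cong rot (lookup-c l)))

  faithful : ∀ {g h : AltElement n} → (∀ i → lookup (proj₁ g) i ≡ lookup (proj₁ h) i) → g ≡ h
  faithful {g = g} {h} p = Filtered.element-≡ isAlt (trans (sym (Vec.tabulate∘lookup (proj₁ g))) (trans (Vec.tabulate-cong p) (Vec.tabulate∘lookup (proj₁ h))))

  no-swap : ∀ (g : AltElement n) y z → (∀ i → i ≢ y → i ≢ z → lookup (proj₁ g) i ≡ i) → lookup (proj₁ g) y ≡ y
  no-swap g y z fix with lookup (proj₁ g) y Fin.≟ y | lookup (proj₁ g) y Fin.≟ z | lookup (proj₁ g) z Fin.≟ y | lookup (proj₁ g) z Fin.≟ z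
  ... | yes p | _     | _     | _     = p
  ... | no p  | no q  | _     | _     = inj g (fix _ p q)
  ... | no p  | yes q | yes r | _     = ⊥-elim (swap-odd (proj₁ g) (inj g) (λ e → p (trans q (sym e))) q r fix (ev g))
  ... | no p  | yes q | no r  | yes s = ⊥-elim (p (trans q (inj g (trans s (sym q)))))
  ... | no p  | yes q | no r  | no s  = ⊥-elim (s (inj g (fix _ r s)))

  altGroup : ∀ n → PermGroup n
  altGroup n = record
    { G        = AltElement n
    ; finite   = alt-finite n
    ; _∙_      = _∙_
    ; ε        = identity
    ; _⁻¹      = inverse
    ; _▹_      = λ g → lookup (proj₁ g)
    ; ▹-∙      = λ g h i → trans (cong (λ t → lookup t i) (proj-∙ g h)) (lookup-· (proj₁ g) (proj₁ h) i)
    ; ▹-ε      = identity-lookup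
    ; ▹-⁻¹     = λ g i → trans (cong (λ t → lookup t (lookup (proj₁ g) i)) (proj-inverse g)) (inv-lookup (proj₁ g) (inj g) i)
    ; faithful = faithful
    ; three    = λ p q r → (ThreeCycle.c p q r , ⇒isAlt (ThreeCycle.c p q r) (ThreeCycle.c-inj p q r) (ThreeCycle.c-even p q r)) ,
                           trans (ThreeCycle.lookup-c p q r _) (ThreeCycle.rot-i p q r) , trans (ThreeCycle.lookup-c p q r _) (ThreeCycle.rot-j p q r) ,
                           trans (ThreeCycle.lookup-c p q r _) (ThreeCycle.rot-k p q r) , λ l a b c → trans (ThreeCycle.lookup-c p q r l) (ThreeCycle.rot-l p q r l a b c)
    ; noSwap   = no-swap }

-- From sets of tables to indicator functions

module Translation (𝔽 : OrderedField) (n : ℕ) where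
  open Sums 𝔽
  open Arithmetic 𝔽
  open AltGroup 𝔽 using (altGroup; proj-∙; proj-inverse)
  𝔾 : PermGroup n
  𝔾 = altGroup n
  open PermGroup 𝔾
  open GroupAlgebra 𝔽 𝔾
  open Averages 𝔽 𝔾 using (Points)
  open Projections 𝔽 𝔾 using (full)
  open Densities 𝔽 𝔾 using (nF; N; N-1; tot; conv; Indicator; indicator)
  open Restriction 𝔽 𝔾 using (Free; _∩_; inFamily)

  ⟦_⟧ˢ : (Tab n → Bool) → Alg
  ⟦ S ⟧ˢ g = [ S (proj₁ g) ]

  ⟦⟧-ind : ∀ S → Indicator ⟦ S ⟧ˢ
  ⟦⟧-ind S = indicator (λ g → S (proj₁ g)) λ _ → refl

  tot-count : ∀ S → tot ⟦ S ⟧ˢ ≡ ι (countAlt n S)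
  tot-count S = trans (Filtered.Count.∑-attach isAlt 𝔽 (allVecs n n) (λ t → [ S t ])) (sym (Filtered.Count.∑-filter S 𝔽 S (Alt n)))

  N-count : N ≡ ι (length (Alt n))
  N-count = trans (sym N-1) (trans (Filtered.Count.∑-attach isAlt 𝔽 (allVecs n n) (λ _ → 1#)) (∑-1 (Alt n)))

  free : ∀ {S} → ProductFree S → Free ⟦ S ⟧ˢ ⟦ S ⟧ˢ ⟦ S ⟧ˢ
  free {S} pf = trans (conv ⟦ S ⟧ˢ ⟦ S ⟧ˢ ⟦ S ⟧ˢ) (trans (∑-cong Gs λ a → trans (sym (∑-*ˡ Gs _ _)) (trans (∑-cong Gs λ b → each a b) (∑-0 Gs))) (∑-0 Gs))
    where
    each : ∀ a b → ⟦ S ⟧ˢ a * (⟦ S ⟧ˢ b * ⟦ S ⟧ˢ (a ∙ b)) ≡ 0#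
    each a b with S (proj₁ a) in p | S (proj₁ b) in q | S (proj₁ (a ∙ b)) in r
    ... | false | _     | _     = *0ˡ ([]-false refl)
    ... | true  | false | _     = *0ʳ (*0ˡ ([]-false refl))
    ... | true  | true  | false = *0ʳ (*0ʳ ([]-false refl))
    ... | true  | true  | true  = ⊥-elim (pf _ _ _ p q r (sym (proj-∙ a b)))

  †-invSet : ∀ S g → (⟦ S ⟧ˢ †) g ≡ ⟦ invSet S ⟧ˢ g
  †-invSet S g = cong (λ t → [ S t ]) (proj-inverse g)

  all-cong : ∀ {p q : Fin n → Bool} xs → (∀ x → p x ≡ q x) → all p xs ≡ all q xs
  all-cong []       e = refl
  all-cong (x ∷ xs) e = cong₂ _∧_ (e x) (all-cong xs e)

  ∩-minusF : ∀ S (I : Points) x g → (⟦ S ⟧ˢ ∩ λ π → not (inFamily I x π)) g ≡ ⟦ minusF S (tabulate I) x ⟧ˢ g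
  ∩-minusF S I x g = trans (cong (λ b → [ S t ] * [ not b ]) (sym (cong₂ _∧_ (I-at _) (all-cong (allFin n) λ i → cong₂ (λ a b → not (a ∧ b)) (I-at i) (I-at _)))))
      (sym ([]-∧ (S t) _))
    where
    t = proj₁ g
    I-at : ∀ i → lookup (tabulate I) i ≡ I i
    I-at = Vec.lookup∘tabulate I

-- The indicator of a ≤ i < a + s.
inside : ℕ → ℕ → ℕ → Bool
inside (suc a) s       zero    = false
inside (suc a) s       (suc i) = inside a s i
inside zero    zero    i       = false
inside zero    (suc s) zero    = true
inside zero    (suc s) (suc i) = inside zero s i

inside-≥ : ∀ a s i → inside a s i ≡ true → a ℕ.≤ i
inside-≥ zero    s i       e = ℕ.z≤n
inside-≥ (suc a) s (suc i) e = ℕ.s≤s (inside-≥ a s i e)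

inside-< : ∀ a s i → inside a s i ≡ true → i ℕ.< a ℕ.+ s
inside-< (suc a) s       (suc i) e = ℕ.s≤s (inside-< a s i e)
inside-< zero    (suc s) zero    e = ℕ.s≤s ℕ.z≤n
inside-< zero    (suc s) (suc i) e = ℕ.s≤s (inside-< zero s i e)

-- Disjoint blocks and the choice of parameters

module Blocks (𝔽 : OrderedField) {n : ℕ} (𝔾 : PermGroup n) where
  open Sums 𝔽
  open Arithmetic 𝔽
  open GroupAlgebra 𝔽 𝔾
  open Averages 𝔽 𝔾
  open Projections 𝔽 𝔾
  open Densities 𝔽 𝔾

  ∑-allFin : ∀ {n} (f : Fin (suc n) → F) → ∑ (allFin (suc n)) f ≡ f zero + ∑ (allFin n) (λ i → f (suc i))
  ∑-allFin {n} f = trans (∑-∷ zero _ f) (cong (f zero +_) (trans (cong (λ xs → ∑ xs f) (sym (List.map-tabulate (λ i → i) suc))) (∑-map (allFin n) suc f)))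

  inside-size : ∀ n a s → a ℕ.+ s ℕ.≤ n → ∑ (allFin n) (λ i → [ inside a s (Fin.toℕ i) ]) ≡ ι s
  inside-size zero    zero    zero    p           = ∑-[] _
  inside-size (suc n) (suc a) s       (ℕ.s≤s p)   = trans (∑-allFin {n} _) (trans (cong₂ _+_ ([]-false refl) (inside-size n a s p)) (+-identityˡ _))
  inside-size (suc n) zero    zero    p           = trans (∑-allFin {n} _) (trans (cong₂ _+_ ([]-false refl) (inside-size n zero zero ℕ.z≤n)) (+-identityˡ _))
  inside-size (suc n) zero    (suc s) (ℕ.s≤s p)   = trans (∑-allFin {n} _) (trans (cong₂ _+_ ([]-true refl) (inside-size n zero s p)) (sym (ι-suc s)))

  nF≡ : nF ≡ ι n
  nF≡ = trans (∑-cong Fs λ _ → []-true refl) (trans (∑-1 Fs) (cong ι {length (allFin n)} {n} (List.length-tabulate (λ i → i))))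

  module _ (s : ℕ) where

    segment : ℕ → Points
    segment a i = inside a s (Fin.toℕ i)

    segments-disjoint : ∀ {a b} → a ℕ.+ s ℕ.≤ b → Disjoint (segment a) (segment b)
    segments-disjoint {a} {b} p i q with bool (segment b i)
    ... | inj₂ r = r
    ... | inj₁ r = ⊥-elim (ℕ.<-irrefl refl (ℕ.<-≤-trans (inside-< a s _ q) (ℕ.≤-trans p (inside-≥ b s _ r))))

    block : ∀ a → a ℕ.+ (s ℕ.+ s) ℕ.≤ n → Block (ι s)
    block a p = record
      { A        = segment a
      ; B        = segment (a ℕ.+ s)
      ; disjoint = segments-disjoint {a} ℕ.≤-refl
      ; sizeA    = ≤-reflexive (sym (inside-size n a s (ℕ.≤-trans (ℕ.+-monoʳ-≤ a (ℕ.m≤m+n s s)) p)))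
      ; sizeB    = ≤-reflexive (sym (inside-size n (a ℕ.+ s) s (ℕ.≤-trans (ℕ.≤-reflexive (ℕ.+-assoc a s s)) p))) }

    block-≥ : ∀ a p i → Block.U (block a p) i ≡ true → a ℕ.≤ Fin.toℕ i
    block-≥ a p i e with ∪-elim {segment a} {segment (a ℕ.+ s)} {i} e
    ... | inj₁ q = inside-≥ a s _ q
    ... | inj₂ q = ℕ.≤-trans (ℕ.m≤m+n a s) (inside-≥ (a ℕ.+ s) s _ q)

    block-< : ∀ a p i → Block.U (block a p) i ≡ true → Fin.toℕ i ℕ.< a ℕ.+ (s ℕ.+ s)
    block-< a p i e with ∪-elim {segment a} {segment (a ℕ.+ s)} {i} e
    ... | inj₁ q = ℕ.<-≤-trans (inside-< a s _ q) (ℕ.+-monoʳ-≤ a (ℕ.m≤m+n s s))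
    ... | inj₂ q = ℕ.<-≤-trans (inside-< (a ℕ.+ s) s _ q) (ℕ.≤-reflexive (ℕ.+-assoc a s s))

    -- The lower bound a on all points of the list is carried along, because it separates the next
    -- block from the later ones.
    blocks : ∀ r a → a ℕ.+ r ℕ.* (s ℕ.+ s) ℕ.≤ n → Σ (List (Block (ι s))) λ bs → length bs ≡ r ×
      All (λ b → ∀ i → Block.U b i ≡ true → a ℕ.≤ Fin.toℕ i) bs × AllPairs (λ b b′ → Disjoint (Block.U b) (Block.U b′)) bs
    blocks zero    a p = [] , refl , [] , []
    blocks (suc r) a p = step (blocks r (a ℕ.+ (s ℕ.+ s)) (ℕ.≤-trans (ℕ.≤-reflexive (ℕ.+-assoc a (s ℕ.+ s) (r ℕ.* (s ℕ.+ s)))) p))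
      where
      fits : a ℕ.+ (s ℕ.+ s) ℕ.≤ n
      fits = ℕ.≤-trans (ℕ.+-monoʳ-≤ a (ℕ.m≤m+n (s ℕ.+ s) (r ℕ.* (s ℕ.+ s)))) p
      step : (Σ (List (Block (ι s))) λ bs → length bs ≡ r × All (λ b → ∀ i → Block.U b i ≡ true → a ℕ.+ (s ℕ.+ s) ℕ.≤ Fin.toℕ i) bs × AllPairs (λ b b′ → Disjoint (Block.U b) (Block.U b′)) bs) →
        Σ (List (Block (ι s))) λ bs → length bs ≡ suc r × All (λ b → ∀ i → Block.U b i ≡ true → a ℕ.≤ Fin.toℕ i) bs × AllPairs (λ b b′ → Disjoint (Block.U b) (Block.U b′)) bs
      step (bs , l , lo , ds) = block a fits ∷ bs , cong suc l , block-≥ a fits ∷ All.map (λ q i e → ℕ.≤-trans (ℕ.m≤m+n a (s ℕ.+ s)) (q i e)) lo ,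
          All.map (λ {b} q → apart b q) lo ∷ ds
        where
        apart : ∀ b → (∀ i → Block.U b i ≡ true → a ℕ.+ (s ℕ.+ s) ℕ.≤ Fin.toℕ i) → Disjoint (Block.U (block a fits)) (Block.U b)
        apart b q i e with bool (Block.U b i)
        ... | inj₂ t = t
        ... | inj₁ t = ⊥-elim (ℕ.<-irrefl refl (ℕ.<-≤-trans (block-< a fits i e) (q i t)))

  ι-^ : ∀ a k → ι (a ℕ.^ k) ≡ pow (ι a) k
  ι-^ a zero    = refl
  ι-^ a (suc k) = trans (ι-* a (a ℕ.^ k)) (cong (ι a *_) (ι-^ a k))

  pow-≤ : ∀ {m} → 1# ≤ m → ∀ {a b} → a ℕ.≤ b → pow m a ≤ pow m b
  pow-≤ {m} p {b = b} ℕ.z≤n     = one b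
    where
    one : ∀ b → 1# ≤ pow m b
    one zero    = ≤-refl
    one (suc b) = ≡-≤ (sym (*-identityˡ 1#)) (*-mono 0≤1 (pow-nn b (≤-trans 0≤1 p)) p (one b))
  pow-≤ p (ℕ.s≤s q) = *-monoˡ (≤-trans 0≤1 p) (pow-≤ p q)

  recip-move : ∀ {x y z} → 0# < z → x * z ≤ y → x ≤ y * recip z
  recip-move {x} {y} {z} p q = ≡-≤ (trans (sym (*1ʳ (*-inv⁺ p))) (sym (*-assoc x z _))) (*-monoʳ (inv-nn p) q)

  open Regularity 𝔽 𝔾 using (Scale)

  -- With m = 2^p and u = k + 1: d = m^(-u), κ = d³/m⁸ = m^(-j) for j = 8 + 3u, and r = pj blocks
  -- give 2^r κ = 1. T is at most m^19, which puts 22 = 3 + 19 into `e-K` and 40 = 2 + 2 · 19 into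
  -- `d-K`. The extra 2 in the block size s makes s - 2 = m^h; `j-h` is then 3 ≤ κ m^(2h), and `h-K`
  -- makes the blocks fit into n points.
  module Parameters (p K k h : ℕ) (big-M : 128 ℕ.≤ 2 ℕ.^ p) (e-M : 9 ℕ.* ((suc k ℕ.+ suc k) ℕ.* (suc k ℕ.+ suc k)) ℕ.≤ 2 ℕ.^ p)
    (R-M : suc (p ℕ.* (suc K ℕ.+ suc K)) ℕ.≤ 2 ℕ.^ p) (j-M : p ℕ.* (8 ℕ.+ 3 ℕ.* suc k) ℕ.≤ 2 ℕ.^ p)
    (≤n : (2 ℕ.^ p) ℕ.^ K ℕ.≤ n) (n≤ : n ℕ.≤ (2 ℕ.^ p) ℕ.^ suc K)
    (d-K : 3 ℕ.* suc k ℕ.+ 40 ℕ.≤ 2 ℕ.* K) (e-K : suc k ℕ.+ 22 ℕ.≤ K) (j-h : 9 ℕ.+ 3 ℕ.* suc k ℕ.≤ 2 ℕ.* h) (h-K : h ℕ.+ 2 ℕ.≤ K) (1≤h : 1 ℕ.≤ h) where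

    private
      u j M s₀ r : ℕ
      u = suc k
      j = 8 ℕ.+ 3 ℕ.* suc k
      M = 2 ℕ.^ p
      s₀ = M ℕ.^ h ℕ.+ 2
      r = p ℕ.* j
      m D d : F
      m = ι M
      D = pow m u
      d = recip D

      128≤m : ι 128 ≤ m
      128≤m = ι-mono big-M

      1≤m : 1# ≤ m
      1≤m = ≤-trans (ι-mono {1} {128} (ℕ.s≤s ℕ.z≤n)) 128≤m

      64≤m : ι 64 ≤ m
      64≤m = ≤-trans (ι-mono {64} {128} (ℕ.m≤m+n 64 64)) 128≤m

      m-pos : 0# < m
      m-pos = <-≤-trans 0<1 1≤m

      m-nn : 0# ≤ m
      m-nn = <⇒≤ m-pos

      D-pos : 0# < D
      D-pos = pow-pos u m-pos

      M≥1 : 1 ℕ.≤ M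
      M≥1 = ℕ.≤-trans (ℕ.s≤s ℕ.z≤n) big-M

      instance
        M-nonZero : ℕ.NonZero M
        M-nonZero = ℕ.>-nonZero M≥1

      fits : 0 ℕ.+ r ℕ.* (s₀ ℕ.+ s₀) ℕ.≤ n
      fits = ℕ.≤-trans (ℕ.*-mono-≤ j-M small) (ℕ.≤-trans (ℕ.≤-reflexive (trans (cong (M ℕ.*_) (ℕ.*-comm M (M ℕ.^ h))) (trans (sym (ℕ.*-assoc M (M ℕ.^ h) M)) (trans (cong (ℕ._* M) (ℕ.*-comm M (M ℕ.^ h))) (trans (ℕ.*-assoc (M ℕ.^ h) M M)
          (trans (cong (λ z → M ℕ.^ h ℕ.* (M ℕ.* z)) (sym (ℕ.*-identityʳ M))) (sym (ℕ.^-distribˡ-+-* M h 2))))))))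
        (ℕ.≤-trans (ℕ.^-monoʳ-≤ M h-K) ≤n))
        where
        q = M ℕ.^ h
        2≤q : 2 ℕ.≤ q
        2≤q = ℕ.≤-trans (ℕ.≤-trans (ℕ.≤-trans (ℕ.m≤m+n 2 126) big-M) (ℕ.≤-reflexive (sym (ℕ.*-identityʳ M)))) (ℕ.^-monoʳ-≤ M 1≤h)
        small : s₀ ℕ.+ s₀ ℕ.≤ M ℕ.* q
        small = ℕ.≤-trans (ℕ.+-mono-≤ (ℕ.+-monoʳ-≤ q 2≤q) (ℕ.+-monoʳ-≤ q 2≤q)) (ℕ.≤-trans (ℕ.≤-reflexive (four q)) (ℕ.*-monoˡ-≤ q (ℕ.≤-trans (ℕ.m≤m+n 4 124) big-M)))
          where
          four : ∀ x → x ℕ.+ x ℕ.+ (x ℕ.+ x) ≡ 4 ℕ.* x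
          four x = trans (ℕ.+-assoc x x (x ℕ.+ x)) (cong (λ z → x ℕ.+ (x ℕ.+ (x ℕ.+ z))) (sym (ℕ.+-identityʳ x)))

      BS = blocks s₀ r 0 fits

      n≥ : pow m K ≤ nF
      n≥ = ≡-≤ (sym (ι-^ M K)) (≤-≡ (ι-mono ≤n) (sym nF≡))

      n² : nF * nF ≤ pow (ι 2) (p ℕ.* (suc K ℕ.+ suc K))
      n² = ≤-≡ (*-mono n-nn (≤-trans n-nn up) up up) (trans (sym (pow-+ (ι 2) (p ℕ.* suc K) (p ℕ.* suc K))) (cong (pow (ι 2)) (sym (ℕ.*-distribˡ-+ p (suc K) (suc K)))))
        where
        n-nn : 0# ≤ nF
        n-nn = ≤-≡ (ι-nn n) (sym nF≡)
        up : nF ≤ pow (ι 2) (p ℕ.* suc K)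
        up = ≡-≤ nF≡ (≤-≡ (ι-mono n≤) (trans (cong ι (ℕ.^-*-assoc 2 p (suc K))) (ι-^ 2 (p ℕ.* suc K))))

      T : F
      T = ι 64 * (m * m * (pow m 4 * pow m 4 * (pow m 4 * pow m 4)))

      T-nn : 0# ≤ T
      T-nn = ι-nn 64 ⊛ (m-nn ⊛ m-nn ⊛ (pow-nn 4 m-nn ⊛ pow-nn 4 m-nn ⊛ (pow-nn 4 m-nn ⊛ pow-nn 4 m-nn)))

      m¹⁶ : pow m 4 * pow m 4 * (pow m 4 * pow m 4) ≡ pow m 16
      m¹⁶ = trans (cong₂ _*_ (sym (pow-+ m 4 4)) (sym (pow-+ m 4 4))) (sym (pow-+ m 8 8))

      T≤ : T ≤ pow m 19
      T≤ = ≤-≡ (*-monoʳ (m-nn ⊛ m-nn ⊛ (pow-nn 4 m-nn ⊛ pow-nn 4 m-nn ⊛ (pow-nn 4 m-nn ⊛ pow-nn 4 m-nn))) 64≤m)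
        (trans (cong (λ z → m * (m * m * z)) m¹⁶) (cong (m *_) (*-assoc m m _)))

      D³ : D * D * D ≡ pow m (3 ℕ.* u)
      D³ = trans (cong (_* D) (sym (pow-+ m u u))) (trans (sym (pow-+ m (u ℕ.+ u) u)) (cong (pow m) (trans (ℕ.+-assoc u u u) (cong (λ z → u ℕ.+ (u ℕ.+ z)) (sym (ℕ.+-identityʳ u))))))

      D³-pos : 0# < D * D * D
      D³-pos = *-pos (*-pos D-pos D-pos) D-pos

      cube : ∀ {x y} → x * pow m (3 ℕ.* u) ≤ y → x ≤ y * (d * d * d)
      cube {x} {y} q = *-cancelˡ D³-pos (≤-≡ (≡-≤ (trans (*-comm _ x) (cong (x *_) D³)) q)
        (sym (trans (solve (D ∷ y ∷ d ∷ []) (v 0 :* v 0 :* v 0 :* (v 1 :* (v 2 :* v 2 :* v 2))) (v 1 :* (v 0 :* v 2 :* (v 0 :* v 2) :* (v 0 :* v 2))) refl)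
          (trans (cong (λ z → y * (z * z * z)) (*-inv⁺ D-pos)) (solve (y ∷ []) (v 0 :* (# 1 :* # 1 :* # 1)) (v 0) refl)))))

      κ : F
      κ = d * d * d * recip (pow m 8)

      m⁸-pos : 0# < pow m 8
      m⁸-pos = pow-pos 8 m-pos

      d-nn : 0# ≤ d
      d-nn = inv-nn D-pos

      κ-lower : ∀ {x y} → x * pow m j ≤ y → x ≤ y * κ
      κ-lower {x} {y} q = ≤-≡ (recip-move m⁸-pos (cube {x * pow m 8} (≡-≤ (trans (*-assoc x _ _) (cong (x *_) (sym (pow-+ m 8 (3 ℕ.* u))))) q))) (*-assoc y _ _)

    scale : Scale
    scale = record
      { big     = <-≤-trans (ι-mono-< {3} {128} (ℕ.s≤s (ℕ.s≤s (ℕ.s≤s (ℕ.s≤s ℕ.z≤n))))) (≤-trans 128≤m (≤-trans (≡-≤ (sym (*-identityʳ m)) (pow-≤ 1≤m {1} {K} (ℕ.≤-trans (ℕ.s≤s ℕ.z≤n) (ℕ.≤-trans (ℕ.m≤n+m 22 (suc k)) e-K)))) n≥))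
      ; m       = m
      ; k       = k
      ; m-big   = ≡-≤ (sym (trans (ι-* 9 ((suc k ℕ.+ suc k) ℕ.* (suc k ℕ.+ suc k))) (cong (ι 9 *_) (ι-* (suc k ℕ.+ suc k) (suc k ℕ.+ suc k))))) (ι-mono {9 ℕ.* ((suc k ℕ.+ suc k) ℕ.* (suc k ℕ.+ suc k))} {M} e-M)
      ; R       = p ℕ.* (suc K ℕ.+ suc K)
      ; R≤m     = ι-mono R-M
      ; m≥128   = 128≤m
      ; n²≤     = n²
      ; T       = T
      ; d       = d
      ; T-big   = ≤-refl
      ; d-dense = ≤-reflexive (sym (*-inv⁺ D-pos))
      ; d-fat   = recip-move D-pos (≤-trans (*-monoʳ (<⇒≤ D-pos) (≤-≡ (*-mono (ι-nn 64) (m-nn ⊛ m-nn ⊛ pow-nn 19 m-nn) 64≤m (*-monoˡ (m-nn ⊛ m-nn) T≤)) (cong (m *_) (*-assoc m m _))))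
                    (≡-≤ (sym (pow-+ m 22 u)) (≤-trans (pow-≤ 1≤m (ℕ.≤-trans (ℕ.≤-reflexive (ℕ.+-comm 22 u)) e-K)) n≥)))
      ; d-pair  = cube (≤-trans (*-monoʳ (pow-nn (3 ℕ.* u) m-nn) (≤-≡ (*-mono (ι-nn 64 ⊛ m-nn) (pow-nn 19 m-nn ⊛ pow-nn 19 m-nn) (*-monoʳ m-nn 64≤m) (*-mono T-nn (pow-nn 19 m-nn) T≤ T≤))
                    (trans (cong (m * m *_) (sym (pow-+ m 19 19))) (*-assoc m m _))))
                    (≡-≤ (sym (pow-+ m 40 (3 ℕ.* u))) (≤-trans (pow-≤ 1≤m (ℕ.≤-trans (ℕ.≤-reflexive (ℕ.+-comm 40 (3 ℕ.* u))) d-K))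
                      (≡-≤ (trans (cong (λ z → pow m (K ℕ.+ z)) (ℕ.+-identityʳ K)) (pow-+ m K K)) (*-mono (pow-nn K m-nn) (≤-trans (pow-nn K m-nn) n≥) n≥ n≥)))))
      ; s       = ι s₀
      ; κ       = κ
      ; s-big   = <-≤-trans (ι-mono-< {9} {128} (ℕ.m≤m+n 10 118)) (≤-trans 128≤m (≤-trans (≡-≤ (sym (*-identityʳ m)) (pow-≤ 1≤m {1} {h} 1≤h)) (≡-≤ (sym (ι-^ M h)) (ι-mono (ℕ.m≤m+n (M ℕ.^ h) 2)))))
      ; κ-nn    = d-nn ⊛ d-nn ⊛ d-nn ⊛ inv-nn m⁸-pos
      ; κ-s     = ≤-≡ (κ-lower {ι 3} {pow m h * pow m h} (≤-trans (*-monoʳ (pow-nn j m-nn) (≤-trans (ι-mono {3} {128} (ℕ.m≤m+n 3 125)) 128≤m))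
                    (≤-≡ (pow-≤ 1≤m {suc j} {h ℕ.+ h} (ℕ.≤-trans j-h (ℕ.≤-reflexive (cong (h ℕ.+_) (ℕ.+-identityʳ h))))) (pow-+ m h h))))
                    (trans (*-comm _ κ) (cong (λ z → κ * (z * z)) (sym s-2)))
      ; bs      = proj₁ BS
      ; ds      = proj₂ (proj₂ (proj₂ BS))
      ; κ-2     = κ-lower (≡-≤ (*-identityˡ _) (≤-reflexive (sym (trans (cong (pow (ι 2)) (proj₁ (proj₂ BS))) (trans (sym (ι-^ 2 r)) (trans (cong ι (sym (ℕ.^-*-assoc 2 p j))) (ι-^ M j)))))))
      ; κ-d     = ≤-reflexive (trans (cong (κ *_) (sym (pow-+ m 4 4))) (trans (*-assoc (d * d * d) _ _) (*1ʳ (trans (*-comm _ _) (*-inv⁺ m⁸-pos))))) }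
      where
      s-2 : ι s₀ - ι 2 ≡ pow m h
      s-2 = trans (cong (_- ι 2) (trans (ι-+ (M ℕ.^ h) 2) (cong (_+ ι 2) (ι-^ M h)))) (solve (pow m h ∷ []) (v 0 :+ # 2 :- # 2) (v 0) refl)

-- Integer powers, logarithms and the comparison of exponents

*-^ : ∀ x y u → (x ℕ.* y) ℕ.^ u ≡ x ℕ.^ u ℕ.* y ℕ.^ u
*-^ x y zero    = refl
*-^ x y (suc u) = trans (cong (x ℕ.* y ℕ.*_) (*-^ x y u)) (medial x y (x ℕ.^ u) (y ℕ.^ u))
  where
  medial : ∀ a b c d → a ℕ.* b ℕ.* (c ℕ.* d) ≡ a ℕ.* c ℕ.* (b ℕ.* d)
  medial a b c d = trans (ℕ.*-assoc a b _) (trans (cong (a ℕ.*_) (trans (sym (ℕ.*-assoc b c d)) (trans (cong (ℕ._* d) (ℕ.*-comm b c)) (ℕ.*-assoc c b d)))) (sym (ℕ.*-assoc a c _)))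

^-cancelˡ-≤ : ∀ u .{{_ : ℕ.NonZero u}} {x y} → x ℕ.^ u ℕ.≤ y ℕ.^ u → x ℕ.≤ y
^-cancelˡ-≤ u {x} {y} p with x ℕ.≤? y
... | yes q = q
... | no  q = ⊥-elim (ℕ.<-irrefl refl (ℕ.<-≤-trans (ℕ.^-monoˡ-< u (ℕ.≰⇒> q)) p))

n<2^n : ∀ n → n ℕ.< 2 ℕ.^ n
n<2^n zero    = ℕ.s≤s ℕ.z≤n
n<2^n (suc n) = ℕ.≤-trans (ℕ.+-mono-≤ (ℕ.m^n>0 2 n) (n<2^n n)) (ℕ.≤-reflexive (cong (2 ℕ.^ n ℕ.+_) (sym (ℕ.+-identityʳ _))))

square<2^ : ∀ n → (5 ℕ.+ n) ℕ.* (5 ℕ.+ n) ℕ.< 2 ℕ.^ (5 ℕ.+ n)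
square<2^ zero    = ℕ.≤ᵇ⇒≤ 26 32 tt
square<2^ (suc n) = ℕ.≤-trans (ℕ.s≤s (step (5 ℕ.+ n) (ℕ.m≤m+n 3 (2 ℕ.+ n))))
    (ℕ.+-mono-≤ (square<2^ n) (ℕ.≤-trans (ℕ.<⇒≤ (square<2^ n)) (ℕ.≤-reflexive (sym (ℕ.+-identityʳ _)))))
  where
  step : ∀ a → 3 ℕ.≤ a → suc a ℕ.* suc a ℕ.≤ a ℕ.* a ℕ.+ a ℕ.* a
  step a 3≤a = ℕ.≤-trans (ℕ.≤-reflexive (trans (cong (suc a ℕ.+_) (ℕ.*-suc a a)) (sym (ℕ.+-assoc (suc a) a (a ℕ.* a)))))
    (ℕ.+-monoˡ-≤ (a ℕ.* a) (ℕ.≤-trans (ℕ.≤-trans (ℕ.+-monoˡ-≤ (a ℕ.+ a) (ℕ.≤-trans (ℕ.s≤s ℕ.z≤n) 3≤a)) (ℕ.≤-reflexive (cong (λ z → a ℕ.+ (a ℕ.+ z)) (sym (ℕ.+-identityʳ a))))) (ℕ.*-monoˡ-≤ a 3≤a)))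

-- A search for the largest p, in which n serves as the bound on the number of steps because n <
-- 2^n.
logarithm : ∀ K .{{_ : ℕ.NonZero K}} n p₀ → (2 ℕ.^ p₀) ℕ.^ K ℕ.≤ n → ∃ λ p → p₀ ℕ.≤ p × (2 ℕ.^ p) ℕ.^ K ℕ.≤ n × n ℕ.< (2 ℕ.^ suc p) ℕ.^ K
logarithm K n p₀ low = go n p₀ low (ℕ.<-≤-trans (n<2^n n) (ℕ.≤-trans (ℕ.^-monoʳ-≤ 2 (ℕ.m≤n+m n p₀)) (x≤x^K (2 ℕ.^ (p₀ ℕ.+ n)) (ℕ.m^n>0 2 (p₀ ℕ.+ n)))))
  where
  x≤x^K : ∀ x → 1 ℕ.≤ x → x ℕ.≤ x ℕ.^ K
  x≤x^K x p = ℕ.≤-trans (ℕ.≤-reflexive (sym (ℕ.*-identityʳ x))) (ℕ.^-monoʳ-≤ x {{ℕ.>-nonZero p}} (ℕ.>-nonZero⁻¹ K))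
  go : ∀ f p → (2 ℕ.^ p) ℕ.^ K ℕ.≤ n → n ℕ.< (2 ℕ.^ (p ℕ.+ f)) ℕ.^ K → ∃ λ q → p ℕ.≤ q × (2 ℕ.^ q) ℕ.^ K ℕ.≤ n × n ℕ.< (2 ℕ.^ suc q) ℕ.^ K
  go zero    p a b = ⊥-elim (ℕ.<-irrefl refl (ℕ.<-≤-trans b (ℕ.≤-trans (ℕ.≤-reflexive (cong (λ z → (2 ℕ.^ z) ℕ.^ K) (ℕ.+-identityʳ p))) a)))
  go (suc f) p a b = next ((2 ℕ.^ suc p) ℕ.^ K ℕ.≤? n)
    where
    next : Dec ((2 ℕ.^ suc p) ℕ.^ K ℕ.≤ n) → ∃ λ q → p ℕ.≤ q × (2 ℕ.^ q) ℕ.^ K ℕ.≤ n × n ℕ.< (2 ℕ.^ suc q) ℕ.^ K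
    next (no  c) = p , ℕ.≤-refl , a , ℕ.≰⇒> c
    next (yes c) with go f (suc p) c (subst (λ z → n ℕ.< (2 ℕ.^ z) ℕ.^ K) (ℕ.+-suc p f) b)
    ... | q , l , r = q , ℕ.≤-trans (ℕ.n≤1+n p) l , r

-- Since n^w ≤ M^((K+1)w), the hypothesis on the exponents leaves a reserve of M³ after taking u-th
-- roots. It covers both directions: 32 M g ≤ M³ g for the density of A, and 2 M² g < M³ g for that
-- of the remainder.
module Thresholds (M K u w e : ℕ) .{{_ : ℕ.NonZero u}} (128≤M : 128 ℕ.≤ M) {n : ℕ} (n≤ : n ℕ.≤ M ℕ.^ suc K) (exponents : 3 ℕ.* u ℕ.+ suc K ℕ.* w ℕ.≤ e ℕ.* u) where

  private
    instance
      M-nonZero : ℕ.NonZero M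
      M-nonZero = ℕ.>-nonZero (ℕ.≤-trans (ℕ.s≤s ℕ.z≤n) 128≤M)

    n^w : n ℕ.^ w ℕ.≤ M ℕ.^ (suc K ℕ.* w)
    n^w = ℕ.≤-trans (ℕ.^-monoˡ-≤ w n≤) (ℕ.≤-reflexive (ℕ.^-*-assoc M (suc K) w))

    absorb : ∀ {x g} → g ℕ.^ u ℕ.≤ x ℕ.^ u ℕ.* n ℕ.^ w → (M ℕ.^ 3 ℕ.* g) ℕ.^ u ℕ.≤ (x ℕ.* M ℕ.^ e) ℕ.^ u
    absorb {x} {g} p = ℕ.≤-trans (ℕ.≤-reflexive (trans (*-^ (M ℕ.^ 3) g u) (cong (ℕ._* g ℕ.^ u) (ℕ.^-*-assoc M 3 u))))
      (ℕ.≤-trans (ℕ.*-monoʳ-≤ (M ℕ.^ (3 ℕ.* u)) (ℕ.≤-trans p (ℕ.*-monoʳ-≤ (x ℕ.^ u) n^w)))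
      (ℕ.≤-trans (ℕ.≤-reflexive (trans (shuffle (M ℕ.^ (3 ℕ.* u)) (x ℕ.^ u) (M ℕ.^ (suc K ℕ.* w))) (cong (x ℕ.^ u ℕ.*_) (sym (ℕ.^-distribˡ-+-* M (3 ℕ.* u) (suc K ℕ.* w))))))
      (ℕ.≤-trans (ℕ.*-monoʳ-≤ (x ℕ.^ u) (ℕ.^-monoʳ-≤ M exponents)) (ℕ.≤-reflexive (trans (cong (x ℕ.^ u ℕ.*_) (sym (ℕ.^-*-assoc M e u))) (sym (*-^ x (M ℕ.^ e) u)))))))
      where
      shuffle : ∀ a b c → a ℕ.* (b ℕ.* c) ≡ b ℕ.* (a ℕ.* c)
      shuffle a b c = trans (sym (ℕ.*-assoc a b c)) (trans (cong (ℕ._* c) (ℕ.*-comm a b)) (ℕ.*-assoc b a c))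

    M³ : ∀ x → M ℕ.^ 3 ℕ.* x ≡ M ℕ.* (M ℕ.* M ℕ.* x)
    M³ x = trans (cong (ℕ._* x) (cong (λ z → M ℕ.* (M ℕ.* z)) (ℕ.*-identityʳ M))) (ℕ.*-assoc M (M ℕ.* M) x)

  large-enough : ∀ {a g} → g ℕ.^ u ℕ.≤ a ℕ.^ u ℕ.* n ℕ.^ w → 32 ℕ.* (M ℕ.* g) ℕ.≤ a ℕ.* M ℕ.^ e
  large-enough {a} {g} p = ℕ.≤-trans (ℕ.≤-trans (ℕ.*-mono-≤ (ℕ.≤-trans (ℕ.m≤m+n 32 96) 128≤M) (ℕ.*-monoˡ-≤ g (ℕ.m≤m*n M M))) (ℕ.≤-reflexive (sym (M³ g)))) (^-cancelˡ-≤ u (absorb p))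

  small-enough : ∀ {c g} → 0 ℕ.< g → c ℕ.* M ℕ.^ e ℕ.≤ 2 ℕ.* (M ℕ.* M ℕ.* g) → c ℕ.^ u ℕ.* n ℕ.^ w ℕ.< g ℕ.^ u
  small-enough {c} {g} 0<g p = ℕ.≰⇒> λ q → ℕ.<-irrefl refl (ℕ.<-≤-trans (ℕ.^-monoˡ-< u strict) (absorb q))
    where
    strict : c ℕ.* M ℕ.^ e ℕ.< M ℕ.^ 3 ℕ.* g
    strict = ℕ.≤-<-trans p (ℕ.<-≤-trans (ℕ.*-monoˡ-< (M ℕ.* M ℕ.* g) {{ℕ.m*n≢0 (M ℕ.* M) g {{ℕ.m*n≢0 M M}} {{ℕ.>-nonZero 0<g}}}} (ℕ.≤-trans (ℕ.m≤m+n 3 125) 128≤M)) (ℕ.≤-reflexive (sym (M³ g))))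

-- The theorem for general exponents

module Conclusion (𝔽 : OrderedField) where
  open Sums 𝔽
  open Arithmetic 𝔽

  ι-reflects : ∀ {x y} → ι x ≤ ι y → x ℕ.≤ y
  ι-reflects {x} {y} p with x ℕ.≤? y
  ... | yes q = q
  ... | no  q = ⊥-elim (ι-mono-< (ℕ.≰⇒> q) p)

  module At (n : ℕ) where
    open Translation 𝔽 n
    open Densities 𝔽 𝔾 using (N; N-pos; tot; dens)
    open Averages 𝔽 𝔾 using (Points)
    open Restriction 𝔽 𝔾 using (_∩_; inFamily)
    open GroupAlgebra 𝔽 𝔾 using (_†; Gs)
    open Blocks 𝔽 𝔾 using (recip-move; ι-^; module Parameters)

    0<g : 0 ℕ.< length (Alt n)
    0<g = ℕ.≰⇒> λ q → N-pos (≡-≤ N-count (ι-mono q))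

    module Bounds (p K k h u w : ℕ) .{{_ : ℕ.NonZero u}} (big-M : 128 ℕ.≤ 2 ℕ.^ p) (e-M : 9 ℕ.* ((suc k ℕ.+ suc k) ℕ.* (suc k ℕ.+ suc k)) ℕ.≤ 2 ℕ.^ p)
      (R-M : suc (p ℕ.* (suc K ℕ.+ suc K)) ℕ.≤ 2 ℕ.^ p) (j-M : p ℕ.* (8 ℕ.+ 3 ℕ.* suc k) ℕ.≤ 2 ℕ.^ p)
      (≤n : (2 ℕ.^ p) ℕ.^ K ℕ.≤ n) (n≤ : n ℕ.≤ (2 ℕ.^ p) ℕ.^ suc K)
      (d-K : 3 ℕ.* suc k ℕ.+ 40 ℕ.≤ 2 ℕ.* K) (e-K : suc k ℕ.+ 22 ℕ.≤ K) (j-h : 9 ℕ.+ 3 ℕ.* suc k ℕ.≤ 2 ℕ.* h) (h-K : h ℕ.+ 2 ℕ.≤ K) (1≤h : 1 ℕ.≤ h)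
      (exponents : 3 ℕ.* u ℕ.+ suc K ℕ.* w ℕ.≤ suc k ℕ.* u) where

      open Parameters p K k h big-M e-M R-M j-M ≤n n≤ d-K e-K j-h h-K 1≤h
      open Thresholds (2 ℕ.^ p) K u w (suc k) big-M n≤ exponents

      private
        M g : ℕ
        M = 2 ℕ.^ p
        g = length (Alt n)
        D : F
        D = pow (ι M) (suc k)
        M-pos : 0# < ι M
        M-pos = <-≤-trans (ι-pos 127) (ι-mono big-M)
        D-pos : 0# < D
        D-pos = pow-pos (suc k) M-pos

      Small : (Tab n → Bool) → Set
      Small S = countAlt n S ℕ.^ u ℕ.* n ℕ.^ w ℕ.< length (Alt n) ℕ.^ u

      dense-enough : ∀ {S} → length (Alt n) ℕ.^ u ℕ.≤ countAlt n S ℕ.^ u ℕ.* n ℕ.^ w → ι 32 * (ι M * recip D) ≤ dens ⟦ S ⟧ˢ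
      dense-enough {S} p = recip-move N-pos (*-cancelˡ D-pos (≡-≤ (trans (solve (D ∷ ι M ∷ recip D ∷ N ∷ []) (v 0 :* (# 32 :* (v 1 :* v 2) :* v 3)) (# 32 :* (v 1 :* v 3) :* (v 0 :* v 2)) refl) (*1ʳ (*-inv⁺ D-pos)))
        (≡-≤ (trans (cong (λ z → ι 32 * (ι M * z)) N-count) (sym (trans (ι-* 32 (M ℕ.* g)) (cong (ι 32 *_) (ι-* M g)))))
        (≤-≡ (ι-mono (large-enough p)) (trans (ι-* (countAlt n S) (M ℕ.^ suc k)) (trans (*-comm _ _) (cong₂ _*_ (ι-^ M (suc k)) (sym (tot-count S)))))))))

      small : ∀ {f S} → (∀ g → f g ≡ ⟦ S ⟧ˢ g) → dens f ≤ ι 2 * (ι M * ι M * recip D) → Small S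
      small {f} {S} e p = small-enough 0<g (ι-reflects (≡-≤ (trans (ι-* (countAlt n S) (M ℕ.^ suc k)) (cong₂ _*_ (sym (trans (∑-cong Gs e) (tot-count S))) (ι-^ M (suc k))))
        (≡-≤ (sym (trans (solve (tot f ∷ recip N ∷ N ∷ D ∷ []) (v 0 :* v 1 :* (v 2 :* v 3)) (v 0 :* v 3 :* (v 2 :* v 1)) refl) (*1ʳ (*-inv⁺ N-pos))))
        (≤-≡ (*-monoʳ (<⇒≤ N-pos ⊛ <⇒≤ D-pos) p)
        (trans (solve (ι M ∷ recip D ∷ N ∷ D ∷ []) (# 2 :* (v 0 :* v 0 :* v 1) :* (v 2 :* v 3)) (# 2 :* (v 0 :* v 0 :* v 2) :* (v 3 :* v 1)) refl) (trans (*1ʳ (*-inv⁺ D-pos))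
          (trans (cong (λ z → ι 2 * (ι M * ι M * z)) N-count) (sym (trans (ι-* 2 (M ℕ.* M ℕ.* g)) (cong (ι 2 *_) (trans (ι-* (M ℕ.* M) g) (cong (_* ι g) (ι-* M M)))))))))))))

      conclude : ∀ {A} → ProductFree A → length (Alt n) ℕ.^ u ℕ.≤ countAlt n A ℕ.^ u ℕ.* n ℕ.^ w →
        Σ (Fin n) λ x → Σ (Subset n) λ I → Small (minusF A I x) ⊎ Small (minusF (invSet A) I x)
      conclude {A} pf p = translate (RowStructure.structure 𝔽 𝔾 scale (⟦⟧-ind A) (free pf) (dense-enough p))
        where
        translate : (∃ λ x → Σ Points λ I → dens (⟦ A ⟧ˢ ∩ λ π → not (inFamily I x π)) ≤ ι 2 * (ι M * ι M * recip D) ⊎ dens (⟦ A ⟧ˢ † ∩ λ π → not (inFamily I x π)) ≤ ι 2 * (ι M * ι M * recip D)) →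
          Σ (Fin n) λ x → Σ (Subset n) λ I → Small (minusF A I x) ⊎ Small (minusF (invSet A) I x)
        translate (x , I , inj₁ q) = x , tabulate I , inj₁ (small (∩-minusF A I x) q)
        translate (x , I , inj₂ q) = x , tabulate I , inj₂ (small (λ g → trans (cong (_* [ not (inFamily I x g) ]) (†-invSet A g)) (∩-minusF (invSet A) I x g)) q)

  large : ∀ K k h u w .{{_ : ℕ.NonZero u}} → 3 ℕ.* suc k ℕ.+ 40 ℕ.≤ 2 ℕ.* K → suc k ℕ.+ 22 ℕ.≤ K → 9 ℕ.+ 3 ℕ.* suc k ℕ.≤ 2 ℕ.* h → h ℕ.+ 2 ℕ.≤ K → 1 ℕ.≤ h →
    3 ℕ.* u ℕ.+ suc K ℕ.* w ℕ.≤ suc k ℕ.* u → ∃ λ N → ∀ n → n ≥ N → ∀ (A : Tab n → Bool) → ProductFree A → length (Alt n) ℕ.^ u ℕ.≤ countAlt n A ℕ.^ u ℕ.* n ℕ.^ w →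
    Σ (Fin n) λ x → Σ (Subset n) λ I →
      countAlt n (minusF A I x) ℕ.^ u ℕ.* n ℕ.^ w ℕ.< length (Alt n) ℕ.^ u ⊎ countAlt n (minusF (invSet A) I x) ℕ.^ u ℕ.* n ℕ.^ w ℕ.< length (Alt n) ℕ.^ u
  large K k h u w d-K e-K j-h h-K 1≤h exponents = (2 ℕ.^ p₀) ℕ.^ K , λ n n≥ A pf bound → choose n A pf bound (logarithm K {{K-nonZero}} n p₀ n≥)
    where
    q₁ q₂ q₃ p₀ : ℕ
    q₁ = suc K ℕ.+ suc K
    q₂ = 8 ℕ.+ 3 ℕ.* suc k
    q₃ = 9 ℕ.* ((suc k ℕ.+ suc k) ℕ.* (suc k ℕ.+ suc k))
    -- For p ≥ p₀ the conditions on 2^p follow from p ≤ 2^p and p² < 2^p, since every coefficient in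
    -- them is at most p; the 7 gives 2^p ≥ 128.
    p₀ = 7 ℕ.+ (q₁ ℕ.+ (q₂ ℕ.+ q₃))
    K-nonZero : ℕ.NonZero K
    K-nonZero = ℕ.>-nonZero (ℕ.≤-trans (ℕ.s≤s ℕ.z≤n) (ℕ.≤-trans (ℕ.m≤n+m 22 (suc k)) e-K))
    choose : ∀ n (A : Tab n → Bool) → ProductFree A → length (Alt n) ℕ.^ u ℕ.≤ countAlt n A ℕ.^ u ℕ.* n ℕ.^ w →
      (∃ λ p → p₀ ℕ.≤ p × (2 ℕ.^ p) ℕ.^ K ℕ.≤ n × n ℕ.< (2 ℕ.^ suc p) ℕ.^ K) →
      Σ (Fin n) λ x → Σ (Subset n) λ I →
        countAlt n (minusF A I x) ℕ.^ u ℕ.* n ℕ.^ w ℕ.< length (Alt n) ℕ.^ u ⊎ countAlt n (minusF (invSet A) I x) ℕ.^ u ℕ.* n ℕ.^ w ℕ.< length (Alt n) ℕ.^ u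
    choose n A pf bound (p , p≥ , ≤n , n<) = At.Bounds.conclude n p K k h u w 7≤ (ℕ.≤-trans q₃≤ p≤2^p) (ℕ.<-≤-trans (ℕ.s≤s (ℕ.*-monoʳ-≤ p q₁≤)) square) (ℕ.≤-trans (ℕ.*-monoʳ-≤ p q₂≤) (ℕ.<⇒≤ square)) ≤n n≤ d-K e-K j-h h-K 1≤h exponents pf bound
      where
      7≤p : 7 ℕ.≤ p
      7≤p = ℕ.≤-trans (ℕ.m≤m+n 7 (q₁ ℕ.+ (q₂ ℕ.+ q₃))) p≥
      rest : q₁ ℕ.+ (q₂ ℕ.+ q₃) ℕ.≤ p
      rest = ℕ.≤-trans (ℕ.m≤n+m (q₁ ℕ.+ (q₂ ℕ.+ q₃)) 7) p≥
      q₁≤ : q₁ ℕ.≤ p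
      q₁≤ = ℕ.≤-trans (ℕ.m≤m+n q₁ (q₂ ℕ.+ q₃)) rest
      q₂₃≤ : q₂ ℕ.+ q₃ ℕ.≤ p
      q₂₃≤ = ℕ.≤-trans (ℕ.m≤n+m (q₂ ℕ.+ q₃) q₁) rest
      q₂≤ : q₂ ℕ.≤ p
      q₂≤ = ℕ.≤-trans (ℕ.m≤m+n q₂ q₃) q₂₃≤
      q₃≤ : q₃ ℕ.≤ p
      q₃≤ = ℕ.≤-trans (ℕ.m≤n+m q₃ q₂) q₂₃≤
      p≤2^p : p ℕ.≤ 2 ℕ.^ p
      p≤2^p = ℕ.<⇒≤ (n<2^n p)
      7≤ : 128 ℕ.≤ 2 ℕ.^ p
      7≤ = ℕ.^-monoʳ-≤ 2 {7} {p} 7≤p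
      square : p ℕ.* p ℕ.< 2 ℕ.^ p
      square = subst (λ z → z ℕ.* z ℕ.< 2 ℕ.^ z) (ℕ.m+[n∸m]≡n (ℕ.≤-trans (ℕ.m≤m+n 5 2) 7≤p)) (square<2^ (p ℕ.∸ 5))
      -- Maximality of p gives n < 2^K m^K, and 2^K ≤ 2^p = m because K ≤ p.
      n≤ : n ℕ.≤ (2 ℕ.^ p) ℕ.^ suc K
      n≤ = ℕ.≤-trans (ℕ.<⇒≤ n<) (ℕ.≤-trans (ℕ.≤-reflexive (*-^ 2 (2 ℕ.^ p) K)) (ℕ.*-monoˡ-≤ ((2 ℕ.^ p) ℕ.^ K) (ℕ.^-monoʳ-≤ 2 (ℕ.≤-trans (ℕ.n≤1+n K) (ℕ.≤-trans (ℕ.m≤m+n (suc K) (suc K)) q₁≤)))))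

-- The rational numbers and the final exponents

rationals : OrderedField
rationals = record
  { F = ℚ ; _+_ = ℚ._+_ ; _*_ = ℚ._*_ ; -_ = ℚ.-_ ; recip = recip ; 0# = 0ℚ ; 1# = 1ℚ ; _≤_ = ℚ._≤_
  ; ring        = ℚ.+-*-isCommutativeRing
  ; *-inv       = *-inv
  ; ≤-reflexive = ℚ.≤-reflexive
  ; ≤-trans     = ℚ.≤-trans
  ; ≤-antisym   = ℚ.≤-antisym
  ; ≤-total     = ℚ.≤-total
  ; _≤?_        = ℚ._≤?_
  ; +-monoʳ     = ℚ.+-monoˡ-≤
  ; *-nonneg    = λ {x} {y} p q → ℚ.nonNegative⁻¹ (x ℚ.* y) {{ℚ.nonNeg*nonNeg⇒nonNeg x {{ℚ.nonNegative p}} y {{ℚ.nonNegative q}}}}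
  ; 1≰0         = from-no (1ℚ ℚ.≤? 0ℚ) }
  where
  recip : ℚ → ℚ
  recip x with x ℚ.≟ 0ℚ
  ... | yes _ = 0ℚ
  ... | no  p = (1/ x) {{ℚ.≢-nonZero p}}
  *-inv : ∀ x → x ≢ 0ℚ → x ℚ.* recip x ≡ 1ℚ
  *-inv x p with x ℚ.≟ 0ℚ
  ... | yes q = ⊥-elim (p q)
  ... | no  q = ℚ.*-inverseʳ x {{ℚ.≢-nonZero q}}

theorem1p2 : ∃ λ (N : ℕ) → ∀ (n : ℕ) → n ≥ N →
    ∀ (A : Tab n → Bool) → SubsetOfAlt A → ProductFree A → μ≥bound n A →
    Σ (Fin n) λ x → Σ (Subset n) λ I →
      μ<bound n (minusF A I x) ⊎ μ<bound n (minusF (invSet A) I x)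
theorem1p2 = proj₁ result , λ n n≥N A _ → proj₂ result n n≥N A
  where
  -- The scale is m = 2^p with m^2549 ≤ n ≤ m^2550, the density floor m^(-1686), and there are blocks of size about m^2547.
  -- The exponents are possible because 3 · 0.66 < 2: they satisfy 3 · 50 + 2550 · 33 = 1686 · 50 and 3 · 1686 + 40 = 2 · 2549.
  result = Conclusion.large rationals 2549 1685 2547 50 33 (ℕ.≤ᵇ⇒≤ _ _ tt) (ℕ.≤ᵇ⇒≤ _ _ tt) (ℕ.≤ᵇ⇒≤ _ _ tt) (ℕ.≤ᵇ⇒≤ _ _ tt) (ℕ.≤ᵇ⇒≤ _ _ tt) (ℕ.≤ᵇ⇒≤ _ _ tt)
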